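{- For all integers $n\ge 273$, $$\bigl(q(n)^2-q(n-1)q(n+1)\bigr)^2>\bigl(q(n-1)^2-q(n-2)q(n)\bigr)\bigl(q(n+1)^2-q(n)q(n+2)\bigr).$$
   Context: $q(n)$ denotes the number of partitions of $n$ into distinct parts. -}

module Defs where

open import Data.Nat using (ℕ; zero; suc; _≟_)
open import Data.List using (List; []; _∷_; map; _++_; length; filter)
open import Data.Nat.ListAction using (sum)
open import Data.Integer using (ℤ; +_)

sublists : List ℕ → List (List ℕ)
sublists [] = [] ∷ []
sublists (x ∷ xs) = map (x ∷_) (sublists xs) ++ sublists xs

down : ℕ → List ℕ
down zero = []
down (suc n) = suc n ∷ down n

-- A partition of n into distinct parts is a set of distinct positive
-- integers (necessarily ≤ n) summing to n; we enumerate the subsets of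
-- {1,…,n} (as strictly decreasing lists) and keep those with sum n.
distinctPartitions : ℕ → List (List ℕ)
distinctPartitions n = filter (λ p → sum p ≟ n) (sublists (down n))

q : ℕ → ℕ
q n = length (distinctPartitions n)

qℤ : ℕ → ℤ
qℤ n = + q n

{-# OPTIONS --safe #-}
module Submission where

{-
Write q(n−1), q(n), q(n+1), … as coefficients of ∏ (1 + uᵐ), tilted by ρᵐ.  With
c = |1 − u|² = 2 − u − ū and I_r the coefficient of uⁿ in cʳ ∏ (1 + ρᵐ uᵐ), the
determinants D_k = a_k² − a_{k−1} a_{k+1} of a_k = ρᵏ q(k) satisfy
D_{n−1} + D_{n+1} − 2 D_n = I₁² − I₀ I₂ and 4 D_n ≥ 4 I₀ I₁ − I₁².  Hence the theorem
for n follows from I₁² < I₀ I₂ and I₂ < 4 I₁, and each of these says that the mean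
of w(c) ∏ (1 + ρᵐ uᵐ) u⁻ⁿ is positive for suitable quadratics w ≥ 0 on [0, 4].

For n ≥ 129600 this is shown by a circle method without analysis.  Means over the
circle are limits of averages over the powers of (3 + 4i)/5, and |u| = 1 is encoded by
real pairs, so everything takes place in ℚ.  At the saddle point ρ the integrand is
bounded below by (1 − c/c₁) hᴰ − (c/c₁)⁴ h^d₁ − (c/c₂)⁸ h^d₂ − η with h = 1 − c/4.  The
means of cʳ hᵈ are products of binomial ratios, which makes the two inequalities
explicit.

For smaller n the numbers q(n) are the base-X digits of the truncation of
∑ₖ ∏_{i≤k} 1/(Xⁱ − 1), a single fraction evaluated by a product tree, and the
inequality is checked digit by digit.
-}

-- All weights `w` are nonnegative, so the integrand has to be bounded from below only. For the
-- Gaussian exp(-Vφ²/2) the moments of c would be 1 : 1/V : 3/V², so I₁² < I₀I₂ holds with a factor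
-- 3 to spare, and a crude kernel with D about 2.1 V can be afforded. The obstacle is the phase near
-- u = 1. The tilted product is the characteristic function of a sum of independent parts m, present
-- with probability pₘ = ρᵐ/(1 + ρᵐ), and the mean of the sum lies in [n, n + 1); but the single
-- means m pₘ are not integers, so a factor cannot be made real by a power of u. Instead the m-th
-- factor is rotated by u^(-eₘ), where the eₘ are the increments of the rounded partial means and
-- sum to n. The fractional parts that remain stay bounded and telescope through auxiliary factors 1
-- ± iδs, leaving phases of third order. Every estimate is scaled by powers of t = 1 - ρ, which is
-- of the order of n^(-1/2). The threshold 129600 = 360² means t ≤ 1/360, on which the phase bound
-- relies, and 2¹⁷ computed values cover what lies below.

-- Ordered fields

module OrderedFields where
  open import Agda.Primitive
  open import Relation.Binary.PropositionalEquality.Core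
  open import Relation.Nullary.Negation.Core using (¬_)
  open import Relation.Nullary.Decidable.Core using (Dec)
  open import Data.Integer.Base as ℤ using (ℤ)
  open import Data.Sum.Base using (_⊎_)
  open import Data.Product.Base using (∃)

  -- The analysis sees only this interface. Integer constants enter through `⟪_⟫`, so that
  -- coefficients of polynomials stay literal integers with which a normaliser can compute; `inv` is
  -- total and constrained only away from 0.
  record OrderedField : Set₁ where
    infixl 6 _+_
    infixl 7 _*_
    infix 8 -_
    infix 4 _≤_
    field
      F : Set
      _+_ _*_ : F → F → F
      -_ : F → F
      inv : F → F
      _≤_ : F → F → Set
      ⟪_⟫ : ℤ → F
      +-assoc : ∀ x y z → (x + y) + z ≡ x + (y + z)
      +-comm : ∀ x y → x + y ≡ y + x
      *-assoc : ∀ x y z → (x * y) * z ≡ x * (y * z)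
      *-comm : ∀ x y → x * y ≡ y * x
      distribˡ : ∀ x y z → x * (y + z) ≡ x * y + x * z
      ⟪0⟫+ : ∀ x → ⟪ ℤ.+ 0 ⟫ + x ≡ x
      ⟪1⟫* : ∀ x → ⟪ ℤ.+ 1 ⟫ * x ≡ x
      +-inv : ∀ x → x + - x ≡ ⟪ ℤ.+ 0 ⟫
      ⟪⟫-+ : ∀ i j → ⟪ i ℤ.+ j ⟫ ≡ ⟪ i ⟫ + ⟪ j ⟫
      ⟪⟫-* : ∀ i j → ⟪ i ℤ.* j ⟫ ≡ ⟪ i ⟫ * ⟪ j ⟫
      ⟪⟫-≤ : ∀ {i j} → i ℤ.≤ j → ⟪ i ⟫ ≤ ⟪ j ⟫
      ⟪⟫-≤⁻ : ∀ {i j} → ⟪ i ⟫ ≤ ⟪ j ⟫ → i ℤ.≤ j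
      *-inv : ∀ x → ¬ (x ≡ ⟪ ℤ.+ 0 ⟫) → x * inv x ≡ ⟪ ℤ.+ 1 ⟫
      ≤-refl : ∀ {x} → x ≤ x
      ≤-trans : ∀ {x y z} → x ≤ y → y ≤ z → x ≤ z
      ≤-antisym : ∀ {x y} → x ≤ y → y ≤ x → x ≡ y
      _≤?_ : ∀ x y → Dec (x ≤ y)
      ≤-total : ∀ x y → x ≤ y ⊎ y ≤ x
      +-monoʳ : ∀ z {x y} → x ≤ y → z + x ≤ z + y
      *≥0 : ∀ {x y} → ⟪ ℤ.+ 0 ⟫ ≤ x → ⟪ ℤ.+ 0 ⟫ ≤ y → ⟪ ℤ.+ 0 ⟫ ≤ x * y
      archimedean : ∀ x → ∃ λ k → x ≤ ⟪ ℤ.+ k ⟫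

-- The rationals as an ordered field

module RationalField where
  open OrderedFields
  open import Relation.Binary.PropositionalEquality
  open import Relation.Nullary using (¬_; yes; no; contradiction)
  open import Data.Integer as ℤ using (ℤ; +_; -[1+_])
  import Data.Integer.Properties as ℤP
  open import Data.Nat as ℕ using (ℕ)
  open import Data.Rational as ℚ
  import Data.Rational.Properties as P
  import Data.Rational.Unnormalised as U
  import Data.Rational.Unnormalised.Properties as UP
  open import Data.Product using (_,_; ∃)

  fromZ : ℤ → ℚ
  fromZ i = i / 1

  toU : ∀ i → toℚᵘ (fromZ i) U.≃ U.mkℚᵘ i 0
  toU i = P.toℚᵘ-fromℚᵘ (U.mkℚᵘ i 0)

  fromZ-+ : ∀ i j → fromZ (i ℤ.+ j) ≡ fromZ i + fromZ j
  fromZ-+ i j = P.toℚᵘ-injective (UP.≃-trans (toU (i ℤ.+ j)) (UP.≃-trans (UP.≃-reflexive eq) (UP.≃-sym (UP.≃-trans (P.toℚᵘ-homo-+ (fromZ i) (fromZ j)) (UP.+-cong (toU i) (toU j))))))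
    where
    eq : U.mkℚᵘ (i ℤ.+ j) 0 ≡ U.mkℚᵘ i 0 U.+ U.mkℚᵘ j 0
    eq = cong (λ k → U.mkℚᵘ k 0) (sym (cong₂ ℤ._+_ (ℤP.*-identityʳ i) (ℤP.*-identityʳ j)))

  fromZ-* : ∀ i j → fromZ (i ℤ.* j) ≡ fromZ i * fromZ j
  fromZ-* i j = P.toℚᵘ-injective (UP.≃-trans (toU (i ℤ.* j)) (UP.≃-sym (UP.≃-trans (P.toℚᵘ-homo-* (fromZ i) (fromZ j)) (UP.*-cong (toU i) (toU j)))))

  fromZ-≤ : ∀ {i j} → i ℤ.≤ j → fromZ i ≤ fromZ j
  fromZ-≤ {i} {j} i≤j = P.toℚᵘ-cancel-≤ (UP.≤-respʳ-≃ (UP.≃-sym (toU j)) (UP.≤-respˡ-≃ (UP.≃-sym (toU i)) (U.*≤* (subst₂ ℤ._≤_ (sym (ℤP.*-identityʳ i)) (sym (ℤP.*-identityʳ j)) i≤j))))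

  fromZ-≤⁻ : ∀ {i j} → fromZ i ≤ fromZ j → i ℤ.≤ j
  fromZ-≤⁻ {i} {j} le with UP.≤-respʳ-≃ (toU j) (UP.≤-respˡ-≃ (toU i) (P.toℚᵘ-mono-≤ le))
  ... | U.*≤* p = subst₂ ℤ._≤_ (ℤP.*-identityʳ i) (ℤP.*-identityʳ j) p

  inv : ℚ → ℚ
  inv x with x P.≟ 0ℚ
  ... | yes _ = 0ℚ
  ... | no x≢0 = 1/_ x {{≢-nonZero x≢0}}

  *-inv : ∀ x → ¬ (x ≡ fromZ (+ 0)) → x * inv x ≡ fromZ (+ 1)
  *-inv x x≢0 with x P.≟ 0ℚ
  ... | yes e = contradiction e x≢0
  ... | no ne = P.*-inverseʳ x {{≢-nonZero ne}}

  -- A denominator is at least 1, so the absolute value of the numerator bounds the fraction.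
  arch : ∀ x → ∃ λ k → x ≤ fromZ (+ k)
  arch x@record{} = ℤ.∣ ↥ x ∣ , P.toℚᵘ-cancel-≤ (UP.≤-respʳ-≃ (UP.≃-sym (toU (+ ℤ.∣ ↥ x ∣))) (U.*≤* lem))
    where
    lem : ↥ x ℤ.* + 1 ℤ.≤ + ℤ.∣ ↥ x ∣ ℤ.* ↧ x
    lem = ℤP.≤-trans (ℤP.≤-reflexive (ℤP.*-identityʳ (↥ x))) (ℤP.≤-trans (abs≤ (↥ x)) (ℤP.≤-trans (ℤP.≤-reflexive (sym (ℤP.*-identityʳ _))) (ℤP.*-monoˡ-≤-nonNeg (+ ℤ.∣ ↥ x ∣) (ℤ.+≤+ (ℕ.s≤s ℕ.z≤n)))))
      where
      abs≤ : ∀ i → i ℤ.≤ + ℤ.∣ i ∣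
      abs≤ (+ n) = ℤP.≤-refl
      abs≤ -[1+ n ] = ℤ.-≤+

  ℚ-field : OrderedField
  ℚ-field = record
    { F = ℚ ; _+_ = _+_ ; _*_ = _*_ ; -_ = -_ ; inv = inv ; _≤_ = _≤_ ; ⟪_⟫ = fromZ
    ; +-assoc = P.+-assoc ; +-comm = P.+-comm ; *-assoc = P.*-assoc ; *-comm = P.*-comm
    ; distribˡ = P.*-distribˡ-+ ; ⟪0⟫+ = P.+-identityˡ ; ⟪1⟫* = P.*-identityˡ ; +-inv = P.+-inverseʳ
    ; ⟪⟫-+ = fromZ-+ ; ⟪⟫-* = fromZ-* ; ⟪⟫-≤ = fromZ-≤ ; ⟪⟫-≤⁻ = fromZ-≤⁻ ; *-inv = *-inv
    ; ≤-refl = P.≤-refl ; ≤-trans = P.≤-trans ; ≤-antisym = P.≤-antisym ; _≤?_ = P._≤?_ ; ≤-total = P.≤-total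
    ; +-monoʳ = λ z p → P.+-monoʳ-≤ z p
    ; *≥0 = λ {x} {y} px py → subst (_≤ x * y) (P.*-zeroʳ x) (P.*-monoˡ-≤-nonNeg x {{ℚ.nonNegative px}} py)
    ; archimedean = arch }

module Scalars where
  open OrderedFields

  -- abstract, so that no arithmetic of fractions is ever unfolded
  abstract
    K : OrderedField
    K = RationalField.ℚ-field

  open OrderedField K public

-- Reflective normalisation of polynomial expressions

module RingSolver where
  open Scalars
  open import Relation.Binary.PropositionalEquality.Core
  open import Agda.Builtin.Int using (pos; negsuc)
  open import Data.Integer.Base as ℤ using (ℤ)
  open import Data.Nat.Base as ℕ using (ℕ; suc; zero)
  open import Data.Fin.Base using (Fin)
  open import Data.Vec.Base using (Vec; []; _∷_; lookup)
  open import Data.List.Base using (List; []; _∷_)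
  open import Data.Product.Base using (_×_; _,_)
  open import Data.Bool.Base using (Bool; true; false)

  0# 1# : F
  0# = ⟪ pos 0 ⟫
  1# = ⟪ pos 1 ⟫

  infixl 6 _-_
  _-_ : F → F → F
  x - y = x + - y

  +0 : ∀ x → x + 0# ≡ x
  +0 x = trans (+-comm x 0#) (⟪0⟫+ x)

  *1 : ∀ x → x * 1# ≡ x
  *1 x = trans (*-comm x 1#) (⟪1⟫* x)

  distribʳ : ∀ x y z → (y + z) * x ≡ y * x + z * x
  distribʳ x y z = trans (*-comm (y + z) x) (trans (distribˡ x y z) (cong₂ _+_ (*-comm x y) (*-comm x z)))

  +-cancelˡ : ∀ x {y z} → x + y ≡ x + z → y ≡ z
  +-cancelˡ x {y} {z} e = trans (lem y) (trans (cong (_+_ (- x)) e) (sym (lem z)))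
    where
    lem : ∀ w → w ≡ - x + (x + w)
    lem w = sym (trans (sym (+-assoc (- x) x w)) (trans (cong (_+ w) (trans (+-comm (- x) x) (+-inv x))) (⟪0⟫+ w)))

  *0 : ∀ x → x * 0# ≡ 0#
  *0 x = +-cancelˡ (x * 0#) (trans (sym (distribˡ x 0# 0#)) (trans (cong (x *_) (⟪0⟫+ 0#)) (sym (+0 _))))

  0* : ∀ x → 0# * x ≡ 0#
  0* x = trans (*-comm 0# x) (*0 x)

  neg-unique : ∀ x y → x + y ≡ 0# → y ≡ - x
  neg-unique x y e = +-cancelˡ x (trans e (sym (+-inv x)))

  ⟪-1⟫* : ∀ x → ⟪ (negsuc 0) ⟫ * x ≡ - x
  ⟪-1⟫* x = neg-unique x _ (trans (cong (_+ ⟪ (negsuc 0) ⟫ * x) (sym (⟪1⟫* x))) (trans (sym (distribʳ x 1# _)) (trans (cong (_* x) (sym (⟪⟫-+ (pos 1) (negsuc 0)))) (0* x))))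

  +-swap : ∀ a b c d → (a + b) + (c + d) ≡ (a + c) + (b + d)
  +-swap a b c d = trans (+-assoc a b (c + d)) (trans (cong (a +_) (trans (sym (+-assoc b c d)) (trans (cong (_+ d) (+-comm b c)) (+-assoc c b d)))) (sym (+-assoc a c (b + d))))

  *-swap : ∀ a b c d → (a * b) * (c * d) ≡ (a * c) * (b * d)
  *-swap a b c d = trans (*-assoc a b (c * d)) (trans (cong (a *_) (trans (sym (*-assoc b c d)) (trans (cong (_* d) (*-comm b c)) (*-assoc c b d)))) (sym (*-assoc a c (b * d))))

  infixr 8 _^_
  _^_ : F → ℕ → F
  x ^ zero = 1#
  x ^ suc n = x * x ^ n

  ^-+ : ∀ x m n → x ^ (m ℕ.+ n) ≡ x ^ m * x ^ n
  ^-+ x zero n = sym (⟪1⟫* _)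
  ^-+ x (suc m) n = trans (cong (x *_) (^-+ x m n)) (sym (*-assoc x _ _))

  module _ {n : ℕ} where
    infixl 6 _:+_ _:-_
    infixl 7 _:*_
    infixr 8 _:^_
    data Expr : Set where
      var : Fin n → Expr
      con : ℤ → Expr
      _:+_ _:-_ _:*_ : Expr → Expr → Expr
      :-_ : Expr → Expr
      _:^_ : Expr → ℕ → Expr

    lit : ℕ → Expr
    lit k = con (pos k)

    ⟦_⟧ : Expr → Vec F n → F
    ⟦ var i ⟧ ρ = lookup ρ i
    ⟦ con z ⟧ ρ = ⟪ z ⟫
    ⟦ a :+ b ⟧ ρ = ⟦ a ⟧ ρ + ⟦ b ⟧ ρ
    ⟦ a :- b ⟧ ρ = ⟦ a ⟧ ρ - ⟦ b ⟧ ρ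
    ⟦ a :* b ⟧ ρ = ⟦ a ⟧ ρ * ⟦ b ⟧ ρ
    ⟦ :- a ⟧ ρ = - ⟦ a ⟧ ρ
    ⟦ a :^ k ⟧ ρ = ⟦ a ⟧ ρ ^ k

  Mono : ℕ → Set
  Mono = Vec ℕ

  Poly : ℕ → Set
  Poly n = List (ℤ × Mono n)

  -- Only equality carries evidence: the order of monomials serves cancellation, and soundness of
  -- addition does not depend on its being respected.
  data Cmp {n} : Mono n → Mono n → Set where
    lt# gt# : ∀ {m k} → Cmp m k
    eq# : ∀ {m} → Cmp m m

  data CmpN : ℕ → ℕ → Set where
    lt# gt# : ∀ {m k} → CmpN m k
    eq# : ∀ {m} → CmpN m m

  cmpN : ∀ m k → CmpN m k
  cmpN zero zero = eq#
  cmpN zero (suc k) = lt#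
  cmpN (suc m) zero = gt#
  cmpN (suc m) (suc k) with cmpN m k
  ... | lt# = lt#
  ... | gt# = gt#
  ... | eq# = eq#

  cmp : ∀ {n} (m k : Mono n) → Cmp m k
  cmp [] [] = eq#
  cmp (x ∷ m) (y ∷ k) with cmpN x y
  ... | lt# = lt#
  ... | gt# = gt#
  ... | eq# with cmp m k
  ...   | lt# = lt#
  ...   | gt# = gt#
  ...   | eq# = eq#

  -- Zero coefficients are dropped at once, so that an expression which vanishes identically
  -- normalises to the empty list.
  cons : ∀ {n} → ℤ → Mono n → Poly n → Poly n
  cons (pos 0) m p = p
  cons c m p = (c , m) ∷ p

  add : ∀ {n} → Poly n → Poly n → Poly n
  add [] q = q
  add ((c , m) ∷ p) q = go q
    where
    go : Poly _ → Poly _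
    go [] = (c , m) ∷ p
    go ((d , k) ∷ q) with cmp m k
    ... | lt# = (c , m) ∷ add p ((d , k) ∷ q)
    ... | gt# = (d , k) ∷ go q
    ... | eq# = cons (c ℤ.+ d) m (add p q)

  mulM : ∀ {n} → Mono n → Mono n → Mono n
  mulM [] [] = []
  mulM (x ∷ m) (y ∷ k) = x ℕ.+ y ∷ mulM m k

  mulT : ∀ {n} → ℤ → Mono n → Poly n → Poly n
  mulT c m [] = []
  mulT c m ((d , k) ∷ p) = cons (c ℤ.* d) (mulM m k) (mulT c m p)

  mul : ∀ {n} → Poly n → Poly n → Poly n
  mul [] q = []
  mul ((c , m) ∷ p) q = add (mulT c m q) (mul p q)

  oneM : ∀ {n} → Mono n
  oneM {zero} = []
  oneM {suc n} = 0 ∷ oneM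

  varM : ∀ {n} → Fin n → Mono n
  varM {suc n} Fin.zero = 1 ∷ oneM
  varM {suc n} (Fin.suc i) = 0 ∷ varM i

  powP : ∀ {n} → Poly n → ℕ → Poly n
  powP p zero = (pos 1 , oneM) ∷ []
  powP p (suc k) = mul p (powP p k)

  norm : ∀ {n} → Expr {n} → Poly n
  norm (var i) = (pos 1 , varM i) ∷ []
  norm (con z) = cons z oneM []
  norm (a :+ b) = add (norm a) (norm b)
  norm (a :- b) = add (norm a) (mulT (negsuc 0) oneM (norm b))
  norm (a :* b) = mul (norm a) (norm b)
  norm (:- a) = mulT (negsuc 0) oneM (norm a)
  norm (a :^ k) = powP (norm a) k

  evM : ∀ {n} → Mono n → Vec F n → F
  evM [] [] = 1#
  evM (e ∷ m) (x ∷ ρ) = x ^ e * evM m ρ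

  ev : ∀ {n} → Poly n → Vec F n → F
  ev [] ρ = 0#
  ev ((c , m) ∷ p) ρ = ⟪ c ⟫ * evM m ρ + ev p ρ

  private
   module _ {n} (ρ : Vec F n) where
    ev-cons : ∀ c m p → ev (cons c m p) ρ ≡ ⟪ c ⟫ * evM m ρ + ev p ρ
    ev-cons (pos 0) m p = sym (trans (cong (_+ ev p ρ) (0* _)) (⟪0⟫+ _))
    ev-cons (pos (suc c)) m p = refl
    ev-cons (negsuc c) m p = refl

    ev-add : ∀ p q → ev (add p q) ρ ≡ ev p ρ + ev q ρ
    ev-add [] q = sym (⟪0⟫+ _)
    ev-add ((c , m) ∷ p) q = go q
      where
      go : ∀ q → ev (add ((c , m) ∷ p) q) ρ ≡ (⟪ c ⟫ * evM m ρ + ev p ρ) + ev q ρ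
      go [] = sym (+0 _)
      go ((d , k) ∷ q) with cmp m k
      ... | lt# = trans (cong (⟪ c ⟫ * evM m ρ +_) (ev-add p ((d , k) ∷ q))) (sym (+-assoc _ _ _))
      ... | gt# = trans (cong (⟪ d ⟫ * evM k ρ +_) (go q)) (trans (sym (+-assoc _ _ _)) (trans (cong (_+ ev q ρ) (+-comm _ _)) (+-assoc _ _ _)))
      ... | eq# = trans (ev-cons (c ℤ.+ d) m (add p q)) (trans (cong₂ _+_ (trans (cong (_* evM m ρ) (⟪⟫-+ c d)) (distribʳ _ _ _)) (ev-add p q)) (+-swap _ _ _ _))

  evM-mul : ∀ {n} (m k : Mono n) ρ → evM (mulM m k) ρ ≡ evM m ρ * evM k ρ
  evM-mul [] [] [] = sym (⟪1⟫* _)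
  evM-mul (e ∷ m) (f ∷ k) (x ∷ ρ) = trans (cong₂ _*_ (^-+ x e f) (evM-mul m k ρ)) (*-swap _ _ _ _)

  evM-one : ∀ {n} (ρ : Vec F n) → evM oneM ρ ≡ 1#
  evM-one [] = refl
  evM-one (x ∷ ρ) = trans (⟪1⟫* _) (evM-one ρ)

  evM-var : ∀ {n} (i : Fin n) (ρ : Vec F n) → evM (varM i) ρ ≡ lookup ρ i
  evM-var Fin.zero (x ∷ ρ) = trans (cong₂ _*_ (*1 x) (evM-one ρ)) (*1 x)
  evM-var (Fin.suc i) (x ∷ ρ) = trans (⟪1⟫* _) (evM-var i ρ)

  private
   module _ {n} (ρ : Vec F n) where
    ev-mulT : ∀ c m p → ev (mulT c m p) ρ ≡ (⟪ c ⟫ * evM m ρ) * ev p ρ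
    ev-mulT c m [] = sym (*0 _)
    ev-mulT c m ((d , k) ∷ p) = trans (ev-cons ρ (c ℤ.* d) (mulM m k) _) (trans (cong₂ _+_ (trans (cong₂ _*_ (⟪⟫-* c d) (evM-mul m k ρ)) (*-swap _ _ _ _)) (ev-mulT c m p)) (sym (distribˡ _ _ _)))

    ev-mul : ∀ p q → ev (mul p q) ρ ≡ ev p ρ * ev q ρ
    ev-mul [] q = sym (0* _)
    ev-mul ((c , m) ∷ p) q = trans (ev-add ρ (mulT c m q) (mul p q)) (trans (cong₂ _+_ (ev-mulT c m q) (ev-mul p q)) (sym (distribʳ _ _ _)))

    ev-neg : ∀ p → ev (mulT (negsuc 0) oneM p) ρ ≡ - ev p ρ
    ev-neg p = trans (ev-mulT (negsuc 0) oneM p) (trans (cong (_* ev p ρ) (trans (cong (⟪ (negsuc 0) ⟫ *_) (evM-one ρ)) (*1 _))) (⟪-1⟫* _))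

    ev-one : ∀ z → ⟪ z ⟫ * evM (oneM {n}) ρ + 0# ≡ ⟪ z ⟫
    ev-one z = trans (+0 _) (trans (cong (⟪ z ⟫ *_) (evM-one ρ)) (*1 _))

    ev-pow : ∀ p k → ev (powP p k) ρ ≡ ev p ρ ^ k
    ev-pow p zero = ev-one (pos 1)
    ev-pow p (suc k) = trans (ev-mul p (powP p k)) (cong (ev p ρ *_) (ev-pow p k))

  ev-norm : ∀ {n} (e : Expr {n}) ρ → ev (norm e) ρ ≡ ⟦ e ⟧ ρ
  ev-norm (var i) ρ = trans (+0 _) (trans (⟪1⟫* _) (evM-var i ρ))
  ev-norm (con z) ρ = trans (ev-cons ρ z oneM []) (ev-one ρ z)
  ev-norm (a :+ b) ρ = trans (ev-add ρ (norm a) (norm b)) (cong₂ _+_ (ev-norm a ρ) (ev-norm b ρ))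
  ev-norm (a :- b) ρ = trans (ev-add ρ (norm a) _) (cong₂ _+_ (ev-norm a ρ) (trans (ev-neg ρ (norm b)) (cong -_ (ev-norm b ρ))))
  ev-norm (a :* b) ρ = trans (ev-mul ρ (norm a) (norm b)) (cong₂ _*_ (ev-norm a ρ) (ev-norm b ρ))
  ev-norm (:- a) ρ = trans (ev-neg ρ (norm a)) (cong -_ (ev-norm a ρ))
  ev-norm (a :^ k) ρ = trans (ev-pow ρ (norm a) k) (cong (_^ k) (ev-norm a ρ))

  isNil : ∀ {n} → Poly n → Bool
  isNil [] = true
  isNil (_ ∷ _) = false

  isNil-ev : ∀ {n} (p : Poly n) ρ → isNil p ≡ true → ev p ρ ≡ 0#
  isNil-ev [] ρ _ = refl

  vanish : ∀ {n} (e : Expr {n}) (ρ : Vec F n) → isNil (norm e) ≡ true → ⟦ e ⟧ ρ ≡ 0#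
  vanish e ρ h = trans (sym (ev-norm e ρ)) (isNil-ev (norm e) ρ h)

  x-y≡0⇒x≡y : ∀ {x y} → x - y ≡ 0# → x ≡ y
  x-y≡0⇒x≡y {x} {y} e = trans (sym (+0 x)) (trans (cong (x +_) (sym (trans (+-comm (- y) y) (+-inv y)))) (trans (sym (+-assoc x (- y) y)) (trans (cong (_+ y) e) (⟪0⟫+ y))))

  ring : ∀ {n} (l r : Expr {n}) (ρ : Vec F n) → isNil (norm (l :- r)) ≡ true → ⟦ l ⟧ ρ ≡ ⟦ r ⟧ ρ
  ring l r ρ e = x-y≡0⇒x≡y (vanish (l :- r) ρ e)

-- Certificates for inequalities and equations

module Inequalities where
  open Scalars public
  open RingSolver public
  open import Relation.Binary.PropositionalEquality.Core public
  open import Agda.Builtin.Int using (pos; negsuc) public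
  import Data.Integer.Base as ℤ
  open import Data.Nat.Base as ℕ using (ℕ; suc; zero)
  open import Data.Vec.Base using (Vec; []; _∷_; lookup) public
  open import Data.Fin.Base using (Fin)
  open import Data.List.Base using ([]; _∷_)
  open import Data.Product.Base using (_,_)
  open import Data.Bool.Base using (Bool; true; false)
  open import Data.Sum.Base using (inj₁; inj₂)
  open import Data.Empty using (⊥-elim)
  open import Relation.Nullary.Negation.Core using (¬_)

  infix 4 _<_
  -- Totality recovers `≤` from this negation, and strict positivity can be proved by deriving a
  -- contradiction from a certificate.
  _<_ : F → F → Set
  x < y = ¬ (y ≤ x)

  <⇒≤ : ∀ {x y} → x < y → x ≤ y
  <⇒≤ {x} {y} x<y with ≤-total x y
  ... | inj₁ p = p
  ... | inj₂ p = ⊥-elim (x<y p)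

  <-≤-trans : ∀ {x y z} → x < y → y ≤ z → x < z
  <-≤-trans x<y y≤z z≤x = x<y (≤-trans y≤z z≤x)

  ≤-<-trans : ∀ {x y z} → x ≤ y → y < z → x < z
  ≤-<-trans x≤y y<z z≤x = y<z (≤-trans z≤x x≤y)

  ≤-reflexive : ∀ {x y} → x ≡ y → x ≤ y
  ≤-reflexive refl = ≤-refl

  +-mono : ∀ {a b c d} → a ≤ b → c ≤ d → a + c ≤ b + d
  +-mono {a} {b} {c} {d} p q = ≤-trans (+-monoʳ a q) (subst₂ _≤_ (+-comm d a) (+-comm d b) (+-monoʳ d p))

  +≥0 : ∀ {x y} → 0# ≤ x → 0# ≤ y → 0# ≤ x + y
  +≥0 {x} {y} p q = subst (_≤ x + y) (⟪0⟫+ 0#) (+-mono p q)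

  sub≥0 : ∀ {x y} → x ≤ y → 0# ≤ y - x
  sub≥0 {x} {y} p = subst₂ _≤_ (trans (+-comm (- x) x) (+-inv x)) (+-comm (- x) y) (+-monoʳ (- x) p)

  from≥0 : ∀ {x y} → 0# ≤ y - x → x ≤ y
  from≥0 {x} {y} p = subst₂ _≤_ (+0 x) (ring (var 0F :+ (var 1F :- var 0F)) (var 1F) (x ∷ y ∷ []) refl) (+-monoʳ x p)
    where
    open import Data.Fin.Patterns using (0F; 1F)

  open import Data.Fin.Patterns public using (0F; 1F; 2F; 3F; 4F; 5F; 6F; 7F; 8F; 9F)

  neg≥0 : ∀ {x} → x ≤ 0# → 0# ≤ - x
  neg≥0 {x} p = subst (0# ≤_) (⟪0⟫+ (- x)) (sub≥0 p)

  sq≥0 : ∀ x → 0# ≤ x * x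
  sq≥0 x with ≤-total 0# x
  ... | inj₁ p = *≥0 p p
  ... | inj₂ p = subst (0# ≤_) (ring (:- var 0F :* :- var 0F) (var 0F :* var 0F) (x ∷ []) refl) (*≥0 (neg≥0 p) (neg≥0 p))

  ⟪⟫≥0 : ∀ n → 0# ≤ ⟪ pos n ⟫
  ⟪⟫≥0 n = ⟪⟫-≤ (ℤ.+≤+ ℕ.z≤n)

  ⟪⟫>0 : ∀ n → 0# < ⟪ pos (suc n) ⟫
  ⟪⟫>0 n p with ⟪⟫-≤⁻ p
  ... | ℤ.+≤+ ()

  -- A piece of a Positivstellensatz certificate: an expression kept as syntax, with a proof that
  -- its value is nonnegative. Hypotheses, squares and literals are combined by sums and products.
  record Nn {n} (ρ : Vec F n) : Set where
    constructor nn
    field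
      expr : Expr {n}
      nonneg : 0# ≤ ⟦ expr ⟧ ρ
  open Nn

  module _ {n} {ρ : Vec F n} where
    infixl 6 _⊕_
    infixl 7 _⊗_
    _⊕_ _⊗_ : Nn ρ → Nn ρ → Nn ρ
    nn a p ⊕ nn b q = nn (a :+ b) (+≥0 p q)
    nn a p ⊗ nn b q = nn (a :* b) (*≥0 p q)
    sq : Expr → Nn ρ
    sq e = nn (e :* e) (sq≥0 (⟦ e ⟧ ρ))
    nat : ℕ → Nn ρ
    nat k = nn (con (pos k)) (⟪⟫≥0 k)
    le : (a b : Expr) → ⟦ a ⟧ ρ ≤ ⟦ b ⟧ ρ → Nn ρ
    le a b p = nn (b :- a) (sub≥0 p)
    ge0 : (a : Expr) → 0# ≤ ⟦ a ⟧ ρ → Nn ρ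
    ge0 a p = nn a p
    -- The value is 0, so the multiplier `m` may have any sign.
    eqn : (a b : Expr) → ⟦ a ⟧ ρ ≡ ⟦ b ⟧ ρ → (m : Expr) → Nn ρ
    eqn a b p m = nn (m :* (a :- b)) (≤-reflexive (sym (trans (cong (λ x → ⟦ m ⟧ ρ * (x - ⟦ b ⟧ ρ)) p) (trans (cong (⟦ m ⟧ ρ *_) (+-inv _)) (*0 _)))))

  -- The difference `r :- l` and the certificate are the same polynomial; this identity is all that
  -- the final `refl` of a use has to check.
  prove : ∀ {n} (l r : Expr {n}) (ρ : Vec F n) (c : Nn ρ) → isNil (norm (r :- l :- expr c)) ≡ true → ⟦ l ⟧ ρ ≤ ⟦ r ⟧ ρ
  prove l r ρ c e = from≥0 (subst (0# ≤_) (sym (ring (r :- l) (expr c) ρ e)) (nonneg c))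

  data NNs : ∀ {n} → Vec F n → Set where
    [] : NNs []
    _∷_ : ∀ {n x} {ρ : Vec F n} → 0# ≤ x → NNs ρ → NNs (x ∷ ρ)

  allNN : ∀ {n} → Poly n → Bool
  allNN [] = true
  allNN ((pos _ , _) ∷ p) = allNN p
  allNN ((negsuc _ , _) ∷ p) = false

  ^≥0 : ∀ {x} → 0# ≤ x → ∀ k → 0# ≤ x ^ k
  ^≥0 p zero = ⟪⟫≥0 1
  ^≥0 p (suc k) = *≥0 p (^≥0 p k)

  evM≥0 : ∀ {n} (m : Mono n) {ρ} → NNs ρ → 0# ≤ evM m ρ
  evM≥0 [] [] = ⟪⟫≥0 1
  evM≥0 (e ∷ m) (x ∷ ρ) = *≥0 (^≥0 x e) (evM≥0 m ρ)

  ev≥0 : ∀ {n} (p : Poly n) {ρ} → NNs ρ → allNN p ≡ true → 0# ≤ ev p ρ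
  ev≥0 [] ρ e = ≤-refl
  ev≥0 ((pos c , m) ∷ p) ρ e = +≥0 (*≥0 (⟪⟫≥0 c) (evM≥0 m ρ)) (ev≥0 p ρ e)

  posE : ∀ {n} {ρ : Vec F n} → NNs ρ → (e : Expr {n}) → allNN (norm e) ≡ true → Nn ρ
  posE {ρ = ρ} h e t = nn e (subst (0# ≤_) (ev-norm e ρ) (ev≥0 (norm e) h t))

  prove⁺ : ∀ {n} (l r : Expr {n}) {ρ : Vec F n} → NNs ρ → allNN (norm (r :- l)) ≡ true → ⟦ l ⟧ ρ ≤ ⟦ r ⟧ ρ
  prove⁺ l r h t = from≥0 (nonneg (posE h (r :- l) t))

  -- If y ≤ 0 then xy ≤ 0, so the hypothesis forces xy = 0, and multiplying by `inv x` gives y = 0.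
  cancel≥0 : ∀ {x y} → 0# < x → 0# ≤ x * y → 0# ≤ y
  cancel≥0 {x} {y} 0<x p with ≤-total 0# y
  ... | inj₁ q = q
  ... | inj₂ q = subst (0# ≤_) y≡0 ≤-refl
    where
    xy≡0 : x * y ≡ 0#
    xy≡0 = ≤-antisym (prove (var 0F :* var 1F) (lit 0) (x ∷ y ∷ []) (ge0 (var 0F) (<⇒≤ 0<x) ⊗ ge0 (:- var 1F) (neg≥0 q)) refl) p
    x≢0 : ¬ (x ≡ 0#)
    x≢0 e = 0<x (≤-reflexive e)
    y≡0 : 0# ≡ y
    y≡0 = sym (trans (sym (⟪1⟫* y)) (trans (cong (_* y) (sym (*-inv x x≢0))) (trans (cong (_* y) (*-comm x (inv x))) (trans (*-assoc (inv x) x y) (trans (cong (inv x *_) xy≡0) (*0 _))))))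

  *-cancel-≤ : ∀ {x y z} → 0# < x → x * y ≤ x * z → y ≤ z
  *-cancel-≤ {x} {y} {z} 0<x p = from≥0 (cancel≥0 0<x (subst (0# ≤_) (ring (var 0F :* var 2F :- var 0F :* var 1F) (var 0F :* (var 2F :- var 1F)) (x ∷ y ∷ z ∷ []) refl) (sub≥0 p)))

  inv-eq : ∀ {x} → 0# < x → x * inv x ≡ 1#
  inv-eq {x} 0<x = *-inv x (λ e → 0<x (≤-reflexive e))

  inv≥0 : ∀ {x} → 0# < x → 0# ≤ inv x
  inv≥0 {x} 0<x = cancel≥0 0<x (subst (0# ≤_) (sym (inv-eq 0<x)) (⟪⟫≥0 1))

  *>0 : ∀ {x y} → 0# < x → 0# < y → 0# < x * y
  *>0 {x} {y} p q xy≤0 = q (from≥0 (subst (0# ≤_) (sym (⟪0⟫+ (- y))) (cancel≥0 p (subst (0# ≤_) (ring (:- (var 0F :* var 1F)) (var 0F :* :- var 1F) (x ∷ y ∷ []) refl) (neg≥0 xy≤0)))))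

  *-mono : ∀ {a b c d} → 0# ≤ a → 0# ≤ c → a ≤ b → c ≤ d → a * c ≤ b * d
  *-mono {a} {b} {c} {d} pa pc ab cd = prove (var 0F :* var 2F) (var 1F :* var 3F) (a ∷ b ∷ c ∷ d ∷ [])
    (ge0 (var 0F) pa ⊗ le (var 2F) (var 3F) cd ⊕ le (var 0F) (var 1F) ab ⊗ ge0 (var 3F) (≤-trans pc cd)) refl

  ^-mono : ∀ {x y} → 0# ≤ x → x ≤ y → ∀ k → x ^ k ≤ y ^ k
  ^-mono p q zero = ≤-refl
  ^-mono p q (suc k) = *-mono p (^≥0 p k) q (^-mono p q k)

  record Zero {n} (ρ : Vec F n) : Set where
    constructor zz
    field
      expr : Expr {n}
      is0 : ⟦ expr ⟧ ρ ≡ 0#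
  open Zero

  module _ {n} {ρ : Vec F n} where
    infixl 6 _⊞_
    _⊞_ : Zero ρ → Zero ρ → Zero ρ
    zz a p ⊞ zz b q = zz (a :+ b) (trans (cong₂ _+_ p q) (⟪0⟫+ 0#))
    by= : (a b : Expr) → ⟦ a ⟧ ρ ≡ ⟦ b ⟧ ρ → (m : Expr) → Zero ρ
    by= a b p m = zz (m :* (a :- b)) (trans (cong (λ x → ⟦ m ⟧ ρ * (x - ⟦ b ⟧ ρ)) p) (trans (cong (⟦ m ⟧ ρ *_) (+-inv _)) (*0 _)))

  prove= : ∀ {n} (l r : Expr {n}) (ρ : Vec F n) (z : Zero ρ) → isNil (norm (l :- r :- expr z)) ≡ true → ⟦ l ⟧ ρ ≡ ⟦ r ⟧ ρ
  prove= l r ρ z e = trans (ring (var 0F) (var 0F :- var 1F :+ var 1F) (⟦ l ⟧ ρ ∷ ⟦ r ⟧ ρ ∷ []) refl)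
    (trans (cong (_+ ⟦ r ⟧ ρ) (trans (ring (l :- r) (expr z) ρ e) (is0 z))) (⟪0⟫+ _))

-- Powers of a point of the unit circle over the rationals

module PowersOfUnit where
  open Inequalities
  open import Data.Nat.Base as ℕ using (ℕ; suc; zero)
  open import Data.Sum.Base using (inj₁; inj₂)

  # : ℕ → F
  # k = ⟪ pos k ⟫

  #-suc : ∀ k → # (suc k) ≡ 1# + # k
  #-suc k = ⟪⟫-+ (pos 1) (pos k)

  sq≤1⇒≤1 : ∀ x → x * x ≤ 1# → x ≤ 1#
  sq≤1⇒≤1 x h with ≤-total x 1#
  ... | inj₁ p = p
  ... | inj₂ p = ≤-trans (prove (var 0F) (var 0F :* var 0F) (x ∷ []) (le (lit 1) (var 0F) p ⊗ (le (lit 1) (var 0F) p ⊕ nat 1)) refl) h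

  halve : ∀ {x y} → ⟪ pos 2 ⟫ * x ≤ ⟪ pos 2 ⟫ * y → x ≤ y
  halve = *-cancel-≤ (⟪⟫>0 1)

  -- Here a = cos φ, σ = sin² φ and c = |1 - u|². Below, `A k` and `U k` are the Chebyshev
  -- polynomials T_k(a) and U_(k-1)(a); with sin φ divided out of the imaginary part no irrational
  -- number occurs.
  module Pow (a : F) where
    σ c : F
    σ = 1# - a * a
    c = ⟪ pos 2 ⟫ - ⟪ pos 2 ⟫ * a

    -- uᵏ = A k + i √σ U k for u = a + i √σ on the unit circle
    mutual
      A U : ℕ → F
      A zero = 1#
      A (suc k) = a * A k - σ * U k
      U zero = 0#
      U (suc k) = a * U k + A k

    -- the deficit 2 − 2 Re uᵏ = |1 − uᵏ|²
    c[_] : ℕ → F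
    c[ k ] = ⟪ pos 2 ⟫ - ⟪ pos 2 ⟫ * A k

    AU-norm : ∀ k → A k * A k + σ * (U k * U k) ≡ 1#
    AU-norm zero = ring (lit 1 :* lit 1 :+ (lit 1 :- var 0F :* var 0F) :* (lit 0 :* lit 0)) (lit 1) (a ∷ []) refl
    AU-norm (suc k) = trans (ring
      (let a = var 0F ; A = var 1F ; U = var 2F ; s = lit 1 :- a :* a in
         (a :* A :- s :* U) :* (a :* A :- s :* U) :+ s :* ((a :* U :+ A) :* (a :* U :+ A)))
      (let a = var 0F ; A = var 1F ; U = var 2F ; s = lit 1 :- a :* a in A :* A :+ s :* (U :* U))
      (a ∷ A k ∷ U k ∷ []) refl) (AU-norm k)

    A-+ : ∀ j k → A (j ℕ.+ k) ≡ A j * A k - σ * (U j * U k)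
    U-+ : ∀ j k → U (j ℕ.+ k) ≡ U j * A k + A j * U k
    A-+ zero k = ring (var 1F) (lit 1 :* var 1F :- var 0F :* (lit 0 :* var 2F)) (σ ∷ A k ∷ U k ∷ []) refl
    A-+ (suc j) k rewrite A-+ j k | U-+ j k = ring
      (let s = var 0F ; a = var 1F ; A = var 2F ; U = var 3F ; B = var 4F ; V = var 5F in
        a :* (A :* B :- s :* (U :* V)) :- s :* (U :* B :+ A :* V))
      (let s = var 0F ; a = var 1F ; A = var 2F ; U = var 3F ; B = var 4F ; V = var 5F in
        (a :* A :- s :* U) :* B :- s :* ((a :* U :+ A) :* V))
      (σ ∷ a ∷ A j ∷ U j ∷ A k ∷ U k ∷ []) refl
    U-+ zero k = ring (var 2F) (lit 0 :* var 1F :+ lit 1 :* var 2F) (σ ∷ A k ∷ U k ∷ []) refl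
    U-+ (suc j) k rewrite A-+ j k | U-+ j k = ring
      (let s = lit 1 :- var 1F :* var 1F ; a = var 1F ; A = var 2F ; U = var 3F ; B = var 4F ; V = var 5F in
        a :* (U :* B :+ A :* V) :+ (A :* B :- s :* (U :* V)))
      (let s = lit 1 :- var 1F :* var 1F ; a = var 1F ; A = var 2F ; U = var 3F ; B = var 4F ; V = var 5F in
        (a :* U :+ A) :* B :+ (a :* A :- s :* U) :* V)
      (σ ∷ a ∷ A j ∷ U j ∷ A k ∷ U k ∷ []) refl

  module Unit (a : F) (a²≤1 : a * a ≤ 1#) where
    open Pow a public

    σ≥0 : 0# ≤ σ
    σ≥0 = sub≥0 a²≤1

    a≤1 : a ≤ 1#
    a≤1 = sq≤1⇒≤1 a a²≤1

    -1≤a : - 1# ≤ a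
    -1≤a = prove (:- lit 1) (var 0F) (a ∷ []) (le (:- var 0F) (lit 1) (sq≤1⇒≤1 (- a) (subst (_≤ 1#) (ring (var 0F :* var 0F) (:- var 0F :* :- var 0F) (a ∷ []) refl) a²≤1))) refl

    c≥0 : 0# ≤ c
    c≥0 = prove (lit 0) (lit 2 :- lit 2 :* var 0F) (a ∷ []) (nat 2 ⊗ le (var 0F) (lit 1) a≤1) refl

    c≤4 : c ≤ ⟪ pos 4 ⟫
    c≤4 = prove (lit 2 :- lit 2 :* var 0F) (lit 4) (a ∷ []) (nat 2 ⊗ le (:- lit 1) (var 0F) -1≤a) refl

    A≤1 : ∀ k → A k ≤ 1#
    A≤1 k = sq≤1⇒≤1 (A k) (prove (var 0F :* var 0F) (lit 1) (A k ∷ σ ∷ U k ∷ [])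
      (ge0 (var 1F) σ≥0 ⊗ sq (var 2F) ⊕ eqn (lit 1) (var 0F :* var 0F :+ var 1F :* (var 2F :* var 2F)) (sym (AU-norm k)) (lit 1)) refl)

    mutual
      -- The step is a convex combination: 2(k - aU) = (1 - a)(k + U) + (1 + a)(k - U), which is why
      -- both signs of the bound are proved together.
      U≤ : ∀ k → U k ≤ # k
      U≤ zero = ≤-refl
      U≤ (suc k) rewrite #-suc k = halve (prove
        (lit 2 :* (var 0F :* var 1F :+ var 2F)) (lit 2 :* (lit 1 :+ var 3F)) (a ∷ U k ∷ A k ∷ # k ∷ [])
        (le (var 0F) (lit 1) a≤1 ⊗ le (:- var 3F) (var 1F) (U≥- k) ⊕ le (:- lit 1) (var 0F) -1≤a ⊗ le (var 1F) (var 3F) (U≤ k)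
         ⊕ nat 2 ⊗ le (var 2F) (lit 1) (A≤1 k)) refl)

      U≥- : ∀ k → - # k ≤ U k
      U≥- zero = ≤-reflexive (ring (:- lit 0) (lit 0) [] refl)
      U≥- (suc k) rewrite #-suc k = halve (prove
        (lit 2 :* :- (lit 1 :+ var 3F)) (lit 2 :* (var 0F :* var 1F :+ var 2F)) (a ∷ U k ∷ A k ∷ # k ∷ [])
        (le (var 0F) (lit 1) a≤1 ⊗ le (var 1F) (var 3F) (U≤ k) ⊕ le (:- lit 1) (var 0F) -1≤a ⊗ le (:- var 3F) (var 1F) (U≥- k)
         ⊕ nat 2 ⊗ le (:- lit 1) (var 2F) (-1≤A k)) refl)

      -1≤A : ∀ k → - 1# ≤ A k
      -1≤A k = prove (:- lit 1) (var 0F) (A k ∷ []) (le (:- var 0F) (lit 1) (sq≤1⇒≤1 (- A k) (prove (:- var 0F :* :- var 0F) (lit 1) (A k ∷ σ ∷ U k ∷ [])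
        (ge0 (var 1F) σ≥0 ⊗ sq (var 2F) ⊕ eqn (lit 1) (var 0F :* var 0F :+ var 1F :* (var 2F :* var 2F)) (sym (AU-norm k)) (lit 1)) refl))) refl

    c[]≥0 : ∀ k → 0# ≤ c[ k ]
    c[]≥0 k = prove (lit 0) (lit 2 :- lit 2 :* var 0F) (A k ∷ []) (nat 2 ⊗ le (var 0F) (lit 1) (A≤1 k)) refl

    c[]≤ : ∀ k → c[ k ] ≤ # k * # k * c
    c[]≤ zero = ≤-reflexive (ring (lit 2 :- lit 2 :* lit 1) (lit 0 :* lit 0 :* var 0F) (c ∷ []) refl)
    c[]≤ (suc k) rewrite #-suc k = prove
      (lit 2 :- lit 2 :* (var 0F :* var 2F :- (lit 1 :- var 0F :* var 0F) :* var 1F))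
      ((lit 1 :+ var 3F) :* (lit 1 :+ var 3F) :* (lit 2 :- lit 2 :* var 0F))
      (a ∷ U k ∷ A k ∷ # k ∷ [])
      (le (lit 2 :- lit 2 :* var 2F) (var 3F :* var 3F :* (lit 2 :- lit 2 :* var 0F)) (c[]≤ k)
       ⊕ ge0 (lit 2 :- lit 2 :* var 0F) c≥0 ⊗ (le (var 2F) (lit 1) (A≤1 k)
          ⊕ le (:- lit 1) (var 0F) -1≤a ⊗ le (var 1F) (var 3F) (U≤ k) ⊕ le (var 0F) (lit 1) a≤1 ⊗ ge0 (var 3F) (⟪⟫≥0 k))) refl

    -- Truncation of the expansion of sin kφ / sin φ in powers of c, which begins k - (k³ - k)c/6.
    U≥ : ∀ k → ⟪ pos 6 ⟫ * # k - c * (# k * # k * # k - # k) ≤ ⟪ pos 6 ⟫ * U k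
    U≥ zero = ≤-reflexive (ring (lit 6 :* lit 0 :- var 0F :* (lit 0 :* lit 0 :* lit 0 :- lit 0)) (lit 6 :* lit 0) (c ∷ []) refl)
    U≥ (suc k) rewrite #-suc k = prove
      (let m = lit 1 :+ var 3F ; c = lit 2 :- lit 2 :* var 0F in lit 6 :* m :- c :* (m :* m :* m :- m))
      (lit 6 :* (var 0F :* var 1F :+ var 2F))
      (a ∷ U k ∷ A k ∷ # k ∷ [])
      (let m = var 3F ; c = lit 2 :- lit 2 :* var 0F in
       le (lit 6 :* m :- c :* (m :* m :* m :- m)) (lit 6 :* var 1F) (U≥ k)
       ⊕ nat 3 ⊗ (ge0 c c≥0 ⊗ le (var 1F) m (U≤ k)) ⊕ nat 3 ⊗ le (lit 2 :- lit 2 :* var 2F) (m :* m :* c) (c[]≤ k)) refl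

    -- Likewise |1 - uᵏ|² begins k²c - k²(k² - 1)c²/12; the induction step uses the truncation in
    -- `U≥`.
    c[]≥ : ∀ k → # k * # k * (⟪ pos 12 ⟫ * c) - # k * # k * (# k * # k - 1#) * (c * c) ≤ ⟪ pos 12 ⟫ * c[ k ]
    c[]≥ zero = ≤-reflexive (ring (lit 0 :* lit 0 :* (lit 12 :* var 0F) :- lit 0 :* lit 0 :* (lit 0 :* lit 0 :- lit 1) :* (var 0F :* var 0F)) (lit 12 :* (lit 2 :- lit 2 :* lit 1)) (c ∷ []) refl)
    c[]≥ (suc k) rewrite #-suc k = prove
      (let m = lit 1 :+ var 3F ; c = lit 2 :- lit 2 :* var 0F in m :* m :* (lit 12 :* c) :- m :* m :* (m :* m :- lit 1) :* (c :* c))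
      (lit 12 :* (lit 2 :- lit 2 :* (var 0F :* var 2F :- (lit 1 :- var 0F :* var 0F) :* var 1F)))
      (a ∷ U k ∷ A k ∷ # k ∷ [])
      (let m = var 3F ; c = lit 2 :- lit 2 :* var 0F in
       le (m :* m :* (lit 12 :* c) :- m :* m :* (m :* m :- lit 1) :* (c :* c)) (lit 12 :* (lit 2 :- lit 2 :* var 2F)) (c[]≥ k)
       ⊕ nat 6 ⊗ (ge0 c c≥0 ⊗ le (lit 2 :- lit 2 :* var 2F) (m :* m :* c) (c[]≤ k))
       ⊕ nat 4 ⊗ (ge0 c c≥0 ⊗ le (lit 6 :* m :- c :* (m :* m :* m :- m)) (lit 6 :* var 1F) (U≥ k))
       ⊕ nat 6 ⊗ (ge0 c c≥0 ⊗ (ge0 c c≥0 ⊗ le (var 1F) m (U≤ k)))) refl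

    A-2a : ∀ k → A (suc (suc k)) + A k ≡ ⟪ pos 2 ⟫ * (a * A (suc k))
    A-2a k = ring
      (let a = var 0F ; A = var 1F ; U = var 2F ; s = lit 1 :- a :* a in (a :* (a :* A :- s :* U) :- s :* (a :* U :+ A)) :+ A)
      (let a = var 0F ; A = var 1F ; U = var 2F ; s = lit 1 :- a :* a in lit 2 :* (a :* (a :* A :- s :* U)))
      (a ∷ A k ∷ U k ∷ []) refl

-- Means over the circle from samples

module SampleMeans where
  open Inequalities
  open PowersOfUnit
  open import Data.Nat.Base as ℕ using (ℕ; suc; zero)
  import Data.Integer.Base as ℤ
  open ℤ using (ℤ)
  open import Data.Product.Base using (Σ; _×_; _,_; proj₁; proj₂; ∃)
  open import Data.Sum.Base using (inj₁; inj₂)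
  open import Data.Empty using (⊥; ⊥-elim)
  open import Data.List.Base using ([]; _∷_)
  open import Relation.Nullary.Decidable.Core using (yes; no)

  Σ< : ℕ → (ℕ → F) → F
  Σ< zero f = 0#
  Σ< (suc n) f = Σ< n f + f n

  -- The sum of L samples is Lα up to an error independent of L. This is stronger than convergence
  -- of the averages and is closed under linear combinations without any limit.
  HasMean : (ℕ → F) → F → Set
  HasMean φ α = Σ F λ B → ∀ L → (Σ< L φ ≤ # L * α + B) × (# L * α - B ≤ Σ< L φ)

  mean-+ : ∀ {φ ψ α β} → HasMean φ α → HasMean ψ β → HasMean (λ l → φ l + ψ l) (α + β)
  mean-+ {φ} {ψ} {α} {β} (B , p) (C , q) = B + C , λ L →
    let ρ = # L ∷ α ∷ β ∷ B ∷ C ∷ Σ< L φ ∷ Σ< L ψ ∷ [] in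
    subst (_≤ # L * (α + β) + (B + C)) (sym (Σ+ L)) (prove (var 5F :+ var 6F) (var 0F :* (var 1F :+ var 2F) :+ (var 3F :+ var 4F)) ρ
      (le (var 5F) (var 0F :* var 1F :+ var 3F) (proj₁ (p L)) ⊕ le (var 6F) (var 0F :* var 2F :+ var 4F) (proj₁ (q L))) refl) ,
    subst (# L * (α + β) - (B + C) ≤_) (sym (Σ+ L)) (prove (var 0F :* (var 1F :+ var 2F) :- (var 3F :+ var 4F)) (var 5F :+ var 6F) ρ
      (le (var 0F :* var 1F :- var 3F) (var 5F) (proj₂ (p L)) ⊕ le (var 0F :* var 2F :- var 4F) (var 6F) (proj₂ (q L))) refl)
    where
    Σ+ : ∀ L → Σ< L (λ l → φ l + ψ l) ≡ Σ< L φ + Σ< L ψ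
    Σ+ zero = sym (⟪0⟫+ 0#)
    Σ+ (suc L) = trans (cong (_+ (φ L + ψ L)) (Σ+ L)) (+-swap _ _ _ _)

  mean-* : ∀ {φ α} x → HasMean φ α → HasMean (λ l → x * φ l) (x * α)
  mean-* {φ} {α} x (B , p) with ≤-total 0# x
  ... | inj₁ 0≤x = x * B , λ L → let ρ = # L ∷ α ∷ x ∷ B ∷ Σ< L φ ∷ [] in
    subst (_≤ # L * (x * α) + x * B) (sym (Σ* L)) (prove (var 2F :* var 4F) (var 0F :* (var 2F :* var 1F) :+ var 2F :* var 3F) ρ
      (ge0 (var 2F) 0≤x ⊗ le (var 4F) (var 0F :* var 1F :+ var 3F) (proj₁ (p L))) refl) ,
    subst (# L * (x * α) - x * B ≤_) (sym (Σ* L)) (prove (var 0F :* (var 2F :* var 1F) :- var 2F :* var 3F) (var 2F :* var 4F) ρ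
      (ge0 (var 2F) 0≤x ⊗ le (var 0F :* var 1F :- var 3F) (var 4F) (proj₂ (p L))) refl)
    where
    Σ* : ∀ L → Σ< L (λ l → x * φ l) ≡ x * Σ< L φ
    Σ* zero = sym (*0 x)
    Σ* (suc L) = trans (cong (_+ (x * φ L)) (Σ* L)) (sym (distribˡ _ _ _))
  ... | inj₂ x≤0 = - x * B , λ L → let ρ = # L ∷ α ∷ x ∷ B ∷ Σ< L φ ∷ [] in
    subst (_≤ # L * (x * α) + - x * B) (sym (Σ* L)) (prove (var 2F :* var 4F) (var 0F :* (var 2F :* var 1F) :+ :- var 2F :* var 3F) ρ
      (ge0 (:- var 2F) (neg≥0 x≤0) ⊗ le (var 0F :* var 1F :- var 3F) (var 4F) (proj₂ (p L))) refl) ,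
    subst (# L * (x * α) - - x * B ≤_) (sym (Σ* L)) (prove (var 0F :* (var 2F :* var 1F) :- :- var 2F :* var 3F) (var 2F :* var 4F) ρ
      (ge0 (:- var 2F) (neg≥0 x≤0) ⊗ le (var 4F) (var 0F :* var 1F :+ var 3F) (proj₁ (p L))) refl)
    where
    Σ* : ∀ L → Σ< L (λ l → x * φ l) ≡ x * Σ< L φ
    Σ* zero = sym (*0 x)
    Σ* (suc L) = trans (cong (_+ (x * φ L)) (Σ* L)) (sym (distribˡ _ _ _))

  mean-≗ : ∀ {φ ψ α β} → (∀ l → φ l ≡ ψ l) → α ≡ β → HasMean φ α → HasMean ψ β
  mean-≗ {φ} {ψ} {α} e refl (B , p) = B , λ L → subst (λ s → (s ≤ # L * α + B) × (# L * α - B ≤ s)) (Σ≗ L) (p L)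
    where
    Σ≗ : ∀ L → Σ< L φ ≡ Σ< L ψ
    Σ≗ zero = refl
    Σ≗ (suc L) = cong₂ _+_ (Σ≗ L) (e L)

  mean-const : ∀ x → HasMean (λ _ → x) x
  mean-const x = 0# , λ L → ≤-reflexive (trans (Σc L) (sym (+0 _))) , ≤-reflexive (trans (ring (var 0F :- lit 0) (var 0F) (# L * x ∷ []) refl) (sym (Σc L)))
    where
    Σc : ∀ L → Σ< L (λ _ → x) ≡ # L * x
    Σc zero = sym (0* x)
    Σc (suc L) = trans (cong (_+ x) (Σc L)) (trans (ring (var 0F :* var 1F :+ var 1F) ((lit 1 :+ var 0F) :* var 1F) (# L ∷ x ∷ []) refl) (cong (_* x) (sym (#-suc L))))

  -- If α < 0, the nonnegative sums would stay below Lα + B, which the Archimedean property makes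
  -- negative for some L.
  mean≥0 : ∀ {φ α} → HasMean φ α → (∀ l → 0# ≤ φ l) → 0# ≤ α
  mean≥0 {φ} {α} (B , p) h with 0# ≤? α
  ... | yes q = q
  ... | no α<0 = ⊥-elim (contra (archimedean ((1# + B) * inv (- α))))
    where
    Σ≥0 : ∀ L → 0# ≤ Σ< L φ
    Σ≥0 zero = ≤-refl
    Σ≥0 (suc L) = +≥0 (Σ≥0 L) (h L)
    0<-α : 0# < - α
    0<-α q = α<0 (prove (lit 0) (var 0F) (α ∷ []) (le (:- var 0F) (lit 0) q) refl)
    contra : (∃ λ k → (1# + B) * inv (- α) ≤ # k) → ⊥
    contra (k , q) = ⟪⟫>0 0 (prove (lit 1) (lit 0) (α ∷ B ∷ inv (- α) ∷ # k ∷ Σ< k φ ∷ [])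
      (ge0 (:- var 0F) (<⇒≤ 0<-α) ⊗ le ((lit 1 :+ var 1F) :* var 2F) (var 3F) q
       ⊕ ge0 (var 4F) (Σ≥0 k) ⊕ le (var 4F) (var 3F :* var 0F :+ var 1F) (proj₁ (p k))
       ⊕ eqn (lit 1) (:- var 0F :* var 2F) (sym (inv-eq 0<-α)) (:- (lit 1 :+ var 1F))) refl)

  five a₀ half : F
  five = ⟪ pos 5 ⟫
  a₀ = ⟪ pos 3 ⟫ * inv five
  half = inv ⟪ pos 2 ⟫

  2half : ⟪ pos 2 ⟫ * half ≡ 1#
  2half = inv-eq (⟪⟫>0 1)

  5a₀ : five * a₀ ≡ ⟪ pos 3 ⟫
  5a₀ = trans (ring (var 0F :* (lit 3 :* var 1F)) (lit 3 :* (var 0F :* var 1F)) (five ∷ inv five ∷ []) refl)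
    (trans (cong (⟪ pos 3 ⟫ *_) (inv-eq (⟪⟫>0 4))) (*1 _))

  abstract
   a₀²≤1 : a₀ * a₀ ≤ 1#
   a₀²≤1 = *-cancel-≤ (⟪⟫>0 24) (prove (lit 25 :* (var 0F :* var 0F)) (lit 25 :* lit 1) (a₀ ∷ [])
    (nat 16 ⊕ eqn (lit 5 :* var 0F) (lit 3) 5a₀ (:- (lit 5 :* var 0F :+ lit 3))) refl)

  module Base = Unit a₀ a₀²≤1

  abstract
   A²≤1 : ∀ l → Base.A l * Base.A l ≤ 1#
   A²≤1 l = prove (var 0F :* var 0F) (lit 1) (Base.A l ∷ Base.σ ∷ Base.U l ∷ [])
    (ge0 (var 1F) Base.σ≥0 ⊗ sq (var 2F) ⊕ eqn (lit 1) (var 0F :* var 0F :+ var 1F :* (var 2F :* var 2F)) (sym (Base.AU-norm l)) (lit 1)) refl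

  -- the l-th sample is the l-th power of (3 + 4i)/5
  module Sample (l : ℕ) = Unit (Base.A l) (A²≤1 l)

  -- The two halves of (uˡ)ᵏ = u^(kl). The imaginary part of a sample is scaled by `Base.U l`; this
  -- factor is multiplied across and not divided out, because it vanishes at l = 0.
  sample-A : ∀ l k → Sample.A l k ≡ Base.A (k ℕ.* l)
  sample-U : ∀ l k → Sample.U l k * Base.U l ≡ Base.U (k ℕ.* l)
  sample-A l zero = refl
  sample-A l (suc k) = sym (trans (Base.A-+ l (k ℕ.* l)) (trans (cong₂ (λ x y → Base.A l * x - Base.σ * (Base.U l * y)) (sym (sample-A l k)) (sym (sample-U l k)))
    (trans (ring (var 0F :* var 1F :- var 2F :* (var 3F :* (var 4F :* var 3F))) (var 0F :* var 1F :- (var 2F :* (var 3F :* var 3F)) :* var 4F)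
       (Base.A l ∷ Sample.A l k ∷ Base.σ ∷ Base.U l ∷ Sample.U l k ∷ []) refl)
     (cong (λ s → Base.A l * Sample.A l k - s * Sample.U l k) σl))))
    where
    σl : Base.σ * (Base.U l * Base.U l) ≡ 1# - Base.A l * Base.A l
    σl = trans (ring (var 1F) (var 0F :+ var 1F :- var 0F) (Base.A l * Base.A l ∷ Base.σ * (Base.U l * Base.U l) ∷ []) refl) (cong (_- Base.A l * Base.A l) (Base.AU-norm l))
  sample-U l zero = 0* _
  sample-U l (suc k) = sym (trans (Base.U-+ l (k ℕ.* l)) (trans (cong₂ (λ x y → Base.U l * x + Base.A l * y) (sym (sample-A l k)) (sym (sample-U l k)))
    (ring (var 0F :* var 1F :+ var 2F :* (var 3F :* var 0F)) ((var 2F :* var 3F :+ var 1F) :* var 0F) (Base.U l ∷ Sample.A l k ∷ Base.A l ∷ Sample.U l k ∷ []) refl)))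

  -- 5ᵏ U k = 5 W with W ≡ 1 (mod 5), so (3 + 4i)/5 is not a root of unity
  base-U-mod5 : ∀ k → Σ ℤ λ i → Σ ℤ λ j → (five ^ k * Base.U (suc k) ≡ five * ⟪ i ⟫ + 1#) × (five ^ k * (five * Base.A (suc k)) ≡ five * ⟪ j ⟫ + ⟪ pos 3 ⟫)
  base-U-mod5 zero = pos 0 , pos 0 ,
    ring (lit 1 :* (var 0F :* lit 0 :+ lit 1)) (lit 5 :* lit 0 :+ lit 1) (a₀ ∷ []) refl ,
    trans (ring (lit 1 :* (lit 5 :* (var 0F :* lit 1 :- var 1F :* lit 0))) (lit 5 :* var 0F) (a₀ ∷ Base.σ ∷ []) refl)
      (trans 5a₀ (ring (lit 3) (lit 5 :* lit 0 :+ lit 3) [] refl))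
  base-U-mod5 (suc k) with base-U-mod5 k
  ... | i , j , eU , eA = i′ , j′ , eU′ , eA′
    where
    i′ = (pos 3 ℤ.* i ℤ.+ j) ℤ.+ pos 1
    j′ = (pos 3 ℤ.* j ℤ.+ negsuc 15 ℤ.* i) ℤ.+ negsuc 1
    ρ = five ^ k ∷ Base.U (suc k) ∷ Base.A (suc k) ∷ a₀ ∷ ⟪ i ⟫ ∷ ⟪ j ⟫ ∷ []
    eU′ : five ^ suc k * (a₀ * Base.U (suc k) + Base.A (suc k)) ≡ five * ⟪ i′ ⟫ + 1#
    eU′ = trans (ring (lit 5 :* var 0F :* (var 3F :* var 1F :+ var 2F)) (lit 5 :* var 3F :* (var 0F :* var 1F) :+ var 0F :* (lit 5 :* var 2F)) ρ refl)
      (trans (cong₂ _+_ (cong₂ _*_ 5a₀ eU) eA)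
      (trans (ring (lit 3 :* (lit 5 :* var 4F :+ lit 1) :+ (lit 5 :* var 5F :+ lit 3)) (lit 5 :* (lit 3 :* var 4F :+ var 5F :+ lit 1) :+ lit 1) ρ refl)
      (cong (λ x → five * x + 1#) (sym (trans (⟪⟫-+ _ _) (cong (_+ 1#) (trans (⟪⟫-+ _ _) (cong (_+ ⟪ j ⟫) (⟪⟫-* _ _)))))))))
    eA′ : five ^ suc k * (five * (a₀ * Base.A (suc k) - (1# - a₀ * a₀) * Base.U (suc k))) ≡ five * ⟪ j′ ⟫ + ⟪ pos 3 ⟫
    eA′ = trans (ring (lit 5 :* var 0F :* (lit 5 :* (var 3F :* var 2F :- (lit 1 :- var 3F :* var 3F) :* var 1F)))
        (lit 5 :* var 3F :* (var 0F :* (lit 5 :* var 2F)) :+ ((lit 5 :* var 3F) :* (lit 5 :* var 3F) :- lit 25) :* (var 0F :* var 1F)) ρ refl)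
      (trans (cong₂ _+_ (cong₂ _*_ 5a₀ eA) (cong₂ (λ x y → (x * x - ⟪ pos 25 ⟫) * y) 5a₀ eU))
      (trans (ring (lit 3 :* (lit 5 :* var 5F :+ lit 3) :+ (lit 3 :* lit 3 :- lit 25) :* (lit 5 :* var 4F :+ lit 1))
         (lit 5 :* (lit 3 :* var 5F :+ con (negsuc 15) :* var 4F :+ con (negsuc 1)) :+ lit 3) ρ refl)
      (cong (λ x → five * x + ⟪ pos 3 ⟫) (sym (trans (⟪⟫-+ _ _) (cong (_+ ⟪ negsuc 1 ⟫) (trans (⟪⟫-+ _ _) (cong₂ _+_ (⟪⟫-* _ _) (⟪⟫-* _ _)))))))))

  base-U≢0 : ∀ k → Base.U (suc k) ≡ 0# → ⊥
  base-U≢0 k U≡0 with base-U-mod5 k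
  ... | i , j , eU , _ = absurd i (trans (sym eU) (trans (cong (five ^ k *_) U≡0) (*0 _)))
    where
    absurd : ∀ i → five * ⟪ i ⟫ + 1# ≡ 0# → ⊥
    absurd (pos n) e = ⟪⟫>0 0 (prove (lit 1) (lit 0) (⟪ pos n ⟫ ∷ []) (nat 5 ⊗ ge0 (var 0F) (⟪⟫≥0 n) ⊕ eqn (lit 5 :* var 0F :+ lit 1) (lit 0) e (con (negsuc 0))) refl)
    absurd (negsuc n) e = ⟪⟫>0 0 (prove (lit 1) (lit 0) (⟪ negsuc n ⟫ ∷ []) (nat 5 ⊗ le (var 0F) (con (negsuc 0)) (⟪⟫-≤ (ℤ.-≤- ℕ.z≤n)) ⊕ nat 3 ⊕ eqn (lit 5 :* var 0F :+ lit 1) (lit 0) e (lit 1)) refl)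

  -- σ of a sample is `Base.σ` times the square of `Base.U`, so its vanishing would make a positive
  -- power of (3 + 4i)/5 real.
  sample-σ>0 : ∀ k → 0# < Sample.σ (suc k)
  sample-σ>0 k σ≤0 = base-U≢0 k U≡0
    where
    u = Base.U (suc k)
    σ₀>0 : 0# < Base.σ
    σ₀>0 p = ⟪⟫>0 15 (prove (lit 16) (lit 0) (a₀ ∷ []) (nat 25 ⊗ le (lit 1 :- var 0F :* var 0F) (lit 0) p ⊕ eqn (lit 5 :* var 0F) (lit 3) 5a₀ (:- (lit 5 :* var 0F :+ lit 3))) refl)
    u²≤0 : u * u ≤ 0#
    u²≤0 = *-cancel-≤ σ₀>0 (prove (var 0F :* (var 1F :* var 1F)) (var 0F :* lit 0) (Base.σ ∷ u ∷ Base.A (suc k) ∷ [])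
      (le (lit 1 :- var 2F :* var 2F) (lit 0) σ≤0 ⊕ eqn (lit 1) (var 2F :* var 2F :+ var 0F :* (var 1F :* var 1F)) (sym (Base.AU-norm (suc k))) (lit 1)) refl)
    U≡0 : u ≡ 0#
    U≡0 = ≤-antisym (nonpos u u²≤0) (prove (lit 0) (var 0F) (u ∷ []) (le (:- var 0F) (lit 0) (nonpos (- u) (subst (_≤ 0#) (ring (var 0F :* var 0F) (:- var 0F :* :- var 0F) (u ∷ []) refl) u²≤0))) refl)
      where
      nonpos : ∀ x → x * x ≤ 0# → x ≤ 0#
      nonpos x h with x ≤? 0#
      ... | yes p = p
      ... | no 0<x = ⊥-elim (*>0 0<x 0<x h)

  δ₀ : ℕ → F
  δ₀ zero = 1#
  δ₀ (suc k) = 0#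

  -- 2 Σ_{l<L} A l telescopes, and U is bounded because σ U² ≤ 1
  mean-A : ∀ k → HasMean (λ l → Sample.A l k) (δ₀ k)
  mean-A zero = mean-const 1#
  mean-A (suc k) = B , λ L → subst (λ s → (s ≤ # L * 0# + B) × (# L * 0# - B ≤ s)) (Σ≗ L) (bound L)
    where
    open Sample (suc k) using (A; U; σ; AU-norm; A≤1; -1≤A; a≤1; -1≤a; σ≥0)
    a = Base.A (suc k)
    i = inv σ
    B = ⟪ pos 2 ⟫ + i
    Σ≗ : ∀ L → Σ< L A ≡ Σ< L (λ l → Sample.A l (suc k))
    Σ≗ zero = refl
    -- A fixed power of the l-th sample is the l-th power of one fixed sample, so the average
    -- becomes a geometric sum.
    Σ≗ (suc L) = cong₂ _+_ (Σ≗ L) (trans (sample-A (suc k) L) (trans (cong Base.A (ℕ*-comm L (suc k))) (sym (sample-A L (suc k)))))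
      where open import Data.Nat.Properties renaming (*-comm to ℕ*-comm) using ()
    tel : ∀ L → ⟪ pos 2 ⟫ * Σ< L A ≡ (1# + a) * U L - A L + 1#
    tel zero = ring (lit 2 :* lit 0) ((lit 1 :+ var 0F) :* lit 0 :- lit 1 :+ lit 1) (a ∷ []) refl
    tel (suc L) = trans (distribˡ _ _ _) (trans (cong (_+ ⟪ pos 2 ⟫ * A L) (tel L)) (ring
      ((lit 1 :+ var 0F) :* var 1F :- var 2F :+ lit 1 :+ lit 2 :* var 2F)
      ((lit 1 :+ var 0F) :* (var 0F :* var 1F :+ var 2F) :- (var 0F :* var 2F :- (lit 1 :- var 0F :* var 0F) :* var 1F) :+ lit 1)
      (a ∷ U L ∷ A L ∷ []) refl))
    i≥0 = inv≥0 (sample-σ>0 k)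
    -- (u − 1)² ≥ 0 and u² ≤ 1/σ give 2u ≤ 1 + 1/σ
    U² : ∀ L → U L * U L ≤ i
    U² L = *-cancel-≤ (sample-σ>0 k) (prove (var 0F :* (var 1F :* var 1F)) (var 0F :* var 2F) (σ ∷ U L ∷ i ∷ A L ∷ [])
      (sq (var 3F) ⊕ eqn (lit 1) (var 3F :* var 3F :+ var 0F :* (var 1F :* var 1F)) (sym (AU-norm L)) (lit 1) ⊕ eqn (var 0F :* var 2F) (lit 1) (inv-eq (sample-σ>0 k)) (lit 1)) refl)
    bound : ∀ L → (Σ< L A ≤ # L * 0# + B) × (# L * 0# - B ≤ Σ< L A)
    bound L =
      halve (prove (lit 2 :* var 0F) (lit 2 :* (var 5F :* lit 0 :+ (lit 2 :+ var 1F))) ρ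
        (e (con (negsuc 0)) ⊕ le (:- lit 1) (var 4F) (-1≤A L) ⊕ x₁ ⊗ u₁ ⊕ x₂ ⊗ u₂) refl) ,
      halve (prove (lit 2 :* (var 5F :* lit 0 :- (lit 2 :+ var 1F))) (lit 2 :* var 0F) ρ
        (e (lit 1) ⊕ le (var 4F) (lit 1) (A≤1 L) ⊕ x₁ ⊗ u₃ ⊕ x₂ ⊗ u₂ ⊕ nat 2) refl)
      where
      ρ = Σ< L A ∷ i ∷ a ∷ U L ∷ A L ∷ # L ∷ []
      e = eqn {ρ = ρ} (lit 2 :* var 0F) ((lit 1 :+ var 2F) :* var 3F :- var 4F :+ lit 1) (tel L)
      x₁ = le {ρ = ρ} (:- lit 1) (var 2F) -1≤a
      x₂ = le {ρ = ρ} (var 2F) (lit 1) a≤1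
      half≤ : ∀ x → x * x ≤ i → x ≤ 1# + i
      half≤ x h = halve (prove (lit 2 :* var 0F) (lit 2 :* (lit 1 :+ var 1F)) (x ∷ i ∷ [])
        (sq (var 0F :- lit 1) ⊕ le (var 0F :* var 0F) (var 1F) h ⊕ ge0 (var 1F) i≥0 ⊕ nat 1) refl)
      u₁ = le {ρ = ρ} (var 3F) (lit 1 :+ var 1F) (half≤ (U L) (U² L))
      u₃ = le {ρ = ρ} (:- var 3F) (lit 1 :+ var 1F) (half≤ (- U L) (subst (_≤ i) (ring (var 0F :* var 0F) (:- var 0F :* :- var 0F) (U L ∷ []) refl) (U² L)))
      u₂ = ge0 {ρ = ρ} (lit 1 :+ var 1F) (+≥0 (⟪⟫≥0 1) i≥0)

-- Products of nearly real factors

module PairProducts where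
  open Inequalities
  open import Data.Nat.Base as ℕ using (ℕ; suc; zero)
  import Data.Nat.Properties as ℕP
  open import Relation.Nullary.Decidable.Core using (yes; no)
  open import Data.Empty using (⊥-elim)
  open import Data.Product.Base using (_×_; _,_; proj₁; proj₂)

  Σ₁ Π₁ : (ℕ → F) → ℕ → F
  Σ₁ f zero = 0#
  Σ₁ f (suc k) = Σ₁ f k + f (suc k)
  Π₁ f zero = 1#
  Π₁ f (suc k) = Π₁ f k * f (suc k)

  Σ₁≥0 : ∀ {f} → (∀ k → 0# ≤ f (suc k)) → ∀ n → 0# ≤ Σ₁ f n
  Σ₁≥0 h zero = ≤-refl
  Σ₁≥0 h (suc n) = +≥0 (Σ₁≥0 h n) (h n)

  Π₁≥0 : ∀ {f} → (∀ k → 0# ≤ f (suc k)) → ∀ n → 0# ≤ Π₁ f n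
  Π₁≥0 h zero = ⟪⟫≥0 1
  Π₁≥0 h (suc n) = *≥0 (Π₁≥0 h n) (h n)

  Σ₁-mono : ∀ {f g} n → (∀ k → k ℕ.< n → f (suc k) ≤ g (suc k)) → Σ₁ f n ≤ Σ₁ g n
  Σ₁-mono zero h = ≤-refl
  Σ₁-mono (suc n) h = +-mono (Σ₁-mono n (λ k p → h k (ℕP.m≤n⇒m≤1+n p))) (h n ℕP.≤-refl)

  Π₁-mono : ∀ {f g} n → (∀ k → 0# ≤ f (suc k)) → (∀ k → k ℕ.< n → f (suc k) ≤ g (suc k)) → Π₁ f n ≤ Π₁ g n
  Π₁-mono zero p h = ≤-refl
  Π₁-mono (suc n) p h = *-mono (Π₁≥0 p n) (p n) (Π₁-mono n p (λ k q → h k (ℕP.m≤n⇒m≤1+n q))) (h n ℕP.≤-refl)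

  abs-square : ∀ {x b} → 0# ≤ b → x * x ≤ b * b → x ≤ b
  abs-square {x} {b} 0≤b h with x ≤? b
  ... | yes p = p
  ... | no b<x = ⊥-elim (*>0 (λ q → b<x (from≥0 (subst (0# ≤_) (ring (:- (var 0F :- var 1F)) (var 1F :- var 0F) (x ∷ b ∷ []) refl) (neg≥0 q))))
      (λ q → b<x (prove (var 0F) (var 1F) (x ∷ b ∷ []) (le (var 0F :+ var 1F) (lit 0) q ⊕ nat 2 ⊗ ge0 (var 1F) 0≤b) refl))
      (prove ((var 0F :- var 1F) :* (var 0F :+ var 1F)) (lit 0) (x ∷ b ∷ []) (le (var 0F :* var 0F) (var 1F :* var 1F) h) refl))

  module Prod (σ : F) (R Y : ℕ → F) where
    mutual
      X W : ℕ → F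
      X zero = 1#
      X (suc k) = X k * R (suc k) - σ * (W k * Y (suc k))
      W zero = 0#
      W (suc k) = X k * Y (suc k) + W k * R (suc k)

    XW-norm : ∀ k → X k * X k + σ * (W k * W k) ≡ Π₁ (λ m → R m * R m + σ * (Y m * Y m)) k
    XW-norm zero = ring (lit 1 :* lit 1 :+ var 0F :* (lit 0 :* lit 0)) (lit 1) (σ ∷ []) refl
    XW-norm (suc k) = trans (ring
      (let x = var 0F ; w = var 1F ; r = var 2F ; y = var 3F ; s = var 4F in (x :* r :- s :* (w :* y)) :* (x :* r :- s :* (w :* y)) :+ s :* ((x :* y :+ w :* r) :* (x :* y :+ w :* r)))
      (let x = var 0F ; w = var 1F ; r = var 2F ; y = var 3F ; s = var 4F in (x :* x :+ s :* (w :* w)) :* (r :* r :+ s :* (y :* y)))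
      (X k ∷ W k ∷ R (suc k) ∷ Y (suc k) ∷ σ ∷ []) refl) (cong (_* (R (suc k) * R (suc k) + σ * (Y (suc k) * Y (suc k)))) (XW-norm k))

    -- |Yₘ| ≤ τₘ Rₘ : every factor turns by at most √σ τₘ, hence Re ∏ ≥ ∏ R (1 − M σ (Σ τ)²/2)
    module Bound (σ≥0 : 0# ≤ σ) (τ : ℕ → F) (M : F) (K : ℕ) (1≤M : 1# ≤ M)
      (R≥0 : ∀ k → 0# ≤ R (suc k)) (τ≥0 : ∀ k → 0# ≤ τ (suc k))
      (Y≤ : ∀ k → k ℕ.< K → Y (suc k) ≤ τ (suc k) * R (suc k)) (Y≥ : ∀ k → k ℕ.< K → - (τ (suc k) * R (suc k)) ≤ Y (suc k))
      (M² : Π₁ (λ m → 1# + σ * (τ m * τ m)) K ≤ M * M) where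

      Q : ℕ → F
      Q = Π₁ (λ m → 1# + σ * (τ m * τ m))

      1≤factor : ∀ k → 1# ≤ 1# + σ * (τ (suc k) * τ (suc k))
      1≤factor k = prove (lit 1) (lit 1 :+ var 0F) (σ * (τ (suc k) * τ (suc k)) ∷ []) (ge0 (var 0F) (*≥0 σ≥0 (sq≥0 (τ (suc k))))) refl

      factor≥0 : ∀ k → 0# ≤ 1# + σ * (τ (suc k) * τ (suc k))
      factor≥0 k = ≤-trans (⟪⟫≥0 1) (1≤factor k)

      Q≤ : ∀ j k → Q k ≤ Q (j ℕ.+ k)
      Q≤ zero k = ≤-refl
      Q≤ (suc j) k = ≤-trans (Q≤ j k) (prove (var 0F) (var 0F :* var 1F) (Q (j ℕ.+ k) ∷ 1# + σ * (τ (suc (j ℕ.+ k)) * τ (suc (j ℕ.+ k))) ∷ [])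
        (ge0 (var 0F) (Π₁≥0 factor≥0 (j ℕ.+ k)) ⊗ le (lit 1) (var 1F) (1≤factor (j ℕ.+ k))) refl)

      Q≤M² : ∀ k → k ℕ.≤ K → Q k ≤ M * M
      Q≤M² k k≤K = ≤-trans (subst (λ m → Q k ≤ Q m) (ℕP.m∸n+n≡m k≤K) (Q≤ (K ℕ.∸ k) k)) M²

      PR : ℕ → F
      PR = Π₁ R

      PR≥0 : ∀ k → 0# ≤ PR k
      PR≥0 = Π₁≥0 R≥0

      norm≤ : ∀ k → k ℕ.≤ K → X k * X k + σ * (W k * W k) ≤ PR k * PR k * Q k
      norm≤ zero _ = ≤-reflexive (ring (lit 1 :* lit 1 :+ var 0F :* (lit 0 :* lit 0)) (lit 1 :* lit 1 :* lit 1) (σ ∷ []) refl)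
      norm≤ (suc k) k<K = ≤-trans (≤-reflexive (trans (XW-norm (suc k)) (cong (_* fac) (sym (XW-norm k)))))
        (≤-trans (*-mono (≤-trans (*≥0' ) ≤-refl) fac≥0 (norm≤ k (ℕP.<⇒≤ k<K)) fac≤)
          (≤-reflexive (ring (var 0F :* var 0F :* var 1F :* (var 2F :* var 2F :* var 3F)) (var 0F :* var 2F :* (var 0F :* var 2F) :* (var 1F :* var 3F)) (PR k ∷ Q k ∷ R (suc k) ∷ 1# + σ * (τ (suc k) * τ (suc k)) ∷ []) refl)))
        where
        fac = R (suc k) * R (suc k) + σ * (Y (suc k) * Y (suc k))
        *≥0' : 0# ≤ X k * X k + σ * (W k * W k)
        *≥0' = +≥0 (sq≥0 _) (*≥0 σ≥0 (sq≥0 _))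
        fac≥0 : 0# ≤ fac
        fac≥0 = +≥0 (sq≥0 _) (*≥0 σ≥0 (sq≥0 _))
        fac≤ : fac ≤ R (suc k) * R (suc k) * (1# + σ * (τ (suc k) * τ (suc k)))
        fac≤ = prove (var 0F :* var 0F :+ var 1F :* (var 2F :* var 2F)) (var 0F :* var 0F :* (lit 1 :+ var 1F :* (var 3F :* var 3F))) (R (suc k) ∷ σ ∷ Y (suc k) ∷ τ (suc k) ∷ [])
          (ge0 (var 1F) σ≥0 ⊗ (le (var 2F) (var 3F :* var 0F) (Y≤ k k<K) ⊗ le (:- (var 3F :* var 0F)) (var 2F) (Y≥ k k<K))) refl

      X² : ∀ k → k ℕ.≤ K → X k * X k ≤ (PR k * M) * (PR k * M)
      X² k k≤K = ≤-trans (prove (var 0F :* var 0F) (var 0F :* var 0F :+ var 1F) (X k ∷ σ * (W k * W k) ∷ []) (ge0 (var 1F) (*≥0 σ≥0 (sq≥0 _))) refl)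
        (≤-trans (norm≤ k k≤K) (prove (var 0F :* var 0F :* var 1F) ((var 0F :* var 2F) :* (var 0F :* var 2F)) (PR k ∷ Q k ∷ M ∷ []) (sq (var 0F) ⊗ le (var 1F) (var 2F :* var 2F) (Q≤M² k k≤K)) refl))

      M≥0 : 0# ≤ M
      M≥0 = ≤-trans (⟪⟫≥0 1) 1≤M

      X≤ : ∀ k → k ℕ.≤ K → X k ≤ PR k * M
      X≤ k k≤K = abs-square (*≥0 (PR≥0 k) M≥0) (X² k k≤K)
      X≥- : ∀ k → k ℕ.≤ K → - (PR k * M) ≤ X k
      X≥- k k≤K = prove (:- var 1F) (var 0F) (X k ∷ PR k * M ∷ []) (le (:- var 0F) (var 1F) (abs-square (*≥0 (PR≥0 k) M≥0)
        (subst (_≤ (PR k * M) * (PR k * M)) (ring (var 0F :* var 0F) (:- var 0F :* :- var 0F) (X k ∷ []) refl) (X² k k≤K)))) refl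

      θ : ℕ → F
      θ = Σ₁ τ

      θ≥0 : ∀ k → 0# ≤ θ k
      θ≥0 = Σ₁≥0 τ≥0

      private
        -- 2(bd - xy) = (b - x)(d + y) + (b + x)(d - y).
        mul≤ : ∀ {x y b d} → x ≤ b → - b ≤ x → y ≤ d → - d ≤ y → x * y ≤ b * d
        mul≤ {x} {y} {b} {d} p q r s = *-cancel-≤ (⟪⟫>0 1) (prove (lit 2 :* (var 0F :* var 1F)) (lit 2 :* (var 2F :* var 3F)) (x ∷ y ∷ b ∷ d ∷ [])
          (le (var 0F) (var 2F) p ⊗ le (:- var 3F) (var 1F) s ⊕ le (:- var 2F) (var 0F) q ⊗ le (var 1F) (var 3F) r) refl)
        mul≥ : ∀ {x y b d} → x ≤ b → - b ≤ x → y ≤ d → - d ≤ y → - (b * d) ≤ x * y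
        mul≥ {x} {y} {b} {d} p q r s = *-cancel-≤ (⟪⟫>0 1) (prove (lit 2 :* :- (var 2F :* var 3F)) (lit 2 :* (var 0F :* var 1F)) (x ∷ y ∷ b ∷ d ∷ [])
          (le (var 0F) (var 2F) p ⊗ le (var 1F) (var 3F) r ⊕ le (:- var 2F) (var 0F) q ⊗ le (:- var 3F) (var 1F) s) refl)

      -- A step adds at most |X||Y| ≤ (∏ R) M τ R; the excess of the modulus over ∏ R is absorbed
      -- once and for all in M.
      W-bound : ∀ k → k ℕ.≤ K → (W k ≤ PR k * M * θ k) × (- (PR k * M * θ k) ≤ W k)
      W-bound zero _ = ≤-reflexive (sym (*0 _)) , ≤-reflexive (ring (:- (var 0F :* lit 0)) (lit 0) (1# * M ∷ []) refl)
      W-bound (suc k) k<K =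
        prove (x :* y :+ w :* r) ((P :* r) :* M′ :* (t :+ u)) ρ (le (x :* y) (P :* M′ :* (u :* r)) (mul≤ x≤ x≥ y≤ y≥) ⊕ ge0 r (R≥0 k) ⊗ le w (P :* M′ :* t) (proj₁ ih)) refl ,
        prove (:- ((P :* r) :* M′ :* (t :+ u))) (x :* y :+ w :* r) ρ (le (:- (P :* M′ :* (u :* r))) (x :* y) (mul≥ x≤ x≥ y≤ y≥) ⊕ ge0 r (R≥0 k) ⊗ le (:- (P :* M′ :* t)) w (proj₂ ih)) refl
        where
        ih = W-bound k (ℕP.<⇒≤ k<K)
        x≤ = X≤ k (ℕP.<⇒≤ k<K)
        x≥ = X≥- k (ℕP.<⇒≤ k<K)
        y≤ = Y≤ k k<K
        y≥ = Y≥ k k<K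
        ρ = X k ∷ Y (suc k) ∷ W k ∷ R (suc k) ∷ PR k ∷ M ∷ θ k ∷ τ (suc k) ∷ []
        x = var 0F ; y = var 1F ; w = var 2F ; r = var 3F ; P = var 4F ; M′ = var 5F ; t = var 6F ; u = var 7F

      -- A step loses at most 2σ|WY| ≤ 2σMθτ ∏ R, and θ² grows by 2θτ + τ².
      X-lower : ∀ k → k ℕ.≤ K → PR k * (⟪ pos 2 ⟫ - σ * M * (θ k * θ k)) ≤ ⟪ pos 2 ⟫ * X k
      X-lower zero _ = ≤-reflexive (ring (lit 1 :* (lit 2 :- var 0F :* (lit 0 :* lit 0))) (lit 2 :* lit 1) (σ * M ∷ []) refl)
      X-lower (suc k) k<K = prove ((P :* r) :* (lit 2 :- s :* M′ :* ((t :+ u) :* (t :+ u)))) (lit 2 :* (x :* r :- s :* (w :* y))) ρ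
        (ge0 r (R≥0 k) ⊗ le (P :* (lit 2 :- s :* M′ :* (t :* t))) (lit 2 :* x) (X-lower k (ℕP.<⇒≤ k<K))
         ⊕ nat 2 ⊗ (ge0 s σ≥0 ⊗ le (w :* y) (P :* M′ :* t :* (u :* r)) (mul≤ (proj₁ ih) (proj₂ ih) (Y≤ k k<K) (Y≥ k k<K)))
         ⊕ ge0 (P :* r :* (s :* M′)) (*≥0 (*≥0 (PR≥0 k) (R≥0 k)) (*≥0 σ≥0 M≥0)) ⊗ sq u) refl
        where
        ih = W-bound k (ℕP.<⇒≤ k<K)
        ρ = X k ∷ Y (suc k) ∷ W k ∷ R (suc k) ∷ PR k ∷ M ∷ θ k ∷ τ (suc k) ∷ σ ∷ []
        x = var 0F ; y = var 1F ; w = var 2F ; r = var 3F ; P = var 4F ; M′ = var 5F ; t = var 6F ; u = var 7F ; s = var 8F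

-- Moments of the binomial kernel

module BinomialKernel where
  open Inequalities
  open PowersOfUnit
  open SampleMeans
  open import Data.Nat.Base as ℕ using (ℕ; suc; zero)

  quarter : F
  quarter = half * half

  4quarter : ⟪ pos 4 ⟫ * quarter ≡ 1#
  4quarter = trans (ring (lit 4 :* (var 0F :* var 0F)) ((lit 2 :* var 0F) :* (lit 2 :* var 0F)) (half ∷ []) refl) (trans (cong₂ _*_ 2half 2half) (*1 1#))

  -- `hₛ` is 1 - c/4 = cos²(φ/2) = (2 + u + ū)/4. Its powers have binomial Fourier coefficients and
  -- take the place of a Gaussian.
  cₛ hₛ : ℕ → F
  cₛ l = Sample.c l
  hₛ l = quarter * (⟪ pos 4 ⟫ - cₛ l)

  -- the mean of hᵈ Re uᵏ over the samples
  E : ℕ → ℕ → F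
  E zero k = δ₀ k
  E (suc d) zero = half * (E d 0 + E d 1)
  E (suc d) (suc k) = quarter * (E d k + ⟪ pos 2 ⟫ * E d (suc k) + E d (suc (suc k)))

  private
   h-a : ∀ l → ⟪ pos 2 ⟫ * hₛ l ≡ 1# + Base.A l
   h-a l = prove= (lit 2 :* (q :* (lit 4 :- (lit 2 :- lit 2 :* a)))) (lit 1 :+ a) (quarter ∷ Base.A l ∷ [])
     (by= (lit 4 :* q) (lit 1) 4quarter (lit 1 :+ a)) refl
    where q = var 0F ; a = var 1F

  *-cancel : ∀ {x y z} → 0# < x → x * y ≡ x * z → y ≡ z
  *-cancel p e = ≤-antisym (*-cancel-≤ p (≤-reflexive e)) (*-cancel-≤ p (≤-reflexive (sym e)))

  mean-hA : ∀ d k → HasMean (λ l → hₛ l ^ d * Sample.A l k) (E d k)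
  mean-hA zero k = mean-≗ (λ l → sym (⟪1⟫* _)) refl (mean-A k)
  mean-hA (suc d) zero = mean-≗ pointwise refl (mean-* half (mean-+ (mean-hA d 0) (mean-hA d 1)))
    where
    pointwise : ∀ l → half * (hₛ l ^ d * 1# + hₛ l ^ d * (Base.A l * 1# - Sample.σ l * 0#)) ≡ hₛ l ^ suc d * 1#
    pointwise l = prove= (hf :* (p :* lit 1 :+ p :* (a :* lit 1 :- s :* lit 0))) (h :* p :* lit 1)
      (half ∷ hₛ l ^ d ∷ Base.A l ∷ Sample.σ l ∷ hₛ l ∷ [])
      (by= (lit 2 :* h) (lit 1 :+ a) (h-a l) (:- hf :* p) ⊞ by= (lit 2 :* hf) (lit 1) 2half (h :* p)) refl
      where hf = var 0F ; p = var 1F ; a = var 2F ; s = var 3F ; h = var 4F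
  mean-hA (suc d) (suc k) = mean-≗ pointwise refl (mean-* quarter (mean-+ (mean-+ (mean-hA d k) (mean-* ⟪ pos 2 ⟫ (mean-hA d (suc k)))) (mean-hA d (suc (suc k)))))
    where
    pointwise : ∀ l → quarter * (hₛ l ^ d * Sample.A l k + ⟪ pos 2 ⟫ * (hₛ l ^ d * Sample.A l (suc k)) + hₛ l ^ d * Sample.A l (suc (suc k))) ≡ hₛ l ^ suc d * Sample.A l (suc k)
    pointwise l = prove= (q :* (p :* x :+ lit 2 :* (p :* y) :+ p :* z)) (h :* p :* y)
      (quarter ∷ hₛ l ^ d ∷ Sample.A l k ∷ Sample.A l (suc k) ∷ Sample.A l (suc (suc k)) ∷ Base.A l ∷ hₛ l ∷ [])
      (by= (z :+ x) (lit 2 :* (a :* y)) (Sample.A-2a l k) (q :* p)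
       ⊞ by= (lit 2 :* h) (lit 1 :+ a) (h-a l) (:- (lit 2 :* (q :* p :* y)))
       ⊞ by= (lit 4 :* q) (lit 1) 4quarter (h :* p :* y)) refl
      where q = var 0F ; p = var 1F ; x = var 2F ; y = var 3F ; z = var 4F ; a = var 5F ; h = var 6F

  -- E d k = C(2d, d+k)/4ᵈ, recorded through the ratio of neighbours
  E-ratio : ∀ d k → (# d + # k + 1#) * E d (suc k) ≡ (# d - # k) * E d k
  E-ratio zero zero = ring ((lit 0 :+ lit 0 :+ lit 1) :* lit 0) ((lit 0 :- lit 0) :* lit 1) [] refl
  E-ratio zero (suc zero) = trans (*0 _) (sym (*0 _))
  E-ratio zero (suc (suc k)) = trans (*0 _) (sym (*0 _))
  E-ratio (suc d) zero rewrite #-suc d = prove=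
    ((lit 1 :+ D :+ lit 0 :+ lit 1) :* (q :* (e0 :+ lit 2 :* e1 :+ e2)))
    ((lit 1 :+ D :- lit 0) :* (hf :* (e0 :+ e1)))
    (# d ∷ quarter ∷ half ∷ E d 0 ∷ E d 1 ∷ E d 2 ∷ [])
    (by= ((D :+ lit 1 :+ lit 1) :* e2) ((D :- lit 1) :* e1) (E-ratio d 1) q
     ⊞ by= ((D :+ lit 0 :+ lit 1) :* e1) ((D :- lit 0) :* e0) (E-ratio d 0) q
     ⊞ by= (lit 4 :* q) (lit 1) 4quarter (hf :* ((D :+ lit 1) :* (e0 :+ e1)))
     ⊞ by= (lit 2 :* hf) (lit 1) 2half (:- (lit 2 :* q :* ((D :+ lit 1) :* (e0 :+ e1))))) refl
    where D = var 0F ; q = var 1F ; hf = var 2F ; e0 = var 3F ; e1 = var 4F ; e2 = var 5F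
  E-ratio (suc d) (suc k) rewrite #-suc d | #-suc k = prove=
    ((lit 1 :+ D :+ (lit 1 :+ k′) :+ lit 1) :* (q :* (e1 :+ lit 2 :* e2 :+ e3)))
    ((lit 1 :+ D :- (lit 1 :+ k′)) :* (q :* (e0 :+ lit 2 :* e1 :+ e2)))
    (# d ∷ # k ∷ quarter ∷ E d k ∷ E d (suc k) ∷ E d (suc (suc k)) ∷ E d (suc (suc (suc k))) ∷ [])
    (by= ((D :+ k′ :+ lit 1) :* e1) ((D :- k′) :* e0) (E-ratio d k) q
     ⊞ by= ((D :+ (lit 1 :+ k′) :+ lit 1) :* e2) ((D :- (lit 1 :+ k′)) :* e1) (subst (λ x → (# d + x + 1#) * E d (suc (suc k)) ≡ (# d - x) * E d (suc k)) (#-suc k) (E-ratio d (suc k))) (lit 2 :* q)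
     ⊞ by= ((D :+ (lit 1 :+ (lit 1 :+ k′)) :+ lit 1) :* e3) ((D :- (lit 1 :+ (lit 1 :+ k′))) :* e2)
         (subst (λ x → (# d + x + 1#) * E d (suc (suc (suc k))) ≡ (# d - x) * E d (suc (suc k))) (trans (#-suc (suc k)) (cong (1# +_) (#-suc k))) (E-ratio d (suc (suc k)))) q) refl
    where D = var 0F ; k′ = var 1F ; q = var 2F ; e0 = var 3F ; e1 = var 4F ; e2 = var 5F ; e3 = var 6F

  γ : ℕ → F
  γ d = E d 0

  γ-suc : ∀ d → (⟪ pos 2 ⟫ * # d + ⟪ pos 2 ⟫) * γ (suc d) ≡ (⟪ pos 2 ⟫ * # d + 1#) * γ d
  γ-suc d = prove= ((lit 2 :* D :+ lit 2) :* (hf :* (e0 :+ e1))) ((lit 2 :* D :+ lit 1) :* e0)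
    (# d ∷ half ∷ E d 0 ∷ E d 1 ∷ [])
    (by= ((D :+ lit 0 :+ lit 1) :* e1) ((D :- lit 0) :* e0) (E-ratio d 0) (lit 1)
     ⊞ by= (lit 2 :* hf) (lit 1) 2half ((D :+ lit 1) :* (e0 :+ e1))) refl
    where D = var 0F ; hf = var 1F ; e0 = var 2F ; e1 = var 3F

  -- The mean of cʳhᵈ, reduced to r = 0 by c = 4(1 - h).
  β : ℕ → ℕ → F
  β zero d = γ d
  β (suc r) d = ⟪ pos 4 ⟫ * (β r d - β r (suc d))

  mean-ch : ∀ r d → HasMean (λ l → cₛ l ^ r * hₛ l ^ d) (β r d)
  mean-ch zero d = mean-≗ (λ l → trans (*1 _) (sym (⟪1⟫* _))) refl (mean-hA d 0)
  mean-ch (suc r) d = mean-≗ pointwise (ring (lit 4 :* (var 0F :+ con (negsuc 0) :* var 1F)) (lit 4 :* (var 0F :- var 1F)) (β r d ∷ β r (suc d) ∷ []) refl)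
      (mean-* ⟪ pos 4 ⟫ (mean-+ (mean-ch r d) (mean-* ⟪ negsuc 0 ⟫ (mean-ch r (suc d)))))
    where
    pointwise : ∀ l → ⟪ pos 4 ⟫ * (cₛ l ^ r * hₛ l ^ d + ⟪ negsuc 0 ⟫ * (cₛ l ^ r * hₛ l ^ suc d)) ≡ cₛ l ^ suc r * hₛ l ^ d
    pointwise l = prove= (lit 4 :* (x :* y :+ con (negsuc 0) :* (x :* ((q :* (lit 4 :- c)) :* y)))) ((c :* x) :* y)
      (cₛ l ^ r ∷ hₛ l ^ d ∷ quarter ∷ cₛ l ∷ []) (by= (lit 4 :* q) (lit 1) 4quarter (:- (x :* (lit 4 :- c) :* y))) refl
      where x = var 0F ; y = var 1F ; q = var 2F ; c = var 3F

  -- The recursions of a Beta integral, proved together: `β-suc r` follows from `β-shift r`, and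
  -- `β-shift (suc r)` from `β-suc r` at d and d + 1.
  β-shift : ∀ r d → (⟪ pos 2 ⟫ * (# d + # r + 1#)) * β r (suc d) ≡ (⟪ pos 2 ⟫ * # d + 1#) * β r d
  β-suc : ∀ r d → (# d + # r + 1#) * β (suc r) d ≡ (⟪ pos 4 ⟫ * # r + ⟪ pos 2 ⟫) * β r d
  β-suc r d = prove= ((D :+ R :+ lit 1) :* (lit 4 :* (x :- y))) ((lit 4 :* R :+ lit 2) :* x)
    (# d ∷ # r ∷ β r d ∷ β r (suc d) ∷ [])
    (by= (lit 2 :* (D :+ R :+ lit 1) :* y) ((lit 2 :* D :+ lit 1) :* x) (β-shift r d) (con (negsuc 1))) refl
    where D = var 0F ; R = var 1F ; x = var 2F ; y = var 3F
  β-shift zero d = trans (ring ((lit 2 :* (D :+ lit 0 :+ lit 1)) :* x) ((lit 2 :* D :+ lit 2) :* x) (# d ∷ γ (suc d) ∷ []) refl) (γ-suc d)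
    where D = var 0F ; x = var 1F
  β-shift (suc r) d rewrite #-suc r = *-cancel D+R>0 (prove=
      ((D :+ R :+ lit 1) :* (lit 2 :* (D :+ (lit 1 :+ R) :+ lit 1) :* y′)) ((D :+ R :+ lit 1) :* ((lit 2 :* D :+ lit 1) :* x′))
      (# d ∷ # r ∷ β r d ∷ β r (suc d) ∷ β (suc r) d ∷ β (suc r) (suc d) ∷ [])
      (by= ((lit 1 :+ D :+ R :+ lit 1) :* y′) ((lit 4 :* R :+ lit 2) :* y) (subst (λ z → (z + # r + 1#) * β (suc r) (suc d) ≡ (⟪ pos 4 ⟫ * # r + ⟪ pos 2 ⟫) * β r (suc d)) (#-suc d) (β-suc r (suc d))) (lit 2 :* (D :+ R :+ lit 1))
       ⊞ by= ((D :+ R :+ lit 1) :* x′) ((lit 4 :* R :+ lit 2) :* x) (β-suc r d) (:- (lit 2 :* D :+ lit 1))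
       ⊞ by= (lit 2 :* (D :+ R :+ lit 1) :* y) ((lit 2 :* D :+ lit 1) :* x) (β-shift r d) (lit 4 :* R :+ lit 2)) refl)
    where
    D = var 0F ; R = var 1F ; x = var 2F ; y = var 3F ; x′ = var 4F ; y′ = var 5F
    D+R>0 : 0# < # d + # r + 1#
    D+R>0 = <-≤-trans (⟪⟫>0 0) (prove⁺ (lit 1) (var 0F :+ var 1F :+ lit 1) (⟪⟫≥0 d ∷ ⟪⟫≥0 r ∷ []) refl)

  -- the mean of cʳ ((1 − i₁ c) hᴰ − (i₁ c)⁴ h^d₁ − (i₂ c)⁸ h^d₂ − η)
  abstract
    moment : (D d₁ d₂ : ℕ) (i₁ i₂ η : F) → ℕ → F
    moment D d₁ d₂ i₁ i₂ η r = β r D - i₁ * β (suc r) D - i₁ ^ 4 * β (4 ℕ.+ r) d₁ - i₂ ^ 8 * β (8 ℕ.+ r) d₂ - η * β r 0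

    moment-def : ∀ D d₁ d₂ i₁ i₂ η r → moment D d₁ d₂ i₁ i₂ η r ≡ β r D - i₁ * β (suc r) D - i₁ ^ 4 * β (4 ℕ.+ r) d₁ - i₂ ^ 8 * β (8 ℕ.+ r) d₂ - η * β r 0
    moment-def D d₁ d₂ i₁ i₂ η r = refl

-- The tilted product and its rotation

module RotatedProduct where
  open Inequalities
  open PowersOfUnit
  open PairProducts
  open import Data.Nat.Base as ℕ using (ℕ; suc; zero)
  import Data.Nat.Properties as ℕP
  open import Data.Fin.Base using (suc)
  open import Data.Product.Base using (_×_; _,_; proj₁; proj₂)

  #-+ : ∀ i j → # (i ℕ.+ j) ≡ # i + # j
  #-+ i j = ⟪⟫-+ (pos i) (pos j)

  sumℕ : (ℕ → ℕ) → ℕ → ℕ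
  sumℕ f zero = 0
  sumℕ f (suc k) = sumℕ f k ℕ.+ f (suc k)

  -- ∏_{m≤N} (1 − pₘ + pₘ uᵐ), and its rotation by u⁻ⁿ
  module Factors (a : F) (p : ℕ → F) where
    open Pow a public

    mutual
      ReF ImF : ℕ → F
      ReF zero = 1#
      ReF (suc m) = ReF m * (1# - p (suc m) + p (suc m) * A (suc m)) - σ * (ImF m * (p (suc m) * U (suc m)))
      ImF zero = 0#
      ImF (suc m) = ReF m * (p (suc m) * U (suc m)) + ImF m * (1# - p (suc m) + p (suc m) * A (suc m))

    rot : ℕ → ℕ → F
    rot N n = ReF N * A n + σ * (ImF N * U n)

    -- |1 - p + puᵐ|² = 1 - p(1 - p)|1 - uᵐ|²: of the distribution of a part only the variance
    -- enters the modulus.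
    F-norm : ∀ N → ReF N * ReF N + σ * (ImF N * ImF N) ≡ Π₁ (λ m → 1# - p m * (1# - p m) * c[ m ]) N
    F-norm zero = ring (lit 1 :* lit 1 :+ var 0F :* (lit 0 :* lit 0)) (lit 1) (σ ∷ []) refl
    F-norm (suc m) = trans (prove=
        ((x :* r :- s :* (w :* y)) :* (x :* r :- s :* (w :* y)) :+ s :* ((x :* y :+ w :* r) :* (x :* y :+ w :* r)))
        ((x :* x :+ s :* (w :* w)) :* (lit 1 :- q :* (lit 1 :- q) :* (lit 2 :- lit 2 :* A′)))
        (ReF m ∷ ImF m ∷ σ ∷ p (suc m) ∷ A (suc m) ∷ U (suc m) ∷ [])
        (by= (A′ :* A′ :+ s :* (U′ :* U′)) (lit 1) (AU-norm (suc m)) (q :* q :* (x :* x :+ s :* (w :* w)))) refl)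
      (cong (_* (1# - p (suc m) * (1# - p (suc m)) * c[ suc m ])) (F-norm m))
      where
      x = var 0F ; w = var 1F ; s = var 2F ; q = var 3F ; A′ = var 4F ; U′ = var 5F
      r = lit 1 :- q :+ q :* A′
      y = q :* U′

    rot²≤ : 0# ≤ σ → ∀ N n → rot N n * rot N n ≤ Π₁ (λ m → 1# - p m * (1# - p m) * c[ m ]) N
    rot²≤ σ≥0 N n = subst (rot N n * rot N n ≤_) (F-norm N) (prove ((x :* A′ :+ s :* (w :* U′)) :* (x :* A′ :+ s :* (w :* U′))) (x :* x :+ s :* (w :* w))
        (ReF N ∷ ImF N ∷ σ ∷ A n ∷ U n ∷ [])
        (ge0 s σ≥0 ⊗ sq (x :* U′ :- w :* A′) ⊕ eqn (lit 1) (A′ :* A′ :+ s :* (U′ :* U′)) (sym (AU-norm n)) (x :* x :+ s :* (w :* w))) refl)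
      where x = var 0F ; w = var 1F ; s = var 2F ; A′ = var 3F ; U′ = var 4F

    -- The rotation is distributed over the factors. The m-th becomes (1 - pₘ)u^(-e m) + pₘu^(m - e
    -- m), which is nearly real when e m is close to m pₘ.
    module Rotated (e : ℕ → ℕ) where
      Nf : ℕ → ℕ
      Nf = sumℕ e

      R₀ Y₀ : ℕ → F
      R₀ m = (1# - p m) * A (e m) + p m * A (m ℕ.∸ e m)
      Y₀ m = p m * U (m ℕ.∸ e m) - (1# - p m) * U (e m)

      open Prod σ R₀ Y₀ using () renaming (X to ZX; W to ZW) public

      module _ (e≤m : ∀ m → e m ℕ.≤ m) where
        factor : ∀ m → (1# - p m + p m * A m ≡ R₀ m * A (e m) - σ * (Y₀ m * U (e m))) × (p m * U m ≡ R₀ m * U (e m) + Y₀ m * A (e m))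
        factor m =
          trans (cong (λ x → 1# - p m + p m * x) (trans (cong A (sym (ℕP.m+[n∸m]≡n (e≤m m)))) (A-+ (e m) (m ℕ.∸ e m))))
            (prove= (lit 1 :- q :+ q :* (A₁ :* A₂ :- s :* (U₁ :* U₂))) (R :* A₁ :- s :* (Y :* U₁)) ρ
              (by= (A₁ :* A₁ :+ s :* (U₁ :* U₁)) (lit 1) (AU-norm (e m)) (q :- lit 1)) refl) ,
          trans (cong (p m *_) (trans (cong U (sym (ℕP.m+[n∸m]≡n (e≤m m)))) (U-+ (e m) (m ℕ.∸ e m))))
            (ring (q :* (U₁ :* A₂ :+ A₁ :* U₂)) (R :* U₁ :+ Y :* A₁) ρ refl)
          where
          ρ = p m ∷ A (e m) ∷ U (e m) ∷ A (m ℕ.∸ e m) ∷ U (m ℕ.∸ e m) ∷ σ ∷ []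
          q = var 0F ; A₁ = var 1F ; U₁ = var 2F ; A₂ = var 3F ; U₂ = var 4F ; s = var 5F
          R = (lit 1 :- q) :* A₁ :+ q :* A₂
          Y = q :* U₂ :- (lit 1 :- q) :* U₁

        F≡Z : ∀ k → (ReF k ≡ ZX k * A (Nf k) - σ * (ZW k * U (Nf k))) × (ImF k ≡ ZX k * U (Nf k) + ZW k * A (Nf k))
        F≡Z zero = ring (lit 1) (lit 1 :* lit 1 :- var 0F :* (lit 0 :* lit 0)) (σ ∷ []) refl ,
                   ring (lit 0) (lit 1 :* lit 0 :+ lit 0 :* lit 1) [] refl
        F≡Z (suc k) =
          prove= (rf :* f₁ :- s :* (mf :* f₂)) (ZR :* A₁₂ :- s :* (ZI :* U₁₂)) ρ
            (by= rf X₁ (proj₁ (F≡Z k)) f₁ ⊞ by= f₁ F₁ (proj₁ (factor (suc k))) X₁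
             ⊞ by= mf X₂ (proj₂ (F≡Z k)) (:- s :* f₂) ⊞ by= f₂ F₂ (proj₂ (factor (suc k))) (:- s :* X₂)
             ⊞ by= A₁₂ (A₁ :* A₂ :- s :* (U₁ :* U₂)) (A-+ (Nf k) (e (suc k))) (:- ZR) ⊞ by= U₁₂ (U₁ :* A₂ :+ A₁ :* U₂) (U-+ (Nf k) (e (suc k))) (s :* ZI)) refl ,
          prove= (rf :* f₂ :+ mf :* f₁) (ZR :* U₁₂ :+ ZI :* A₁₂) ρ
            (by= rf X₁ (proj₁ (F≡Z k)) f₂ ⊞ by= f₂ F₂ (proj₂ (factor (suc k))) X₁
             ⊞ by= mf X₂ (proj₂ (F≡Z k)) f₁ ⊞ by= f₁ F₁ (proj₁ (factor (suc k))) X₂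
             ⊞ by= A₁₂ (A₁ :* A₂ :- s :* (U₁ :* U₂)) (A-+ (Nf k) (e (suc k))) (:- ZI) ⊞ by= U₁₂ (U₁ :* A₂ :+ A₁ :* U₂) (U-+ (Nf k) (e (suc k))) (:- ZR)) refl
          where
          q = p (suc k)
          ρ = ZX k ∷ ZW k ∷ R₀ (suc k) ∷ Y₀ (suc k) ∷ A (Nf k) ∷ U (Nf k) ∷ A (e (suc k)) ∷ U (e (suc k)) ∷ σ ∷ ReF k
            ∷ ImF k ∷ 1# - q + q * A (suc k) ∷ q * U (suc k) ∷ A (Nf k ℕ.+ e (suc k)) ∷ U (Nf k ℕ.+ e (suc k)) ∷ []
          x = var 0F ; w = var 1F ; R = var 2F ; Y = var 3F ; A₁ = var 4F ; U₁ = var 5F ; A₂ = var 6F ; U₂ = var 7F ; s = var 8F ; rf = var 9F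
          mf = var (suc 9F) ; f₁ = var (suc (suc 9F)) ; f₂ = var (suc (suc (suc 9F))) ; A₁₂ = var (suc (suc (suc (suc 9F)))) ; U₁₂ = var (suc (suc (suc (suc (suc 9F)))))
          X₁ = x :* A₁ :- s :* (w :* U₁)
          X₂ = x :* U₁ :+ w :* A₁
          F₁ = R :* A₂ :- s :* (Y :* U₂)
          F₂ = R :* U₂ :+ Y :* A₂
          ZR = x :* R :- s :* (w :* Y)
          ZI = x :* Y :+ w :* R

        rot≡ZX : ∀ k → rot k (Nf k) ≡ ZX k
        rot≡ZX k rewrite proj₁ (F≡Z k) | proj₂ (F≡Z k) = prove= ((x :* A₁ :- s :* (w :* U₁)) :* A₁ :+ s :* ((x :* U₁ :+ w :* A₁) :* U₁)) x
          (ZX k ∷ ZW k ∷ A (Nf k) ∷ U (Nf k) ∷ σ ∷ []) (by= (A₁ :* A₁ :+ s :* (U₁ :* U₁)) (lit 1) (AU-norm (Nf k)) x) refl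
          where x = var 0F ; w = var 1F ; A₁ = var 2F ; U₁ = var 3F ; s = var 4F

      -- The fractional parts δ of the partial means are rotated away: the factors g = (1 − iδₘs) (Z-factor) (1 + iδₘ₋₁s)
      -- have imaginary parts of third order only.
      module Smoothed (δ : ℕ → F) (δ0 : δ 0 ≡ 0#) where
        R Y : ℕ → F
        R zero = 1#
        R (suc k) = R₀ (suc k) * (1# + σ * (δ k * δ (suc k))) - σ * (Y₀ (suc k) * (δ k - δ (suc k)))
        Y zero = 0#
        Y (suc k) = Y₀ (suc k) * (1# + σ * (δ k * δ (suc k))) + R₀ (suc k) * (δ k - δ (suc k))

        open Prod σ R Y using () renaming (X to GX; W to GW) public

        -- Between consecutive factors 1 - iδs and 1 + iδs meet and leave 1 + σδ²; these are
        -- collected here.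
        Dn : ℕ → F
        Dn zero = 1#
        Dn (suc k) = Dn k * (1# + σ * (δ k * δ k))

        -- Telescoping: apart from `Dn`, of all auxiliary factors only the last one, 1 - iδₖs,
        -- survives.
        G≡Z : ∀ k → (GX k ≡ Dn k * (ZX k + σ * (ZW k * δ k))) × (GW k ≡ Dn k * (ZW k - ZX k * δ k))
        G≡Z zero rewrite δ0 = ring (lit 1) (lit 1 :* (lit 1 :+ var 0F :* (lit 0 :* lit 0))) (σ ∷ []) refl ,
                              ring (lit 0) (lit 1 :* (lit 0 :- lit 1 :* lit 0)) [] refl
        G≡Z (suc k) rewrite proj₁ (G≡Z k) | proj₂ (G≡Z k) =
          ring ((D :* (x :+ s :* (w :* d))) :* R′ :- s :* ((D :* (w :- x :* d)) :* Y′)) (D :* (lit 1 :+ s :* (d :* d)) :* ((x :* r :- s :* (w :* y)) :+ s :* ((x :* y :+ w :* r) :* d′))) ρ refl ,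
          ring ((D :* (x :+ s :* (w :* d))) :* Y′ :+ (D :* (w :- x :* d)) :* R′) (D :* (lit 1 :+ s :* (d :* d)) :* ((x :* y :+ w :* r) :- (x :* r :- s :* (w :* y)) :* d′)) ρ refl
          where
          ρ = ZX k ∷ ZW k ∷ R₀ (suc k) ∷ Y₀ (suc k) ∷ δ k ∷ δ (suc k) ∷ Dn k ∷ σ ∷ []
          x = var 0F ; w = var 1F ; r = var 2F ; y = var 3F ; d = var 4F ; d′ = var 5F ; D = var 6F ; s = var 7F
          R′ = r :* (lit 1 :+ s :* (d :* d′)) :- s :* (y :* (d :- d′))
          Y′ = y :* (lit 1 :+ s :* (d :* d′)) :+ r :* (d :- d′)

        -- Multiplication by 1 + iδₖs removes the surviving factor at the price of one more factor
        -- of `Dn`.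
        unwind : ∀ k → GX k - σ * (GW k * δ k) ≡ Dn (suc k) * ZX k
        unwind k rewrite proj₁ (G≡Z k) | proj₂ (G≡Z k) = ring
          (D :* (x :+ s :* (w :* d)) :- s :* (D :* (w :- x :* d) :* d)) (D :* (lit 1 :+ s :* (d :* d)) :* x)
          (ZX k ∷ ZW k ∷ δ k ∷ Dn k ∷ σ ∷ []) refl
          where x = var 0F ; w = var 1F ; d = var 2F ; D = var 3F ; s = var 4F

-- Lower bound on the central arc

module CentralBound where
  open Inequalities
  open PowersOfUnit
  open PairProducts
  open RotatedProduct
  open BinomialKernel using (quarter; 4quarter)
  open import Data.Nat.Base as ℕ using (ℕ; suc; zero)
  import Data.Nat.Properties as ℕP
  open import Data.Product.Base using (proj₁)

  pow≤1 : ∀ {x} → 0# ≤ x → x ≤ 1# → ∀ k → x ^ k ≤ 1#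
  pow≤1 p q zero = ≤-refl
  pow≤1 {x} p q (suc k) = prove (var 0F :* var 1F) (lit 1) (x ∷ x ^ k ∷ []) (ge0 (var 0F) p ⊗ le (var 1F) (lit 1) (pow≤1 p q k) ⊕ le (var 0F) (lit 1) q) refl

  -- Bernoulli's inequality as (1 - q)ᵏ ≤ 1/(1 + kq), from (1 - q)(1 + (k + 1)q) ≤ 1 + kq.
  pow-bernoulli : ∀ {q} → 0# ≤ q → q ≤ 1# → ∀ k → (1# - q) ^ k * (1# + # k * q) ≤ 1#
  pow-bernoulli {q} p r zero = ≤-reflexive (ring (lit 1 :* (lit 1 :+ lit 0 :* var 0F)) (lit 1) (q ∷ []) refl)
  pow-bernoulli {q} p r (suc k) rewrite #-suc k = ≤-trans
    (prove (((lit 1 :- Q) :* w) :* (lit 1 :+ (lit 1 :+ n) :* Q)) (w :* (lit 1 :+ n :* Q)) (q ∷ (1# - q) ^ k ∷ # k ∷ [])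
      (ge0 w (^≥0 (sub≥0 r) k) ⊗ ((nat 1 ⊕ ge0 n (⟪⟫≥0 k)) ⊗ (ge0 Q p ⊗ ge0 Q p))) refl)
    (pow-bernoulli p r k)
    where Q = var 0F ; w = var 1F ; n = var 2F

  module Lower (a : F) (a²≤1 : a * a ≤ 1#) (p : ℕ → F) (e : ℕ → ℕ) (δ : ℕ → F)
    (p≥0 : ∀ k → 0# ≤ p (suc k)) (p≤½ : ∀ k → ⟪ pos 2 ⟫ * p (suc k) ≤ 1#)
    (e≤m : ∀ m → e m ℕ.≤ m)
    (δ0 : δ 0 ≡ 0#) (δ≥0 : ∀ k → 0# ≤ δ k) (δ≤1 : ∀ k → δ k ≤ 1#)
    (δ-step : ∀ k → δ (suc k) ≡ δ k + # (suc k) * p (suc k) - # (e (suc k)))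
    (c₁ : F) (c₁-small : ⟪ pos 1000 ⟫ * c₁ ≤ 1#) where

    open Unit a a²≤1 using (σ; c; A; U; σ≥0; c≥0; c≤4; a≤1; A≤1; U≤; U≥; c[]≤; c[]≥0)
    open Factors a p using (rot; module Rotated)
    open Rotated e using (Nf; R₀; Y₀; ZX; rot≡ZX; module Smoothed)
    open Smoothed δ δ0

    -- The variance of the m-th part, and a third moment for which c κ₆/6 bounds what the linear
    -- phase leaves of the imaginary part.
    vm² κ₆ : ℕ → F
    vm² m = p m * (1# - p m) * (# m * # m)
    κ₆ m = p m * (# m * # m * # m) + # (e m) * # (e m) * # (e m)

    σ≤c : σ ≤ c
    σ≤c = prove (lit 1 :- x :* x) (lit 2 :- lit 2 :* x) (a ∷ []) (sq (lit 1 :- x)) refl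
      where x = var 0F

    private
      #-∸ : ∀ m → # (m ℕ.∸ e m) ≡ # m - # (e m)
      #-∸ m = trans (ring x (x :+ y :- y) (# (m ℕ.∸ e m) ∷ # (e m) ∷ []) refl) (cong (_- # (e m)) (trans (sym (#-+ (m ℕ.∸ e m) (e m))) (cong # (ℕP.m∸n+n≡m (e≤m m)))))
        where x = var 0F ; y = var 1F

    module Factor (k : ℕ) (c≤c₁ : c ≤ c₁) where
      m = suc k
      E = # (e m)
      L = # m
      Δ = δ (suc k) - δ k
      q = p m

      -- The increment of δ is exactly the linear phase m pₘ - e m of the rotated factor; this is
      -- what lets the δ's cancel it.
      Δ-def : Δ ≡ L * q - E
      Δ-def = trans (cong (_- δ k) (δ-step k)) (ring (x :+ y :- z :- x) (y :- z) (δ k ∷ L * q ∷ E ∷ []) refl)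
        where x = var 0F ; y = var 1F ; z = var 2F

      Δ≤1 : Δ ≤ 1#
      Δ≤1 = prove (x :- y) (lit 1) (δ (suc k) ∷ δ k ∷ []) (le x (lit 1) (δ≤1 (suc k)) ⊕ ge0 y (δ≥0 k)) refl
        where x = var 0F ; y = var 1F
      Δ≥-1 : - 1# ≤ Δ
      Δ≥-1 = prove (:- lit 1) (x :- y) (δ (suc k) ∷ δ k ∷ []) (ge0 x (δ≥0 (suc k)) ⊕ le y (lit 1) (δ≤1 k)) refl
        where x = var 0F ; y = var 1F

      c≤1 : ⟪ pos 1000 ⟫ * c ≤ 1#
      c≤1 = ≤-trans (*-mono (⟪⟫≥0 1000) c≥0 ≤-refl c≤c₁) c₁-small

      q≤1 : q ≤ 1#
      q≤1 = prove x (lit 1) (q ∷ []) (ge0 x (p≥0 k) ⊕ le (lit 2 :* x) (lit 1) (p≤½ k)) refl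
        where x = var 0F

      E≥0 = ⟪⟫≥0 (e m)
      L-E≥0 : 0# ≤ L - E
      L-E≥0 = subst (0# ≤_) (#-∸ m) (⟪⟫≥0 (m ℕ.∸ e m))
      κ≥0 : 0# ≤ κ₆ m
      κ≥0 = +≥0 (*≥0 (p≥0 k) (*≥0 (*≥0 (⟪⟫≥0 m) (⟪⟫≥0 m)) (⟪⟫≥0 m))) (*≥0 (*≥0 E≥0 E≥0) E≥0)

      private
        ρ : Vec F 8
        ρ = q ∷ A (e m) ∷ U (e m) ∷ A (m ℕ.∸ e m) ∷ U (m ℕ.∸ e m) ∷ E ∷ L ∷ c ∷ []
        q′ = var {8} 0F ; A₁ = var {8} 1F ; U₁ = var {8} 2F ; A₂ = var {8} 3F ; U₂ = var {8} 4F ; E′ = var {8} 5F ; L′ = var {8} 6F ; c′ = var {8} 7F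
        D′ = L′ :* q′ :- E′
        Q≥0 = ge0 {ρ = ρ} q′ (p≥0 k)
        1-Q≥0 = le {ρ = ρ} q′ (lit 1) q≤1
        C≥0 = ge0 {ρ = ρ} c′ c≥0
        L-E = ge0 {ρ = ρ} (L′ :- E′) L-E≥0
        E₊ = ge0 {ρ = ρ} E′ E≥0
        cE = le {ρ = ρ} (lit 2 :- lit 2 :* A₁) (E′ :* E′ :* c′) (c[]≤ (e m))
        cLE = le {ρ = ρ} (lit 2 :- lit 2 :* A₂) ((L′ :- E′) :* (L′ :- E′) :* c′) (subst (λ z → ⟪ pos 2 ⟫ - ⟪ pos 2 ⟫ * A (m ℕ.∸ e m) ≤ z * z * c) (#-∸ m) (c[]≤ (m ℕ.∸ e m)))
        UE≤ = le {ρ = ρ} U₁ E′ (U≤ (e m))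
        ULE≤ = le {ρ = ρ} U₂ (L′ :- E′) (subst (U (m ℕ.∸ e m) ≤_) (#-∸ m) (U≤ (m ℕ.∸ e m)))
        UE≥ = le {ρ = ρ} (lit 6 :* E′ :- c′ :* (E′ :* E′ :* E′ :- E′)) (lit 6 :* U₁) (U≥ (e m))
        ULE≥ = le {ρ = ρ} (lit 6 :* (L′ :- E′) :- c′ :* ((L′ :- E′) :* (L′ :- E′) :* (L′ :- E′) :- (L′ :- E′))) (lit 6 :* U₂)
          (subst (λ z → ⟪ pos 6 ⟫ * z - c * (z * z * z - z) ≤ ⟪ pos 6 ⟫ * U (m ℕ.∸ e m)) (#-∸ m) (U≥ (m ℕ.∸ e m)))
        L³≥ : (L - E) * (L - E) * (L - E) ≤ L * L * L
        L³≥ = *-mono (*≥0 L-E≥0 L-E≥0) L-E≥0 (*-mono L-E≥0 L-E≥0 ≤L ≤L) ≤L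
          where
          ≤L : L - E ≤ L
          ≤L = prove (x :- y) x (L ∷ E ∷ []) (ge0 y E≥0) refl
            where x = var 0F ; y = var 1F

      R₀≤1 : R₀ m ≤ 1#
      R₀≤1 = prove ((lit 1 :- q′) :* A₁ :+ q′ :* A₂) (lit 1) ρ
        (1-Q≥0 ⊗ le A₁ (lit 1) (A≤1 (e m)) ⊕ Q≥0 ⊗ le A₂ (lit 1) (A≤1 (m ℕ.∸ e m))) refl

      -- The deficit is at most c times the second moment of the rotated exponent, that is variance
      -- plus squared mean, and this mean is Δ with |Δ| ≤ 1.
      R₀≥ : ⟪ pos 2 ⟫ - c * (vm² m + 1#) ≤ ⟪ pos 2 ⟫ * R₀ m
      R₀≥ = prove (lit 2 :- c′ :* (q′ :* (lit 1 :- q′) :* (L′ :* L′) :+ lit 1)) (lit 2 :* ((lit 1 :- q′) :* A₁ :+ q′ :* A₂)) ρ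
        (1-Q≥0 ⊗ cE ⊕ Q≥0 ⊗ cLE ⊕ C≥0 ⊗ (le D′ (lit 1) (subst (_≤ 1#) Δ-def Δ≤1) ⊗ le (:- lit 1) D′ (subst (- 1# ≤_) Δ-def Δ≥-1))) refl

      Y₀≤ : ⟪ pos 6 ⟫ * Y₀ m ≤ ⟪ pos 6 ⟫ * Δ + c * κ₆ m
      Y₀≤ = subst (λ z → ⟪ pos 6 ⟫ * Y₀ m ≤ ⟪ pos 6 ⟫ * z + c * κ₆ m) (sym Δ-def) (prove
        (lit 6 :* (q′ :* U₂ :- (lit 1 :- q′) :* U₁)) (lit 6 :* D′ :+ c′ :* (q′ :* (L′ :* L′ :* L′) :+ E′ :* E′ :* E′)) ρ
        (nat 6 ⊗ (Q≥0 ⊗ ULE≤) ⊕ 1-Q≥0 ⊗ UE≥ ⊕ 1-Q≥0 ⊗ (C≥0 ⊗ E₊) ⊕ Q≥0 ⊗ (C≥0 ⊗ (E₊ ⊗ (E₊ ⊗ E₊))) ⊕ C≥0 ⊗ (Q≥0 ⊗ ge0 (L′ :* L′ :* L′) (*≥0 (*≥0 (⟪⟫≥0 m) (⟪⟫≥0 m)) (⟪⟫≥0 m)))) refl)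

      Y₀≥ : ⟪ pos 6 ⟫ * Δ - c * κ₆ m ≤ ⟪ pos 6 ⟫ * Y₀ m
      Y₀≥ = subst (λ z → ⟪ pos 6 ⟫ * z - c * κ₆ m ≤ ⟪ pos 6 ⟫ * Y₀ m) (sym Δ-def) (prove
        (lit 6 :* D′ :- c′ :* (q′ :* (L′ :* L′ :* L′) :+ E′ :* E′ :* E′)) (lit 6 :* (q′ :* U₂ :- (lit 1 :- q′) :* U₁)) ρ
        (Q≥0 ⊗ ULE≥ ⊕ nat 6 ⊗ (1-Q≥0 ⊗ UE≤) ⊕ Q≥0 ⊗ (C≥0 ⊗ L-E) ⊕ C≥0 ⊗ (E₊ ⊗ (E₊ ⊗ E₊)) ⊕ C≥0 ⊗ (Q≥0 ⊗ le ((L′ :- E′) :* (L′ :- E′) :* (L′ :- E′)) (L′ :* L′ :* L′) L³≥)) refl)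

      vm²≥0 : 0# ≤ vm² m
      vm²≥0 = *≥0 (*≥0 (p≥0 k) (sub≥0 q≤1)) (*≥0 (⟪⟫≥0 m) (⟪⟫≥0 m))

      private
        ρ₂ : Vec F 8
        ρ₂ = R₀ m ∷ Y₀ m ∷ δ k ∷ δ (suc k) ∷ σ ∷ c ∷ κ₆ m ∷ vm² m ∷ []
        r = var {8} 0F ; y = var {8} 1F ; d = var {8} 2F ; d′ = var {8} 3F ; s = var {8} 4F ; C = var {8} 5F ; κ = var {8} 6F ; V = var {8} 7F
        D = d′ :- d
        yu = le {ρ = ρ₂} (lit 6 :* y) (lit 6 :* D :+ C :* κ) Y₀≤
        yl = le {ρ = ρ₂} (lit 6 :* D :- C :* κ) (lit 6 :* y) Y₀≥
        D≤ = le {ρ = ρ₂} D (lit 1) Δ≤1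
        D≥ = le {ρ = ρ₂} (:- lit 1) D Δ≥-1
        s≥0 = ge0 {ρ = ρ₂} s σ≥0
        s≤ = le {ρ = ρ₂} s C σ≤c
        C₊ = ge0 {ρ = ρ₂} C c≥0
        κ₊ = ge0 {ρ = ρ₂} κ κ≥0
        d₊ = ge0 {ρ = ρ₂} d (δ≥0 k)
        d′₊ = ge0 {ρ = ρ₂} d′ (δ≥0 (suc k))
        d≤ = le {ρ = ρ₂} d (lit 1) (δ≤1 k)
        d′≤ = le {ρ = ρ₂} d′ (lit 1) (δ≤1 (suc k))
        r≤ = le {ρ = ρ₂} r (lit 1) R₀≤1
        r≥ = le {ρ = ρ₂} (lit 2 :- C :* (V :+ lit 1)) (lit 2 :* r) R₀≥

      -- Y₀ is Δ up to an error of size cκ₆/6, so the product is Δ² up to that error, and the square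
      -- is discarded.
      YΔ≥ : - (c * κ₆ m) ≤ ⟪ pos 6 ⟫ * (Y₀ m * (δ (suc k) - δ k))
      YΔ≥ = *-cancel-≤ (⟪⟫>0 1) (prove (lit 2 :* :- (C :* κ)) (lit 2 :* (lit 6 :* (y :* D))) ρ₂
        (yu ⊗ D≤′ ⊕ yl ⊗ D≥ ⊕ nat 12 ⊗ sq D) refl)
        where D≤′ = D≤

      module _ (R₀≥0 : 0# ≤ R₀ m) where
        R≥ : ⟪ pos 6 ⟫ * R₀ m - c * (c * κ₆ m) ≤ ⟪ pos 6 ⟫ * R m
        R≥ = prove (lit 6 :* r :- C :* (C :* κ)) (lit 6 :* (r :* (lit 1 :+ s :* (d :* d′)) :- s :* (y :* (d :- d′)))) ρ₂
          (nat 6 ⊗ (ge0 r R₀≥0 ⊗ (s≥0 ⊗ (d₊ ⊗ d′₊))) ⊕ s≥0 ⊗ le (:- (C :* κ)) (lit 6 :* (y :* D)) YΔ≥ ⊕ s≤ ⊗ (C₊ ⊗ κ₊)) refl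

        private
          bound : ∀ {n} → Expr {n} → Expr {n} → Expr {n} → Expr {n}
          bound C κ V = C :* (lit 1001 :* κ :+ lit 3000 :* (V :+ lit 3))
          rest = (C₊ ⊗ κ₊) ⊗ (le (lit 1000 :* C) (lit 1) c≤1 ⊕ nat 1000 ⊗ (s≤ ⊕ s≥0 ⊗ (d≤ ⊕ d₊ ⊗ d′≤)))
           ⊕ nat 3000 ⊗ r≥ ⊕ nat 6000 ⊗ (s≤ ⊕ s≥0 ⊗ (d≤ ⊕ d₊ ⊗ d′≤))
        -- The linear part Δ of Y₀ cancels against R₀(δₖ - δₖ₊₁) up to multiples of 1 - R₀ and of σ,
        -- which are of order c. The 1001 instead of 1000 absorbs products with σδδ′ by c ≤ 1/1000.
        Y≤ : ⟪ pos 6000 ⟫ * Y m ≤ c * (⟪ pos 1001 ⟫ * κ₆ m + ⟪ pos 3000 ⟫ * (vm² m + ⟪ pos 3 ⟫))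
        Y≤ = prove (lit 6000 :* (y :* (lit 1 :+ s :* (d :* d′)) :+ r :* (d :- d′))) (bound C κ V) ρ₂
          (nat 1000 ⊗ (yu ⊗ (nat 1 ⊕ s≥0 ⊗ (d₊ ⊗ d′₊))) ⊕ nat 6000 ⊗ (D≤ ⊗ (r≤ ⊕ s≥0 ⊗ (d₊ ⊗ d′₊))) ⊕ rest) refl
        Y≥ : - (c * (⟪ pos 1001 ⟫ * κ₆ m + ⟪ pos 3000 ⟫ * (vm² m + ⟪ pos 3 ⟫))) ≤ ⟪ pos 6000 ⟫ * Y m
        Y≥ = prove (:- bound C κ V) (lit 6000 :* (y :* (lit 1 :+ s :* (d :* d′)) :+ r :* (d :- d′))) ρ₂
          (nat 1000 ⊗ (yl ⊗ (nat 1 ⊕ s≥0 ⊗ (d₊ ⊗ d′₊))) ⊕ nat 6000 ⊗ (D≥ ⊗ (r≤ ⊕ s≥0 ⊗ (d₊ ⊗ d′₊))) ⊕ rest) refl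

    -- τₘ = c zₘ works because 6000 |Y| ≤ c (1001 κ₆ + 3000 (v m² + 3)) and R ≥ 19/20
    module Final (N : ℕ) (z : ℕ → F) (kk : ℕ → ℕ) (M : F) (c≤c₁ : c ≤ c₁)
      (z≥0 : ∀ k → 0# ≤ z (suc k))
      (hz : ∀ k → ⟪ pos 1001 ⟫ * κ₆ (suc k) + ⟪ pos 3000 ⟫ * (vm² (suc k) + ⟪ pos 3 ⟫) ≤ ⟪ pos 5700 ⟫ * z (suc k))
      (hx : ∀ k → c₁ * (⟪ pos 60 ⟫ * (vm² (suc k) + 1#) + ⟪ pos 20 ⟫ * (c₁ * κ₆ (suc k))) ≤ ⟪ pos 6 ⟫)
      (hk : ∀ k → ⟪ pos 120 ⟫ * (vm² (suc k) + 1#) + ⟪ pos 40 ⟫ * (c₁ * κ₆ (suc k)) ≤ ⟪ pos 57 ⟫ * # (kk (suc k)))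
      (1≤M : 1# ≤ M) (hM : Π₁ (λ m → 1# + c₁ * (c₁ * c₁) * (z m * z m)) N ≤ M * M)
      (hθ : M * (c₁ * ((c₁ * Σ₁ z N + 1#) * (c₁ * Σ₁ z N + 1#))) ≤ ⟪ pos 2 ⟫) where

      module _ (k : ℕ) where
        open Factor k c≤c₁
        private
          ρ : Vec F 9
          ρ = R₀ m ∷ R m ∷ c ∷ c₁ ∷ κ₆ m ∷ vm² m ∷ # (kk m) ∷ z m ∷ Y m ∷ []
          r₀ = var {9} 0F ; r = var {9} 1F ; C = var {9} 2F ; C₁ = var {9} 3F ; κ = var {9} 4F ; V = var {9} 5F ; k′ = var {9} 6F ; z′ = var {9} 7F ; y = var {9} 8F
          C₊ = ge0 {ρ = ρ} C c≥0
          κ₊ = ge0 {ρ = ρ} κ κ≥0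
          V₊ = ge0 {ρ = ρ} V vm²≥0
          C≤ = le {ρ = ρ} C C₁ c≤c₁
          w = con {9} (pos 60) :* (V :+ lit 1) :+ lit 20 :* (C :* κ)
          cw≤6 : c * (⟪ pos 60 ⟫ * (vm² m + 1#) + ⟪ pos 20 ⟫ * (c * κ₆ m)) ≤ ⟪ pos 6 ⟫
          cw≤6 = prove (C :* w) (lit 6) ρ (le (C₁ :* (lit 60 :* (V :+ lit 1) :+ lit 20 :* (C₁ :* κ))) (lit 6) (hx k)
            ⊕ C≤ ⊗ (nat 60 ⊗ (V₊ ⊕ nat 1) ⊕ nat 20 ⊗ ((C₊ ⊕ C≤ ⊕ C₊) ⊗ κ₊))) refl
          r₀≥ = le {ρ = ρ} (lit 2 :- C :* (V :+ lit 1)) (lit 2 :* r₀) R₀≥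
          cw = le {ρ = ρ} (C :* w) (lit 6) cw≤6
          R₀≥0 : 0# ≤ R₀ m
          R₀≥0 = *-cancel-≤ (⟪⟫>0 119) (prove (lit 120 :* lit 0) (lit 120 :* r₀) ρ (nat 60 ⊗ r₀≥ ⊕ cw ⊕ C₊ ⊗ (nat 20 ⊗ (C₊ ⊗ κ₊)) ⊕ nat 114) refl)
          R≥w : ⟪ pos 120 ⟫ - c * (⟪ pos 60 ⟫ * (vm² m + 1#) + ⟪ pos 20 ⟫ * (c * κ₆ m)) ≤ ⟪ pos 120 ⟫ * R m
          R≥w = prove (lit 120 :- C :* w) (lit 120 :* r) ρ (nat 20 ⊗ le (lit 6 :* r₀ :- C :* (C :* κ)) (lit 6 :* r) (R≥ R₀≥0) ⊕ nat 60 ⊗ r₀≥) refl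
          rw = le {ρ = ρ} (lit 120 :- C :* w) (lit 120 :* r) R≥w
          R≥19 : ⟪ pos 114 ⟫ ≤ ⟪ pos 120 ⟫ * R m
          R≥19 = prove (lit 114) (lit 120 :* r) ρ (rw ⊕ cw) refl
          r≥ = le {ρ = ρ} (lit 114) (lit 120 :* r) R≥19
          cz = C₊ ⊗ ge0 {ρ = ρ} z′ (z≥0 k)
          hz′ = C₊ ⊗ le {ρ = ρ} (lit 1001 :* κ :+ lit 3000 :* (V :+ lit 3)) (lit 5700 :* z′) (hz k)
          by = C :* (lit 1001 :* κ :+ lit 3000 :* (V :+ lit 3))

        R-nonneg : 0# ≤ R m
        R-nonneg = *-cancel-≤ (⟪⟫>0 119) (prove (lit 120 :* lit 0) (lit 120 :* r) ρ (r≥ ⊕ nat 114) refl)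

        Y-upper : Y m ≤ c * z m * R m
        Y-upper = *-cancel-≤ (⟪⟫>0 5999) (prove (lit 6000 :* y) (lit 6000 :* (C :* z′ :* r)) ρ (le (lit 6000 :* y) by (Y≤ R₀≥0) ⊕ hz′ ⊕ nat 50 ⊗ (cz ⊗ r≥)) refl)
        Y-lower : - (c * z m * R m) ≤ Y m
        Y-lower = *-cancel-≤ (⟪⟫>0 5999) (prove (lit 6000 :* :- (C :* z′ :* r)) (lit 6000 :* y) ρ (le (:- by) (lit 6000 :* y) (Y≥ R₀≥0) ⊕ hz′ ⊕ nat 50 ⊗ (cz ⊗ r≥)) refl)

        -- With `h^-bernoulli` this gives R ≥ 4/(4 + kc) ≥ hᵏ and turns the bound on real parts into
        -- a power of the kernel.
        R-kernel : ⟪ pos 4 ⟫ ≤ R m * (⟪ pos 4 ⟫ + # (kk m) * c)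
        R-kernel = *-cancel-≤ (⟪⟫>0 119) (prove (lit 120 :* lit 4) (lit 120 :* (r :* (lit 4 :+ k′ :* C))) ρ
          (rw ⊗ (nat 4 ⊕ ge0 k′ (⟪⟫≥0 (kk m)) ⊗ C₊) ⊕ (ge0 k′ (⟪⟫≥0 (kk m)) ⊗ C₊) ⊗ cw
           ⊕ nat 2 ⊗ (C₊ ⊗ (le (lit 120 :* (V :+ lit 1) :+ lit 40 :* (C₁ :* κ)) (lit 57 :* k′) (hk k) ⊕ nat 40 ⊗ (C≤ ⊗ κ₊)))) refl)

      τ : ℕ → F
      τ m = c * z m

      private
        Q≤ : Π₁ (λ m → 1# + σ * (τ m * τ m)) N ≤ M * M
        Q≤ = ≤-trans (Π₁-mono N (λ k → +≥0 (⟪⟫≥0 1) (*≥0 σ≥0 (sq≥0 (τ (suc k))))) (λ k _ → +-monoʳ 1# (factor≤ (suc k)))) hM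
          where
          factor≤ : ∀ m → σ * (τ m * τ m) ≤ c₁ * (c₁ * c₁) * (z m * z m)
          factor≤ m = prove (s :* (C :* z′ :* (C :* z′))) (C₁ :* (C₁ :* C₁) :* (z′ :* z′)) (σ ∷ c ∷ c₁ ∷ z m ∷ [])
            (sq z′ ⊗ (le s C₁ (≤-trans σ≤c c≤c₁) ⊗ (ge0 C c≥0 ⊗ ge0 C c≥0) ⊕ ge0 C₁ (≤-trans c≥0 c≤c₁) ⊗ (le C C₁ c≤c₁ ⊗ (ge0 C c≥0 ⊕ ge0 C c≥0 ⊕ le C C₁ c≤c₁)))) refl
            where s = var 0F ; C = var 1F ; C₁ = var 2F ; z′ = var 3F

      open Prod.Bound σ R Y σ≥0 τ M N 1≤M (λ k → R-nonneg k) (λ k → *≥0 c≥0 (z≥0 k)) (λ k _ → Y-upper k) (λ k _ → Y-lower k) Q≤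
        using (PR; PR≥0; θ; θ≥0; W-bound; X-lower; M≥0)

      h : F
      h = quarter * (⟪ pos 4 ⟫ - c)

      private
        q = quarter * c
        h≡1-q : h ≡ 1# - q
        h≡1-q = prove= (Q :* (lit 4 :- C)) (lit 1 :- Q :* C) (quarter ∷ c ∷ []) (by= (lit 4 :* Q) (lit 1) 4quarter (lit 1)) refl
          where Q = var 0F ; C = var 1F
        4q≡c : ⟪ pos 4 ⟫ * q ≡ c
        4q≡c = prove= (lit 4 :* (Q :* C)) C (quarter ∷ c ∷ []) (by= (lit 4 :* Q) (lit 1) 4quarter C) refl
          where Q = var 0F ; C = var 1F
        q≥0 : 0# ≤ q
        q≥0 = *-cancel-≤ (⟪⟫>0 3) (subst₂ _≤_ (sym (*0 _)) (sym 4q≡c) c≥0)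
        q≤1 : q ≤ 1#
        q≤1 = *-cancel-≤ (⟪⟫>0 3) (subst₂ _≤_ (sym 4q≡c) (sym (*1 _)) c≤4)

      h^-bernoulli : ∀ k → h ^ k * (⟪ pos 4 ⟫ + # k * c) ≤ ⟪ pos 4 ⟫
      h^-bernoulli k = subst₂ (λ x y → x ^ k * (⟪ pos 4 ⟫ + # k * y) ≤ ⟪ pos 4 ⟫) (sym h≡1-q) 4q≡c
        (prove (w :* (lit 4 :+ n :* (lit 4 :* Q))) (lit 4) ((1# - q) ^ k ∷ # k ∷ q ∷ [])
          (nat 4 ⊗ le (w :* (lit 1 :+ n :* Q)) (lit 1) (pow-bernoulli q≥0 q≤1 k)) refl)
        where w = var 0F ; n = var 1F ; Q = var 2F

      h≥0 : 0# ≤ h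
      h≥0 = subst (0# ≤_) (sym h≡1-q) (sub≥0 q≤1)

      h^k≤R : ∀ k → h ^ kk (suc k) ≤ R (suc k)
      h^k≤R k = *-cancel-≤ (⟪⟫>0 3) (prove (lit 4 :* w) (lit 4 :* r) (h ^ kk (suc k) ∷ R (suc k) ∷ # (kk (suc k)) ∷ c ∷ [])
        (ge0 w (^≥0 h≥0 (kk (suc k))) ⊗ le (lit 4) (r :* (lit 4 :+ n :* C)) (R-kernel k)
         ⊕ ge0 r (R-nonneg k) ⊗ le (w :* (lit 4 :+ n :* C)) (lit 4) (h^-bernoulli (kk (suc k)))) refl)
        where w = var 0F ; r = var 1F ; n = var 2F ; C = var 3F

      h^≤PR : ∀ k → h ^ sumℕ kk k ≤ PR k
      h^≤PR zero = ≤-refl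
      h^≤PR (suc k) = subst (_≤ PR (suc k)) (sym (^-+ h (sumℕ kk k) (kk (suc k)))) (*-mono (^≥0 h≥0 (sumℕ kk k)) (^≥0 h≥0 (kk (suc k))) (h^≤PR k) (h^k≤R k))

      Dn≥1 : ∀ k → 1# ≤ Dn k
      Dn≥1 zero = ≤-refl
      Dn≥1 (suc k) = prove (lit 1) (D :* (lit 1 :+ x)) (Dn k ∷ σ * (δ k * δ k) ∷ [])
        (le (lit 1) D (Dn≥1 k) ⊗ (nat 1 ⊕ ge0 x (*≥0 σ≥0 (sq≥0 (δ k)))) ⊕ ge0 x (*≥0 σ≥0 (sq≥0 (δ k)))) refl
        where D = var 0F ; x = var 1F

      -- 1 + σδ² ≤ 1 + c ≤ h⁻⁴ by `h^-bernoulli`: four further powers of the kernel pay for each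
      -- factor of `Dn`.
      h^Dn : ∀ k → h ^ (k ℕ.* 4) * Dn k ≤ 1#
      h^Dn zero = ≤-reflexive (*1 1#)
      h^Dn (suc k) = subst (λ x → x * Dn (suc k) ≤ 1#) (sym (^-+ h 4 (k ℕ.* 4)))
        (*-cancel-≤ (⟪⟫>0 3) (prove (lit 4 :* (u :* w :* (D :* (lit 1 :+ s :* (d :* d))))) (lit 4 :* lit 1) (h ^ 4 ∷ h ^ (k ℕ.* 4) ∷ Dn k ∷ σ ∷ δ k ∷ c ∷ [])
          (le (u :* (lit 4 :+ lit 4 :* C)) (lit 4) (h^-bernoulli 4)
           ⊕ (nat 4 ⊗ (ge0 u (^≥0 h≥0 4) ⊗ (nat 1 ⊕ ge0 C c≥0))) ⊗ le (w :* D) (lit 1) (h^Dn k)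
           ⊕ (nat 4 ⊗ (ge0 u (^≥0 h≥0 4) ⊗ (ge0 w (^≥0 h≥0 (k ℕ.* 4)) ⊗ ge0 D (≤-trans (⟪⟫≥0 1) (Dn≥1 k))))) ⊗ le (s :* (d :* d)) C sdd≤c) refl))
        where
        u = var 0F ; w = var 1F ; D = var 2F ; s = var 3F ; d = var 4F ; C = var 5F
        sdd≤c : σ * (δ k * δ k) ≤ c
        sdd≤c = prove (x :* (y :* y)) z′ (σ ∷ δ k ∷ c ∷ []) (le x z′ σ≤c ⊕ ge0 x σ≥0 ⊗ (le y (lit 1) (δ≤1 k) ⊗ (nat 1 ⊕ ge0 y (δ≥0 k)))) refl
          where x = var 0F ; y = var 1F ; z′ = var 2F

      θ≡ : ∀ k → θ k ≡ c * Σ₁ z k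
      θ≡ zero = sym (*0 c)
      θ≡ (suc k) = trans (cong (_+ c * z (suc k)) (θ≡ k)) (sym (distribˡ _ _ _))

      -- the residual rotation by δ N costs one more unit in θ
      GX-lower : PR N * (⟪ pos 2 ⟫ - σ * M * ((θ N + 1#) * (θ N + 1#))) ≤ ⟪ pos 2 ⟫ * (GX N - σ * (GW N * δ N))
      GX-lower = prove (P :* (lit 2 :- s :* m :* ((t :+ lit 1) :* (t :+ lit 1)))) (lit 2 :* (x :- s :* (w :* d)))
        (PR N ∷ σ ∷ M ∷ θ N ∷ GX N ∷ GW N ∷ δ N ∷ [])
        (le (P :* (lit 2 :- s :* m :* (t :* t))) (lit 2 :* x) (X-lower N ℕP.≤-refl)
         ⊕ nat 2 ⊗ (s₊ ⊗ (ge0 d (δ≥0 N) ⊗ le w (P :* m :* t) (proj₁ (W-bound N ℕP.≤-refl)) ⊕ P₊ ⊗ (m₊ ⊗ (ge0 t (θ≥0 N) ⊗ le d (lit 1) (δ≤1 N)))))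
         ⊕ P₊ ⊗ (s₊ ⊗ m₊)) refl
        where
        P = var 0F ; s = var 1F ; m = var 2F ; t = var 3F ; x = var 4F ; w = var 5F ; d = var 6F
        s₊ = ge0 {ρ = PR N ∷ σ ∷ M ∷ θ N ∷ GX N ∷ GW N ∷ δ N ∷ []} s σ≥0
        m₊ = ge0 {ρ = PR N ∷ σ ∷ M ∷ θ N ∷ GX N ∷ GW N ∷ δ N ∷ []} m M≥0
        P₊ = ge0 {ρ = PR N ∷ σ ∷ M ∷ θ N ∷ GX N ∷ GW N ∷ δ N ∷ []} P (PR≥0 N)

      -- After σ ≤ c both sides carry a factor c; what remains on the left is largest at c = c₁,
      -- where `hθ` bounds it.
      phase : c₁ * (σ * M * ((θ N + 1#) * (θ N + 1#))) ≤ ⟪ pos 2 ⟫ * c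
      phase = subst (λ t → c₁ * (σ * M * ((t + 1#) * (t + 1#))) ≤ ⟪ pos 2 ⟫ * c) (sym (θ≡ N))
        (prove (C₁ :* (s :* m :* ((C :* Z :+ lit 1) :* (C :* Z :+ lit 1)))) (lit 2 :* C) ρ
          (C₊ ⊗ le (m :* (C₁ :* ((C₁ :* Z :+ lit 1) :* (C₁ :* Z :+ lit 1)))) (lit 2) hθ
           ⊕ m₊ ⊗ (C₁₊ ⊗ ((sq (C :* Z :+ lit 1)) ⊗ le s C σ≤c))
           ⊕ C₊ ⊗ (m₊ ⊗ (C₁₊ ⊗ ((Z₊ ⊗ le C C₁ c≤c₁) ⊗ (nat 2 ⊕ C₊ ⊗ Z₊ ⊕ C₁₊ ⊗ Z₊))))) refl)
        where
        ρ : Vec F 5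
        ρ = c₁ ∷ σ ∷ M ∷ c ∷ Σ₁ z N ∷ []
        C₁ = var 0F ; s = var 1F ; m = var 2F ; C = var 3F ; Z = var 4F
        C₊ = ge0 {ρ = ρ} C c≥0
        m₊ = ge0 {ρ = ρ} m M≥0
        C₁₊ = ge0 {ρ = ρ} C₁ (≤-trans c≥0 c≤c₁)
        Z₊ = ge0 {ρ = ρ} Z (Σ₁≥0 z≥0 N)

      -- Here ∏ R ≥ h^Σkk, the phase costs the factor 1 - c/c₁, and h^(4(N + 1)) outweighs `Dn`.
      central-lower : h ^ (sumℕ kk N ℕ.+ suc N ℕ.* 4) * (c₁ - c) ≤ c₁ * rot N (Nf N)
      central-lower rewrite rot≡ZX e≤m N | ^-+ h (sumℕ kk N) (suc N ℕ.* 4) = *-cancel-≤ (<-≤-trans (⟪⟫>0 0) (Dn≥1 (suc N)))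
        (≤-trans
          (prove (D :* (u :* w :* (C₁ :- C))) (u :* (C₁ :- C)) (Dn (suc N) ∷ h ^ sumℕ kk N ∷ h ^ (suc N ℕ.* 4) ∷ c₁ ∷ c ∷ [])
            (ge0 u (^≥0 h≥0 (sumℕ kk N)) ⊗ (le C C₁ c≤c₁ ⊗ le (w :* D) (lit 1) (h^Dn (suc N)))) refl)
          (≤-trans
            (*-cancel-≤ (⟪⟫>0 1) (prove (lit 2 :* (x :* (y :- x′))) (lit 2 :* (y :* z′)) (h ^ sumℕ kk N ∷ c₁ ∷ c ∷ GX N - σ * (GW N * δ N) ∷ PR N ∷ σ * M * ((θ N + 1#) * (θ N + 1#)) ∷ [])
              (ge0 y (≤-trans c≥0 c≤c₁) ⊗ le (P :* (lit 2 :- t)) (lit 2 :* z′) GX-lower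
               ⊕ ge0 P (PR≥0 N) ⊗ le (y :* t) (lit 2 :* x′) phase
               ⊕ nat 2 ⊗ (le x′ y c≤c₁ ⊗ le x P (h^≤PR N))) refl))
            (≤-reflexive (trans (cong (c₁ *_) (unwind N)) (ring (var 0F :* (var 1F :* var 2F)) (var 1F :* (var 0F :* var 2F)) (c₁ ∷ Dn (suc N) ∷ ZX N ∷ []) refl)))))
        where
        D = var 0F ; u = var 1F ; w = var 2F ; C₁ = var 3F ; C = var 4F
        x = var 0F ; y = var 1F ; x′ = var 2F ; z′ = var 3F ; P = var 4F ; t = var 5F

-- Upper bounds away from the central arc

module UpperBounds where
  open Inequalities
  open PowersOfUnit
  open PairProducts
  open RotatedProduct
  open BinomialKernel using (quarter; 4quarter)
  open import Data.Nat.Base as ℕ using (ℕ; suc; zero)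
  import Data.Nat.Properties as ℕP
  open import Data.Sum.Base using (_⊎_; inj₁; inj₂)

  bernoulli : ∀ {q} → 0# ≤ q → q ≤ 1# → ∀ k → 1# - # k * q ≤ (1# - q) ^ k
  bernoulli {q} q≥0 q≤1 zero = ≤-reflexive (ring (lit 1 :- lit 0 :* var 0F) (lit 1) (q ∷ []) refl)
  bernoulli {q} q≥0 q≤1 (suc k) = subst (λ n → 1# - n * q ≤ (1# - q) ^ suc k) (sym (#-suc k))
    (prove (lit 1 :- (lit 1 :+ n) :* Q) ((lit 1 :- Q) :* w) (q ∷ # k ∷ (1# - q) ^ k ∷ [])
      (le Q (lit 1) q≤1 ⊗ le (lit 1 :- n :* Q) w (bernoulli q≥0 q≤1 k) ⊕ ge0 n (⟪⟫≥0 k) ⊗ (ge0 Q q≥0 ⊗ ge0 Q q≥0)) refl)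
    where Q = var 0F ; n = var 1F ; w = var 2F

  ^-distrib-* : ∀ x y k → (x * y) ^ k ≡ x ^ k * y ^ k
  ^-distrib-* x y zero = sym (*1 1#)
  ^-distrib-* x y (suc k) = trans (cong (x * y *_) (^-distrib-* x y k)) (*-swap _ _ _ _)

  ^-anti : ∀ {x} → 0# ≤ x → x ≤ 1# → ∀ {j k} → j ℕ.≤ k → x ^ k ≤ x ^ j
  ^-anti {x} p q {j} {k} j≤k = subst (λ i → x ^ i ≤ x ^ j) (ℕP.m∸n+n≡m j≤k) (go (k ℕ.∸ j))
    where
    go : ∀ i → x ^ (i ℕ.+ j) ≤ x ^ j
    go zero = ≤-refl
    go (suc i) = prove (X :* y) z (x ∷ x ^ (i ℕ.+ j) ∷ x ^ j ∷ []) (le X (lit 1) q ⊗ ge0 y (^≥0 p (i ℕ.+ j)) ⊕ le y z (go i)) refl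
      where X = var 0F ; y = var 1F ; z = var 2F

  1^ : ∀ k → 1# ^ k ≡ 1#
  1^ zero = refl
  1^ (suc k) = trans (⟪1⟫* _) (1^ k)

  ≥-from-sq : ∀ {x b} → 0# ≤ b → x * x ≤ b * b → - b ≤ x
  ≥-from-sq {x} {b} b≥0 h = prove (:- y) X (x ∷ b ∷ []) (le (:- X) y (abs-square b≥0 (subst (_≤ b * b) (ring (X :* X) (:- X :* :- X) (x ∷ b ∷ []) refl) h))) refl
    where X = var 0F ; y = var 1F

  module Upper (a : F) (a²≤1 : a * a ≤ 1#) (p : ℕ → F)
    (p≥0 : ∀ k → 0# ≤ p (suc k)) (p≤½ : ∀ k → ⟪ pos 2 ⟫ * p (suc k) ≤ 1#) where

    open Unit a a²≤1 using (σ; c; A; U; σ≥0; c≥0; c≤4; A≤1; -1≤A; c[_]; c[]≥; c[]≥0)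
    open Factors a p using (rot; rot²≤)

    v : ℕ → F
    v m = p m * (1# - p m)

    v≥0 : ∀ k → 0# ≤ v (suc k)
    v≥0 k = prove (lit 0) (q :* (lit 1 :- q)) (p (suc k) ∷ []) (ge0 q (p≥0 k) ⊗ (ge0 q (p≥0 k) ⊕ le (lit 2 :* q) (lit 1) (p≤½ k))) refl
      where q = var 0F

    -- 1 - vc = (1 - 2p)² + 2v(1 + A), because 4v = 1 - (1 - 2p)² and c = 2 - 2A for the m-th power.
    factor≥0 : ∀ k → 0# ≤ 1# - v (suc k) * c[ suc k ]
    factor≥0 k = prove (lit 0) (lit 1 :- q :* (lit 1 :- q) :* (lit 2 :- lit 2 :* A′)) (p (suc k) ∷ A (suc k) ∷ v (suc k) ∷ [])
      (sq (lit 1 :- lit 2 :* q) ⊕ nat 2 ⊗ (ge0 V (v≥0 k) ⊗ le (:- lit 1) A′ (-1≤A (suc k))) ⊕ eqn (q :* (lit 1 :- q)) V refl (lit 2 :* (A′ :+ lit 1))) refl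
      where q = var 0F ; A′ = var 1F ; V = var 2F

    h : F
    h = quarter * (⟪ pos 4 ⟫ - c)
    private
      q = quarter * c
      h≡1-q : h ≡ 1# - q
      h≡1-q = prove= (Q :* (lit 4 :- C)) (lit 1 :- Q :* C) (quarter ∷ c ∷ []) (by= (lit 4 :* Q) (lit 1) 4quarter (lit 1)) refl
        where Q = var 0F ; C = var 1F
      4q≡c : ⟪ pos 4 ⟫ * q ≡ c
      4q≡c = prove= (lit 4 :* (Q :* C)) C (quarter ∷ c ∷ []) (by= (lit 4 :* Q) (lit 1) 4quarter C) refl
        where Q = var 0F ; C = var 1F
      q≥0 : 0# ≤ q
      q≥0 = *-cancel-≤ (⟪⟫>0 3) (subst₂ _≤_ (sym (*0 _)) (sym 4q≡c) c≥0)
      q≤1 : q ≤ 1#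
      q≤1 = *-cancel-≤ (⟪⟫>0 3) (subst₂ _≤_ (sym 4q≡c) (sym (*1 _)) c≤4)

    h≥0 : 0# ≤ h
    h≥0 = subst (0# ≤_) (sym h≡1-q) (sub≥0 q≤1)
    h≤1 : h ≤ 1#
    h≤1 = subst (_≤ 1#) (sym h≡1-q) (prove (lit 1 :- var 0F) (lit 1) (q ∷ []) (ge0 (var 0F) q≥0) refl)

    module _ (N : ℕ) (kk : ℕ → ℕ) (c̄ : F) (c≤c̄ : c ≤ c̄)
      (hk : ∀ k → kk (suc k) ≡ 0 ⊎ ⟪ pos 3 ⟫ * # (kk (suc k)) ≤ v (suc k) * (⟪ pos 12 ⟫ * (# (suc k) * # (suc k)) - # (suc k) * # (suc k) * (# (suc k) * # (suc k)) * c̄)) where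

      -- By `c[]≥` and c ≤ c̄ the condition on k gives 1 - v|1 - uᵐ|² ≤ 1 - kc/4, which Bernoulli
      -- bounds by hᵏ. For large m the quartic term spoils this; there the exponent is 0.
      factor≤ : ∀ k → 1# - v (suc k) * c[ suc k ] ≤ h ^ kk (suc k)
      factor≤ k with hk k
      ... | inj₁ e = subst (λ j → 1# - v (suc k) * c[ suc k ] ≤ h ^ j) (sym e)
        (prove (lit 1 :- x :* y) (lit 1) (v (suc k) ∷ c[ suc k ] ∷ []) (ge0 x (v≥0 k) ⊗ ge0 y (c[]≥0 (suc k))) refl)
        where x = var 0F ; y = var 1F
      ... | inj₂ le₃ = ≤-trans (*-cancel-≤ (⟪⟫>0 11) (prove (lit 12 :* (lit 1 :- x :* y)) (lit 12 :* (lit 1 :- n :* Q))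
          (v (suc k) ∷ c[ suc k ] ∷ # (kk (suc k)) ∷ q ∷ # (suc k) ∷ c ∷ c̄ ∷ [])
          (x₊ ⊗ le (L :* L :* (lit 12 :* C) :- L :* L :* (L :* L :- lit 1) :* (C :* C)) (lit 12 :* y) (c[]≥ (suc k))
           ⊕ C₊ ⊗ le (lit 3 :* n) (x :* (lit 12 :* (L :* L) :- L :* L :* (L :* L) :* C̄)) le₃
           ⊕ x₊ ⊗ (C₊ ⊗ (sq (L :* L) ⊗ le C C̄ c≤c̄))
           ⊕ x₊ ⊗ (C₊ ⊗ (C₊ ⊗ sq L))
           ⊕ eqn (lit 4 :* Q) C 4q≡c (:- (lit 3 :* n))) refl))
        (subst (λ z → 1# - # (kk (suc k)) * q ≤ z ^ kk (suc k)) (sym h≡1-q) (bernoulli q≥0 q≤1 (kk (suc k))))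
        where
        x = var 0F ; y = var 1F ; n = var 2F ; Q = var 3F ; L = var 4F ; C = var 5F ; C̄ = var 6F
        ρ : Vec F 7
        ρ = v (suc k) ∷ c[ suc k ] ∷ # (kk (suc k)) ∷ q ∷ # (suc k) ∷ c ∷ c̄ ∷ []
        x₊ = ge0 {ρ = ρ} x (v≥0 k)
        C₊ = ge0 {ρ = ρ} C c≥0

      Π≤h : ∀ j → Π₁ (λ m → 1# - v m * c[ m ]) j ≤ h ^ sumℕ kk j
      Π≤h zero = ≤-refl
      Π≤h (suc j) = subst (Π₁ (λ m → 1# - v m * c[ m ]) (suc j) ≤_) (sym (^-+ h (sumℕ kk j) (kk (suc j))))
        (*-mono (Π₁≥0 factor≥0 j) (factor≥0 j) (Π≤h j) (factor≤ j))

      -- `rot²≤` bounds the square, so half of the collected exponents survives.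
      tier : ∀ n d → d ℕ.+ d ℕ.≤ sumℕ kk N → - (h ^ d) ≤ rot N n
      tier n d 2d≤ = ≥-from-sq (^≥0 h≥0 d) (≤-trans (rot²≤ σ≥0 N n) (≤-trans (Π≤h N) (subst (h ^ sumℕ kk N ≤_) (^-+ h d d) (^-anti h≥0 h≤1 2d≤))))

    module _ (H : ℕ) where
      private
        j = inv (# (suc H))
        Hj : # (suc H) * j ≡ 1#
        Hj = inv-eq (⟪⟫>0 H)
        j≥0 = inv≥0 (⟪⟫>0 H)

      -- A rational form of ∏ (1 - x) ≤ exp(-Σ x). With z = y/(H + 1), Bernoulli gives 1 - y ≤ (1 -
      -- z)^(H+1), and (1 - z)(1 + z) ≤ 1.
      Π-exp : ∀ (x : ℕ → F) → (∀ k → 0# ≤ x (suc k)) → (∀ k → x (suc k) ≤ 1#) → ∀ N → Π₁ (λ m → 1# - x m) N * (1# + j * Σ₁ x N) ^ suc H ≤ 1#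
      Π-exp x x≥0 x≤1 zero = ≤-reflexive (trans (⟪1⟫* _) (trans (cong (_^ suc H) (trans (cong (1# +_) (*0 j)) (+0 1#))) (1^ (suc H))))
      Π-exp x x≥0 x≤1 (suc N) = ≤-trans
        (*-mono (*≥0 (Π₁≥0 1-x≥0 N) (1-x≥0 N)) (^≥0 s₁≥0 (suc H)) ≤-refl (^-mono s₁≥0 split (suc H)))
        (≤-trans (≤-reflexive (trans (cong (Π₁ (λ m → 1# - x m) N * (1# - y) *_) (^-distrib-* s (1# + j * y) (suc H)))
            (*-swap _ _ _ _)))
          (≤-trans (*-mono (*≥0 (Π₁≥0 1-x≥0 N) (^≥0 s≥0 (suc H))) (*≥0 (1-x≥0 N) (^≥0 sy≥0 (suc H))) (Π-exp x x≥0 x≤1 N) one) (≤-reflexive (*1 1#))))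
        where
        y = x (suc N)
        s = 1# + j * Σ₁ x N
        1-x≥0 : ∀ k → 0# ≤ 1# - x (suc k)
        1-x≥0 k = sub≥0 (x≤1 k)
        jx≥0 : 0# ≤ j * Σ₁ x N
        jx≥0 = *≥0 j≥0 (Σ₁≥0 x≥0 N)
        jy≥0 : 0# ≤ j * y
        jy≥0 = *≥0 j≥0 (x≥0 N)
        s≥0 = +≥0 (⟪⟫≥0 1) jx≥0
        sy≥0 = +≥0 (⟪⟫≥0 1) jy≥0
        s₁≥0 : 0# ≤ 1# + j * (Σ₁ x N + y)
        s₁≥0 = +≥0 (⟪⟫≥0 1) (*≥0 j≥0 (+≥0 (Σ₁≥0 x≥0 N) (x≥0 N)))
        split : 1# + j * (Σ₁ x N + y) ≤ s * (1# + j * y)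
        split = prove (lit 1 :+ J :* (S :+ Y)) ((lit 1 :+ J :* S) :* (lit 1 :+ J :* Y)) (j ∷ Σ₁ x N ∷ y ∷ [])
          (ge0 (J :* S) jx≥0 ⊗ ge0 (J :* Y) jy≥0) refl
          where J = var 0F ; S = var 1F ; Y = var 2F
        jy≤1 : j * y ≤ 1#
        jy≤1 = *-cancel-≤ (⟪⟫>0 H) (prove (n :* (J :* Y)) (n :* lit 1) (# (suc H) ∷ j ∷ y ∷ [])
          (le Y (lit 1) (x≤1 N) ⊕ le (lit 1) n (subst (1# ≤_) (sym (#-suc H)) (prove (lit 1) (lit 1 :+ var 0F) (# H ∷ []) (ge0 (var 0F) (⟪⟫≥0 H)) refl))
           ⊕ eqn (n :* J) (lit 1) Hj (:- Y)) refl)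
          where n = var 0F ; J = var 1F ; Y = var 2F
        one : (1# - y) * (1# + j * y) ^ suc H ≤ 1#
        one = ≤-trans (*-mono (1-x≥0 N) (^≥0 sy≥0 (suc H)) (≤-trans (≤-reflexive (prove= (lit 1 :- Y) (lit 1 :- n :* (J :* Y)) (# (suc H) ∷ j ∷ y ∷ []) (by= (n :* J) (lit 1) Hj Y) refl)) (bernoulli jy≥0 jy≤1 (suc H))) ≤-refl)
          (≤-trans (≤-reflexive (sym (^-distrib-* (1# - j * y) (1# + j * y) (suc H))))
            (≤-trans (^-mono (*≥0 (sub≥0 jy≤1) sy≥0) (prove ((lit 1 :- Z) :* (lit 1 :+ Z)) (lit 1) (j * y ∷ []) (sq Z) refl) (suc H)) (≤-reflexive (1^ (suc H)))))
          where n = var 0F ; J = var 1F ; Y = var 2F ; Z = var 0F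

      minor : ∀ N n η W → 0# ≤ η → 0# ≤ W → W ≤ Σ₁ (λ m → v m * c[ m ]) N → 1# ≤ η * η * (1# + j * W) ^ suc H → - η ≤ rot N n
      minor N n η W η≥0 W≥0 W≤ hη = ≥-from-sq η≥0 (≤-trans (rot²≤ σ≥0 N n) (*-cancel-≤ E>0 (≤-trans
          (≤-trans (≤-reflexive (*-comm E Π)) (≤-trans (*-mono Π≥0 (^≥0 1+jW≥0 (suc H)) ≤-refl (^-mono 1+jW≥0 jW≤ (suc H))) (Π-exp x x≥0 x≤1 N)))
          (≤-trans hη (≤-reflexive (*-comm (η * η) E))))))
        where
        x : ℕ → F
        x m = v m * c[ m ]
        x≥0 : ∀ k → 0# ≤ x (suc k)
        x≥0 k = *≥0 (v≥0 k) (c[]≥0 (suc k))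
        x≤1 : ∀ k → x (suc k) ≤ 1#
        x≤1 k = from≥0 (factor≥0 k)
        Π = Π₁ (λ m → 1# - x m) N
        E = (1# + j * W) ^ suc H
        Π≥0 : 0# ≤ Π
        Π≥0 = Π₁≥0 factor≥0 N
        1+jW≥0 : 0# ≤ 1# + j * W
        1+jW≥0 = +≥0 (⟪⟫≥0 1) (*≥0 j≥0 W≥0)
        jW≤ : 1# + j * W ≤ 1# + j * Σ₁ x N
        jW≤ = +-monoʳ 1# (*-mono j≥0 W≥0 ≤-refl W≤)
        E>0 : 0# < E
        E>0 E≤0 = ⟪⟫>0 0 (≤-trans hη (prove (y :* y :* z) (lit 0) (η ∷ E ∷ []) (sq y ⊗ le z (lit 0) E≤0) refl))
          where y = var 0F ; z = var 1F

-- Coefficients as means over the circle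

module Coefficients where
  open Inequalities
  open PowersOfUnit
  open SampleMeans
  open BinomialKernel using (cₛ)
  open import Defs using (sublists; down)
  open import Data.Nat.Base as ℕ using (ℕ; suc; zero)
  import Data.Nat.Properties as ℕP
  open import Data.Nat.ListAction using (sum)
  open import Data.List.Base using (List; []; _∷_; map; _++_)
  open import Data.Product.Base using (_,_)

  -- Functions of the sum alone are enough, since a list contributes to ∏ (1 + ρᵐuᵐ) only through
  -- the power of ρu.
  lsum : List (List ℕ) → (ℕ → F) → F
  lsum [] f = 0#
  lsum (p ∷ ps) f = f (sum p) + lsum ps f

  lsum-++ : ∀ ps qs f → lsum (ps ++ qs) f ≡ lsum ps f + lsum qs f
  lsum-++ [] qs f = sym (⟪0⟫+ _)
  lsum-++ (p ∷ ps) qs f = trans (cong (f (sum p) +_) (lsum-++ ps qs f)) (sym (+-assoc _ _ _))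

  lsum-map : ∀ m ps f → lsum (map (m ∷_) ps) f ≡ lsum ps (λ s → f (m ℕ.+ s))
  lsum-map m [] f = refl
  lsum-map m (p ∷ ps) f = cong (f (m ℕ.+ sum p) +_) (lsum-map m ps f)

  lsum-cong : ∀ ps {f g} → (∀ s → f s ≡ g s) → lsum ps f ≡ lsum ps g
  lsum-cong [] e = refl
  lsum-cong (p ∷ ps) e = cong₂ _+_ (e (sum p)) (lsum-cong ps e)

  lsum-lin : ∀ ps x y f g → lsum ps (λ s → x * f s + y * g s) ≡ x * lsum ps f + y * lsum ps g
  lsum-lin [] x y f g = ring (lit 0) (var 0F :* lit 0 :+ var 1F :* lit 0) (x ∷ y ∷ []) refl
  lsum-lin (p ∷ ps) x y f g = trans (cong (x * f (sum p) + y * g (sum p) +_) (lsum-lin ps x y f g))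
    (ring (var 0F :* var 2F :+ var 1F :* var 3F :+ (var 0F :* var 4F :+ var 1F :* var 5F)) (var 0F :* (var 2F :+ var 4F) :+ var 1F :* (var 3F :+ var 5F))
      (x ∷ y ∷ f (sum p) ∷ g (sum p) ∷ lsum ps f ∷ lsum ps g ∷ []) refl)

  lsum-down : ∀ m f → lsum (sublists (down (suc m))) f ≡ lsum (sublists (down m)) (λ s → f (suc m ℕ.+ s)) + lsum (sublists (down m)) f
  lsum-down m f = trans (lsum-++ (map (suc m ∷_) (sublists (down m))) _ f) (cong (_+ lsum (sublists (down m)) f) (lsum-map (suc m) (sublists (down m)) f))

  mean-lsum : ∀ ps (φ : ℕ → ℕ → F) (α : ℕ → F) → (∀ s → HasMean (λ l → φ l s) (α s)) → HasMean (λ l → lsum ps (φ l)) (lsum ps α)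
  mean-lsum [] φ α h = mean-const 0#
  mean-lsum (p ∷ ps) φ α h = mean-+ (h (sum p)) (mean-lsum ps φ α h)

  module Γ (ρ a : F) where
    open Pow a

    -- ∏_{m≤N} (1 + ρᵐ uᵐ), as a pair (real part, imaginary part / sin φ)
    mutual
      ReΓ ImΓ : ℕ → F
      ReΓ zero = 1#
      ReΓ (suc m) = ReΓ m + ρ ^ suc m * (A (suc m) * ReΓ m - σ * (U (suc m) * ImΓ m))
      ImΓ zero = 0#
      ImΓ (suc m) = ImΓ m + ρ ^ suc m * (U (suc m) * ReΓ m + A (suc m) * ImΓ m)

    ReΓ-sum : ∀ N → ReΓ N ≡ lsum (sublists (down N)) (λ s → ρ ^ s * A s)
    ImΓ-sum : ∀ N → ImΓ N ≡ lsum (sublists (down N)) (λ s → ρ ^ s * U s)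
    ReΓ-sum zero = ring (lit 1) (lit 1 :* lit 1 :+ lit 0) [] refl
    ReΓ-sum (suc m) rewrite ReΓ-sum m | ImΓ-sum m = sym (trans (lsum-down m _)
      (trans (cong (_+ lsum S (λ s → ρ ^ s * A s)) (trans (lsum-cong S pointwise) (lsum-lin S (ρ ^ suc m * A (suc m)) (- (ρ ^ suc m * (σ * U (suc m)))) (λ s → ρ ^ s * A s) (λ s → ρ ^ s * U s))))
       (ring (var 0F :* var 1F :* var 4F :+ :- (var 0F :* (var 2F :* var 3F)) :* var 5F :+ var 4F) (var 4F :+ var 0F :* (var 1F :* var 4F :- var 2F :* (var 3F :* var 5F)))
         (ρ ^ suc m ∷ A (suc m) ∷ σ ∷ U (suc m) ∷ lsum S (λ s → ρ ^ s * A s) ∷ lsum S (λ s → ρ ^ s * U s) ∷ []) refl)))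
      where
      S = sublists (down m)
      pointwise : ∀ s → ρ ^ (suc m ℕ.+ s) * A (suc m ℕ.+ s) ≡ (ρ ^ suc m * A (suc m)) * (ρ ^ s * A s) + - (ρ ^ suc m * (σ * U (suc m))) * (ρ ^ s * U s)
      pointwise s rewrite ^-+ ρ (suc m) s | A-+ (suc m) s = ring
        (var 0F :* var 1F :* (var 2F :* var 3F :- var 4F :* (var 5F :* var 6F))) ((var 0F :* var 2F) :* (var 1F :* var 3F) :+ :- (var 0F :* (var 4F :* var 5F)) :* (var 1F :* var 6F))
        (ρ ^ suc m ∷ ρ ^ s ∷ A (suc m) ∷ A s ∷ σ ∷ U (suc m) ∷ U s ∷ []) refl
    ImΓ-sum zero = ring (lit 0) (lit 1 :* lit 0 :+ lit 0) [] refl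
    ImΓ-sum (suc m) rewrite ReΓ-sum m | ImΓ-sum m = sym (trans (lsum-down m _)
      (trans (cong (_+ lsum S (λ s → ρ ^ s * U s)) (trans (lsum-cong S pointwise) (lsum-lin S (ρ ^ suc m * U (suc m)) (ρ ^ suc m * A (suc m)) (λ s → ρ ^ s * A s) (λ s → ρ ^ s * U s))))
       (ring (var 0F :* var 2F :* var 3F :+ var 0F :* var 1F :* var 4F :+ var 4F) (var 4F :+ var 0F :* (var 2F :* var 3F :+ var 1F :* var 4F))
         (ρ ^ suc m ∷ A (suc m) ∷ U (suc m) ∷ lsum S (λ s → ρ ^ s * A s) ∷ lsum S (λ s → ρ ^ s * U s) ∷ []) refl)))
      where
      S = sublists (down m)
      pointwise : ∀ s → ρ ^ (suc m ℕ.+ s) * U (suc m ℕ.+ s) ≡ (ρ ^ suc m * U (suc m)) * (ρ ^ s * A s) + (ρ ^ suc m * A (suc m)) * (ρ ^ s * U s)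
      pointwise s rewrite ^-+ ρ (suc m) s | U-+ (suc m) s = ring
        (var 0F :* var 1F :* (var 5F :* var 3F :+ var 2F :* var 6F)) ((var 0F :* var 5F) :* (var 1F :* var 3F) :+ (var 0F :* var 2F) :* (var 1F :* var 6F))
        (ρ ^ suc m ∷ ρ ^ s ∷ A (suc m) ∷ A s ∷ σ ∷ U (suc m) ∷ U s ∷ []) refl

    -- Re (uˢ ūⁿ)
    B : ℕ → ℕ → F
    B s n = A s * A n + σ * (U s * U n)

    B-diag : ∀ n k → B (n ℕ.+ k) n ≡ A k
    B-diag n k rewrite A-+ n k | U-+ n k = prove=
      ((An :* Ak :- s :* (Un :* Uk)) :* An :+ s :* ((Un :* Ak :+ An :* Uk) :* Un)) Ak
      (A n ∷ A k ∷ U n ∷ U k ∷ σ ∷ []) (by= (An :* An :+ s :* (Un :* Un)) (lit 1) (AU-norm n) Ak) refl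
      where An = var 0F ; Ak = var 1F ; Un = var 2F ; Uk = var 3F ; s = var 4F

    B-comm : ∀ s n → B s n ≡ B n s
    B-comm s n = cong₂ (λ x y → x + σ * y) (*-comm _ _) (*-comm _ _)

    -- Multiplication by c = 2 - u - ū, where u raises s and ū raises n.
    B-suc : ∀ s n → ⟪ pos 2 ⟫ * B s n + (⟪ negsuc 0 ⟫ * B (suc s) n + ⟪ negsuc 0 ⟫ * B s (suc n)) ≡ c * B s n
    B-suc s n = ring
      (lit 2 :* (As :* An :+ g :* (Us :* Un)) :+ (con (negsuc 0) :* ((x :* As :- g :* Us) :* An :+ g :* ((x :* Us :+ As) :* Un)) :+ con (negsuc 0) :* (As :* (x :* An :- g :* Un) :+ g :* (Us :* (x :* Un :+ An)))))
      ((lit 2 :- lit 2 :* x) :* (As :* An :+ g :* (Us :* Un)))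
      (a ∷ A s ∷ U s ∷ A n ∷ U n ∷ σ ∷ []) refl
      where x = var 0F ; As = var 1F ; Us = var 2F ; An = var 3F ; Un = var 4F ; g = var 5F

    -- Re (ūⁿ ∏ (1 + ρᵐuᵐ))
    P : ℕ → ℕ → F
    P N n = ReΓ N * A n + σ * (ImΓ N * U n)

    P-sum : ∀ N n → P N n ≡ lsum (sublists (down N)) (λ s → ρ ^ s * B s n)
    P-sum N n rewrite ReΓ-sum N | ImΓ-sum N = sym (trans (lsum-cong S pointwise) (trans (lsum-lin S (A n) (σ * U n) (λ s → ρ ^ s * A s) (λ s → ρ ^ s * U s))
      (ring (var 0F :* var 3F :+ var 1F :* var 2F :* var 4F) (var 3F :* var 0F :+ var 1F :* (var 4F :* var 2F)) (A n ∷ σ ∷ U n ∷ lsum S (λ s → ρ ^ s * A s) ∷ lsum S (λ s → ρ ^ s * U s) ∷ []) refl)))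
      where
      S = sublists (down N)
      pointwise : ∀ s → ρ ^ s * B s n ≡ A n * (ρ ^ s * A s) + (σ * U n) * (ρ ^ s * U s)
      pointwise s = ring (var 0F :* (var 1F :* var 2F :+ var 3F :* (var 4F :* var 5F))) (var 2F :* (var 0F :* var 1F) :+ (var 3F :* var 5F) :* (var 0F :* var 4F))
        (ρ ^ s ∷ A s ∷ A n ∷ σ ∷ U s ∷ U n ∷ []) refl

  -- the constant term of cʳ uˢ ūⁿ
  ω : ℕ → ℕ → ℕ → F
  ω zero s n = δ₀ ℕ.∣ s - n ∣
  ω (suc r) s n = ⟪ pos 2 ⟫ * ω r s n + (⟪ negsuc 0 ⟫ * ω r (suc s) n + ⟪ negsuc 0 ⟫ * ω r s (suc n))

  module _ (ρ : F) where
    private module G l = Γ ρ (Base.A l)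

    mean-B : ∀ r s n → HasMean (λ l → cₛ l ^ r * G.B l s n) (ω r s n)
    mean-B zero s n = mean-≗ (λ l → sym (trans (⟪1⟫* _) (B≡A l))) refl (mean-A ℕ.∣ s - n ∣)
      where
      open import Data.Sum.Base using (inj₁; inj₂)
      B≡A : ∀ l → G.B l s n ≡ Sample.A l ℕ.∣ s - n ∣
      B≡A l with ℕP.≤-total n s
      ... | inj₁ n≤s = trans (cong (λ x → G.B l x n) (sym (ℕP.m+[n∸m]≡n n≤s))) (trans (G.B-diag l n (s ℕ.∸ n)) (cong (Sample.A l) (trans (sym (ℕP.m≤n⇒∣n-m∣≡n∸m n≤s)) refl)))
      ... | inj₂ s≤n = trans (G.B-comm l s n) (trans (cong (λ x → G.B l x s) (sym (ℕP.m+[n∸m]≡n s≤n))) (trans (G.B-diag l s (n ℕ.∸ s)) (cong (Sample.A l) (sym (ℕP.m≤n⇒∣m-n∣≡n∸m s≤n)))))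
    mean-B (suc r) s n = mean-≗ pointwise refl (mean-+ (mean-* ⟪ pos 2 ⟫ (mean-B r s n)) (mean-+ (mean-* ⟪ negsuc 0 ⟫ (mean-B r (suc s) n)) (mean-* ⟪ negsuc 0 ⟫ (mean-B r s (suc n)))))
      where
      pointwise : ∀ l → ⟪ pos 2 ⟫ * (cₛ l ^ r * G.B l s n) + (⟪ negsuc 0 ⟫ * (cₛ l ^ r * G.B l (suc s) n) + ⟪ negsuc 0 ⟫ * (cₛ l ^ r * G.B l s (suc n))) ≡ cₛ l ^ suc r * G.B l s n
      pointwise l = prove= (lit 2 :* (x :* b) :+ (con (negsuc 0) :* (x :* b₁) :+ con (negsuc 0) :* (x :* b₂))) ((c :* x) :* b)
        (cₛ l ^ r ∷ G.B l s n ∷ G.B l (suc s) n ∷ G.B l s (suc n) ∷ cₛ l ∷ [])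
        (by= (lit 2 :* b :+ (con (negsuc 0) :* b₁ :+ con (negsuc 0) :* b₂)) (c :* b) (G.B-suc l s n) x) refl
        where x = var 0F ; b = var 1F ; b₁ = var 2F ; b₂ = var 3F ; c = var 4F

    -- the coefficient of uⁿ in cʳ ∏ (1 + ρᵐuᵐ)
    I : ℕ → ℕ → ℕ → F
    I N n r = lsum (sublists (down N)) (λ s → ρ ^ s * ω r s n)

    mean-P : ∀ N n r → HasMean (λ l → cₛ l ^ r * G.P l N n) (I N n r)
    mean-P N n r = mean-≗ pointwise refl (mean-lsum S (λ l s → ρ ^ s * (cₛ l ^ r * G.B l s n)) (λ s → ρ ^ s * ω r s n) (λ s → mean-* (ρ ^ s) (mean-B r s n)))
      where
      S = sublists (down N)
      lsum-* : ∀ ps x f → lsum ps (λ s → x * f s) ≡ x * lsum ps f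
      lsum-* [] x f = sym (*0 x)
      lsum-* (p ∷ ps) x f = trans (cong (x * f (sum p) +_) (lsum-* ps x f)) (sym (distribˡ _ _ _))
      pointwise : ∀ l → lsum S (λ s → ρ ^ s * (cₛ l ^ r * G.B l s n)) ≡ cₛ l ^ r * G.P l N n
      pointwise l = trans (lsum-cong S (λ s → ring (var 0F :* (var 1F :* var 2F)) (var 1F :* (var 0F :* var 2F)) (ρ ^ s ∷ cₛ l ^ r ∷ G.B l s n ∷ []) refl))
        (trans (lsum-* S (cₛ l ^ r) _) (cong (cₛ l ^ r *_) (sym (G.P-sum l N n))))

-- From a minorant of the integrand to the coefficients

module Minorant where
  open Inequalities
  open PowersOfUnit
  open SampleMeans
  open PairProducts
  open RotatedProduct
  open BinomialKernel
  open Coefficients using (I; mean-P)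
  open import Data.Nat.Base as ℕ using (ℕ; suc; zero)

  module _ (ρ : F) (p : ℕ → F) (p-def : ∀ m → p m * (1# + ρ ^ m) ≡ ρ ^ m) where
    G : ℕ → F
    G = Π₁ (λ m → 1# + ρ ^ m)

    module _ (a : F) where
      open Factors a p using (ReF; ImF; rot; A; U; σ)
      open Coefficients.Γ ρ a using (ReΓ; ImΓ; P)
      private
        ReΓ≡ : ∀ N → ReΓ N ≡ G N * ReF N
        ImΓ≡ : ∀ N → ImΓ N ≡ G N * ImF N
        ReΓ≡ zero = sym (*1 1#)
        ReΓ≡ (suc m) = prove= (X :+ y :* (A′ :* X :- s :* (U′ :* W))) (g :* (lit 1 :+ y) :* (x :* (lit 1 :- q :+ q :* A′) :- s :* (w :* (q :* U′))))
          (ReΓ m ∷ ImΓ m ∷ G m ∷ ReF m ∷ ImF m ∷ ρ ^ suc m ∷ p (suc m) ∷ A (suc m) ∷ U (suc m) ∷ σ ∷ [])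
          (by= X (g :* x) (ReΓ≡ m) (lit 1 :+ y :* A′) ⊞ by= W (g :* w) (ImΓ≡ m) (:- (y :* (s :* U′)))
           ⊞ by= (q :* (lit 1 :+ y)) y (p-def (suc m)) (:- (g :* (x :* (A′ :- lit 1) :- s :* (w :* U′))))) refl
          where X = var 0F ; W = var 1F ; g = var 2F ; x = var 3F ; w = var 4F ; y = var 5F ; q = var 6F ; A′ = var 7F ; U′ = var 8F ; s = var 9F
        ImΓ≡ zero = sym (*0 1#)
        ImΓ≡ (suc m) = prove= (W :+ y :* (U′ :* X :+ A′ :* W)) (g :* (lit 1 :+ y) :* (x :* (q :* U′) :+ w :* (lit 1 :- q :+ q :* A′)))
          (ReΓ m ∷ ImΓ m ∷ G m ∷ ReF m ∷ ImF m ∷ ρ ^ suc m ∷ p (suc m) ∷ A (suc m) ∷ U (suc m) ∷ [])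
          (by= W (g :* w) (ImΓ≡ m) (lit 1 :+ y :* A′) ⊞ by= X (g :* x) (ReΓ≡ m) (y :* U′)
           ⊞ by= (q :* (lit 1 :+ y)) y (p-def (suc m)) (:- (g :* (w :* (A′ :- lit 1) :+ x :* U′)))) refl
          where X = var 0F ; W = var 1F ; g = var 2F ; x = var 3F ; w = var 4F ; y = var 5F ; q = var 6F ; A′ = var 7F ; U′ = var 8F

      -- 1 + ρᵐuᵐ = (1 + ρᵐ)(1 - pₘ + pₘuᵐ): the constants `G` are split off and a probability
      -- generating function remains.
      P≡G*rot : ∀ N n → P N n ≡ G N * rot N n
      P≡G*rot N n = prove= (X :* A′ :+ s :* (W :* U′)) (g :* (x :* A′ :+ s :* (w :* U′))) (ReΓ N ∷ ImΓ N ∷ G N ∷ ReF N ∷ ImF N ∷ A n ∷ U n ∷ σ ∷ [])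
        (by= X (g :* x) (ReΓ≡ N) A′ ⊞ by= W (g :* w) (ImΓ≡ N) (s :* U′)) refl
        where X = var 0F ; W = var 1F ; g = var 2F ; x = var 3F ; w = var 4F ; A′ = var 5F ; U′ = var 6F ; s = var 7F

    rotₛ : ℕ → ℕ → ℕ → F
    rotₛ N n l = Factors.rot (Base.A l) p N n

    module _ (N n D d₁ d₂ : ℕ) (i₁ i₂ η : F)
      (minorant : ∀ l → (1# - i₁ * cₛ l) * hₛ l ^ D ≤ rotₛ N n l + i₁ ^ 4 * (cₛ l ^ 4 * hₛ l ^ d₁) + i₂ ^ 8 * (cₛ l ^ 8 * hₛ l ^ d₂) + η)
      where

      X : ℕ → F
      X = moment D d₁ d₂ i₁ i₂ η

      private
        Y : ℕ → F
        Y r = I ρ N n r + ⟪ negsuc 0 ⟫ * (G N * X r)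

        ψ : ℕ → F
        ψ l = G N * (rotₛ N n l - ((1# - i₁ * cₛ l) * hₛ l ^ D - i₁ ^ 4 * (cₛ l ^ 4 * hₛ l ^ d₁) - i₂ ^ 8 * (cₛ l ^ 8 * hₛ l ^ d₂) - η))

        mean-ψ : ∀ r → HasMean (λ l → cₛ l ^ r * ψ l) (Y r)
        mean-ψ r = mean-≗ pointwise (trans eqβ (cong (λ x → I ρ N n r + ⟪ negsuc 0 ⟫ * (G N * x)) (sym (moment-def D d₁ d₂ i₁ i₂ η r)))) (mean-+ (mean-P ρ N n r) (mean-* ⟪ negsuc 0 ⟫ (mean-* (G N)
          (mean-+ (mean-ch r D) (mean-* ⟪ negsuc 0 ⟫ (mean-+ (mean-* i₁ (mean-ch (suc r) D)) (mean-+ (mean-* (i₁ ^ 4) (mean-ch (4 ℕ.+ r) d₁)) (mean-+ (mean-* (i₂ ^ 8) (mean-ch (8 ℕ.+ r) d₂)) (mean-* η (mean-ch r 0))))))))))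
          where
          eqβ : I ρ N n r + ⟪ negsuc 0 ⟫ * (G N * (β r D + ⟪ negsuc 0 ⟫ * (i₁ * β (suc r) D + (i₁ ^ 4 * β (4 ℕ.+ r) d₁ + (i₂ ^ 8 * β (8 ℕ.+ r) d₂ + η * β r 0))))) ≡ I ρ N n r + ⟪ negsuc 0 ⟫ * (G N * (β r D - i₁ * β (suc r) D - i₁ ^ 4 * β (4 ℕ.+ r) d₁ - i₂ ^ 8 * β (8 ℕ.+ r) d₂ - η * β r 0))
          eqβ = ring (x0 :+ con (negsuc 0) :* (x1 :* (x2 :+ con (negsuc 0) :* (x3 :+ (x4 :+ (x5 :+ x6)))))) (x0 :+ con (negsuc 0) :* (x1 :* (x2 :- x3 :- x4 :- x5 :- x6)))
            (I ρ N n r ∷ G N ∷ β r D ∷ i₁ * β (suc r) D ∷ i₁ ^ 4 * β (4 ℕ.+ r) d₁ ∷ i₂ ^ 8 * β (8 ℕ.+ r) d₂ ∷ η * β r 0 ∷ []) refl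
            where x0 = var 0F ; x1 = var 1F ; x2 = var 2F ; x3 = var 3F ; x4 = var 4F ; x5 = var 5F ; x6 = var 6F
          pointwise : ∀ l → cₛ l ^ r * Coefficients.Γ.P ρ (Base.A l) N n + ⟪ negsuc 0 ⟫ * (G N * (cₛ l ^ r * hₛ l ^ D + ⟪ negsuc 0 ⟫ * (i₁ * (cₛ l ^ suc r * hₛ l ^ D) + (i₁ ^ 4 * (cₛ l ^ (4 ℕ.+ r) * hₛ l ^ d₁) + (i₂ ^ 8 * (cₛ l ^ (8 ℕ.+ r) * hₛ l ^ d₂) + η * (cₛ l ^ r * 1#)))))) ≡ cₛ l ^ r * ψ l
          pointwise l = prove=
            (x :* P :+ con (negsuc 0) :* (g :* (x :* hD :+ con (negsuc 0) :* (j₁ :* ((c :* x) :* hD) :+ (j₁⁴ :* (C4 :* h₁) :+ (j₂⁸ :* (C8 :* h₂) :+ e :* (x :* lit 1)))))))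
            (x :* (g :* (rt :- ((lit 1 :- j₁ :* c) :* hD :- j₁⁴ :* (c4 :* h₁) :- j₂⁸ :* (c8 :* h₂) :- e))))
            (cₛ l ^ r ∷ Coefficients.Γ.P ρ (Base.A l) N n ∷ G N ∷ hₛ l ^ D ∷ i₁ ∷ cₛ l ∷ i₁ ^ 4 ∷ cₛ l ^ (4 ℕ.+ r) ∷ hₛ l ^ d₁ ∷ i₂ ^ 8 ∷ cₛ l ^ (8 ℕ.+ r) ∷ hₛ l ^ d₂ ∷ η ∷ rotₛ N n l ∷ cₛ l ^ 4 ∷ cₛ l ^ 8 ∷ [])
            (by= P (g :* rt) (P≡G*rot (Base.A l) N n) x
             ⊞ by= C4 (c4 :* x) (^-+ (cₛ l) 4 r) (g :* j₁⁴ :* h₁) ⊞ by= C8 (c8 :* x) (^-+ (cₛ l) 8 r) (g :* j₂⁸ :* h₂)) refl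
            where
            open import Data.Fin.Base using (suc)
            x = var 0F ; P = var 1F ; g = var 2F ; hD = var 3F ; j₁ = var 4F ; c = var 5F ; j₁⁴ = var 6F ; C4 = var 7F ; h₁ = var 8F ; j₂⁸ = var 9F
            C8 = var (suc 9F) ; h₂ = var (suc (suc 9F)) ; e = var (suc (suc (suc 9F))) ; rt = var (suc (suc (suc (suc 9F)))) ; c4 = var (suc (suc (suc (suc (suc 9F))))) ; c8 = var (suc (suc (suc (suc (suc (suc 9F))))))

      G≥0 : (∀ m → 0# ≤ ρ ^ m) → ∀ k → 0# ≤ G k
      G≥0 ρ≥0 = Π₁≥0 (λ k → +≥0 (⟪⟫≥0 1) (ρ≥0 (suc k)))

      -- w(c) times integrand minus minorant is nonnegative at every sample, hence in the mean, and
      -- the mean of the minorant is explicit.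
      coefficient-bound : (∀ m → 0# ≤ ρ ^ m) → ∀ w₀ w₁ w₂ → (∀ x → 0# ≤ x → x ≤ ⟪ pos 4 ⟫ → 0# ≤ w₀ + w₁ * x + w₂ * (x * x)) →
        G N * (w₀ * X 0 + w₁ * X 1 + w₂ * X 2) ≤ w₀ * I ρ N n 0 + w₁ * I ρ N n 1 + w₂ * I ρ N n 2
      coefficient-bound ρ≥0 w₀ w₁ w₂ w≥0 = prove (g :* (a :* x0 :+ b :* x1 :+ d :* x2)) (a :* i0 :+ b :* i1 :+ d :* i2)
          (G N ∷ w₀ ∷ w₁ ∷ w₂ ∷ X 0 ∷ X 1 ∷ X 2 ∷ I ρ N n 0 ∷ I ρ N n 1 ∷ I ρ N n 2 ∷ [])
          (ge0 (a :* (i0 :+ con (negsuc 0) :* (g :* x0)) :+ (b :* (i1 :+ con (negsuc 0) :* (g :* x1)) :+ d :* (i2 :+ con (negsuc 0) :* (g :* x2)))) nonneg) refl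
        where
        g = var 0F ; a = var 1F ; b = var 2F ; d = var 3F ; x0 = var 4F ; x1 = var 5F ; x2 = var 6F ; i0 = var 7F ; i1 = var 8F ; i2 = var 9F
        nonneg : 0# ≤ w₀ * Y 0 + (w₁ * Y 1 + w₂ * Y 2)
        nonneg = mean≥0 (mean-+ (mean-* w₀ (mean-ψ 0)) (mean-+ (mean-* w₁ (mean-ψ 1)) (mean-* w₂ (mean-ψ 2)))) pos′
          where
          pos′ : ∀ l → 0# ≤ w₀ * (cₛ l ^ 0 * ψ l) + (w₁ * (cₛ l ^ 1 * ψ l) + w₂ * (cₛ l ^ 2 * ψ l))
          pos′ l = subst (0# ≤_) (ring ((va :+ vb :* vc :+ vd :* (vc :* vc)) :* vs) (va :* (lit 1 :* vs) :+ (vb :* ((vc :* lit 1) :* vs) :+ vd :* ((vc :* (vc :* lit 1)) :* vs))) (w₀ ∷ w₁ ∷ w₂ ∷ cₛ l ∷ ψ l ∷ []) refl)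
            (*≥0 (w≥0 (cₛ l) (Sample.c≥0 l) (Sample.c≤4 l)) (*≥0 (G≥0 ρ≥0 N) ψ≥0))
            where
            va = var 0F ; vb = var 1F ; vd = var 2F ; vc = var 3F ; vs = var 4F
            ψ≥0 : 0# ≤ rotₛ N n l - ((1# - i₁ * cₛ l) * hₛ l ^ D - i₁ ^ 4 * (cₛ l ^ 4 * hₛ l ^ d₁) - i₂ ^ 8 * (cₛ l ^ 8 * hₛ l ^ d₂) - η)
            ψ≥0 = prove (lit 0) (x :- (y :- z :- u :- e)) (rotₛ N n l ∷ (1# - i₁ * cₛ l) * hₛ l ^ D ∷ i₁ ^ 4 * (cₛ l ^ 4 * hₛ l ^ d₁) ∷ i₂ ^ 8 * (cₛ l ^ 8 * hₛ l ^ d₂) ∷ η ∷ [])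
              (le y (x :+ z :+ u :+ e) (minorant l)) refl
              where x = var 0F ; y = var 1F ; z = var 2F ; u = var 3F ; e = var 4F

-- Power sums with geometric weights

module PowerSums where
  open Inequalities
  open PowersOfUnit
  open PairProducts
  open import Data.Nat.Base as ℕ using (ℕ; suc; zero)

  Σ₁-+ : ∀ f g N → Σ₁ (λ m → f m + g m) N ≡ Σ₁ f N + Σ₁ g N
  Σ₁-+ f g zero = sym (+0 0#)
  Σ₁-+ f g (suc N) = trans (cong (_+ (f (suc N) + g (suc N))) (Σ₁-+ f g N)) (+-swap _ _ _ _)

  Σ₁-* : ∀ a f N → Σ₁ (λ m → a * f m) N ≡ a * Σ₁ f N
  Σ₁-* a f zero = sym (*0 a)
  Σ₁-* a f (suc N) = trans (cong (_+ a * f (suc N)) (Σ₁-* a f N)) (sym (distribˡ a _ _))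

  Σ₁-≗ : ∀ (f g : ℕ → F) N → (∀ k → f (suc k) ≡ g (suc k)) → Σ₁ f N ≡ Σ₁ g N
  Σ₁-≗ f g zero h = refl
  Σ₁-≗ f g (suc N) h = cong₂ _+_ (Σ₁-≗ f g N h) (h N)

  Σ₁-const : ∀ a N → Σ₁ (λ _ → a) N ≡ # N * a
  Σ₁-const a zero = sym (0* a)
  Σ₁-const a (suc N) = trans (cong (_+ a) (Σ₁-const a N)) (trans (ring (n :* x :+ x) ((lit 1 :+ n) :* x) (# N ∷ a ∷ []) refl) (cong (_* a) (sym (#-suc N))))
    where n = var 0F ; x = var 1F

  Σ₁≤ : ∀ (f g : ℕ → F) N → (∀ k → f (suc k) ≤ g (suc k)) → Σ₁ f N ≤ Σ₁ g N
  Σ₁≤ f g N h = Σ₁-mono {f} {g} N (λ k _ → h k)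

  module Geometric (x : F) (x≥0 : 0# ≤ x) (x≤1 : x ≤ 1#) where
    -- Abel summation; the discarded boundary term f(N)x^(N+1) is nonnegative.
    summation-by-parts : ∀ (f g : ℕ → F) → f 0 ≡ 0# → (∀ m → f (suc m) ≡ f m + g (suc m)) → (∀ m → 0# ≤ f m) → ∀ N →
      (1# - x) * Σ₁ (λ m → f m * x ^ m) N ≤ Σ₁ (λ m → g m * x ^ m) N
    summation-by-parts f g f0 step f≥0 N = prove l r (x ∷ Σ₁ (λ m → f m * x ^ m) N ∷ Σ₁ (λ m → g m * x ^ m) N ∷ f N ∷ x ^ N ∷ [])
        (ge0 (var 3F :* (var 0F :* var 4F)) (*≥0 (f≥0 N) (*≥0 x≥0 (^≥0 x≥0 N))) ⊕ eqn l′ r (exact N) (con (negsuc 0))) refl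
      where
      l = (lit 1 :- var 0F) :* var 1F
      r = var 2F
      l′ = (lit 1 :- var 0F) :* var 1F :+ var 3F :* (var 0F :* var 4F)
      exact : ∀ k → (1# - x) * Σ₁ (λ m → f m * x ^ m) k + f k * (x * x ^ k) ≡ Σ₁ (λ m → g m * x ^ m) k
      exact zero = trans (cong (λ z → (1# - x) * 0# + z * (x * 1#)) f0) (ring ((lit 1 :- X) :* lit 0 :+ lit 0 :* (X :* lit 1)) (lit 0) (x ∷ []) refl)
        where X = var 0F
      exact (suc k) = prove= ((lit 1 :- X) :* (s :+ f′ :* (X :* w)) :+ f′ :* (X :* (X :* w))) (u :+ G :* (X :* w))
        (x ∷ Σ₁ (λ m → f m * x ^ m) k ∷ Σ₁ (λ m → g m * x ^ m) k ∷ f k ∷ f (suc k) ∷ g (suc k) ∷ x ^ k ∷ [])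
        (by= ((lit 1 :- X) :* s :+ f₀ :* (X :* w)) u (exact k) (lit 1) ⊞ by= f′ (f₀ :+ G) (step k) (X :* w)) refl
        where X = var 0F ; s = var 1F ; u = var 2F ; f₀ = var 3F ; f′ = var 4F ; G = var 5F ; w = var 6F

    private
      d = 1# - x
      -- Rising factorials: the difference of one of degree r is r times the one of degree r - 1, so
      -- repeated summation by parts gives d^(r+1) Σ ≤ r!.
      n2 n3 n4 : ℕ → F
      n2 m = # m * (# m + 1#)
      n3 m = # m * (# m + 1#) * (# m + ⟪ pos 2 ⟫)
      n4 m = # m * (# m + 1#) * (# m + ⟪ pos 2 ⟫) * (# m + ⟪ pos 3 ⟫)
      d≥0 : 0# ≤ d
      d≥0 = sub≥0 x≤1
      S : (ℕ → F) → ℕ → F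
      S f N = Σ₁ (λ m → f m * x ^ m) N
      pull : ∀ e (f : ℕ → F) N → S (λ m → e * f m) N ≡ e * S f N
      pull e f N = trans (Σ₁-≗ (λ m → e * f m * x ^ m) (λ m → e * (f m * x ^ m)) N (λ k → *-assoc e (f (suc k)) (x ^ suc k))) (Σ₁-* e (λ m → f m * x ^ m) N)

    Σ1≤ : ∀ N → d * Σ₁ (λ m → x ^ m) N ≤ 1#
    Σ1≤ N = prove ((lit 1 :- X) :* s) (lit 1) (x ∷ Σ₁ (λ m → x ^ m) N ∷ x ^ N ∷ [])
      (le X (lit 1) x≤1 ⊕ ge0 (X :* w) (*≥0 x≥0 (^≥0 x≥0 N)) ⊕ eqn ((lit 1 :- X) :* s :+ X :* w) X (exact N) (con (negsuc 0))) refl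
      where
      X = var 0F ; s = var 1F ; w = var 2F
      exact : ∀ k → d * Σ₁ (λ m → x ^ m) k + x * x ^ k ≡ x
      exact zero = ring ((lit 1 :- var 0F) :* lit 0 :+ var 0F :* lit 1) (var 0F) (x ∷ []) refl
      exact (suc k) = prove= ((lit 1 :- X) :* (s :+ X :* w) :+ X :* (X :* w)) X (x ∷ Σ₁ (λ m → x ^ m) k ∷ x ^ k ∷ [])
        (by= ((lit 1 :- X) :* s :+ X :* w) X (exact k) (lit 1)) refl

    Σm≤ : ∀ N → d ^ 2 * S # N ≤ 1#
    Σm≤ N = ≤-trans (prove ((D :* (D :* lit 1)) :* a) (D :* b) (d ∷ S # N ∷ Σ₁ (λ m → x ^ m) N ∷ [])
      (ge0 D d≥0 ⊗ le (D :* a) b (≤-trans (summation-by-parts # (λ _ → 1#) refl (λ m → trans (#-suc m) (+-comm 1# (# m))) (λ m → ⟪⟫≥0 m) N)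
        (≤-reflexive (Σ₁-≗ (λ m → 1# * x ^ m) (x ^_) N (λ k → ⟪1⟫* (x ^ suc k)))))) refl) (Σ1≤ N)
      where D = var 0F ; a = var 1F ; b = var 2F

    Σn2≤ : ∀ N → d ^ 3 * S n2 N ≤ ⟪ pos 2 ⟫
    Σn2≤ N = ≤-trans (prove ((D :* (D :* (D :* lit 1))) :* a) (lit 2 :* ((D :* (D :* lit 1)) :* b)) (d ∷ S n2 N ∷ S # N ∷ [])
      (sq D ⊗ le (D :* a) (lit 2 :* b) (≤-trans (summation-by-parts n2 (λ m → ⟪ pos 2 ⟫ * # m) (0* _) step (λ m → *≥0 (⟪⟫≥0 m) (+≥0 (⟪⟫≥0 m) (⟪⟫≥0 1))) N) (≤-reflexive (pull _ # N)))) refl)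
      (prove (lit 2 :* y) (lit 2) (d ^ 2 * S # N ∷ []) (nat 2 ⊗ le y (lit 1) (Σm≤ N)) refl)
      where
      D = var 0F ; a = var 1F ; b = var 2F ; y = var 0F
      step : ∀ m → n2 (suc m) ≡ n2 m + ⟪ pos 2 ⟫ * # (suc m)
      step m = prove= (N′ :* (N′ :+ lit 1)) (M :* (M :+ lit 1) :+ lit 2 :* N′) (# m ∷ # (suc m) ∷ []) (by= N′ (lit 1 :+ M) (#-suc m) (N′ :+ M)) refl
        where M = var 0F ; N′ = var 1F

    Σn3≤ : ∀ N → d ^ 4 * S n3 N ≤ ⟪ pos 6 ⟫
    Σn3≤ N = ≤-trans (prove ((D :* (D :* (D :* (D :* lit 1)))) :* a) (lit 3 :* ((D :* (D :* (D :* lit 1))) :* b)) (d ∷ S n3 N ∷ S n2 N ∷ [])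
      (ge0 D d≥0 ⊗ sq D ⊗ le (D :* a) (lit 3 :* b) (≤-trans (summation-by-parts n3 (λ m → ⟪ pos 3 ⟫ * n2 m) (trans (cong (_* (# 0 + ⟪ pos 2 ⟫)) (0* _)) (0* _)) step
        (λ m → *≥0 (*≥0 (⟪⟫≥0 m) (+≥0 (⟪⟫≥0 m) (⟪⟫≥0 1))) (+≥0 (⟪⟫≥0 m) (⟪⟫≥0 2))) N) (≤-reflexive (pull _ n2 N)))) refl)
      (prove (lit 3 :* y) (lit 6) (d ^ 3 * S n2 N ∷ []) (nat 3 ⊗ le y (lit 2) (Σn2≤ N)) refl)
      where
      D = var 0F ; a = var 1F ; b = var 2F ; y = var 0F
      step : ∀ m → n3 (suc m) ≡ n3 m + ⟪ pos 3 ⟫ * n2 (suc m)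
      step m = prove= (N′ :* (N′ :+ lit 1) :* (N′ :+ lit 2)) (M :* (M :+ lit 1) :* (M :+ lit 2) :+ lit 3 :* (N′ :* (N′ :+ lit 1))) (# m ∷ # (suc m) ∷ [])
        (by= N′ (lit 1 :+ M) (#-suc m) (N′ :* N′ :+ N′ :* (M :+ lit 1) :+ (M :+ lit 1) :* (M :+ lit 1) :- lit 1)) refl
        where M = var 0F ; N′ = var 1F

    Σn4≤ : ∀ N → d ^ 5 * S n4 N ≤ ⟪ pos 24 ⟫
    Σn4≤ N = ≤-trans (prove ((D :* (D :* (D :* (D :* (D :* lit 1))))) :* a) (lit 4 :* ((D :* (D :* (D :* (D :* lit 1)))) :* b)) (d ∷ S n4 N ∷ S n3 N ∷ [])
      (sq D ⊗ sq D ⊗ le (D :* a) (lit 4 :* b) (≤-trans (summation-by-parts n4 (λ m → ⟪ pos 4 ⟫ * n3 m) (trans (cong (λ z → z * (# 0 + ⟪ pos 2 ⟫) * (# 0 + ⟪ pos 3 ⟫)) (0* _)) (trans (cong (_* (# 0 + ⟪ pos 3 ⟫)) (0* _)) (0* _))) step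
        (λ m → *≥0 (*≥0 (*≥0 (⟪⟫≥0 m) (+≥0 (⟪⟫≥0 m) (⟪⟫≥0 1))) (+≥0 (⟪⟫≥0 m) (⟪⟫≥0 2))) (+≥0 (⟪⟫≥0 m) (⟪⟫≥0 3))) N) (≤-reflexive (pull _ n3 N)))) refl)
      (prove (lit 4 :* y) (lit 24) (d ^ 4 * S n3 N ∷ []) (nat 4 ⊗ le y (lit 6) (Σn3≤ N)) refl)
      where
      D = var 0F ; a = var 1F ; b = var 2F ; y = var 0F
      step : ∀ m → n4 (suc m) ≡ n4 m + ⟪ pos 4 ⟫ * n3 (suc m)
      step m = prove= (N′ :* (N′ :+ lit 1) :* (N′ :+ lit 2) :* (N′ :+ lit 3)) (M :* (M :+ lit 1) :* (M :+ lit 2) :* (M :+ lit 3) :+ lit 4 :* (N′ :* (N′ :+ lit 1) :* (N′ :+ lit 2))) (# m ∷ # (suc m) ∷ [])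
        (by= N′ (lit 1 :+ M) (#-suc m) (N′ :* N′ :* N′ :+ N′ :* N′ :* L :+ N′ :* L :* L :+ L :* L :* L :+ lit 2 :* (N′ :* N′ :+ N′ :* L :+ L :* L) :- (N′ :+ L) :- lit 2)) refl
        where M = var 0F ; N′ = var 1F ; L = M :+ lit 1

    private
      mono-S : ∀ (f g : ℕ → F) N → (∀ m → f m ≤ g m) → ∀ e → 0# ≤ e → ∀ {b} → e * S g N ≤ b → e * S f N ≤ b
      mono-S f g N h e e≥0 p = ≤-trans (*-mono′ e≥0 (Σ₁≤ (λ m → f m * x ^ m) (λ m → g m * x ^ m) N (λ k → prove (F₁ :* w) (F₂ :* w) (f (suc k) ∷ g (suc k) ∷ x ^ suc k ∷ []) (le F₁ F₂ (h (suc k)) ⊗ ge0 w (^≥0 x≥0 (suc k))) refl))) p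
        where
        F₁ = var 0F ; F₂ = var 1F ; w = var 2F
        *-mono′ : ∀ {a b c} → 0# ≤ a → b ≤ c → a * b ≤ a * c
        *-mono′ {a} {b} {c} p q = prove (var 0F :* var 1F) (var 0F :* var 2F) (a ∷ b ∷ c ∷ []) (ge0 (var 0F) p ⊗ le (var 1F) (var 2F) q) refl

    Σm²≤ : ∀ N → d ^ 3 * S (λ m → # m * # m) N ≤ ⟪ pos 2 ⟫
    Σm²≤ N = mono-S _ n2 N (λ m → prove⁺ (M :* M) (M :* (M :+ lit 1)) (⟪⟫≥0 m ∷ []) refl) (d ^ 3) (^≥0 d≥0 3) (Σn2≤ N)
      where M = var 0F
    Σm³≤ : ∀ N → d ^ 4 * S (λ m → # m * # m * # m) N ≤ ⟪ pos 6 ⟫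
    Σm³≤ N = mono-S _ n3 N (λ m → prove⁺ (M :* M :* M) (M :* (M :+ lit 1) :* (M :+ lit 2)) (⟪⟫≥0 m ∷ []) refl) (d ^ 4) (^≥0 d≥0 4) (Σn3≤ N)
      where M = var 0F
    Σm⁴≤ : ∀ N → d ^ 5 * S (λ m → # m * # m * (# m * # m)) N ≤ ⟪ pos 24 ⟫
    Σm⁴≤ N = mono-S _ n4 N (λ m → prove⁺ (M :* M :* (M :* M)) (M :* (M :+ lit 1) :* (M :+ lit 2) :* (M :+ lit 3)) (⟪⟫≥0 m ∷ []) refl) (d ^ 5) (^≥0 d≥0 5) (Σn4≤ N)
      where M = var 0F

    -- Kept exact, with boundary term, because the lower bound on the variance must control the
    -- truncation at N.
    Σm²≡ : ∀ N → d ^ 3 * S (λ m → # m * # m) N + x * x ^ N * (# N * # N * (d * d) + ⟪ pos 2 ⟫ * (# N * d) + 1# + x) ≡ x * (1# + x)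
    Σm²≡ zero = ring (D :^ 3 :* lit 0 :+ X :* lit 1 :* (lit 0 :* lit 0 :* (D :* D) :+ lit 2 :* (lit 0 :* D) :+ lit 1 :+ X)) (X :* (lit 1 :+ X)) (x ∷ []) refl
      where X = var 0F ; D = lit 1 :- X
    Σm²≡ (suc k) = prove= (D :^ 3 :* (s :+ N′ :* N′ :* (X :* w)) :+ X :* (X :* w) :* (N′ :* N′ :* (D :* D) :+ lit 2 :* (N′ :* D) :+ lit 1 :+ X)) (X :* (lit 1 :+ X))
      (x ∷ S (λ m → # m * # m) k ∷ x ^ k ∷ # k ∷ # (suc k) ∷ [])
      (by= (D :^ 3 :* s :+ X :* w :* (M :* M :* (D :* D) :+ lit 2 :* (M :* D) :+ lit 1 :+ X)) (X :* (lit 1 :+ X)) (Σm²≡ k) (lit 1)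
       ⊞ by= N′ (lit 1 :+ M) (#-suc k) (X :* w :* (D :* D :* (N′ :+ M :+ lit 1) :+ lit 2 :* (D :* X)))) refl
      where X = var 0F ; D = lit 1 :- X ; s = var 1F ; w = var 2F ; M = var 3F ; N′ = var 4F

    Σm²≤′ : ∀ N → d ^ 3 * S (λ m → # m * # m) N ≤ x * (1# + x)
    Σm²≤′ N = ≤-trans (prove (var 0F) (var 0F :+ var 1F) (d ^ 3 * S (λ m → # m * # m) N ∷ x * x ^ N * (# N * # N * (d * d) + ⟪ pos 2 ⟫ * (# N * d) + 1# + x) ∷ [])
        (ge0 (var 1F) (*≥0 (*≥0 x≥0 (^≥0 x≥0 N)) (+≥0 (+≥0 (+≥0 (*≥0 (sq≥0 (# N)) (sq≥0 d)) (*≥0 (⟪⟫≥0 2) (*≥0 (⟪⟫≥0 N) d≥0))) (⟪⟫≥0 1)) x≥0))) refl)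
      (≤-reflexive (Σm²≡ N))

    -- The terms of the expansion of (1 − d)⁻ᵐ, each bounded by the whole.
    power-tail : ∀ m → x ^ m * (⟪ pos 6 ⟫ + ⟪ pos 6 ⟫ * (# m * d) + ⟪ pos 3 ⟫ * (n2 m * (d * d)) + n3 m * (d * (d * d))) ≤ ⟪ pos 6 ⟫
    power-tail zero = ≤-reflexive (ring (lit 1 :* (lit 6 :+ lit 6 :* (lit 0 :* D) :+ lit 3 :* (lit 0 :* (lit 0 :+ lit 1) :* (D :* D)) :+ lit 0 :* (lit 0 :+ lit 1) :* (lit 0 :+ lit 2) :* (D :* (D :* D)))) (lit 6) (d ∷ []) refl)
      where D = var 0F
    power-tail (suc k) = ≤-trans (prove (X :* w :* expn N′) (w :* expn M) (x ∷ x ^ k ∷ # k ∷ # (suc k) ∷ [])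
        (ge0 w (^≥0 x≥0 k) ⊗ (sq D ⊗ sq D ⊗ posE′) ⊕ eqn N′ (lit 1 :+ M) (#-suc k) (:- (X :* w :* (lit 6 :* D :+ lit 3 :* (D :* D) :* (N′ :+ M :+ lit 2) :+ D :* (D :* D) :* (N′ :* (N′ :+ M :+ lit 1) :+ (M :+ lit 1) :* (M :+ lit 1) :+ lit 3 :* (N′ :+ M :+ lit 1) :+ lit 2))))) refl)
      (power-tail k)
      where
      X = var 0F ; w = var 1F ; M = var 2F ; N′ = var 3F
      D = lit 1 :- X
      expn : Expr → Expr
      expn m = lit 6 :+ lit 6 :* (m :* D) :+ lit 3 :* (m :* (m :+ lit 1) :* (D :* D)) :+ m :* (m :+ lit 1) :* (m :+ lit 2) :* (D :* (D :* D))
      posE′ : Nn (x ∷ x ^ k ∷ # k ∷ # (suc k) ∷ [])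
      posE′ = posE (x≥0 ∷ ^≥0 x≥0 k ∷ ⟪⟫≥0 k ∷ ⟪⟫≥0 (suc k) ∷ []) ((M :+ lit 1) :* (M :+ lit 2) :* (M :+ lit 3)) refl

    private
      pt : ∀ m → (l : F) → l ≤ ⟪ pos 6 ⟫ + ⟪ pos 6 ⟫ * (# m * d) + ⟪ pos 3 ⟫ * (n2 m * (d * d)) + n3 m * (d * (d * d)) → x ^ m * l ≤ ⟪ pos 6 ⟫
      pt m l h = ≤-trans (prove (var 0F :* var 1F) (var 0F :* var 2F) (x ^ m ∷ l ∷ _ ∷ []) (ge0 (var 0F) (^≥0 x≥0 m) ⊗ le (var 1F) (var 2F) h) refl) (power-tail m)
      E : Expr {2}
      E = lit 6 :+ lit 6 :* (var 0F :* var 1F) :+ lit 3 :* (var 0F :* (var 0F :+ lit 1) :* (var 1F :* var 1F)) :+ var 0F :* (var 0F :+ lit 1) :* (var 0F :+ lit 2) :* (var 1F :* (var 1F :* var 1F))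

    mx^m≤ : ∀ m → x ^ m * (# m * d) ≤ 1#
    mx^m≤ m = *-cancel-≤ (⟪⟫>0 5) (≤-trans (≤-reflexive (ring (lit 6 :* (var 0F :* var 1F)) (var 0F :* (lit 6 :* var 1F)) (x ^ m ∷ # m * d ∷ []) refl)) (≤-trans (pt m _ (prove⁺ (lit 6 :* (var 0F :* var 1F)) E (⟪⟫≥0 m ∷ d≥0 ∷ []) refl)) (≤-reflexive (sym (*1 _)))))
    m²x^m≤ : ∀ m → x ^ m * (# m * # m * (d * d)) ≤ ⟪ pos 2 ⟫
    m²x^m≤ m = *-cancel-≤ (⟪⟫>0 2) (≤-trans (≤-reflexive (ring (lit 3 :* (var 0F :* var 1F)) (var 0F :* (lit 3 :* var 1F)) (x ^ m ∷ # m * # m * (d * d) ∷ []) refl)) (≤-trans (pt m _ (prove⁺ (lit 3 :* (var 0F :* var 0F :* (var 1F :* var 1F))) E (⟪⟫≥0 m ∷ d≥0 ∷ []) refl)) (≤-reflexive (⟪⟫-* (pos 3) (pos 2)))))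
    m³x^m≤ : ∀ m → x ^ m * (# m * # m * # m * (d * (d * d))) ≤ ⟪ pos 6 ⟫
    m³x^m≤ m = pt m _ (prove⁺ (var 0F :* var 0F :* var 0F :* (var 1F :* (var 1F :* var 1F))) E (⟪⟫≥0 m ∷ d≥0 ∷ []) refl)

-- Variance and third moments of the tilted distribution

module TiltedSums where
  open Inequalities
  open PowersOfUnit
  open PairProducts
  open CentralBound using (pow≤1)
  open UpperBounds using (^-distrib-*)
  open PowerSums
  open import Data.Nat.Base as ℕ using (ℕ; suc)

  module Probability (ρ : F) (ρ≥0 : 0# ≤ ρ) (ρ≤1 : ρ ≤ 1#) where
    p v : ℕ → F
    p m = ρ ^ m * inv (1# + ρ ^ m)
    v m = p m * (1# - p m)

    module _ (m : ℕ) where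
      private
        y = ρ ^ m
      y≥0 : 0# ≤ y
      y≥0 = ^≥0 ρ≥0 m
      y≤1 : y ≤ 1#
      y≤1 = pow≤1 ρ≥0 ρ≤1 m
      1+y>0 : 0# < 1# + y
      1+y>0 = <-≤-trans (⟪⟫>0 0) (prove⁺ (lit 1) (lit 1 :+ var 0F) (y≥0 ∷ []) refl)
      p-def : p m * (1# + y) ≡ y
      p-def = prove= (Y :* i :* (lit 1 :+ Y)) Y (y ∷ inv (1# + y) ∷ []) (by= ((lit 1 :+ Y) :* i) (lit 1) (inv-eq 1+y>0) Y) refl
        where Y = var 0F ; i = var 1F
      p≥0 : 0# ≤ p m
      p≥0 = *≥0 y≥0 (inv≥0 1+y>0)
      p≤y : p m ≤ y
      p≤y = prove P Y (p m ∷ y ∷ []) (ge0 P p≥0 ⊗ ge0 Y y≥0 ⊕ eqn (P :* (lit 1 :+ Y)) Y p-def (con (negsuc 0))) refl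
        where P = var 0F ; Y = var 1F
      2p≤1 : ⟪ pos 2 ⟫ * p m ≤ 1#
      2p≤1 = *-cancel-≤ 1+y>0 (prove ((lit 1 :+ Y) :* (lit 2 :* P)) ((lit 1 :+ Y) :* lit 1) (p m ∷ y ∷ [])
        (le Y (lit 1) y≤1 ⊕ eqn (P :* (lit 1 :+ Y)) Y p-def (con (negsuc 1))) refl)
        where P = var 0F ; Y = var 1F
      y≤2p : y ≤ ⟪ pos 2 ⟫ * p m
      y≤2p = prove Y (lit 2 :* P) (p m ∷ y ∷ []) (ge0 P p≥0 ⊗ le Y (lit 1) y≤1 ⊕ eqn (P :* (lit 1 :+ Y)) Y p-def (lit 1)) refl
        where P = var 0F ; Y = var 1F

      private
        z = 1# + y
        z²>0 : 0# < z * z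
        z²>0 = *>0 1+y>0 1+y>0
        v-def : v m * (z * z) ≡ y
        v-def = prove= (P :* (lit 1 :- P) :* (Z :* Z)) Y (p m ∷ y ∷ [])
          (by= (P :* Z) Y p-def (Z :- P :* Z :- Y)) refl
          where P = var 0F ; Y = var 1F ; Z = lit 1 :+ Y
        Z₂ : Expr {2}
        Z₂ = (lit 1 :+ var 1F) :* (lit 1 :+ var 1F)

      v≥0 : 0# ≤ v m
      v≥0 = *-cancel-≤ z²>0 (≤-trans (≤-reflexive (*0 _)) (≤-trans y≥0 (≤-reflexive (trans (sym v-def) (*-comm (v m) (z * z))))))
      v≤p : v m ≤ p m
      v≤p = prove (P :* (lit 1 :- P)) P (p m ∷ []) (sq P) refl
        where P = var 0F
      v≤y : v m ≤ y
      v≤y = ≤-trans v≤p p≤y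
      -- y / (1 + y)² minus its Taylor-type minorant is y³ (1 − y)² (1 + ¾ y) / (1 + y)².
      v≥quartic : y * ⟪ pos 4 ⟫ - ⟪ pos 8 ⟫ * (y * y) + ⟪ pos 8 ⟫ * (y * (y * y)) - ⟪ pos 3 ⟫ * (y * y * (y * y)) ≤ ⟪ pos 4 ⟫ * v m
      v≥quartic = *-cancel-≤ z²>0 (prove (Z₂ :* (Y :* lit 4 :- lit 8 :* (Y :* Y) :+ lit 8 :* (Y :* (Y :* Y)) :- lit 3 :* (Y :* Y :* (Y :* Y)))) (Z₂ :* (lit 4 :* V)) (v m ∷ y ∷ [])
        (ge0 Y y≥0 ⊗ (sq (Y :* (lit 1 :- Y)) ⊗ (nat 4 ⊕ nat 3 ⊗ ge0 Y y≥0)) ⊕ eqn (V :* Z₂) Y v-def (lit 4)) refl)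
        where V = var 0F ; Y = var 1F
      v≥quadratic : ⟪ pos 2 ⟫ * y - y * y ≤ ⟪ pos 4 ⟫ * v m
      v≥quadratic = *-cancel-≤ z²>0 (prove (Z₂ :* (lit 2 :* Y :- Y :* Y)) (Z₂ :* (lit 4 :* V)) (v m ∷ y ∷ [])
        (ge0 Y y≥0 ⊗ (sq (lit 1 :- Y) ⊗ (ge0 Y y≥0 ⊕ nat 2)) ⊕ eqn (V :* Z₂) Y v-def (lit 4)) refl)
        where V = var 0F ; Y = var 1F
      -- Clearing (1 + y)³ leaves 4y ≤ (1 + y)³. The square on the right turns a sum of cubes of m
      -- pₘ into a geometric sum at ρ².
      4p³≤y² : ⟪ pos 4 ⟫ * (p m * p m * p m) ≤ y * y
      4p³≤y² = *-cancel-≤ (*>0 z²>0 1+y>0) (prove (Z₃ :* (lit 4 :* (P :* P :* P))) (Z₃ :* (Y :* Y)) (p m ∷ y ∷ [])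
        (sq Y ⊗ (sq (lit 1 :- Y) ⊗ (nat 1 ⊕ ge0 Y y≥0) ⊕ nat 4 ⊗ sq Y)
         ⊕ eqn (P :* Z) Y p-def (con (negsuc 3) :* (P :* P :* Z :* Z :+ P :* Z :* Y :+ Y :* Y))) refl)
        where P = var 0F ; Y = var 1F ; Z = lit 1 :+ Y ; Z₃ = Z :* Z :* Z

  -- The hypotheses are what the saddle point will provide: Nt² is at most about 1, and cutting the
  -- sums at N costs less than 1/400 on the scale t⁻³.
  module Sums (t : F) (t>0 : 0# < t) (360t≤1 : ⟪ pos 360 ⟫ * t ≤ 1#) (N : ℕ)
    (Nt²≤ : # N * (t * t) ≤ 1# + ⟪ pos 2 ⟫ * (t * t))
    (tail : ⟪ pos 400 ⟫ * ((1# - t) ^ N * (# N * # N * (t * t) + ⟪ pos 2 ⟫ * (# N * t) + ⟪ pos 2 ⟫)) ≤ 1#) where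

    t≥0 : 0# ≤ t
    t≥0 = <⇒≤ t>0
    t≤1 : t ≤ 1#
    t≤1 = prove (var 0F) (lit 1) (t ∷ []) (le (lit 360 :* var 0F) (lit 1) 360t≤1 ⊕ nat 359 ⊗ ge0 (var 0F) t≥0) refl
    t² : ⟪ pos 129600 ⟫ * (t * t) ≤ 1#
    t² = prove (lit 129600 :* (T :* T)) (lit 1) (t ∷ []) (le (lit 360 :* T) (lit 1) 360t≤1 ⊗ (nat 1 ⊕ nat 360 ⊗ ge0 T t≥0)) refl
      where T = var 0F
    Nt³≤ : ⟪ pos 359 ⟫ * (# N * t ^ 3) ≤ 1#
    Nt³≤ = *-cancel-≤ (⟪⟫>0 64799) (prove (lit 64800 :* (lit 359 :* (n :* T :^ 3))) (lit 64800 :* lit 1) (t ∷ # N ∷ [])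
        (nat (359 ℕ.* 64800) ⊗ (ge0 T t≥0 ⊗ le (n :* (T :* T)) (lit 1 :+ lit 2 :* (T :* T)) Nt²≤)
         ⊕ nat 359 ⊗ (ge0 T t≥0 ⊗ le (lit 129600 :* (T :* T)) (lit 1) t²)
         ⊕ nat 64800 ⊗ le (lit 360 :* T) (lit 1) 360t≤1 ⊕ nat 64441 ⊗ ge0 T t≥0) refl)
      where T = var 0F ; n = var 1F
    ρ = 1# - t
    ρ≥0 : 0# ≤ ρ
    ρ≥0 = sub≥0 t≤1
    ρ≤1 : ρ ≤ 1#
    ρ≤1 = prove (lit 1 :- var 0F) (lit 1) (t ∷ []) (ge0 (var 0F) t≥0) refl
    open Probability ρ ρ≥0 ρ≤1 public

    private
      x₂ x₃ x₄ : F
      x₂ = ρ * ρ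
      x₃ = ρ * (ρ * ρ)
      x₄ = x₂ * x₂
      1-ρ : 1# - ρ ≡ t
      1-ρ = ring (lit 1 :- (lit 1 :- var 0F)) (var 0F) (t ∷ []) refl
      x₂≥0 = *≥0 ρ≥0 ρ≥0
      x₃≥0 = *≥0 ρ≥0 x₂≥0
      x₄≥0 = *≥0 x₂≥0 x₂≥0
      x₂≤1 = pow≤1′
        where
        pow≤1′ : x₂ ≤ 1#
        pow≤1′ = subst (_≤ 1#) (cong (ρ *_) (*1 ρ)) (pow≤1 ρ≥0 ρ≤1 2)
      x₃≤1 : x₃ ≤ 1#
      x₃≤1 = subst (_≤ 1#) (cong (λ z → ρ * (ρ * z)) (*1 ρ)) (pow≤1 ρ≥0 ρ≤1 3)
      x₄≤1 : x₄ ≤ 1#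
      x₄≤1 = subst (_≤ 1#) (trans (cong (λ z → ρ * (ρ * (ρ * z))) (*1 ρ)) (sym (*-assoc ρ ρ (ρ * ρ)))) (pow≤1 ρ≥0 ρ≤1 4)
      module G₁ = Geometric ρ ρ≥0 ρ≤1
      module G₂ = Geometric x₂ x₂≥0 x₂≤1
      module G₃ = Geometric x₃ x₃≥0 x₃≤1
      module G₄ = Geometric x₄ x₄≥0 x₄≤1
      x₂^ : ∀ m → x₂ ^ m ≡ ρ ^ m * ρ ^ m
      x₂^ m = ^-distrib-* ρ ρ m
      x₃^ : ∀ m → x₃ ^ m ≡ ρ ^ m * (ρ ^ m * ρ ^ m)
      x₃^ m = trans (^-distrib-* ρ x₂ m) (cong (ρ ^ m *_) (x₂^ m))
      x₄^ : ∀ m → x₄ ^ m ≡ ρ ^ m * ρ ^ m * (ρ ^ m * ρ ^ m)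
      x₄^ m = trans (^-distrib-* x₂ x₂ m) (cong₂ _*_ (x₂^ m) (x₂^ m))

    ρ^N-small : ⟪ pos 800 ⟫ * ρ ^ N ≤ 1#
    ρ^N-small = ≤-trans (prove (lit 800 :* w) (lit 400 :* (w :* (n :* n :* (T :* T) :+ lit 2 :* (n :* T) :+ lit 2))) (ρ ^ N ∷ # N ∷ t ∷ [])
        (nat 400 ⊗ (ge0 w (^≥0 ρ≥0 N) ⊗ (sq (n :* T) ⊕ nat 2 ⊗ (ge0 n (⟪⟫≥0 N) ⊗ ge0 T t≥0)))) refl) tail
      where w = var 0F ; n = var 1F ; T = var 2F

    vm² κ₃ : ℕ → F
    vm² m = v m * (# m * # m)

    S₁ : (ℕ → F) → F
    S₁ f = Σ₁ (λ m → f m * ρ ^ m) N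
    m² m³ m⁴ : ℕ → F
    m² m = # m * # m
    m³ m = # m * # m * # m
    m⁴ m = # m * # m * (# m * # m)
    κ₃ m = p m * m³ m

    V V₄ : F
    V = Σ₁ vm² N
    V₄ = Σ₁ (λ m → v m * m⁴ m) N

    private
      Σρ≤ : ∀ (f g h : ℕ → F) B d → d ≡ t → ∀ k → d ^ k * Σ₁ h N ≤ B → (∀ m → 0# ≤ f m * g m) → (∀ m → f m * g m ≤ h m) → t ^ k * Σ₁ (λ m → f m * g m) N ≤ B
      Σρ≤ f g h B d refl k b _ q = ≤-trans (prove (var 0F :* var 1F) (var 0F :* var 2F) (t ^ k ∷ Σ₁ (λ m → f m * g m) N ∷ Σ₁ h N ∷ [])
        (ge0 (var 0F) (^≥0 t≥0 k) ⊗ le (var 1F) (var 2F) (Σ₁≤ (λ m → f m * g m) h N (λ j → q (suc j)))) refl) b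
      mul≤ : ∀ {a b c} → 0# ≤ c → a ≤ b → a * c ≤ c * b
      mul≤ {a} {b} {c} p q = prove (var 0F :* var 2F) (var 2F :* var 1F) (a ∷ b ∷ c ∷ []) (ge0 (var 2F) p ⊗ le (var 0F) (var 1F) q) refl
      m³≥0 : ∀ m → 0# ≤ m³ m
      m³≥0 m = *≥0 (sq≥0 (# m)) (⟪⟫≥0 m)

    V≤ : t ^ 3 * V ≤ ⟪ pos 2 ⟫
    V≤ = Σρ≤ v m² (λ m → m² m * ρ ^ m) _ _ 1-ρ 3 (G₁.Σm²≤ N) (λ m → *≥0 (v≥0 m) (sq≥0 (# m))) (λ m → mul≤ (sq≥0 (# m)) (v≤y m))
    V₄≤ : t ^ 5 * V₄ ≤ ⟪ pos 24 ⟫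
    V₄≤ = Σρ≤ v m⁴ (λ m → m⁴ m * ρ ^ m) _ _ 1-ρ 5 (G₁.Σm⁴≤ N) (λ m → *≥0 (v≥0 m) (sq≥0 (m² m))) (λ m → mul≤ (sq≥0 (m² m)) (v≤y m))
    Σκ₃≤ : t ^ 4 * Σ₁ κ₃ N ≤ ⟪ pos 6 ⟫
    Σκ₃≤ = Σρ≤ p m³ (λ m → m³ m * ρ ^ m) _ _ 1-ρ 4 (G₁.Σm³≤ N) (λ m → *≥0 (p≥0 m) (m³≥0 m)) (λ m → mul≤ (m³≥0 m) (p≤y m))

    private
      Σp³m³ = Σ₁ (λ m → p m * p m * p m * m³ m) N
    -- Σ m³ρ^(2m) is about 6/(2t)⁴, and a quarter of it is 0.09375/t⁴; the bound allows 0.0945/t⁴.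
    Σp³m³≤ : ⟪ pos 4000 ⟫ * (t ^ 4 * Σp³m³) ≤ ⟪ pos 378 ⟫
    Σp³m³≤ = ≤-trans (prove (lit 4000 :* (T :* a)) (lit 1000 :* (T :* b)) (t ^ 4 ∷ Σp³m³ ∷ Σ₁ (λ m → m³ m * x₂ ^ m) N ∷ [])
          (nat 1000 ⊗ (ge0 T (^≥0 t≥0 4) ⊗ le (lit 4 :* a) b
            (≤-trans (≤-reflexive (sym (Σ₁-* ⟪ pos 4 ⟫ (λ m → p m * p m * p m * m³ m) N))) (Σ₁≤ (λ m → ⟪ pos 4 ⟫ * (p m * p m * p m * m³ m)) (λ m → m³ m * x₂ ^ m) N (λ k → pointwise (suc k)))))) refl)
        (*-cancel-≤ (⟪⟫>0 158) (prove (lit 159 :* (lit 1000 :* ((u :^ 4) :* b′))) (lit 159 :* lit 378) (t ∷ Σ₁ (λ m → m³ m * x₂ ^ m) N ∷ [])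
          (nat 10000 ⊗ le ((lit 1 :- (lit 1 :- u) :* (lit 1 :- u)) :^ 4 :* b′) (lit 6) (G₂.Σm³≤ N)
            ⊕ nat 102
            ⊕ posE (t≥0 ∷ b≥0 ∷ []) (u :^ 4 :* b′ :* (lit 40000 :* u :+ lit 160000 :* u :^ 2 :+ lit 10000 :* u :^ 4)) refl
            ⊕ posE (t≥0 ∷ b≥0 ∷ []) (lit 80000 :* u :^ 6 :* b′) refl ⊗ le u (lit 1) t≤1
            ⊕ nat 1000 ⊗ (posE (t≥0 ∷ b≥0 ∷ []) (u :^ 4 :* b′) refl ⊗ le (lit 360 :* u) (lit 1) 360t≤1)) refl))
      where
      T = var 0F ; a = var 1F ; b = var 2F ; u = var 0F ; b′ = var 1F
      b≥0 : 0# ≤ Σ₁ (λ m → m³ m * x₂ ^ m) N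
      b≥0 = Σ₁≥0 (λ k → *≥0 (m³≥0 (suc k)) (^≥0 x₂≥0 (suc k))) N
      pointwise : ∀ m → ⟪ pos 4 ⟫ * (p m * p m * p m * m³ m) ≤ m³ m * x₂ ^ m
      pointwise m = subst (λ z → ⟪ pos 4 ⟫ * (p m * p m * p m * m³ m) ≤ m³ m * z) (sym (x₂^ m))
        (prove (lit 4 :* (P :* M)) (M :* Y) (p m * p m * p m ∷ m³ m ∷ ρ ^ m * ρ ^ m ∷ []) (ge0 M (m³≥0 m) ⊗ le (lit 4 :* P) Y (4p³≤y² m)) refl)
        where P = var 0F ; M = var 1F ; Y = var 2F

    private
      s₁ s₂ s₃ s₄ : F
      s₁ = S₁ m²
      s₂ = Σ₁ (λ m → m² m * x₂ ^ m) N
      s₃ = Σ₁ (λ m → m² m * x₃ ^ m) N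
      s₄ = Σ₁ (λ m → m² m * x₄ ^ m) N
      w n : F
      w = ρ ^ N
      n = # N
      w≥0 = ^≥0 ρ≥0 N
      s≥0 : ∀ x → 0# ≤ x → 0# ≤ Σ₁ (λ m → m² m * x ^ m) N
      s≥0 x x≥0 = Σ₁≥0 (λ k → *≥0 (sq≥0 (# (suc k))) (^≥0 x≥0 (suc k))) N

      s₁≥ : ⟪ pos 400 ⟫ * (⟪ pos 2 ⟫ - ⟪ pos 3 ⟫ * t) - 1# ≤ ⟪ pos 400 ⟫ * (t ^ 3 * s₁)
      s₁≥ = prove (lit 400 :* (lit 2 :- lit 3 :* T) :- lit 1) (lit 400 :* (T :^ 3 :* s)) (t ∷ s₁ ∷ w ∷ n ∷ [])
        (eqn (D :^ 3 :* s :+ x :* y :* B) (x :* (lit 1 :+ x)) (G₁.Σm²≡ N) (lit 400)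
         ⊕ le (lit 400 :* (y :* (m :* m :* (T :* T) :+ lit 2 :* (m :* T) :+ lit 2))) (lit 1) tail
         ⊕ nat 400 ⊗ (ge0 T t≥0 ⊗ (ge0 y w≥0 ⊗ B′)) ⊕ nat 400 ⊗ (sq T) ⊕ nat 400 ⊗ (ge0 T t≥0 ⊗ ge0 y w≥0)) refl
        where
        T = var 0F ; s = var 1F ; y = var 2F ; m = var 3F ; x = lit 1 :- T ; D = lit 1 :- x
        B = m :* m :* (D :* D) :+ lit 2 :* (m :* D) :+ lit 1 :+ x
        B′ : Nn (t ∷ s₁ ∷ w ∷ n ∷ [])
        B′ = sq (m :* T) ⊕ nat 2 ⊗ (ge0 m (⟪⟫≥0 N) ⊗ ge0 T t≥0) ⊕ nat 1 ⊕ ge0 x ρ≥0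

      -- 1 - ρ² = t(1 + ρ), so multiplying by (1 + ρ)³ produces the form of `Σm²≤′` at ρ².
      s₂≤ : ⟪ pos 4 ⟫ * (t ^ 3 * s₂) ≤ 1#
      s₂≤ = *-cancel-≤ {x = (1# + ρ) ^ 3} (<-≤-trans (⟪⟫>0 0) (prove⁺ (lit 1) ((lit 1 :+ var 0F) :^ 3) (ρ≥0 ∷ []) refl))
        (prove ((lit 1 :+ x) :^ 3 :* (lit 4 :* (T :^ 3 :* s))) ((lit 1 :+ x) :^ 3 :* lit 1) (t ∷ s₂ ∷ [])
          (nat 4 ⊗ le (D :^ 3 :* s) (x :* x :* (lit 1 :+ x :* x)) (G₂.Σm²≤′ N)
           ⊕ (X₊ ⊕ nat 1) ⊗ sq T
           ⊕ nat 4 ⊗ (ge0 T t≥0 ⊗ X₊ ⊗ (sq x ⊕ X₊ ⊕ nat 1))) refl)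
        where
        T = var 0F ; s = var 1F ; x = lit 1 :- T ; D = lit 1 :- x :* x
        X₊ = ge0 {ρ = t ∷ s₂ ∷ []} x ρ≥0

      1-x₃≤ : 1# - x₃ ≤ ⟪ pos 3 ⟫ * t
      1-x₃≤ = prove (lit 1 :- x :* (x :* x)) (lit 3 :* T) (t ∷ []) (sq T ⊗ (le T (lit 1) t≤1 ⊕ nat 2)) refl
        where T = var 0F ; x = lit 1 :- T

      s₃≥ : ⟪ pos 400 ⟫ * (⟪ pos 2 ⟫ - ⟪ pos 9 ⟫ * t) - ⟪ pos 9 ⟫ ≤ ⟪ pos 10800 ⟫ * (t ^ 3 * s₃)
      s₃≥ = prove (lit 400 :* (lit 2 :- lit 9 :* T) :- lit 9) (lit 10800 :* (T :^ 3 :* s)) (t ∷ s₃ ∷ w ∷ n ∷ x₃ ∷ x₃ ^ N ∷ [])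
        (nat 400 ⊗ (ge0 s (s≥0 x₃ x₃≥0) ⊗ (le D (lit 3 :* T) 1-x₃≤ ⊗ (nat 9 ⊗ sq T ⊕ nat 3 ⊗ (ge0 T t≥0 ⊗ ge0 D D≥0) ⊕ sq D)))
         ⊕ eqn (D :^ 3 :* s :+ z :* w₃ :* B) (z :* (lit 1 :+ z)) (G₃.Σm²≡ N) (lit 400)
         ⊕ nat 1200 ⊗ le D (lit 3 :* T) 1-x₃≤ ⊕ nat 400 ⊗ sq D
         ⊕ nat 9 ⊗ le (lit 400 :* (y :* B₁)) (lit 1) tail
         ⊕ nat 400 ⊗ le (z :* w₃) y zw₃≤ ⊗ B₊
         ⊕ nat 400 ⊗ (ge0 y w≥0 ⊗ (sq m ⊗ (le D (lit 3 :* T) 1-x₃≤ ⊗ (nat 3 ⊗ ge0 T t≥0 ⊕ ge0 D D≥0)) ⊕ nat 2 ⊗ (ge0 m (⟪⟫≥0 N) ⊗ le D (lit 3 :* T) 1-x₃≤) ⊕ nat 12 ⊗ (ge0 m (⟪⟫≥0 N) ⊗ ge0 T t≥0) ⊕ le z (lit 1) x₃≤1 ⊕ nat 16))) refl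
        where
        T = var 0F ; s = var 1F ; y = var 2F ; m = var 3F ; z = var 4F ; w₃ = var 5F ; D = lit 1 :- z
        B = m :* m :* (D :* D) :+ lit 2 :* (m :* D) :+ lit 1 :+ z
        B₁ = m :* m :* (T :* T) :+ lit 2 :* (m :* T) :+ lit 2
        D≥0 = sub≥0 x₃≤1
        B₊ : Nn (t ∷ s₃ ∷ w ∷ n ∷ x₃ ∷ x₃ ^ N ∷ [])
        B₊ = sq (m :* D) ⊕ nat 2 ⊗ (ge0 m (⟪⟫≥0 N) ⊗ ge0 D D≥0) ⊕ nat 1 ⊕ ge0 z x₃≥0
        zw₃≤ : x₃ * x₃ ^ N ≤ w
        zw₃≤ = subst (λ u → x₃ * u ≤ w) (sym (x₃^ N)) (prove (Z :* (W :* (W :* W))) W (x₃ ∷ w ∷ [])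
          (ge0 W w≥0 ⊗ (le Z (lit 1) x₃≤1 ⊗ sq W ⊕ le W (lit 1) (y≤1 N) ⊗ (ge0 W w≥0 ⊕ nat 1))) refl)
          where Z = var 0F ; W = var 1F

      s₄≤ : ⟪ pos 32 ⟫ * (t ^ 3 * s₄) ≤ 1#
      s₄≤ = *-cancel-≤ {x = (1# + ρ) ^ 3 * (1# + ρ * ρ) ^ 3} (*>0 (<-≤-trans (⟪⟫>0 0) (prove⁺ (lit 1) ((lit 1 :+ var 0F) :^ 3) (ρ≥0 ∷ []) refl)) (<-≤-trans (⟪⟫>0 0) (prove⁺ (lit 1) ((lit 1 :+ var 0F :* var 0F) :^ 3) (ρ≥0 ∷ []) refl)))
        (prove (Q :* (lit 32 :* (T :^ 3 :* s))) (Q :* lit 1) (t ∷ s₄ ∷ [])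
          (nat 32 ⊗ le (D :^ 3 :* s) (x :^ 2 :* x :^ 2 :* (lit 1 :+ x :^ 2 :* x :^ 2)) (subst₂ _≤_ (cong (λ u → (1# - u * u) ^ 3 * s₄) (cong (ρ *_) (sym (*1 ρ)))) (cong (λ u → u * u * (1# + u * u)) (cong (ρ *_) (sym (*1 ρ)))) (G₄.Σm²≤′ N))
           ⊕ ((X₊ ⊕ nat 1) ⊗ sq T ⊕ nat 4 ⊗ (X₊ ⊗ ge0 T t≥0)) ⊗ ge0 ((lit 1 :+ x :* x) :^ 3) (^≥0 (+≥0 (⟪⟫≥0 1) x₂≥0) 3)
           ⊕ nat 8 ⊗ (sq x ⊗ (ge0 T t≥0 ⊗ ((X₊ ⊕ nat 1) ⊗ (nat 1 ⊕ nat 3 ⊗ sq (x :* x)))))) refl)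
        where
        T = var 0F ; s = var 1F ; x = lit 1 :- T ; D = lit 1 :- x :^ 2 :* x :^ 2
        Q = (lit 1 :+ x) :^ 3 :* (lit 1 :+ x :* x) :^ 3
        X₊ = ge0 {ρ = t ∷ s₄ ∷ []} x ρ≥0

      4V≥ : ⟪ pos 4 ⟫ * s₁ - ⟪ pos 8 ⟫ * s₂ + ⟪ pos 8 ⟫ * s₃ - ⟪ pos 3 ⟫ * s₄ ≤ ⟪ pos 4 ⟫ * V
      4V≥ = ≤-trans (≤-reflexive (sym linear)) (≤-trans (Σ₁≤ combination (λ m → ⟪ pos 4 ⟫ * vm² m) N (λ k → pointwise (suc k))) (≤-reflexive (Σ₁-* ⟪ pos 4 ⟫ vm² N)))
        where
        f₁ f₂ f₃ f₄ combination : ℕ → F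
        f₁ m = m² m * ρ ^ m
        f₂ m = m² m * x₂ ^ m
        f₃ m = m² m * x₃ ^ m
        f₄ m = m² m * x₄ ^ m
        combination m = ⟪ pos 4 ⟫ * f₁ m + ⟪ negsuc 7 ⟫ * f₂ m + (⟪ pos 8 ⟫ * f₃ m + ⟪ negsuc 2 ⟫ * f₄ m)
        linear : Σ₁ combination N ≡ ⟪ pos 4 ⟫ * s₁ - ⟪ pos 8 ⟫ * s₂ + ⟪ pos 8 ⟫ * s₃ - ⟪ pos 3 ⟫ * s₄
        linear = trans (Σ₁-+ (λ m → ⟪ pos 4 ⟫ * f₁ m + ⟪ negsuc 7 ⟫ * f₂ m) (λ m → ⟪ pos 8 ⟫ * f₃ m + ⟪ negsuc 2 ⟫ * f₄ m) N)
          (trans (cong₂ _+_ (trans (Σ₁-+ (λ m → ⟪ pos 4 ⟫ * f₁ m) (λ m → ⟪ negsuc 7 ⟫ * f₂ m) N) (cong₂ _+_ (Σ₁-* _ f₁ N) (Σ₁-* _ f₂ N)))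
                           (trans (Σ₁-+ (λ m → ⟪ pos 8 ⟫ * f₃ m) (λ m → ⟪ negsuc 2 ⟫ * f₄ m) N) (cong₂ _+_ (Σ₁-* _ f₃ N) (Σ₁-* _ f₄ N))))
            (ring (lit 4 :* a :+ con (negsuc 7) :* b :+ (lit 8 :* c :+ con (negsuc 2) :* d)) (lit 4 :* a :- lit 8 :* b :+ lit 8 :* c :- lit 3 :* d) (s₁ ∷ s₂ ∷ s₃ ∷ s₄ ∷ []) refl))
          where a = var 0F ; b = var 1F ; c = var 2F ; d = var 3F
        pointwise : ∀ m → combination m ≤ ⟪ pos 4 ⟫ * vm² m
        pointwise m = subst₂ (λ a b → ⟪ pos 4 ⟫ * f₁ m + ⟪ negsuc 7 ⟫ * (m² m * a) + b ≤ ⟪ pos 4 ⟫ * vm² m) (sym (x₂^ m)) (cong₂ (λ a b → ⟪ pos 8 ⟫ * (m² m * a) + ⟪ negsuc 2 ⟫ * (m² m * b)) (sym (x₃^ m)) (sym (x₄^ m)))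
          (prove (lit 4 :* (M :* Y) :+ con (negsuc 7) :* (M :* (Y :* Y)) :+ (lit 8 :* (M :* (Y :* (Y :* Y))) :+ con (negsuc 2) :* (M :* (Y :* Y :* (Y :* Y))))) (lit 4 :* (v′ :* M)) (v m ∷ m² m ∷ ρ ^ m ∷ [])
            (ge0 M (sq≥0 (# m)) ⊗ le (Y :* lit 4 :- lit 8 :* (Y :* Y) :+ lit 8 :* (Y :* (Y :* Y)) :- lit 3 :* (Y :* Y :* (Y :* Y))) (lit 4 :* v′) (v≥quartic m)) refl)
          where v′ = var 0F ; M = var 1F ; Y = var 2F

    -- From v ≥ y - 2y² + 2y³ - (3/4)y⁴ the sums at ρ, ρ², ρ³, ρ⁴ contribute 2 - 1/2 + 4/27 - 3/128,
    -- about 1.625, as t → 0 (the true limit is π²/6). What exceeds 1.6 pays for t ≤ 1/360 and for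
    -- the truncation.
    V≥ : ⟪ pos 8 ⟫ ≤ ⟪ pos 5 ⟫ * (t ^ 3 * V)
    V≥ = *-cancel-≤ (⟪⟫>0 34559) (prove (lit 34560 :* lit 8) (lit 34560 :* (lit 5 :* (T₃ :* V′))) (t ∷ t ^ 3 ∷ V ∷ s₁ ∷ s₂ ∷ s₃ ∷ s₄ ∷ [])
      (nat 43200 ⊗ (ge0 T₃ (^≥0 t≥0 3) ⊗ le (lit 4 :* a :- lit 8 :* b :+ lit 8 :* c :- lit 3 :* d) (lit 4 :* V′) 4V≥)
       ⊕ nat 432 ⊗ le (lit 400 :* (lit 2 :- lit 3 :* T) :- lit 1) (lit 400 :* (T₃ :* a)) s₁≥
       ⊕ nat 86400 ⊗ le (lit 4 :* (T₃ :* b)) (lit 1) s₂≤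
       ⊕ nat 32 ⊗ le (lit 400 :* (lit 2 :- lit 9 :* T) :- lit 9) (lit 10800 :* (T₃ :* c)) s₃≥
       ⊕ nat 4050 ⊗ le (lit 32 :* (T₃ :* d)) (lit 1) s₄≤
       ⊕ nat 1760 ⊗ le (lit 360 :* T) (lit 1) 360t≤1 ⊕ nat 1790) refl)
      where T = var 0F ; T₃ = var 1F ; V′ = var 2F ; a = var 3F ; b = var 4F ; c = var 5F ; d = var 6F

-- Floors and the rounding of partial means

module Rounding where
  open Inequalities
  open PowersOfUnit
  open PairProducts
  open RotatedProduct using (sumℕ; #-+)
  open import Data.Nat.Base as ℕ using (ℕ; suc; zero)
  import Data.Nat.Properties as ℕP
  import Data.Integer.Base as ℤ
  open import Data.Sum.Base using (_⊎_; inj₁; inj₂)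
  open import Data.Product.Base using (∃; _×_; _,_; proj₁; proj₂)
  open import Relation.Nullary.Decidable.Core using (yes; no)

  #-mono : ∀ {j k} → j ℕ.≤ k → # j ≤ # k
  #-mono p = ⟪⟫-≤ (ℤ.+≤+ p)

  #-mono⁻ : ∀ {j k} → # j ≤ # k → j ℕ.≤ k
  #-mono⁻ p with ⟪⟫-≤⁻ p
  ... | ℤ.+≤+ q = q

  floor : ∀ x → 0# ≤ x → ∃ λ k → # k ≤ x × x ≤ # k + 1# × x < # k + 1#
  floor x x≥0 = go (proj₁ (archimedean x)) (≤-<-trans (proj₂ (archimedean x)) (λ p → ℕP.<-irrefl refl (#-mono⁻ (subst (_≤ # k) (trans (+-comm (# k) 1#) (sym (#-suc k))) p))))
    where
    k = proj₁ (archimedean x)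
    go : ∀ k → x < # k + 1# → ∃ λ k → # k ≤ x × x ≤ # k + 1# × x < # k + 1#
    go zero p = zero , x≥0 , <⇒≤ p , p
    go (suc k) p with # (suc k) ≤? x
    ... | yes q = suc k , q , <⇒≤ p , p
    ... | no q = go k (subst (x <_) (trans (#-suc k) (+-comm 1# (# k))) q)

  -- The value is 0 on negative numbers, whence the alternative in `⌊⌋≡0⊎≤`.
  ⌊_⌋ : F → ℕ
  ⌊ x ⌋ with 0# ≤? x
  ... | yes p = proj₁ (floor x p)
  ... | no _ = 0

  ⌊⌋≡0⊎≤ : ∀ x → ⌊ x ⌋ ≡ 0 ⊎ # ⌊ x ⌋ ≤ x
  ⌊⌋≡0⊎≤ x with 0# ≤? x
  ... | yes p = inj₂ (proj₁ (proj₂ (floor x p)))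
  ... | no _ = inj₁ refl

  ⌊⌋≤ : ∀ {x} → 0# ≤ x → # ⌊ x ⌋ ≤ x
  ⌊⌋≤ {x} p with ⌊⌋≡0⊎≤ x
  ... | inj₁ e = subst (λ k → # k ≤ x) (sym e) p
  ... | inj₂ q = q

  <⌊⌋+1 : ∀ x → x < # ⌊ x ⌋ + 1#
  <⌊⌋+1 x with 0# ≤? x
  ... | yes p = proj₂ (proj₂ (proj₂ (floor x p)))
  ... | no q = <-≤-trans q (prove⁺ (lit 0) (lit 0 :+ lit 1) [] refl)

  ≤⌊⌋+1 : ∀ x → x ≤ # ⌊ x ⌋ + 1#
  ≤⌊⌋+1 x = <⇒≤ (<⌊⌋+1 x)

  ⌊⌋-unique : ∀ {x} k → # k ≤ x → x < # (suc k) → ⌊ x ⌋ ≡ k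
  ⌊⌋-unique {x} k p q = ℕP.≤-antisym
    (ℕP.≤-pred (ℕP.≰⇒> (λ r → q (≤-trans (#-mono r) (⌊⌋≤ (≤-trans (⟪⟫≥0 k) p))))))
    (ℕP.≤-pred (ℕP.≰⇒> (λ r → <⌊⌋+1 x (≤-trans (≤-reflexive (trans (+-comm _ 1#) (sym (#-suc ⌊ x ⌋)))) (≤-trans (#-mono r) p)))))

  ⌊⌋-mono : ∀ {x y} → 0# ≤ x → x ≤ y → ⌊ x ⌋ ℕ.≤ ⌊ y ⌋
  ⌊⌋-mono {x} {y} p q = ℕP.≤-pred (ℕP.≰⇒> (λ r → <⌊⌋+1 y (≤-trans (≤-reflexive (trans (+-comm _ 1#) (sym (#-suc ⌊ y ⌋)))) (≤-trans (#-mono r) (≤-trans (⌊⌋≤ p) q)))))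

  -- Cumulative rounding: the increments of ⌊M⌋ sum to a floor again, and the error δ stays in
  -- [0, 1] however many terms there are. Rounding each term separately would let it grow.
  module Greedy (f : ℕ → F) (f≥0 : ∀ k → 0# ≤ f (suc k)) (2f≤ : ∀ k → ⟪ pos 2 ⟫ * f (suc k) ≤ # (suc k)) where
    M : ℕ → F
    M = Σ₁ f
    e : ℕ → ℕ
    e zero = 0
    e (suc k) = ⌊ M (suc k) ⌋ ℕ.∸ ⌊ M k ⌋
    δ : ℕ → F
    δ k = M k - # ⌊ M k ⌋

    private
      M≥0 : ∀ k → 0# ≤ M k
      M≥0 = Σ₁≥0 f≥0
      step : ∀ k → ⌊ M k ⌋ ℕ.≤ ⌊ M (suc k) ⌋
      step k = ⌊⌋-mono (M≥0 k) (prove (var 0F) (var 0F :+ var 1F) (M k ∷ f (suc k) ∷ []) (ge0 (var 1F) (f≥0 k)) refl)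
      ⌊M0⌋ : ⌊ M 0 ⌋ ≡ 0
      ⌊M0⌋ = ⌊⌋-unique 0 ≤-refl (⟪⟫>0 0)
      #e : ∀ k → # ⌊ M k ⌋ + # (e (suc k)) ≡ # ⌊ M (suc k) ⌋
      #e k = trans (sym (#-+ ⌊ M k ⌋ (e (suc k)))) (cong # (ℕP.m+[n∸m]≡n (step k)))

    sum-e : ∀ k → sumℕ e k ≡ ⌊ M k ⌋
    sum-e zero = sym ⌊M0⌋
    sum-e (suc k) = trans (cong (ℕ._+ e (suc k)) (sum-e k)) (ℕP.m+[n∸m]≡n (step k))

    δ0 : δ 0 ≡ 0#
    δ0 = trans (cong (λ k → 0# - # k) ⌊M0⌋) (+-inv 0#)
    δ≥0 : ∀ k → 0# ≤ δ k
    δ≥0 k = sub≥0 (⌊⌋≤ (M≥0 k))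
    δ≤1 : ∀ k → δ k ≤ 1#
    δ≤1 k = prove (var 0F :- var 1F) (lit 1) (M k ∷ # ⌊ M k ⌋ ∷ []) (le (var 0F) (var 1F :+ lit 1) (≤⌊⌋+1 (M k))) refl
    δ-step : ∀ k → δ (suc k) ≡ δ k + f (suc k) - # (e (suc k))
    δ-step k = prove= (m :+ g :- x) (m :- y :+ g :- z) (M k ∷ f (suc k) ∷ # ⌊ M (suc k) ⌋ ∷ # ⌊ M k ⌋ ∷ # (e (suc k)) ∷ []) (by= (y :+ z) x (#e k) (lit 1)) refl
      where m = var 0F ; g = var 1F ; x = var 2F ; y = var 3F ; z = var 4F
    e≤f+1 : ∀ k → # (e (suc k)) ≤ f (suc k) + 1#
    e≤f+1 k = prove E (g :+ lit 1) (# (e (suc k)) ∷ f (suc k) ∷ δ k ∷ δ (suc k) ∷ [])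
      (ge0 d′ (δ≥0 (suc k)) ⊕ le d (lit 1) (δ≤1 k) ⊕ eqn d′ (d :+ g :- E) (δ-step k) (con (negsuc 0))) refl
      where E = var 0F ; g = var 1F ; d = var 2F ; d′ = var 3F
    -- e ≤ f + 1 ≤ m/2 + 1 < m + 1 for m ≥ 1.
    e≤m : ∀ m → e m ℕ.≤ m
    e≤m zero = ℕ.z≤n
    e≤m (suc k) = ℕP.≮⇒≥ (λ q → ⟪⟫>0 0 (prove (lit 1) (lit 0) (# (e (suc k)) ∷ f (suc k) ∷ # (suc k) ∷ # k ∷ [])
        (nat 2 ⊗ le E (g :+ lit 1) (e≤f+1 k) ⊕ le (lit 2 :* g) m (2f≤ k) ⊕ nat 2 ⊗ le (lit 1 :+ m) E (subst (_≤ # (e (suc k))) (#-suc (suc k)) (#-mono q))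
         ⊕ ge0 l (⟪⟫≥0 k) ⊕ eqn m (lit 1 :+ l) (#-suc k) (lit 1)) refl))
      where E = var 0F ; g = var 1F ; m = var 2F ; l = var 3F

-- Numerical data of the central arc

module CentralArcs where
  open Inequalities
  open PowersOfUnit
  open PairProducts
  open RotatedProduct using (sumℕ; #-+)
  open PowerSums
  open TiltedSums
  open Rounding
  open import Data.Nat.Base as ℕ using (ℕ; suc; zero)

  #-sumℕ : ∀ f N → # (sumℕ f N) ≡ Σ₁ (λ m → # (f m)) N
  #-sumℕ f zero = refl
  #-sumℕ f (suc N) = trans (#-+ (sumℕ f N) (f (suc N))) (cong (_+ # (f (suc N))) (#-sumℕ f N))

  -- A rational form of ∏ (1 + x) ≤ 1/(1 - Σ x), from (1 + y)(1 - s - y) ≤ 1 - s.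
  Π₁-1+ : ∀ (x : ℕ → F) → (∀ k → 0# ≤ x (suc k)) → ∀ N → Π₁ (λ m → 1# + x m) N * (1# - Σ₁ x N) ≤ 1#
  Π₁-1+ x x≥0 zero = prove (lit 1 :* (lit 1 :- lit 0)) (lit 1) [] (nat 0) refl
  Π₁-1+ x x≥0 (suc N) = ≤-trans (prove (P :* (lit 1 :+ y) :* (lit 1 :- (s :+ y))) (P :* (lit 1 :- s)) (Π₁ (λ m → 1# + x m) N ∷ x (suc N) ∷ Σ₁ x N ∷ [])
      (ge0 P (Π₁≥0 (λ k → +≥0 (⟪⟫≥0 1) (x≥0 k)) N) ⊗ (ge0 y (x≥0 N) ⊗ (ge0 s (Σ₁≥0 x≥0 N) ⊕ ge0 y (x≥0 N)))) refl) (Π₁-1+ x x≥0 N)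
    where P = var 0F ; y = var 1F ; s = var 2F

  reciprocal : ∀ k → # (suc k) * inv (# (suc k)) ≡ 1#
  reciprocal k = inv-eq (⟪⟫>0 k)

  module CentralArc (t : F) (t>0 : 0# < t) (360t≤1 : ⟪ pos 360 ⟫ * t ≤ 1#) (N : ℕ)
    (Nt²≤ : # N * (t * t) ≤ 1# + ⟪ pos 2 ⟫ * (t * t))
    (tail : ⟪ pos 400 ⟫ * ((1# - t) ^ N * (# N * # N * (t * t) + ⟪ pos 2 ⟫ * (# N * t) + ⟪ pos 2 ⟫)) ≤ 1#)
    (e : ℕ → ℕ) (e≤ : ∀ k → # (e (suc k)) ≤ # (suc k) * Sums.p t t>0 360t≤1 N Nt²≤ tail (suc k) + 1#) where

    open Sums t t>0 360t≤1 N Nt²≤ tail public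

    κ₆ : ℕ → F
    κ₆ m = p m * (# m * # m * # m) + # (e m) * # (e m) * # (e m)

    V>0 : 0# < V
    V>0 V≤0 = ⟪⟫>0 7 (≤-trans V≥ (prove (lit 5 :* (T :* v′)) (lit 0) (t ^ 3 ∷ V ∷ []) (nat 5 ⊗ (ge0 T (^≥0 t≥0 3) ⊗ le v′ (lit 0) V≤0)) refl))
      where T = var 0F ; v′ = var 1F
    V≥0 = <⇒≤ V>0

    abstract
      -- The arc ends about 3.6 standard deviations out: far enough for the factor 1 - c/c₁ to cost
      -- little in the moments, near enough for the phase bound `hθ`.
      c₁ : F
      c₁ = ⟪ pos 13 ⟫ * inv V
      c₁-def : c₁ ≡ ⟪ pos 13 ⟫ * inv V
      c₁-def = refl

    c₁V : c₁ * V ≡ ⟪ pos 13 ⟫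
    c₁V = trans (cong (_* V) c₁-def) (prove= (lit 13 :* j :* v′) (lit 13) (inv V ∷ V ∷ []) (by= (v′ :* j) (lit 1) (inv-eq V>0) (lit 13)) refl)
      where j = var 0F ; v′ = var 1F
    c₁>0 : 0# < c₁
    c₁>0 q = ⟪⟫>0 12 (subst (_≤ 0#) c₁V (prove (C :* v′) (lit 0) (c₁ ∷ V ∷ []) (le C (lit 0) q ⊗ ge0 v′ V≥0) refl))
      where C = var 0F ; v′ = var 1F
    c₁≥0 : 0# ≤ c₁
    c₁≥0 = <⇒≤ c₁>0
    8c₁≤ : ⟪ pos 8 ⟫ * c₁ ≤ ⟪ pos 65 ⟫ * t ^ 3
    8c₁≤ = prove (lit 8 :* C) (lit 65 :* T) (c₁ ∷ V ∷ t ^ 3 ∷ [])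
        (ge0 C c₁≥0 ⊗ le (lit 8) (lit 5 :* (T :* v′)) V≥ ⊕ eqn (C :* v′) (lit 13) c₁V (con (negsuc 4) :* T)) refl
        where C = var 0F ; v′ = var 1F ; T = var 2F

    private
      t₊ : ∀ k → 0# ≤ t ^ k
      t₊ = ^≥0 t≥0
      module _ (k : ℕ) where
        private
          m = suc k
        -- (x + 1)³ ≤ 4x³ + 4 with difference 3(x - 1)²(x + 1), at x = m pₘ.
        e³≤ : # (e m) * # (e m) * # (e m) ≤ ⟪ pos 4 ⟫ * (p m * p m * p m * m³ m) + ⟪ pos 4 ⟫
        e³≤ = ≤-trans (*-mono (sq≥0 (# (e m))) (⟪⟫≥0 (e m)) (*-mono (⟪⟫≥0 (e m)) (⟪⟫≥0 (e m)) (e≤ k) (e≤ k)) (e≤ k))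
          (prove ((x :* q :+ lit 1) :* (x :* q :+ lit 1) :* (x :* q :+ lit 1)) (lit 4 :* (q :* q :* q :* (x :* x :* x)) :+ lit 4) (# m ∷ p m ∷ [])
            (nat 3 ⊗ (sq (x :* q :- lit 1) ⊗ (ge0 x (⟪⟫≥0 m) ⊗ ge0 q (p≥0 m) ⊕ nat 1))) refl)
          where x = var 0F ; q = var 1F
        t²vm²≤ : t ^ 2 * vm² m ≤ ⟪ pos 2 ⟫
        t²vm²≤ = ≤-trans (prove (T :^ 2 :* (v′ :* (x :* x))) (y :* (x :* x :* (T :* T))) (t ∷ v m ∷ # m ∷ ρ ^ m ∷ [])
          (sq (x :* T) ⊗ le v′ y (v≤y m)) refl) (subst (λ u → ρ ^ m * (# m * # m * (u * u)) ≤ ⟪ pos 2 ⟫) (ring (lit 1 :- (lit 1 :- var 0F)) (var 0F) (t ∷ []) refl) (Geometric.m²x^m≤ ρ ρ≥0 ρ≤1 m))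
          where T = var 0F ; v′ = var 1F ; x = var 2F ; y = var 3F
        t³κ₃≤ : t ^ 3 * κ₃ m ≤ ⟪ pos 6 ⟫
        t³κ₃≤ = ≤-trans (prove (T :^ 3 :* (v′ :* (x :* x :* x))) (y :* (x :* x :* x :* (T :* (T :* T)))) (t ∷ p m ∷ # m ∷ ρ ^ m ∷ [])
          (sq (x :* T) ⊗ ge0 T t≥0 ⊗ ge0 x (⟪⟫≥0 m) ⊗ le v′ y (p≤y m)) refl) (subst (λ u → ρ ^ m * (# m * # m * # m * (u * (u * u))) ≤ ⟪ pos 6 ⟫) (ring (lit 1 :- (lit 1 :- var 0F)) (var 0F) (t ∷ []) refl) (Geometric.m³x^m≤ ρ ρ≥0 ρ≤1 m))
          where T = var 0F ; v′ = var 1F ; x = var 2F ; y = var 3F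
        360te≤ : ⟪ pos 360 ⟫ * (t * # (e m)) ≤ ⟪ pos 361 ⟫
        360te≤ = prove (lit 360 :* (T :* E′)) (lit 361) (t ∷ # (e m) ∷ p m ∷ # m ∷ ρ ^ m ∷ [])
          (nat 360 ⊗ (ge0 T t≥0 ⊗ le E′ (x :* q :+ lit 1) (e≤ k)) ⊕ nat 360 ⊗ (ge0 T t≥0 ⊗ (ge0 x (⟪⟫≥0 m) ⊗ le q y (p≤y m)))
           ⊕ nat 360 ⊗ le (y :* (x :* (lit 1 :- (lit 1 :- T)))) (lit 1) (Geometric.mx^m≤ ρ ρ≥0 ρ≤1 m) ⊕ le (lit 360 :* T) (lit 1) 360t≤1) refl
          where T = var 0F ; E′ = var 1F ; q = var 2F ; x = var 3F ; y = var 4F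
        t³e³≤ : ⟪ pos 100 ⟫ * (t ^ 3 * (# (e m) * # (e m) * # (e m))) ≤ ⟪ pos 102 ⟫
        t³e³≤ = *-cancel-≤ (⟪⟫>0 46655999) (prove (lit 46656000 :* (lit 100 :* (T :^ 3 :* (E′ :* E′ :* E′)))) (lit 46656000 :* lit 102) (t ∷ # (e m) ∷ [])
          (nat 100 ⊗ (le (lit 360 :* (T :* E′)) (lit 361) 360te≤ ⊗ (nat (361 ℕ.* 361) ⊕ nat (361 ℕ.* 360) ⊗ TE ⊕ nat (360 ℕ.* 360) ⊗ (TE ⊗ TE))) ⊕ nat (46656000 ℕ.* 102 ℕ.∸ 361 ℕ.* 361 ℕ.* 36100)) refl)
          where
          T = var 0F ; E′ = var 1F
          TE : Nn (t ∷ # (e m) ∷ [])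
          TE = ge0 T t≥0 ⊗ ge0 E′ (⟪⟫≥0 (e m))
        t³κ₆≤ : ⟪ pos 50 ⟫ * (t ^ 3 * κ₆ m) ≤ ⟪ pos 351 ⟫
        t³κ₆≤ = *-cancel-≤ (⟪⟫>0 1) (prove (lit 2 :* (lit 50 :* (T :* (a :+ b)))) (lit 2 :* lit 351) (t ^ 3 ∷ κ₃ m ∷ # (e m) * # (e m) * # (e m) ∷ [])
          (nat 100 ⊗ le (T :* a) (lit 6) t³κ₃≤ ⊕ le (lit 100 :* (T :* b)) (lit 102) t³e³≤) refl)
          where T = var 0F ; a = var 1F ; b = var 2F
        κ₃≥0 : 0# ≤ κ₃ m
        κ₃≥0 = *≥0 (p≥0 m) (*≥0 (sq≥0 (# m)) (⟪⟫≥0 m))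
        e³≥0 : 0# ≤ # (e m) * # (e m) * # (e m)
        e³≥0 = *≥0 (sq≥0 (# (e m))) (⟪⟫≥0 (e m))
        κ₆≥0 : 0# ≤ κ₆ m
        κ₆≥0 = +≥0 κ₃≥0 e³≥0
        vm²≥0 : 0# ≤ vm² m
        vm²≥0 = *≥0 (v≥0 m) (sq≥0 (# m))

    -- 6 from Σ p m³, 4 · 0.0945 from the rounded means by `e³≤`, and 0.001 for the additive 4 in
    -- each of N terms.
    Σκ₆≤ : ⟪ pos 1000 ⟫ * (t ^ 4 * Σ₁ κ₆ N) ≤ ⟪ pos 6379 ⟫
    Σκ₆≤ = ≤-trans (prove (lit 1000 :* (T :* a)) (lit 1000 :* (T :* b) :+ lit 4000 :* (T :* c) :+ lit 4000 :* (T :* n))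
        (t ^ 4 ∷ Σ₁ κ₆ N ∷ Σ₁ κ₃ N ∷ Σ₁ (λ m → p m * p m * p m * m³ m) N ∷ # N ∷ []) (nat 1000 ⊗ (ge0 T (t₊ 4) ⊗ le a (b :+ (lit 4 :* c :+ n :* lit 4)) split)) refl)
      (prove (lit 1000 :* (u :^ 4 :* b) :+ lit 4000 :* (u :^ 4 :* c) :+ lit 4000 :* (u :^ 4 :* n)) (lit 6379) (t ∷ t ∷ Σ₁ κ₃ N ∷ Σ₁ (λ m → p m * p m * p m * m³ m) N ∷ # N ∷ [])
        (nat 1000 ⊗ le (u :^ 4 :* b) (lit 6) Σκ₃≤ ⊕ le (lit 4000 :* (u :^ 4 :* c)) (lit 378) Σp³m³≤
         ⊕ nat 12 ⊗ (ge0 u t≥0 ⊗ le (lit 359 :* (n :* u :^ 3)) (lit 1) Nt³≤) ⊕ le (lit 360 :* u) (lit 1) 360t≤1 ⊕ posE (t≥0 ∷ t≥0 ∷ κ₃Σ ∷ pΣ ∷ ⟪⟫≥0 N ∷ []) (lit 348 :* u :+ lit 308 :* (n :* u :^ 4)) refl) refl)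
      where
      T = var 0F ; a = var 1F ; b = var 2F ; c = var 3F ; n = var 4F ; u = var 0F
      κ₃Σ = Σ₁≥0 κ₃≥0 N
      pΣ : 0# ≤ Σ₁ (λ m → p m * p m * p m * m³ m) N
      pΣ = Σ₁≥0 {λ m → p m * p m * p m * m³ m} (λ k → *≥0 (*≥0 (*≥0 (p≥0 (suc k)) (p≥0 (suc k))) (p≥0 (suc k))) (*≥0 (sq≥0 (# (suc k))) (⟪⟫≥0 (suc k)))) N
      split : Σ₁ κ₆ N ≤ Σ₁ κ₃ N + (⟪ pos 4 ⟫ * Σ₁ (λ m → p m * p m * p m * m³ m) N + # N * ⟪ pos 4 ⟫)
      split = ≤-trans (≤-reflexive (Σ₁-+ κ₃ (λ m → # (e m) * # (e m) * # (e m)) N)) (+-monoʳ _ (≤-trans (Σ₁≤ (λ m → # (e m) * # (e m) * # (e m)) (λ m → ⟪ pos 4 ⟫ * (p m * p m * p m * m³ m) + ⟪ pos 4 ⟫) N e³≤)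
        (≤-reflexive (trans (Σ₁-+ (λ m → ⟪ pos 4 ⟫ * (p m * p m * p m * m³ m)) (λ _ → ⟪ pos 4 ⟫) N) (cong₂ _+_ (Σ₁-* _ (λ m → p m * p m * p m * m³ m) N) (Σ₁-const _ N))))))

    z : ℕ → F
    z m = inv (# 5700) * (⟪ pos 1001 ⟫ * κ₆ m + ⟪ pos 3000 ⟫ * (vm² m + ⟪ pos 3 ⟫))

    5700z : ∀ m → ⟪ pos 5700 ⟫ * z m ≡ ⟪ pos 1001 ⟫ * κ₆ m + ⟪ pos 3000 ⟫ * (vm² m + ⟪ pos 3 ⟫)
    5700z m = prove= (lit 5700 :* (i :* x)) x (inv (# 5700) ∷ ⟪ pos 1001 ⟫ * κ₆ m + ⟪ pos 3000 ⟫ * (vm² m + ⟪ pos 3 ⟫) ∷ []) (by= (lit 5700 :* i) (lit 1) (reciprocal 5699) x) refl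
      where i = var 0F ; x = var 1F

    z≥0 : ∀ k → 0# ≤ z (suc k)
    z≥0 k = *≥0 (inv≥0 (⟪⟫>0 5699)) (+≥0 (*≥0 (⟪⟫≥0 1001) (κ₆≥0 k)) (*≥0 (⟪⟫≥0 3000) (+≥0 (vm²≥0 k) (⟪⟫≥0 3))))

    private
      t³z≤ : ∀ k → ⟪ pos 5700 ⟫ * (t ^ 3 * z (suc k)) ≤ ⟪ pos 7045 ⟫
      t³z≤ k = *-cancel-≤ (⟪⟫>0 49) (prove (lit 50 :* (lit 5700 :* (T :^ 3 :* Z))) (lit 50 :* lit 7045) (t ∷ z (suc k) ∷ κ₆ (suc k) ∷ vm² (suc k) ∷ [])
        (nat 1001 ⊗ le (lit 50 :* (T :^ 3 :* κ)) (lit 351) (t³κ₆≤ k) ⊕ nat 150000 ⊗ (ge0 T t≥0 ⊗ le (T :^ 2 :* q) (lit 2) (t²vm²≤ k))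
         ⊕ nat 4 ⊗ (ge0 T t≥0 ⊗ le (lit 129600 :* (T :* T)) (lit 1) t²)
         ⊕ nat 899 ⊗ le (lit 360 :* T) (lit 1) 360t≤1 ⊕ (nat 23636 ⊗ ge0 T t≥0 ⊕ nat 68400 ⊗ (sq T ⊗ ge0 T t≥0))
         ⊕ eqn (lit 5700 :* Z) (lit 1001 :* κ :+ lit 3000 :* (q :+ lit 3)) (5700z (suc k)) (con (negsuc 49) :* T :^ 3)) refl)
        where T = var 0F ; Z = var 1F ; κ = var 2F ; q = var 3F

      Σz : F
      Σz = Σ₁ z N
      5700Σz : ⟪ pos 5700 ⟫ * Σz ≡ ⟪ pos 1001 ⟫ * Σ₁ κ₆ N + ⟪ pos 3000 ⟫ * (V + # N * ⟪ pos 3 ⟫)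
      5700Σz = trans (sym (Σ₁-* _ z N)) (trans (Σ₁-≗ (λ m → ⟪ pos 5700 ⟫ * z m) (λ m → ⟪ pos 1001 ⟫ * κ₆ m + ⟪ pos 3000 ⟫ * (vm² m + ⟪ pos 3 ⟫)) N (λ k → 5700z (suc k)))
        (trans (Σ₁-+ (λ m → ⟪ pos 1001 ⟫ * κ₆ m) (λ m → ⟪ pos 3000 ⟫ * (vm² m + ⟪ pos 3 ⟫)) N)
          (cong₂ _+_ (Σ₁-* _ κ₆ N) (trans (Σ₁-* _ (λ m → vm² m + ⟪ pos 3 ⟫) N) (cong (⟪ pos 3000 ⟫ *_) (trans (Σ₁-+ vm² (λ _ → ⟪ pos 3 ⟫) N) (cong (V +_) (Σ₁-const _ N))))))))
      Σz≥0 : 0# ≤ Σz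
      Σz≥0 = Σ₁≥0 z≥0 N
      t⁴Σz≤ : ⟪ pos 57000 ⟫ * (t ^ 4 * Σz) ≤ ⟪ pos 64025 ⟫
      t⁴Σz≤ = *-cancel-≤ (⟪⟫>0 99) (prove (lit 100 :* (lit 57000 :* (T :^ 4 :* Z))) (lit 100 :* lit 64025) (t ∷ Σz ∷ Σ₁ κ₆ N ∷ V ∷ # N ∷ [])
        (nat 1001 ⊗ le (lit 1000 :* (T :^ 4 :* κ)) (lit 6379) Σκ₆≤ ⊕ nat 3000000 ⊗ (ge0 T t≥0 ⊗ le (T :^ 3 :* q) (lit 2) V≤)
         ⊕ nat 25070 ⊗ (ge0 T t≥0 ⊗ le (lit 359 :* (n :* T :^ 3)) (lit 1) Nt³≤)
         ⊕ nat 17121 ⊗ le (lit 360 :* T) (lit 1) 360t≤1 ⊕ (nat (17121 ℕ.* 360 ℕ.∸ 6025070) ⊗ ge0 T t≥0 ⊕ nat (359 ℕ.* 25070 ℕ.∸ 9000000) ⊗ (sq (T :* T) ⊗ ge0 n (⟪⟫≥0 N)))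
         ⊕ eqn (lit 5700 :* Z) (lit 1001 :* κ :+ lit 3000 :* (q :+ n :* lit 3)) 5700Σz (con (negsuc 999) :* T :^ 4)) refl)
        where T = var 0F ; Z = var 1F ; κ = var 2F ; q = var 3F ; n = var 4F

      g : F
      g = t * (c₁ * Σz + 1#)
      g≥0 : 0# ≤ g
      g≥0 = *≥0 t≥0 (+≥0 (*≥0 c₁≥0 Σz≥0) (⟪⟫≥0 1))
      g≤ : ⟪ pos 1000 ⟫ * g ≤ ⟪ pos 9130 ⟫
      g≤ = *-cancel-≤ (⟪⟫>0 455) (prove (lit 456 :* (lit 1000 :* (T :* (C :* Z :+ lit 1)))) (lit 456 :* lit 9130) (t ∷ c₁ ∷ Σz ∷ [])
        (nat 57000 ⊗ (ge0 T t≥0 ⊗ (le (lit 8 :* C) (lit 65 :* T :^ 3) 8c₁≤ ⊗ ge0 Z Σz≥0)) ⊕ nat 65 ⊗ le (lit 57000 :* (T :^ 4 :* Z)) (lit 64025) t⁴Σz≤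
          ⊕ nat 1267 ⊗ le (lit 360 :* T) (lit 1) 360t≤1 ⊕ nat (1267 ℕ.* 360 ℕ.∸ 456000) ⊗ ge0 T t≥0 ⊕ nat (456 ℕ.* 9130 ℕ.∸ (65 ℕ.* 64025 ℕ.+ 1267))) refl)
        where T = var 0F ; C = var 1F ; Z = var 2F

    M : F
    M = ⟪ pos 101 ⟫ * inv (# 100)
    100M : ⟪ pos 100 ⟫ * M ≡ ⟪ pos 101 ⟫
    100M = prove= (lit 100 :* (lit 101 :* i)) (lit 101) (inv (# 100) ∷ []) (by= (lit 100 :* i) (lit 1) (reciprocal 99) (lit 101)) refl
      where i = var 0F
    1≤M : 1# ≤ M
    1≤M = *-cancel-≤ (⟪⟫>0 99) (prove (lit 100 :* lit 1) (lit 100 :* x) (M ∷ []) (nat 1 ⊕ eqn (lit 100 :* x) (lit 101) 100M (lit 1)) refl)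
      where x = var 0F

    -- c₁ ≤ 65t³/8 and c₁ Σ z + 1 ≤ 9.13/t, so the left side is at most about 1.01 · 677.3 t, which
    -- is 1.90 at t = 1/360.
    hθ : M * (c₁ * ((c₁ * Σ₁ z N + 1#) * (c₁ * Σ₁ z N + 1#))) ≤ ⟪ pos 2 ⟫
    hθ = *-cancel-≤ {x = t * t} (*>0 t>0 t>0) (*-cancel-≤ (⟪⟫>0 799999999) (prove
        (lit 800000000 :* (T :* T :* (m :* (C :* (s :* s))))) (lit 800000000 :* (T :* T :* lit 2)) (t ∷ c₁ ∷ c₁ * Σ₁ z N + 1# ∷ M ∷ [])
        (eqn (lit 100 :* m) (lit 101) 100M (lit 8000000 :* (:- (T :* T :* (C :* (s :* s)))))
         ⊕ nat 101000000 ⊗ (le (lit 8 :* C) (lit 65 :* T :^ 3) 8c₁≤ ⊗ sq (T :* s))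
         ⊕ nat 6565 ⊗ (sq T ⊗ ge0 T t≥0 ⊗ le (lit 1000000 :* (T :* s :* (T :* s))) (con (pos (9130 ℕ.* 9130))) g²≤)
         ⊕ sq T ⊗ (nat 1520105691 ⊗ le (lit 360 :* T) (lit 1) 360t≤1 ⊕ nat (360 ℕ.* 1520105691 ℕ.∸ 547238048500) ⊗ ge0 T t≥0 ⊕ nat (1600000000 ℕ.∸ 1520105691))) refl))
      where
      T = var 0F ; C = var 1F ; s = var 2F ; m = var 3F
      g²≤ : ⟪ pos 1000000 ⟫ * (g * g) ≤ ⟪ pos (9130 ℕ.* 9130) ⟫
      g²≤ = prove (lit 1000000 :* (G :* G)) (con (pos (9130 ℕ.* 9130))) (g ∷ []) (le (lit 1000 :* G) (lit 9130) g≤ ⊗ (nat 9130 ⊕ nat 1000 ⊗ ge0 G g≥0)) refl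
        where G = var 0F

    private
      t³c₁≤ : ∀ x → 0# ≤ x → ⟪ pos 8 ⟫ * (c₁ * x) ≤ ⟪ pos 65 ⟫ * (t ^ 3 * x)
      t³c₁≤ x x≥0 = prove (lit 8 :* (C :* X)) (lit 65 :* (T :* X)) (c₁ ∷ t ^ 3 ∷ x ∷ []) (le (lit 8 :* C) (lit 65 :* T) 8c₁≤ ⊗ ge0 X x≥0) refl
        where C = var 0F ; T = var 1F ; X = var 2F
      500c₁z≤ : ∀ k → ⟪ pos 45600 ⟫ * (c₁ * z (suc k)) ≤ ⟪ pos 457925 ⟫
      500c₁z≤ k = prove (lit 45600 :* (C :* Z)) (lit 457925) (t ^ 3 ∷ c₁ ∷ z (suc k) ∷ [])
        (nat 5700 ⊗ le (lit 8 :* (C :* Z)) (lit 65 :* (T :* Z)) (t³c₁≤ _ (z≥0 k)) ⊕ nat 65 ⊗ le (lit 5700 :* (T :* Z)) (lit 7045) (t³z≤ k)) refl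
        where T = var 0F ; C = var 1F ; Z = var 2F

    -- By `Π₁-1+` it is enough that Σ c₁³z² ≤ 1/100. One factor c₁z is bounded by its maximum, about
    -- 10, and the others through the sum `Σz`.
    hM : Π₁ (λ m → 1# + c₁ * (c₁ * c₁) * (z m * z m)) N ≤ M * M
    hM = *-cancel-≤ (⟪⟫>0 989999) (prove (lit 990000 :* P) (lit 990000 :* (m :* m)) (Π₁ (λ m → 1# + x m) N ∷ Σ₁ x N ∷ M ∷ [])
        (nat 1000000 ⊗ le (P :* (lit 1 :- s)) (lit 1) (Π₁-1+ x x≥0 N) ⊕ nat 10000 ⊗ (ge0 P (Π₁≥0 (λ k → +≥0 (⟪⟫≥0 1) (x≥0 k)) N) ⊗ le (lit 100 :* s) (lit 1) 100Σx≤)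
         ⊕ eqn (lit 100 :* m) (lit 101) 100M (lit 99 :* (lit 100 :* m :+ lit 101)) ⊕ nat (99 ℕ.* 10201 ℕ.∸ 1000000)) refl)
      where
      P = var 0F ; s = var 1F ; m = var 2F
      x : ℕ → F
      x m = c₁ * (c₁ * c₁) * (z m * z m)
      x≥0 : ∀ k → 0# ≤ x (suc k)
      x≥0 k = *≥0 (*≥0 c₁≥0 (sq≥0 c₁)) (sq≥0 (z (suc k)))
      Σx≤ : ⟪ pos 45600 ⟫ * Σ₁ x N ≤ ⟪ pos 457925 ⟫ * (c₁ * c₁) * Σz
      Σx≤ = ≤-trans (≤-reflexive (sym (Σ₁-* ⟪ pos 45600 ⟫ x N))) (≤-trans (Σ₁≤ (λ m → ⟪ pos 45600 ⟫ * x m) (λ m → ⟪ pos 457925 ⟫ * (c₁ * c₁) * z m) N (λ k →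
          prove (lit 45600 :* (C :* (C :* C) :* (Z :* Z))) (lit 457925 :* (C :* C) :* Z) (c₁ ∷ z (suc k) ∷ [])
            (sq C ⊗ (ge0 Z (z≥0 k) ⊗ le (lit 45600 :* (C :* Z)) (lit 457925) (500c₁z≤ k))) refl))
        (≤-reflexive (Σ₁-* (⟪ pos 457925 ⟫ * (c₁ * c₁)) z N)))
        where C = var 0F ; Z = var 1F
      100Σx≤ : ⟪ pos 100 ⟫ * Σ₁ x N ≤ 1#
      100Σx≤ = *-cancel-≤ t>0 (*-cancel-≤ (⟪⟫>0 3647999) (prove (lit 3648000 :* (T :* (lit 100 :* s′))) (lit 3648000 :* (T :* lit 1)) (t ∷ Σ₁ x N ∷ c₁ ∷ Σz ∷ [])
        (nat 8000 ⊗ (ge0 T t≥0 ⊗ le (lit 45600 :* s′) (lit 457925 :* (C :* C) :* Z) Σx≤)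
         ⊕ nat (8 ℕ.* 457925) ⊗ (ge0 C c₁≥0 ⊗ le (lit 1000 :* (T :* (C :* Z :+ lit 1))) (lit 9130) g≤) ⊕ nat (8000 ℕ.* 457925) ⊗ (ge0 C c₁≥0 ⊗ ge0 T t≥0)
         ⊕ nat (457925 ℕ.* 9130) ⊗ le (lit 8 :* C) (lit 65 :* T :^ 3) 8c₁≤
         ⊕ ge0 T t≥0 ⊗ (nat 2097000 ⊗ le (lit 129600 :* (T :* T)) (lit 1) t² ⊕ nat (2097000 ℕ.* 129600 ℕ.∸ 457925 ℕ.* 9130 ℕ.* 65) ⊗ sq T ⊕ nat (3648000 ℕ.∸ 2097000))) refl))
        where T = var 0F ; s′ = var 1F ; C = var 2F ; Z = var 3F

    hx : ∀ k → c₁ * (⟪ pos 60 ⟫ * (vm² (suc k) + 1#) + ⟪ pos 20 ⟫ * (c₁ * κ₆ (suc k))) ≤ ⟪ pos 6 ⟫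
    hx k = *-cancel-≤ (⟪⟫>0 31) (prove (lit 32 :* (C :* (lit 60 :* (q :+ lit 1) :+ lit 20 :* (C :* κ)))) (lit 32 :* lit 6) (t ∷ c₁ ∷ vm² (suc k) ∷ κ₆ (suc k) ∷ [])
      (nat 240 ⊗ (le (lit 8 :* C) (lit 65 :* T :^ 3) 8c₁≤ ⊗ (ge0 q (vm²≥0 k) ⊕ nat 1))
       ⊕ nat (240 ℕ.* 65) ⊗ (ge0 T t≥0 ⊗ le (T :^ 2 :* q) (lit 2) (t²vm²≤ k))
       ⊕ nat 80 ⊗ (ge0 C c₁≥0 ⊗ (le (lit 8 :* (C :* κ)) (lit 65 :* (T :^ 3 :* κ)) (t³c₁≤ _ (κ₆≥0 k))))
       ⊕ nat 104 ⊗ (ge0 C c₁≥0 ⊗ le (lit 50 :* (T :^ 3 :* κ)) (lit 351) (t³κ₆≤ k))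
       ⊕ nat 4563 ⊗ le (lit 8 :* C) (lit 65 :* T :^ 3) 8c₁≤
       ⊕ ge0 T t≥0 ⊗ (nat 3 ⊗ le (lit 129600 :* (T :* T)) (lit 1) t² ⊕ nat 37917 ⊕ nat 76605 ⊗ sq T)
       ⊕ nat 192 ⊗ le (lit 360 :* T) (lit 1) 360t≤1) refl)
      where T = var 0F ; C = var 1F ; q = var 2F ; κ = var 3F

    private
      X : ℕ → F
      X m = inv (# 57) * (⟪ pos 120 ⟫ * (vm² m + 1#) + ⟪ pos 40 ⟫ * (c₁ * κ₆ m))
      57X : ∀ m → ⟪ pos 57 ⟫ * X m ≡ ⟪ pos 120 ⟫ * (vm² m + 1#) + ⟪ pos 40 ⟫ * (c₁ * κ₆ m)
      57X m = prove= (lit 57 :* (i :* x)) x (inv (# 57) ∷ ⟪ pos 120 ⟫ * (vm² m + 1#) + ⟪ pos 40 ⟫ * (c₁ * κ₆ m) ∷ []) (by= (lit 57 :* i) (lit 1) (reciprocal 56) x) refl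
        where i = var 0F ; x = var 1F
      X≥0 : ∀ k → 0# ≤ X (suc k)
      X≥0 k = *≥0 (inv≥0 (⟪⟫>0 56)) (+≥0 (*≥0 (⟪⟫≥0 120) (+≥0 (vm²≥0 k) (⟪⟫≥0 1))) (*≥0 (⟪⟫≥0 40) (*≥0 c₁≥0 (κ₆≥0 k))))

    -- Rounded upwards, as `hk` demands. The leading 120/57 = 2/0.95 is the exponent per unit of
    -- variance that keeps hᵏ below R when R ≥ 19/20.
    kk : ℕ → ℕ
    kk m = suc ⌊ X m ⌋

    hk : ∀ k → ⟪ pos 120 ⟫ * (vm² (suc k) + 1#) + ⟪ pos 40 ⟫ * (c₁ * κ₆ (suc k)) ≤ ⟪ pos 57 ⟫ * # (kk (suc k))
    hk k = subst₂ _≤_ (57X (suc k)) (cong (⟪ pos 57 ⟫ *_) (trans (+-comm _ 1#) (sym (#-suc ⌊ X (suc k) ⌋))))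
      (prove (lit 57 :* x) (lit 57 :* (y :+ lit 1)) (X (suc k) ∷ # ⌊ X (suc k) ⌋ ∷ []) (nat 57 ⊗ le x (y :+ lit 1) (≤⌊⌋+1 (X (suc k)))) refl)
      where x = var 0F ; y = var 1F

    D : ℕ
    D = sumℕ kk N ℕ.+ suc N ℕ.* 4

    private
      Σkk : F
      Σkk = Σ₁ (λ m → # (kk m)) N
      #D : # D ≡ Σkk + (1# + # N) * ⟪ pos 4 ⟫
      #D = trans (#-+ (sumℕ kk N) (suc N ℕ.* 4)) (cong₂ _+_ (#-sumℕ kk N) (trans (⟪⟫-* (pos (suc N)) (pos 4)) (cong (_* ⟪ pos 4 ⟫) (#-suc N))))
      57ΣX : ⟪ pos 57 ⟫ * Σ₁ X N ≡ ⟪ pos 120 ⟫ * (V + # N * 1#) + ⟪ pos 40 ⟫ * (c₁ * Σ₁ κ₆ N)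
      57ΣX = trans (sym (Σ₁-* _ X N)) (trans (Σ₁-≗ (λ m → ⟪ pos 57 ⟫ * X m) (λ m → ⟪ pos 120 ⟫ * (vm² m + 1#) + ⟪ pos 40 ⟫ * (c₁ * κ₆ m)) N (λ k → 57X (suc k)))
        (trans (Σ₁-+ (λ m → ⟪ pos 120 ⟫ * (vm² m + 1#)) (λ m → ⟪ pos 40 ⟫ * (c₁ * κ₆ m)) N)
          (cong₂ _+_ (trans (Σ₁-* _ (λ m → vm² m + 1#) N) (cong (⟪ pos 120 ⟫ *_) (trans (Σ₁-+ vm² (λ _ → 1#) N) (cong (V +_) (Σ₁-const _ N)))))
            (trans (Σ₁-* _ (λ m → c₁ * κ₆ m) N) (cong (⟪ pos 40 ⟫ *_) (Σ₁-* c₁ κ₆ N))))))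
      ΣX≤Σkk : Σ₁ X N ≤ Σkk
      ΣX≤Σkk = Σ₁≤ X (λ m → # (kk m)) N (λ k → ≤-trans (≤⌊⌋+1 (X (suc k))) (≤-reflexive (trans (+-comm _ 1#) (sym (#-suc ⌊ X (suc k) ⌋)))))
      Σkk≤ : Σkk ≤ Σ₁ X N + # N * 1#
      Σkk≤ = ≤-trans (Σ₁≤ (λ m → # (kk m)) (λ m → X m + 1#) N (λ k → ≤-trans (≤-reflexive (#-suc ⌊ X (suc k) ⌋)) (prove (lit 1 :+ var 0F) (var 1F :+ lit 1) (# ⌊ X (suc k) ⌋ ∷ X (suc k) ∷ []) (le (var 0F) (var 1F) (⌊⌋≤ (X≥0 k))) refl)))
        (≤-reflexive (trans (Σ₁-+ X (λ _ → 1#) N) (cong (Σ₁ X N +_) (Σ₁-const 1# N))))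
      Σκ₆≥0 : 0# ≤ Σ₁ κ₆ N
      Σκ₆≥0 = Σ₁≥0 κ₆≥0 N

    -- The exponent is (120/57)V plus contributions of order N and c₁ Σ κ₆. Both are smaller than V,
    -- which is of order t⁻³, by a factor of order t, so D lies between 2.1 V and 2.121 V.
    D≥ : ⟪ pos 21 ⟫ * V ≤ ⟪ pos 10 ⟫ * # D
    D≥ = *-cancel-≤ (⟪⟫>0 56) (prove (lit 57 :* (lit 21 :* v′)) (lit 57 :* (lit 10 :* d)) (V ∷ # D ∷ Σkk ∷ Σ₁ X N ∷ # N ∷ c₁ ∷ Σ₁ κ₆ N ∷ [])
      (eqn d (s :+ (lit 1 :+ n) :* lit 4) #D (lit 570) ⊕ nat 570 ⊗ le x s ΣX≤Σkk ⊕ eqn (lit 57 :* x) (lit 120 :* (v′ :+ n :* lit 1) :+ lit 40 :* (C :* κ)) 57ΣX (lit 10)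
       ⊕ posE (V≥0 ∷ ⟪⟫≥0 D ∷ (Σ₁≥0 (λ k → ⟪⟫≥0 (kk (suc k))) N) ∷ Σ₁≥0 X≥0 N ∷ ⟪⟫≥0 N ∷ c₁≥0 ∷ Σκ₆≥0 ∷ []) (lit 3 :* v′ :+ lit 3480 :* n :+ lit 2280 :+ lit 400 :* (C :* κ)) refl) refl)
      where v′ = var 0F ; d = var 1F ; s = var 2F ; x = var 3F ; n = var 4F ; C = var 5F ; κ = var 6F

    private
      t³c₁Σκ₆≤ : ⟪ pos 8000 ⟫ * (t ^ 3 * (c₁ * Σ₁ κ₆ N)) ≤ ⟪ pos 414635 ⟫ * (t * t)
      t³c₁Σκ₆≤ = prove (lit 8000 :* (T :^ 3 :* (C :* κ))) (lit 414635 :* (T :* T)) (t ∷ c₁ ∷ Σ₁ κ₆ N ∷ [])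
        (nat 1000 ⊗ (ge0 (T :^ 3) (t₊ 3) ⊗ le (lit 8 :* (C :* κ)) (lit 65 :* (T :^ 3 :* κ)) (t³c₁≤ _ Σκ₆≥0)) ⊕ nat 65 ⊗ (sq T ⊗ le (lit 1000 :* (T :^ 4 :* κ)) (lit 6379) Σκ₆≤)) refl
        where T = var 0F ; C = var 1F ; κ = var 2F

    D≤ : ⟪ pos 1000 ⟫ * (# D + ⟪ pos 2 ⟫) ≤ ⟪ pos 2121 ⟫ * V
    D≤ = *-cancel-≤ {x = t ^ 3} (*>0 t>0 (*>0 t>0 (*>0 t>0 (⟪⟫>0 0)))) (*-cancel-≤ (⟪⟫>0 56) (prove (lit 57 :* (T :^ 3 :* (lit 1000 :* (d :+ lit 2)))) (lit 57 :* (T :^ 3 :* (lit 2121 :* v′)))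
      (V ∷ # D ∷ Σkk ∷ Σ₁ X N ∷ # N ∷ c₁ ∷ Σ₁ κ₆ N ∷ t ∷ [])
      (eqn d (s :+ (lit 1 :+ n) :* lit 4) #D (con (negsuc 56999) :* T :^ 3) ⊕ nat 57000 ⊗ (ge0 (T :^ 3) (t₊ 3) ⊗ le s (x :+ n :* lit 1) Σkk≤)
       ⊕ eqn (lit 57 :* x) (lit 120 :* (v′ :+ n :* lit 1) :+ lit 40 :* (C :* κ)) 57ΣX (con (negsuc 999) :* T :^ 3)
       ⊕ nat 5 ⊗ le (lit 8000 :* (T :^ 3 :* (C :* κ))) (lit 414635 :* (T :* T)) t³c₁Σκ₆≤
       ⊕ nat 179 ⊗ le (lit 8) (lit 5 :* (T :^ 3 :* v′)) V≥
       ⊕ nat 1129 ⊗ le (lit 359 :* (n :* T :^ 3)) (lit 1) Nt³≤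
       ⊕ nat 303 ⊗ le (lit 360 :* T) (lit 1) 360t≤1
       ⊕ ge0 T t≥0 ⊗ (nat 5759 ⊗ le (lit 360 :* T) (lit 1) 360t≤1 ⊕ nat 3 ⊗ le (lit 129600 :* (T :* T)) (lit 1) t²)
       ⊕ posE (V≥0 ∷ ⟪⟫≥0 D ∷ (Σ₁≥0 (λ k → ⟪⟫≥0 (kk (suc k))) N) ∷ Σ₁≥0 X≥0 N ∷ ⟪⟫≥0 N ∷ c₁≥0 ∷ Σκ₆≥0 ∷ t≥0 ∷ [])
           (lit 65 :* T :^ 2 :+ lit 46800 :* T :^ 3 :+ lit 103318 :* T :+ lit 311 :* (n :* T :^ 3) :+ lit 2 :* (T :^ 3 :* v′)) refl) refl))
      where v′ = var 0F ; d = var 1F ; s = var 2F ; x = var 3F ; n = var 4F ; C = var 5F ; κ = var 6F ; T = var 7F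

-- Numerical data of the outer arcs

module OuterArcs where
  open Inequalities
  open PowersOfUnit
  open PairProducts
  open RotatedProduct using (sumℕ; #-+)
  open PowerSums
  open TiltedSums
  open Rounding
  open CentralArcs using (#-sumℕ; reciprocal)
  open UpperBounds using (^-distrib-*)
  open import Data.Nat.Base as ℕ using (ℕ; suc; zero)
  import Data.Nat.Properties as ℕP
  open import Data.Sum.Base using (_⊎_; inj₁; inj₂)

  -- ∑ xᵐ |1 − uᵐ|², the Poisson kernel
  module Poisson (a : F) (a²≤1 : a * a ≤ 1#) (x : F) (x≥0 : 0# ≤ x) (x≤1 : x ≤ 1#) where
    open Unit a a²≤1 using (c; A; U; c[_]; AU-norm; c≥0)
    q : F
    q = (1# - x) * (1# - x) + x * c
    B T : ℕ → F
    B N = Σ₁ (λ m → c[ m ] * x ^ m) N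
    T N = ⟪ pos 2 ⟫ * q - ⟪ pos 2 ⟫ * ((1# - x) * (A (suc N) - x * A N))

    -- The finite form of Σ |1 - uᵐ|²xᵐ = x(1 + x)c/((1 - x)|1 - xu|²), with q = |1 - xu|² and the
    -- boundary term in T.
    exact : ∀ N → (1# - x) * q * B N + x * x ^ N * T N ≡ x * (1# + x) * c
    exact zero = ring ((lit 1 :- X) :* Q :* lit 0 :+ X :* lit 1 :* (lit 2 :* Q :- lit 2 :* ((lit 1 :- X) :* ((y :* lit 1 :- (lit 1 :- y :* y) :* lit 0) :- X :* lit 1))))
        (X :* (lit 1 :+ X) :* (lit 2 :- lit 2 :* y)) (a ∷ x ∷ []) refl
      where y = var 0F ; X = var 1F ; Q = (lit 1 :- X) :* (lit 1 :- X) :+ X :* (lit 2 :- lit 2 :* y)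
    exact (suc k) = prove= ((lit 1 :- X) :* Q :* (b :+ (lit 2 :- lit 2 :* A₁) :* (X :* w)) :+ X :* (X :* w) :* (lit 2 :* Q :- lit 2 :* ((lit 1 :- X) :* (y :* A₁ :- s :* (y :* U₀ :+ A₀) :- X :* A₁))))
        (X :* (lit 1 :+ X) :* (lit 2 :- lit 2 :* y)) (a ∷ x ∷ B k ∷ x ^ k ∷ A k ∷ U k ∷ [])
        (by= ((lit 1 :- X) :* Q :* b :+ X :* w :* (lit 2 :* Q :- lit 2 :* ((lit 1 :- X) :* (A₁ :- X :* A₀)))) (X :* (lit 1 :+ X) :* (lit 2 :- lit 2 :* y)) (exact k) (lit 1)) refl
      where
      y = var 0F ; X = var 1F ; b = var 2F ; w = var 3F ; A₀ = var 4F ; U₀ = var 5F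
      Q = (lit 1 :- X) :* (lit 1 :- X) :+ X :* (lit 2 :- lit 2 :* y)
      s = lit 1 :- y :* y ; A₁ = y :* A₀ :- s :* U₀

    private
      r : ℕ → F
      r N = A (suc N) - x * A N
      -- uᴺ (u − x) has modulus |1 − x u|, whose square is q
      r²≤q : ∀ N → r N * r N ≤ q
      r²≤q N = prove (R :* R) Q (a ∷ x ∷ A N ∷ U N ∷ [])
          (le (y :* y) (lit 1) a²≤1 ⊗ sq (A₀ :+ U₀ :* (y :- X)) ⊕ eqn (A₀ :* A₀ :+ s :* (U₀ :* U₀)) (lit 1) (AU-norm N) (:- Q)) refl
        where
        y = var 0F ; X = var 1F ; A₀ = var 2F ; U₀ = var 3F ; s = lit 1 :- y :* y
        R = y :* A₀ :- s :* U₀ :- X :* A₀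
        Q = (lit 1 :- X) :* (lit 1 :- X) :+ X :* (lit 2 :- lit 2 :* y)
      d²≤q : (1# - x) * (1# - x) ≤ q
      d²≤q = prove (D :* D) (D :* D :+ X :* C) (x ∷ c ∷ []) (ge0 X x≥0 ⊗ ge0 C c≥0) refl
        where X = var 0F ; C = var 1F ; D = lit 1 :- X

    module _ (N : ℕ) where
      T≥0 : 0# ≤ T N
      T≥0 = prove (lit 0) (lit 2 :* Q :- lit 2 :* (D :* R)) (1# - x ∷ r N ∷ q ∷ []) (le (R :* R) Q (r²≤q N) ⊕ le (D :* D) Q d²≤q ⊕ sq (D :- R)) refl
        where D = var 0F ; R = var 1F ; Q = var 2F
      T≤4q : T N ≤ ⟪ pos 4 ⟫ * q
      T≤4q = prove (lit 2 :* Q :- lit 2 :* (D :* R)) (lit 4 :* Q) (1# - x ∷ r N ∷ q ∷ []) (le (R :* R) Q (r²≤q N) ⊕ le (D :* D) Q d²≤q ⊕ sq (D :+ R)) refl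
        where D = var 0F ; R = var 1F ; Q = var 2F
      B≤ : (1# - x) * q * B N ≤ x * (1# + x) * c
      B≤ = ≤-trans (prove (var 0F) (var 0F :+ var 1F) ((1# - x) * q * B N ∷ x * x ^ N * T N ∷ []) (ge0 (var 1F) (*≥0 (*≥0 x≥0 (^≥0 x≥0 N)) T≥0)) refl) (≤-reflexive (exact N))
      B≥ : x * (1# + x) * c ≤ (1# - x) * q * B N + ⟪ pos 4 ⟫ * (x * x ^ N * q)
      B≥ = ≤-trans (≤-reflexive (sym (exact N))) (prove (b :+ w :* τ) (b :+ lit 4 :* (w :* Q)) ((1# - x) * q * B N ∷ x * x ^ N ∷ T N ∷ q ∷ []) (ge0 w (*≥0 x≥0 (^≥0 x≥0 N)) ⊗ le τ (lit 4 :* Q) T≤4q) refl)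
        where b = var 0F ; w = var 1F ; τ = var 2F ; Q = var 3F

  module OuterArc (t : F) (t>0 : 0# < t) (360t≤1 : ⟪ pos 360 ⟫ * t ≤ 1#) (N : ℕ)
    (Nt²≤ : # N * (t * t) ≤ 1# + ⟪ pos 2 ⟫ * (t * t))
    (tail : ⟪ pos 400 ⟫ * ((1# - t) ^ N * (# N * # N * (t * t) + ⟪ pos 2 ⟫ * (# N * t) + ⟪ pos 2 ⟫)) ≤ 1#) where

    open Sums t t>0 360t≤1 N Nt²≤ tail

    private
      t₊ : ∀ k → 0# ≤ t ^ k
      t₊ = ^≥0 t≥0
      half-sum : ∀ n → # n ≤ # ℕ.⌊ n /2⌋ + # ℕ.⌊ n /2⌋ + 1#
      half-sum zero = prove (lit 0) (lit 0 :+ lit 0 :+ lit 1) [] (nat 1) refl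
      half-sum (suc zero) = prove (lit 1) (lit 0 :+ lit 0 :+ lit 1) [] (nat 0) refl
      half-sum (suc (suc n)) = subst₂ (λ x y → x ≤ y + y + 1#) (sym (#-+ 2 n)) (sym (#-suc ℕ.⌊ n /2⌋))
        (prove (lit 2 :+ x) ((lit 1 :+ y) :+ (lit 1 :+ y) :+ lit 1) (# n ∷ # ℕ.⌊ n /2⌋ ∷ []) (le x (y :+ y :+ lit 1) (half-sum n)) refl)
        where x = var 0F ; y = var 1F

    -- On c ≤ c̄ each factor receives the largest integral exponent that `factor≤` admits; `d` is
    -- half of their sum, because that bound is for squares.
    module Tier (c̄ : F) (c̄≥0 : 0# ≤ c̄) where
      Y : ℕ → F
      Y m = v m * (⟪ pos 12 ⟫ * (# m * # m) - # m * # m * (# m * # m) * c̄)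

      exponent : ℕ → ℕ
      exponent m = ⌊ inv (# 3) * Y m ⌋

      private
        3Y : ∀ m → ⟪ pos 3 ⟫ * (inv (# 3) * Y m) ≡ Y m
        3Y m = prove= (lit 3 :* (i :* x)) x (inv (# 3) ∷ Y m ∷ []) (by= (lit 3 :* i) (lit 1) (reciprocal 2) x) refl
          where i = var 0F ; x = var 1F

      exponent-spec : ∀ k → exponent (suc k) ≡ 0 ⊎ ⟪ pos 3 ⟫ * # (exponent (suc k)) ≤ Y (suc k)
      exponent-spec k with ⌊⌋≡0⊎≤ (inv (# 3) * Y (suc k))
      ... | inj₁ p = inj₁ p
      ... | inj₂ p = inj₂ (≤-trans (prove (lit 3 :* var 0F) (lit 3 :* var 1F) (# (exponent (suc k)) ∷ inv (# 3) * Y (suc k) ∷ []) (nat 3 ⊗ le (var 0F) (var 1F) p) refl) (≤-reflexive (3Y (suc k))))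

      d : ℕ
      d = ℕ.⌊ sumℕ exponent N /2⌋

      2d≤ : d ℕ.+ d ℕ.≤ sumℕ exponent N
      2d≤ = subst (d ℕ.+ d ℕ.≤_) (ℕP.⌊n/2⌋+⌈n/2⌉≡n (sumℕ exponent N)) (ℕP.+-monoʳ-≤ d (ℕP.⌊n/2⌋≤⌈n/2⌉ (sumℕ exponent N)))

      private
        Σx : F
        Σx = Σ₁ (λ m → # (exponent m)) N
        ΣY≤ : ⟪ pos 12 ⟫ * V + ⟪ negsuc 0 ⟫ * c̄ * V₄ ≤ ⟪ pos 3 ⟫ * Σx + # N * ⟪ pos 3 ⟫
        ΣY≤ = ≤-trans (≤-reflexive (sym (trans (Σ₁-+ (λ m → ⟪ pos 12 ⟫ * vm² m) (λ m → ⟪ negsuc 0 ⟫ * c̄ * (v m * m⁴ m)) N) (cong₂ _+_ (Σ₁-* _ vm² N) (Σ₁-* _ (λ m → v m * m⁴ m) N)))))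
          (≤-trans (Σ₁≤ (λ m → ⟪ pos 12 ⟫ * vm² m + ⟪ negsuc 0 ⟫ * c̄ * (v m * m⁴ m)) (λ m → ⟪ pos 3 ⟫ * # (exponent m) + ⟪ pos 3 ⟫) N (λ k → pointwise (suc k)))
            (≤-reflexive (trans (Σ₁-+ (λ m → ⟪ pos 3 ⟫ * # (exponent m)) (λ _ → ⟪ pos 3 ⟫) N) (cong₂ _+_ (Σ₁-* _ (λ m → # (exponent m)) N) (Σ₁-const _ N)))))
          where
          pointwise : ∀ m → ⟪ pos 12 ⟫ * vm² m + ⟪ negsuc 0 ⟫ * c̄ * (v m * m⁴ m) ≤ ⟪ pos 3 ⟫ * # (exponent m) + ⟪ pos 3 ⟫
          pointwise m = prove (lit 12 :* (w :* (x :* x)) :+ con (negsuc 0) :* C :* (w :* (x :* x :* (x :* x)))) (lit 3 :* f :+ lit 3) (v m ∷ # m ∷ c̄ ∷ # (exponent m) ∷ inv (# 3) * Y m ∷ [])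
            (nat 3 ⊗ le y (f :+ lit 1) (≤⌊⌋+1 (inv (# 3) * Y m)) ⊕ eqn (lit 3 :* y) (w :* (lit 12 :* (x :* x) :- x :* x :* (x :* x) :* C)) (3Y m) (lit 1)) refl
            where w = var 0F ; x = var 1F ; C = var 2F ; f = var 3F ; y = var 4F

        ΣY≥ : ⟪ pos 3 ⟫ * Σx ≤ ⟪ pos 12 ⟫ * V
        ΣY≥ = ≤-trans (≤-reflexive (sym (Σ₁-* _ (λ m → # (exponent m)) N))) (≤-trans (Σ₁≤ (λ m → ⟪ pos 3 ⟫ * # (exponent m)) (λ m → ⟪ pos 12 ⟫ * vm² m) N pointwise) (≤-reflexive (Σ₁-* _ vm² N)))
          where
          pointwise : ∀ k → ⟪ pos 3 ⟫ * # (exponent (suc k)) ≤ ⟪ pos 12 ⟫ * vm² (suc k)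
          pointwise k with exponent-spec k
          ... | inj₁ p = subst (λ j → ⟪ pos 3 ⟫ * # j ≤ ⟪ pos 12 ⟫ * vm² (suc k)) (sym p) (prove (lit 3 :* lit 0) (lit 12 :* x) (vm² (suc k) ∷ []) (nat 12 ⊗ ge0 x (*≥0 (v≥0 (suc k)) (sq≥0 (# (suc k))))) refl)
            where x = var 0F
          ... | inj₂ p = ≤-trans p (prove (w :* (lit 12 :* (x :* x) :- x :* x :* (x :* x) :* C)) (lit 12 :* (w :* (x :* x))) (v (suc k) ∷ # (suc k) ∷ c̄ ∷ []) (ge0 w (v≥0 (suc k)) ⊗ (sq (x :* x) ⊗ ge0 C c̄≥0)) refl)
            where w = var 0F ; x = var 1F ; C = var 2F

      d≤2V : # d ≤ ⟪ pos 2 ⟫ * V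
      d≤2V = *-cancel-≤ (⟪⟫>0 5) (prove (lit 6 :* x) (lit 6 :* (lit 2 :* w)) (# d ∷ V ∷ Σx ∷ [])
        (le (lit 3 :* y) (lit 12 :* w) ΣY≥ ⊕ nat 3 ⊗ le (x :+ x) y (subst₂ _≤_ (#-+ d d) (#-sumℕ exponent N) (#-mono 2d≤))) refl)
        where x = var 0F ; w = var 1F ; y = var 2F

      -- Up to rounding, 6d is at least 12V - c̄V₄. The summand 4 pays for the N floors and for the
      -- halving.
      d≥ : ∀ B → t ^ 3 * (c̄ * V₄) ≤ B → ⟪ pos 359 ⟫ * (⟪ pos 12 ⟫ * (t ^ 3 * V)) ≤ ⟪ pos 359 ⟫ * (⟪ pos 6 ⟫ * (t ^ 3 * # d) + B) + ⟪ pos 4 ⟫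
      d≥ B h = prove (lit 359 :* (lit 12 :* (T :^ 3 :* w))) (lit 359 :* (lit 6 :* (T :^ 3 :* x) :+ b) :+ lit 4) (t ∷ V ∷ # d ∷ V₄ ∷ c̄ ∷ B ∷ Σx ∷ # N ∷ [])
        (nat 359 ⊗ (ge0 (T :^ 3) (t₊ 3) ⊗ le (lit 12 :* w :+ con (negsuc 0) :* C :* w₄) (lit 3 :* y :+ n :* lit 3) ΣY≤)
         ⊕ nat 1077 ⊗ (ge0 (T :^ 3) (t₊ 3) ⊗ le y (x :+ x :+ lit 1) (subst (_≤ # d + # d + 1#) (#-sumℕ exponent N) (half-sum (sumℕ exponent N))))
         ⊕ nat 359 ⊗ le (T :^ 3 :* (C :* w₄)) b h ⊕ nat 3 ⊗ le (lit 359 :* (n :* T :^ 3)) (lit 1) Nt³≤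
         ⊕ nat 3 ⊗ (ge0 T t≥0 ⊗ le (lit 129600 :* (T :* T)) (lit 1) t²) ⊕ le (lit 360 :* T) (lit 1) 360t≤1 ⊕ nat 357 ⊗ ge0 T t≥0 ⊕ nat 387723 ⊗ ge0 (T :^ 3) (t₊ 3)) refl
        where T = var 0F ; w = var 1F ; x = var 2F ; w₄ = var 3F ; C = var 4F ; b = var 5F ; y = var 6F ; n = var 7F

    module Spread (a : F) (a²≤1 : a * a ≤ 1#) where
      open Unit a a²≤1 using (c; c≥0; c[_]; c[]≥; c[]≥0)
      Z : F
      Z = Σ₁ (λ m → v m * c[ m ]) N

      private
        module P₁ = Poisson a a²≤1 ρ ρ≥0 ρ≤1
        ρ²≤1 : ρ * ρ ≤ 1#
        ρ²≤1 = prove (x :* x) (lit 1) (ρ ∷ []) (le x (lit 1) ρ≤1 ⊗ (ge0 x ρ≥0 ⊕ nat 1)) refl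
          where x = var 0F
        module P₂ = Poisson a a²≤1 (ρ * ρ) (*≥0 ρ≥0 ρ≥0) ρ²≤1
        t²>0 : 0# < t * t
        t²>0 = *>0 t>0 t>0

        12Z≥ : ⟪ pos 12 ⟫ * c * V + ⟪ negsuc 0 ⟫ * (c * c) * V₄ ≤ ⟪ pos 12 ⟫ * Z
        12Z≥ = ≤-trans (≤-reflexive (sym (trans (Σ₁-+ (λ m → ⟪ pos 12 ⟫ * c * vm² m) (λ m → ⟪ negsuc 0 ⟫ * (c * c) * (v m * m⁴ m)) N) (cong₂ _+_ (Σ₁-* _ vm² N) (Σ₁-* _ (λ m → v m * m⁴ m) N)))))
          (≤-trans (Σ₁≤ (λ m → ⟪ pos 12 ⟫ * c * vm² m + ⟪ negsuc 0 ⟫ * (c * c) * (v m * m⁴ m)) (λ m → ⟪ pos 12 ⟫ * (v m * c[ m ])) N (λ k → pointwise (suc k))) (≤-reflexive (Σ₁-* _ (λ m → v m * c[ m ]) N)))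
          where
          pointwise : ∀ m → ⟪ pos 12 ⟫ * c * vm² m + ⟪ negsuc 0 ⟫ * (c * c) * (v m * m⁴ m) ≤ ⟪ pos 12 ⟫ * (v m * c[ m ])
          pointwise m = prove (lit 12 :* C :* (w :* (L :* L)) :+ con (negsuc 0) :* (C :* C) :* (w :* (L :* L :* (L :* L)))) (lit 12 :* (w :* y)) (c ∷ v m ∷ # m ∷ c[ m ] ∷ [])
            (ge0 w (v≥0 m) ⊗ (le (L :* L :* (lit 12 :* C) :- L :* L :* (L :* L :- lit 1) :* (C :* C)) (lit 12 :* y) (c[]≥ m) ⊕ sq (L :* C))) refl
            where C = var 0F ; w = var 1F ; L = var 2F ; y = var 3F

        -- With s = c/t², the quartic expansion gives tZ ≥ 1.6s - 2s², which is concave in s and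
        -- above 0.295 at both ends s = 0.3364 and s = 0.5.
        near : ⟪ pos 841 ⟫ * (t * t) ≤ ⟪ pos 2500 ⟫ * c → ⟪ pos 2 ⟫ * c ≤ t * t → ⟪ pos 295 ⟫ ≤ ⟪ pos 1000 ⟫ * (t * Z)
        near h₁ h₂ = *-cancel-≤ {x = t * t * (t * t)} (*>0 t²>0 t²>0) (*-cancel-≤ (⟪⟫>0 59) (prove
          (lit 60 :* (T :* T :* (T :* T) :* lit 295)) (lit 60 :* (T :* T :* (T :* T) :* (lit 1000 :* (T :* z)))) (t ∷ c ∷ V ∷ V₄ ∷ Z ∷ [])
          (nat 5000 ⊗ (ge0 (T :^ 5) (t₊ 5) ⊗ le (lit 12 :* C :* w :+ con (negsuc 0) :* (C :* C) :* w₄) (lit 12 :* z) 12Z≥)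
           ⊕ nat 12000 ⊗ (ge0 C c≥0 ⊗ sq T ⊗ le (lit 8) (lit 5 :* (T :^ 3 :* w)) V≥)
           ⊕ nat 5000 ⊗ (sq C ⊗ le (T :^ 5 :* w₄) (lit 24) V₄≤)
           ⊕ nat 24 ⊗ (le (lit 841 :* (T :* T)) (lit 2500 :* C) h₁ ⊗ le (lit 2 :* C) (T :* T) h₂)
           ⊕ nat 2184 ⊗ (sq T ⊗ le (lit 2 :* C) (T :* T) h₂) ⊕ nat 300 ⊗ sq (T :* T)) refl))
          where T = var 0F ; C = var 1F ; w = var 2F ; w₄ = var 3F ; z = var 4F

        4Z≥ : ⟪ pos 2 ⟫ * P₁.B N + ⟪ negsuc 0 ⟫ * P₂.B N ≤ ⟪ pos 4 ⟫ * Z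
        4Z≥ = ≤-trans (≤-reflexive (sym (trans (Σ₁-+ (λ m → ⟪ pos 2 ⟫ * (c[ m ] * ρ ^ m)) (λ m → ⟪ negsuc 0 ⟫ * (c[ m ] * (ρ * ρ) ^ m)) N) (cong₂ _+_ (Σ₁-* _ (λ m → c[ m ] * ρ ^ m) N) (Σ₁-* _ (λ m → c[ m ] * (ρ * ρ) ^ m) N)))))
          (≤-trans (Σ₁≤ (λ m → ⟪ pos 2 ⟫ * (c[ m ] * ρ ^ m) + ⟪ negsuc 0 ⟫ * (c[ m ] * (ρ * ρ) ^ m)) (λ m → ⟪ pos 4 ⟫ * (v m * c[ m ])) N (λ k → pointwise (suc k))) (≤-reflexive (Σ₁-* _ (λ m → v m * c[ m ]) N)))
          where
          pointwise : ∀ m → ⟪ pos 2 ⟫ * (c[ m ] * ρ ^ m) + ⟪ negsuc 0 ⟫ * (c[ m ] * (ρ * ρ) ^ m) ≤ ⟪ pos 4 ⟫ * (v m * c[ m ])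
          pointwise m = subst (λ x → ⟪ pos 2 ⟫ * (c[ m ] * ρ ^ m) + ⟪ negsuc 0 ⟫ * (c[ m ] * x) ≤ ⟪ pos 4 ⟫ * (v m * c[ m ])) (sym (^-distrib-* ρ ρ m))
            (prove (lit 2 :* (x :* y) :+ con (negsuc 0) :* (x :* (y :* y))) (lit 4 :* (w :* x)) (c[ m ] ∷ ρ ^ m ∷ v m ∷ []) (ge0 x (c[]≥0 m) ⊗ le (lit 2 :* y :- y :* y) (lit 4 :* w) (v≥quadratic m)) refl)
            where x = var 0F ; y = var 1F ; w = var 2F

        B₁≥ : ⟪ pos 200 ⟫ * ((⟪ pos 2 ⟫ - ⟪ pos 3 ⟫ * t) * c) ≤ (⟪ pos 200 ⟫ * (t * P₁.B N) + 1#) * (t * t + c)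
        B₁≥ = prove (lit 200 :* ((lit 2 :- lit 3 :* T) :* C)) ((lit 200 :* (T :* b) :+ lit 1) :* (T :* T :+ C)) (t ∷ c ∷ P₁.B N ∷ ρ ^ N ∷ [])
          (nat 200 ⊗ le (x :* (lit 1 :+ x) :* C) (d :* (d :* d :+ x :* C) :* b :+ lit 4 :* (x :* y :* (d :* d :+ x :* C))) (P₁.B≥ N)
           ⊕ nat 200 ⊗ (sq T ⊗ ge0 C c≥0) ⊕ nat 200 ⊗ (sq T ⊗ ge0 C c≥0 ⊗ ge0 b b≥0)
           ⊕ ge0 (x :* y) (*≥0 ρ≥0 (^≥0 ρ≥0 N)) ⊗ (nat 800 ⊗ (ge0 T t≥0 ⊗ ge0 C c≥0))
           ⊕ le (lit 800 :* y) (lit 1) ρ^N-small ⊗ (ge0 x ρ≥0 ⊗ (sq T ⊕ ge0 C c≥0)) ⊕ ge0 T t≥0 ⊗ (sq T ⊕ ge0 C c≥0)) refl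
          where
          T = var 0F ; C = var 1F ; b = var 2F ; y = var 3F ; x = lit 1 :- T ; d = lit 1 :- x
          b≥0 : 0# ≤ P₁.B N
          b≥0 = Σ₁≥0 (λ k → *≥0 (c[]≥0 (suc k)) (^≥0 ρ≥0 (suc k))) N

        B₂≤ : 0# < c → t * P₂.B N * (⟪ pos 4 ⟫ * (t * t) + c) ≤ c
        B₂≤ c>0 = *-cancel-≤ {x = (1# + ρ) * P₂.q} (*>0 (<-≤-trans (⟪⟫>0 0) (prove⁺ (lit 1) (lit 1 :+ var 0F) (ρ≥0 ∷ []) refl)) q>0)
          (prove ((lit 1 :+ x) :* q :* (T :* b :* (lit 4 :* (T :* T) :+ C))) ((lit 1 :+ x) :* q :* C) (t ∷ c ∷ P₂.B N ∷ [])
            (le ((lit 1 :- x :* x) :* q :* b) (x :* x :* (lit 1 :+ x :* x) :* C) (P₂.B≤ N) ⊗ (nat 4 ⊗ sq T ⊕ ge0 C c≥0)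
             ⊕ ge0 C c≥0 ⊗ (sq T ⊗ ((ge0 x ρ≥0 ⊕ nat 1) ⊗ sq T ⊕ nat 4 ⊗ (ge0 x ρ≥0 ⊗ ge0 T t≥0 ⊗ (nat 1 ⊕ ge0 x ρ≥0 ⊕ sq x))) ⊕ ge0 C c≥0 ⊗ (sq x ⊗ ge0 x ρ≥0 ⊗ ge0 T t≥0))) refl)
          where
          T = var 0F ; C = var 1F ; b = var 2F ; x = lit 1 :- T ; q = (lit 1 :- x :* x) :* (lit 1 :- x :* x) :+ x :* x :* C
          q>0 : 0# < P₂.q
          q>0 = <-≤-trans t²>0 (prove (T′ :* T′) (q′) (t ∷ c ∷ []) (sq x′ ⊗ ge0 C′ c≥0 ⊕ sq T′ ⊗ (ge0 x′ ρ≥0 ⊗ (ge0 x′ ρ≥0 ⊕ nat 2))) refl)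
            where T′ = var 0F ; C′ = var 1F ; x′ = lit 1 :- T′ ; q′ = (lit 1 :- x′ :* x′) :* (lit 1 :- x′ :* x′) :+ x′ :* x′ :* C′

        -- With s = c/t², the Poisson kernels at ρ and ρ² bound tZ below by about s/(1 + s) - s/(4(4
        -- + s)). This increases in s and is 0.305 at s = 1/2.
        far : t * t ≤ ⟪ pos 2 ⟫ * c → ⟪ pos 295 ⟫ ≤ ⟪ pos 1000 ⟫ * (t * Z)
        far h = *-cancel-≤ {x = (t * t + c) * (⟪ pos 4 ⟫ * (t * t) + c)} E>0 (*-cancel-≤ (⟪⟫>0 11) (prove
          (lit 12 :* ((T :* T :+ C) :* (lit 4 :* (T :* T) :+ C) :* lit 295)) (lit 12 :* ((T :* T :+ C) :* (lit 4 :* (T :* T) :+ C) :* (lit 1000 :* (T :* z))))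
          (t ∷ c ∷ P₁.B N ∷ P₂.B N ∷ Z ∷ [])
          (nat 3000 ⊗ (t²+c ⊗ 4t²+c ⊗ (ge0 T t≥0 ⊗ le (lit 2 :* b₁ :+ con (negsuc 0) :* b₂) (lit 4 :* z) 4Z≥))
           ⊕ nat 30 ⊗ (4t²+c ⊗ le (lit 200 :* ((lit 2 :- lit 3 :* T) :* C)) ((lit 200 :* (T :* b₁) :+ lit 1) :* (T :* T :+ C)) B₁≥)
           ⊕ nat 3000 ⊗ (t²+c ⊗ le (T :* b₂ :* (lit 4 :* (T :* T) :+ C)) C (B₂≤ c>0))
           ⊕ nat 50 ⊗ (ge0 C c≥0 ⊗ 4t²+c ⊗ le (lit 360 :* T) (lit 1) 360t≤1)
           ⊕ le (T :* T) (lit 2 :* C) h ⊗ (nat 2690 ⊗ ge0 C c≥0 ⊕ nat 14820 ⊗ sq T) ⊕ nat 540 ⊗ sq (T :* T)) refl))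
          where
          T = var 0F ; C = var 1F ; b₁ = var 2F ; b₂ = var 3F ; z = var 4F
          t²+c 4t²+c : Nn (t ∷ c ∷ P₁.B N ∷ P₂.B N ∷ Z ∷ [])
          t²+c = sq T ⊕ ge0 C c≥0
          4t²+c = nat 4 ⊗ sq T ⊕ ge0 C c≥0
          c>0 : 0# < c
          c>0 q = t²>0 (≤-trans h (prove (lit 2 :* x) (lit 0) (c ∷ []) (nat 2 ⊗ le x (lit 0) q) refl))
            where x = var 0F
          E>0 : 0# < (t * t + c) * (⟪ pos 4 ⟫ * (t * t) + c)
          E>0 = *>0 (<-≤-trans c>0 (prove y (x :* x :+ y) (t ∷ c ∷ []) (sq x) refl)) (<-≤-trans c>0 (prove y (lit 4 :* (x :* x) :+ y) (t ∷ c ∷ []) (nat 4 ⊗ sq x) refl))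
            where x = var 0F ; y = var 1F

      spread : ⟪ pos 841 ⟫ * (t * t) ≤ ⟪ pos 2500 ⟫ * c → ⟪ pos 295 ⟫ ≤ ⟪ pos 1000 ⟫ * (t * Z)
      spread h with ≤-total (⟪ pos 2 ⟫ * c) (t * t)
      ... | inj₁ q = near h q
      ... | inj₂ q = far q

-- The error term of the minor arcs

module MinorArcs where
  open Inequalities
  open PowersOfUnit
  open UpperBounds using (^-distrib-*)
  open CentralArcs using (reciprocal)
  open import Data.Nat.Base as ℕ using (ℕ; suc; zero)
  import Data.Nat.Properties as ℕP
  open Rounding using (#-mono)
  open import Data.Unit.Base using (tt)

  ^-* : ∀ x m n → (x ^ m) ^ n ≡ x ^ (n ℕ.* m)
  ^-* x m zero = refl
  ^-* x m (suc n) = trans (cong (x ^ m *_) (^-* x m n)) (sym (^-+ x m (n ℕ.* m)))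

  #-^ : ∀ m n → # (m ℕ.^ n) ≡ # m ^ n
  #-^ m zero = refl
  #-^ m (suc n) = trans (⟪⟫-*′ m (m ℕ.^ n)) (cong (# m *_) (#-^ m n))
    where
    open import Data.Integer.Properties using (pos-*)
    ⟪⟫-*′ : ∀ m n → # (m ℕ.* n) ≡ # m * # n
    ⟪⟫-*′ m n = trans (cong ⟪_⟫ (pos-* m n)) (⟪⟫-* (pos m) (pos n))

  1+≤ : ∀ {y} → 0# ≤ y → ∀ k → 1# + # k * y ≤ (1# + y) ^ k
  1+≤ {y} y≥0 zero = prove (lit 1 :+ lit 0 :* var 0F) (lit 1) (y ∷ []) (nat 0) refl
  1+≤ {y} y≥0 (suc k) = subst (λ n → 1# + n * y ≤ (1# + y) ^ suc k) (sym (#-suc k))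
    (prove (lit 1 :+ (lit 1 :+ n) :* Y) ((lit 1 :+ Y) :* w) (y ∷ # k ∷ (1# + y) ^ k ∷ [])
      ((nat 1 ⊕ ge0 Y y≥0) ⊗ le (lit 1 :+ n :* Y) w (1+≤ y≥0 k) ⊕ ge0 n (⟪⟫≥0 k) ⊗ sq Y) refl)
    where Y = var 0F ; n = var 1F ; w = var 2F

  module MinorArc (t : F) (t>0 : 0# < t) (360t≤1 : ⟪ pos 360 ⟫ * t ≤ 1#) where
    private
      t≥0 = <⇒≤ t>0
      S : F
      S = inv t
      tS : t * S ≡ 1#
      tS = inv-eq t>0
      S≥ : ⟪ pos 360 ⟫ ≤ S
      S≥ = prove (lit 360) s (t ∷ S ∷ []) (ge0 s (inv≥0 t>0) ⊗ le (lit 360 :* T) (lit 1) 360t≤1 ⊕ eqn (T :* s) (lit 1) tS (lit 360)) refl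
        where T = var 0F ; s = var 1F
    W : F
    W = ⟪ pos 295 ⟫ * (inv (# 1000) * inv t)
    W≥0 : 0# ≤ W
    W≥0 = *≥0 (⟪⟫≥0 295) (*≥0 (inv≥0 (⟪⟫>0 999)) (inv≥0 t>0))

    W≤ : ∀ z → ⟪ pos 295 ⟫ ≤ ⟪ pos 1000 ⟫ * (t * z) → W ≤ z
    W≤ z h = prove (lit 295 :* (i :* s)) x (t ∷ S ∷ inv (# 1000) ∷ z ∷ [])
      (ge0 s (inv≥0 t>0) ⊗ (ge0 i (inv≥0 (⟪⟫>0 999)) ⊗ le (lit 295) (lit 1000 :* (T :* x)) h)
       ⊕ eqn (lit 1000 :* i) (lit 1) (reciprocal 999) (:- (T :* s :* x)) ⊕ eqn (T :* s) (lit 1) tS (:- x)) refl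
      where T = var 0F ; s = var 1F ; i = var 2F ; x = var 3F

    abstract
      -- g^4996 = (1 + W/4996)^4996 stands in for e^W with W = 0.295/t.
      g : F
      g = 1# + inv (# 4996) * W
      g-def : g ≡ 1# + inv (# 4996) * W
      g-def = refl

    private
      -- g₀ is g at t = 1/360, rounded down. Since 119880 = 333 · 360, one has 1 + 333y = 1/(360t),
      -- so Bernoulli carries the bound at 1/360 to every smaller t.
      g₀ y : F
      g₀ = ⟪ pos 10212 ⟫ * inv (# 10000)
      y = inv (# 119880) * (S - ⟪ pos 360 ⟫)
      y≥0 : 0# ≤ y
      y≥0 = *≥0 (inv≥0 (⟪⟫>0 119879)) (sub≥0 S≥)
      g₀≥0 : 0# ≤ g₀
      g₀≥0 = *≥0 (⟪⟫≥0 10212) (inv≥0 (⟪⟫>0 9999))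

      4996000g : ⟪ pos 4996000 ⟫ * g ≡ ⟪ pos 4996000 ⟫ + ⟪ pos 295 ⟫ * S
      4996000g = trans (cong (⟪ pos 4996000 ⟫ *_) g-def) (prove= (lit 4996000 :* (lit 1 :+ k :* (lit 295 :* (l :* s)))) (lit 4996000 :+ lit 295 :* s)
        (S ∷ inv (# 4996) ∷ inv (# 1000) ∷ []) (by= (lit 4996 :* k) (lit 1) (reciprocal 4995) (lit 295000 :* (l :* s)) ⊞ by= (lit 1000 :* l) (lit 1) (reciprocal 999) (lit 295 :* s)) refl)
        where s = var 0F ; k = var 1F ; l = var 2F

      g≥ : g₀ * (1# + y) ≤ g
      g≥ = *-cancel-≤ (⟪⟫>0 (119880 ℕ.* 10000 ℕ.* 4996000 ℕ.∸ 1)) (prove (con (pos K′) :* (x :* (lit 1 :+ Y))) (con (pos K′) :* G) (S ∷ g ∷ g₀ ∷ y ∷ [])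
        (eqn (lit 4996000 :* G) (lit 4996000 :+ lit 295 :* s) 4996000g (con (pos (119880 ℕ.* 10000)))
         ⊕ eqn (lit 10000 :* x) (lit 10212) 10000g₀ (:- (con (pos (4996000 ℕ.* 119880)) :* (lit 1 :+ Y)))
         ⊕ eqn (lit 119880 :* Y) (s :- lit 360) 119880y (:- con (pos (4996000 ℕ.* 10212)))
         ⊕ nat 302626848000 ⊗ le (lit 360) s S≥ ⊕ nat (119880 ℕ.* 10000 ℕ.* (4996000 ℕ.+ 295 ℕ.* 360) ℕ.∸ 4996000 ℕ.* 10212 ℕ.* 119880)) refl)
        where
        K′ = 119880 ℕ.* 10000 ℕ.* 4996000
        s = var 0F ; G = var 1F ; x = var 2F ; Y = var 3F
        10000g₀ : ⟪ pos 10000 ⟫ * g₀ ≡ ⟪ pos 10212 ⟫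
        10000g₀ = prove= (lit 10000 :* (lit 10212 :* i)) (lit 10212) (inv (# 10000) ∷ []) (by= (lit 10000 :* i) (lit 1) (reciprocal 9999) (lit 10212)) refl
          where i = var 0F
        119880y : ⟪ pos 119880 ⟫ * y ≡ S - ⟪ pos 360 ⟫
        119880y = prove= (lit 119880 :* (i :* z)) z (inv (# 119880) ∷ S - ⟪ pos 360 ⟫ ∷ []) (by= (lit 119880 :* i) (lit 1) (reciprocal 119879) z) refl
          where i = var 0F ; z = var 1F

      -- The only large evaluation here: 1.0212^333 exceeds 1080 = 3 · 360, compared as integers.
      g₀^333≥ : ⟪ pos 1080 ⟫ ≤ g₀ ^ 333
      g₀^333≥ = *-cancel-≤ {x = # 10000 ^ 333} (λ q → ⟪⟫>0 0 (≤-trans (#-mono (ℕP.m^n>0 10000 333)) (≤-trans (≤-reflexive (#-^ 10000 333)) q)))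
        (≤-trans (≤-reflexive (trans (cong (_* ⟪ pos 1080 ⟫) (sym (#-^ 10000 333))) (sym (⟪⟫-* (pos (10000 ℕ.^ 333)) (pos 1080)))))
          (≤-trans (#-mono (ℕP.≤ᵇ⇒≤ (10000 ℕ.^ 333 ℕ.* 1080) (10212 ℕ.^ 333) tt))
            (≤-reflexive (trans (#-^ 10212 333) (trans (cong (_^ 333) 10212≡) (^-distrib-* (# 10000) g₀ 333))))))
        where
        10212≡ : # 10212 ≡ # 10000 * g₀
        10212≡ = sym (prove= (lit 10000 :* (lit 10212 :* i)) (lit 10212) (inv (# 10000) ∷ []) (by= (lit 10000 :* i) (lit 1) (reciprocal 9999) (lit 10212)) refl)
          where i = var 0F

      1+y>0 : 0# ≤ 1# + y
      1+y>0 = +≥0 (⟪⟫≥0 1) y≥0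

      tg^333≥ : ⟪ pos 3 ⟫ ≤ t * g ^ 333
      tg^333≥ = ≤-trans (prove (lit 3) (T :* (lit 3 :* s)) (t ∷ S ∷ []) (eqn (T :* s) (lit 1) tS (lit 3)) refl)
        (*-mono t≥0 (*≥0 (⟪⟫≥0 3) (inv≥0 t>0)) ≤-refl
          (≤-trans 3S≤ (≤-trans (*-mono (⟪⟫≥0 1080) (+≥0 (⟪⟫≥0 1) (*≥0 (⟪⟫≥0 333) y≥0)) g₀^333≥ (1+≤ y≥0 333))
            (≤-trans (≤-reflexive (sym (^-distrib-* g₀ (1# + y) 333))) (^-mono (*≥0 g₀≥0 1+y>0) g≥ 333)))))
        where
        T = var 0F ; s = var 1F
        3S≤ : ⟪ pos 3 ⟫ * S ≤ ⟪ pos 1080 ⟫ * (1# + ⟪ pos 333 ⟫ * y)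
        3S≤ = prove (lit 3 :* s′) (lit 1080 :* (lit 1 :+ lit 333 :* (i :* (s′ :- lit 360)))) (S ∷ inv (# 119880) ∷ [])
          (eqn (lit 119880 :* i) (lit 1) (reciprocal 119879) (lit 3 :* (s′ :- lit 360))) refl
          where s′ = var 0F ; i = var 1F

      1≤g : 1# ≤ g
      1≤g = subst (1# ≤_) (sym g-def) (prove (lit 1) (lit 1 :+ var 0F) (inv (# 4996) * W ∷ []) (ge0 (var 0F) (*≥0 (inv≥0 (⟪⟫>0 4995)) W≥0)) refl)
      g>0 : 0# < g
      g>0 = <-≤-trans (⟪⟫>0 0) 1≤g
      g^>0 : ∀ k → 0# < g ^ k
      g^>0 zero = ⟪⟫>0 0
      g^>0 (suc k) = *>0 g>0 (g^>0 k)

    -- Since (3/t)¹⁵ ≤ g⁴⁹⁹⁵, η is negligible against t^(15/2).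
    η : F
    η = inv (g ^ 2498)
    η≥0 : 0# ≤ η
    η≥0 = inv≥0 (g^>0 2498)

    η²g : η * η * g ^ 4996 ≡ 1#
    η²g = trans (cong (η * η *_) (^-+ g 2498 2498)) (prove= (i :* i :* (G :* G)) (lit 1) (g ^ 2498 ∷ η ∷ []) (by= (G :* i) (lit 1) (inv-eq (g^>0 2498)) (G :* i :+ lit 1)) refl)
      where G = var 0F ; i = var 1F

    abstract
      H : ℕ
      H = 4995
      H-def : H ≡ 4995
      H-def = refl

    1≤η²g : 1# ≤ η * η * (1# + inv (# (suc H)) * W) ^ suc H
    1≤η²g = subst (λ k → 1# ≤ η * η * (1# + inv (# (suc k)) * W) ^ suc k) (sym H-def)
      (subst (λ x → 1# ≤ η * η * x ^ 4996) g-def (≤-reflexive (sym η²g)))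

    η-small : ⟪ pos 14348907 ⟫ * (η * η) ≤ t ^ 15
    η-small = ≤-trans (prove (lit 14348907 :* e) (e :* (T :* G)) (η * η ∷ t ^ 15 ∷ g ^ 4996 ∷ [])
        (ge0 e (sq≥0 η) ⊗ le (lit 14348907) (T :* G) powers) refl)
      (≤-reflexive (prove= (e :* (T :* G)) T (η * η ∷ t ^ 15 ∷ g ^ 4996 ∷ []) (by= (e :* G) (lit 1) η²g T) refl))
      where
      e = var 0F ; T = var 1F ; G = var 2F
      powers : ⟪ pos 14348907 ⟫ ≤ t ^ 15 * g ^ 4996
      powers = ≤-trans (≤-reflexive (#-^ 3 15)) (≤-trans (^-mono (⟪⟫≥0 3) tg^333≥ 15) (≤-trans (≤-reflexive (trans (^-distrib-* t (g ^ 333) 15) (cong (t ^ 15 *_) (^-* g 333 15))))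
        (≤-trans (prove (x :* y′) (x :* (u :* y′)) (t ^ 15 ∷ g ^ 4995 ∷ g ∷ []) (ge0 x (^≥0 t≥0 15) ⊗ ge0 y′ (<⇒≤ (g^>0 4995)) ⊗ le (lit 1) u 1≤g) refl) ≤-refl)))
        where x = var 0F ; y′ = var 1F ; u = var 2F

-- Moments of the minorant and their consequences

module Moments where
  open Inequalities
  open PowersOfUnit
  open BinomialKernel
  open PairProducts using (abs-square)
  open UpperBounds using (^-distrib-*)
  open Rounding using (#-mono)
  open MinorArcs using (#-^)
  open import Data.Nat.Base as ℕ using (ℕ; suc; zero)
  import Data.Nat.Properties as ℕP

  -- γ(d)²d increases (towards 1/π): after `γ-suc` the step is 4d(d + 1) ≤ (2d + 1)².
  γ²d-step : ∀ d → γ d * γ d * # d ≤ γ (suc d) * γ (suc d) * # (suc d)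
  γ²d-step d = subst (λ z → γ d * γ d * # d ≤ γ (suc d) * γ (suc d) * z) (sym (#-suc d)) (*-cancel-≤ {x = 1# + # d} n>0 (*-cancel-≤ (⟪⟫>0 3)
    (prove (lit 4 :* ((lit 1 :+ n) :* (x :* x :* n))) (lit 4 :* ((lit 1 :+ n) :* (y :* y :* (lit 1 :+ n)))) (# d ∷ γ d ∷ γ (suc d) ∷ [])
      (sq x ⊕ eqn ((lit 2 :* n :+ lit 2) :* y) ((lit 2 :* n :+ lit 1) :* x) (γ-suc d) ((lit 2 :* n :+ lit 2) :* y :+ (lit 2 :* n :+ lit 1) :* x)) refl)))
    where
    n = var 0F ; x = var 1F ; y = var 2F
    n>0 : 0# < 1# + # d
    n>0 = subst (0# <_) (#-suc d) (⟪⟫>0 d)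

  γ²d-mono : ∀ {d d′} → d ℕ.≤ d′ → γ d * γ d * # d ≤ γ d′ * γ d′ * # d′
  γ²d-mono {d} {d′} p = subst (λ k → γ d * γ d * # d ≤ γ k * γ k * # k) (ℕP.m∸n+n≡m p) (go (d′ ℕ.∸ d))
    where
    go : ∀ j → γ d * γ d * # d ≤ γ (j ℕ.+ d) * γ (j ℕ.+ d) * # (j ℕ.+ d)
    go zero = ≤-refl
    go (suc j) = ≤-trans (go j) (γ²d-step (j ℕ.+ d))

  β00 : β 0 0 ≡ 1#
  β00 = refl
  β10 : β 1 0 ≡ ⟪ pos 2 ⟫
  β10 = trans (ring x ((lit 0 :+ lit 0 :+ lit 1) :* x) (β 1 0 ∷ []) refl) (trans (β-suc 0 0) (ring ((lit 4 :* lit 0 :+ lit 2) :* lit 1) (lit 2) [] refl))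
    where x = var 0F
  β20 : β 2 0 ≡ ⟪ pos 6 ⟫
  β20 = *-cancel (⟪⟫>0 1) (trans (ring (lit 2 :* x) ((lit 0 :+ lit 1 :+ lit 1) :* x) (β 2 0 ∷ []) refl) (trans (β-suc 1 0) (trans (cong ((⟪ pos 4 ⟫ * # 1 + ⟪ pos 2 ⟫) *_) β10) (ring ((lit 4 :* lit 1 :+ lit 2) :* lit 2) (lit 2 :* lit 6) [] refl))))
    where x = var 0F

  γ>0 : ∀ d → 0# < γ d
  γ>0 zero = ⟪⟫>0 0
  γ>0 (suc d) q = γ>0 d (*-cancel-≤ {x = ⟪ pos 2 ⟫ * # d + 1#} (<-≤-trans (⟪⟫>0 0) (prove⁺ (lit 1) (lit 2 :* var 0F :+ lit 1) (⟪⟫≥0 d ∷ []) refl))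
    (≤-trans (≤-reflexive (sym (γ-suc d))) (prove ((lit 2 :* n :+ lit 2) :* y) ((lit 2 :* n :+ lit 1) :* lit 0) (# d ∷ γ (suc d) ∷ []) ((nat 2 ⊗ ge0 n (⟪⟫≥0 d) ⊕ nat 2) ⊗ le y (lit 0) q) refl)))
    where n = var 0F ; y = var 1F

  β≥0 : ∀ r d → 0# ≤ β r d
  β≥0 zero d = <⇒≤ (γ>0 d)
  β≥0 (suc r) d = cancel≥0 {x = # d + # r + 1#} (<-≤-trans (⟪⟫>0 0) (prove⁺ (lit 1) (var 0F :+ var 1F :+ lit 1) (⟪⟫≥0 d ∷ ⟪⟫≥0 r ∷ []) refl))
    (subst (0# ≤_) (sym (β-suc r d)) (*≥0 (+≥0 (*≥0 (⟪⟫≥0 4) (⟪⟫≥0 r)) (⟪⟫≥0 2)) (β≥0 r d)))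

  -- Equality at d = 1, where γ = 1/2, propagated by monotonicity.
  4dγ²≥1 : ∀ d → 1# ≤ ⟪ pos 4 ⟫ * (# (suc d) * (γ (suc d) * γ (suc d)))
  4dγ²≥1 d = ≤-trans (prove (lit 1) (lit 4 :* (x :* x :* lit 1)) (γ 1 ∷ []) (eqn ((lit 2 :* lit 0 :+ lit 2) :* x) ((lit 2 :* lit 0 :+ lit 1) :* lit 1) (γ-suc 0) (lit 2 :* x :+ lit 1)) refl)
    (prove (lit 4 :* y) (lit 4 :* (n :* z)) (γ 1 * γ 1 * # 1 ∷ # (suc d) ∷ γ (suc d) * γ (suc d) ∷ []) (nat 4 ⊗ le y (z :* n) (γ²d-mono {1} {suc d} (ℕ.s≤s ℕ.z≤n))) refl)
    where x = var 0F ; y = var 0F ; n = var 1F ; z = var 2F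

  -- The numerators of the telescoped ratios `β-suc` when their denominators are replaced by aV/b.
  ∏ : ℕ → ℕ → ℕ
  ∏ b zero = 1
  ∏ b (suc k) = ∏ b k ℕ.* ((4 ℕ.* k ℕ.+ 2) ℕ.* b)

  #-* : ∀ i j → # (i ℕ.* j) ≡ # i * # j
  #-* i j = trans (cong ⟪_⟫ (pos-* i j)) (⟪⟫-* (pos i) (pos j))
    where open import Data.Integer.Properties using (pos-*)

  module _ (V : F) (V≥0 : 0# ≤ V) (d a b : ℕ) (aV≤bd : # a * V ≤ # b * # d) where
    β-step : ∀ k → # a * V * β (suc k) d ≤ # ((4 ℕ.* k ℕ.+ 2) ℕ.* b) * β k d
    β-step k = ≤-trans (prove (A :* w :* y) (B :* ((D :+ K′ :+ lit 1) :* y)) (# a ∷ V ∷ # b ∷ # d ∷ # k ∷ β (suc k) d ∷ [])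
        (le (A :* w) (B :* D) aV≤bd ⊗ ge0 y (β≥0 (suc k) d) ⊕ ge0 B (⟪⟫≥0 b) ⊗ ((ge0 K′ (⟪⟫≥0 k) ⊕ nat 1) ⊗ ge0 y (β≥0 (suc k) d))) refl)
      (≤-reflexive (trans (cong (# b *_) (β-suc k d)) (trans (ring (B′ :* ((lit 4 :* K″ :+ lit 2) :* x)) ((lit 4 :* K″ :+ lit 2) :* B′ :* x) (# b ∷ # k ∷ β k d ∷ []) refl)
        (cong (_* β k d) (sym (trans (#-* (4 ℕ.* k ℕ.+ 2) b) (cong (_* # b) (trans (⟪⟫-+ (pos (4 ℕ.* k)) (pos 2)) (cong (_+ ⟪ pos 2 ⟫) (#-* 4 k))))))))))
      where
      A = var 0F ; w = var 1F ; B = var 2F ; D = var 3F ; K′ = var 4F ; y = var 5F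
      B′ = var 0F ; K″ = var 1F ; x = var 2F

    β-upper : ∀ k → (# a * V) ^ k * β k d ≤ # (∏ b k) * γ d
    β-upper zero = ≤-refl
    β-upper (suc k) = ≤-trans (prove (x :* X :* y) (X :* (q :* z)) (# a * V ∷ (# a * V) ^ k ∷ β (suc k) d ∷ # ((4 ℕ.* k ℕ.+ 2) ℕ.* b) ∷ β k d ∷ [])
        (ge0 X (^≥0 (*≥0 (⟪⟫≥0 a) V≥0) k) ⊗ le (x :* y) (q :* z) (β-step k)) refl)
      (≤-trans (prove (X′ :* (q′ :* z′)) (u :* q′ :* g) ((# a * V) ^ k ∷ # ((4 ℕ.* k ℕ.+ 2) ℕ.* b) ∷ β k d ∷ # (∏ b k) ∷ γ d ∷ []) (ge0 q′ (⟪⟫≥0 _) ⊗ le (X′ :* z′) (u :* g) (β-upper k)) refl)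
        (≤-reflexive (cong (_* γ d) (sym (#-* (∏ b k) _)))))
      where
      x = var 0F ; X = var 1F ; y = var 2F ; q = var 3F ; z = var 4F
      X′ = var 0F ; q′ = var 1F ; z′ = var 2F ; u = var 3F ; g = var 4F

  module Estimates (V : F) (2≤V : ⟪ pos 2 ⟫ ≤ V) (D d₁ d₂ : ℕ)
    (D≥ : ⟪ pos 21 ⟫ * V ≤ ⟪ pos 10 ⟫ * # D) (D≤ : ⟪ pos 1000 ⟫ * (# D + ⟪ pos 2 ⟫) ≤ ⟪ pos 2121 ⟫ * V)
    (d₁≥ : # 46 * V ≤ # 25 * # d₁) (d₂≥ : # 231 * V ≤ # 200 * # d₂) (d₁≤D : d₁ ℕ.≤ D) (d₂≤D : d₂ ℕ.≤ D)
    (i₁ i₂ η : F) (13i₁ : ⟪ pos 13 ⟫ * i₁ ≡ V) (i₂≥0 : 0# ≤ i₂) (36i₂≤V : ⟪ pos 36 ⟫ * i₂ ≤ V) (η≥0 : 0# ≤ η)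
    (η-small : ⟪ pos 50000 ⟫ * (⟪ pos 4 ⟫ * (# D * (η * η * V ^ 4))) ≤ 1#) where

    private
      G : F
      G = γ D
      G≥0 = β≥0 0 D
      V≥0 : 0# ≤ V
      V≥0 = ≤-trans (⟪⟫≥0 2) 2≤V

      -- Monotonicity of γ²d gives γ(d)/γ(D) ≤ √(D/d), and x/y is a rational bound for this root by
      -- D ≤ 2.121 V and the lower bound on d.
      γ-ratio : ∀ d a b x y → d ℕ.≤ D → # (suc a) * V ≤ # b * # d → 0# < # d → (2121 ℕ.* b ℕ.* (y ℕ.* y)) ℕ.≤ (1000 ℕ.* suc a ℕ.* (x ℕ.* x)) → # y * γ d ≤ # x * G
      γ-ratio d a b x y d≤D aV≤bd d>0 num = abs-square (*≥0 (⟪⟫≥0 x) G≥0) (*-cancel-≤ {x = # (1000 ℕ.* suc a) * # d} (*>0 (⟪⟫>0 _) d>0)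
        (≤-trans (prove (A :* d′ :* (y′ :* g :* (y′ :* g))) (A :* (y′ :* y′) :* (G′ :* G′ :* D′)) (# (1000 ℕ.* suc a) ∷ # d ∷ # y ∷ γ d ∷ G ∷ # D ∷ [])
            (ge0 A (⟪⟫≥0 (1000 ℕ.* suc a)) ⊗ sq y′ ⊗ le (g :* g :* d′) (G′ :* G′ :* D′) (γ²d-mono d≤D)) refl)
          (≤-trans (prove (A₁ :* (y₁ :* y₁) :* (G₁ :* G₁ :* D₁)) (lit 2121 :* B :* (y₁ :* y₁) :* (G₁ :* G₁ :* d″)) (# (1000 ℕ.* suc a) ∷ # y ∷ G ∷ # D ∷ V ∷ # b ∷ # d ∷ # (suc a) ∷ [])
              (sq (y₁ :* G₁) ⊗ (nat 2121 ⊗ le (a′ :* w) (B :* d″) aV≤bd ⊕ ge0 a′ (⟪⟫≥0 (suc a)) ⊗ (le (lit 1000 :* (D₁ :+ lit 2)) (lit 2121 :* w) D≤ ⊕ nat 2000)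
                ⊕ eqn A₁ (lit 1000 :* a′) (#-* 1000 (suc a)) (:- D₁))) refl)
            (prove (lit 2121 :* b′ :* (y₂ :* y₂) :* (G₂ :* G₂ :* d₃)) (A₂ :* d₃ :* (x₂ :* G₂ :* (x₂ :* G₂))) (# (1000 ℕ.* suc a) ∷ # d ∷ # y ∷ # b ∷ G ∷ # x ∷ [])
              (sq G₂ ⊗ ge0 d₃ (⟪⟫≥0 d) ⊗ le (lit 2121 :* b′ :* (y₂ :* y₂)) (A₂ :* (x₂ :* x₂)) (subst₂ _≤_ (trans (#-* (2121 ℕ.* b) (y ℕ.* y)) (cong₂ _*_ (#-* 2121 b) (#-* y y))) (trans (#-* (1000 ℕ.* suc a) (x ℕ.* x)) (cong (# (1000 ℕ.* suc a) *_) (#-* x x))) (#-mono num))) refl))))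
        where
        A = var 0F ; d′ = var 1F ; y′ = var 2F ; g = var 3F ; G′ = var 4F ; D′ = var 5F
        A₁ = var 0F ; y₁ = var 1F ; G₁ = var 2F ; D₁ = var 3F ; w = var 4F ; B = var 5F ; d″ = var 6F ; a′ = var 7F
        A₂ = var 0F ; d₃ = var 1F ; y₂ = var 2F ; b′ = var 3F ; G₂ = var 4F ; x₂ = var 5F

      d>0 : ∀ {d a b} → # (suc a) * V ≤ # b * # d → 0# < # d
      d>0 {d} {a} {b} h q = *>0 (⟪⟫>0 a) (<-≤-trans (⟪⟫>0 1) 2≤V) (≤-trans h (prove (x :* y) (lit 0) (# b ∷ # d ∷ []) (ge0 x (⟪⟫≥0 b) ⊗ le y (lit 0) q) refl))
        where x = var 0F ; y = var 1F

      γ₁≤ : ⟪ pos 100 ⟫ * γ d₁ ≤ ⟪ pos 108 ⟫ * G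
      γ₁≤ = γ-ratio d₁ 45 25 108 100 d₁≤D d₁≥ (d>0 {d₁} {45} {25} d₁≥) (ℕP.≤ᵇ⇒≤ _ _ _)
      γ₂≤ : ⟪ pos 100 ⟫ * γ d₂ ≤ ⟪ pos 136 ⟫ * G
      γ₂≤ = γ-ratio d₂ 230 200 136 100 d₂≤D d₂≥ (d>0 {d₂} {230} {200} d₂≥) (ℕP.≤ᵇ⇒≤ _ _ _)

      ηV²≤ : ⟪ pos 200 ⟫ * (η * V ^ 2) ≤ G
      ηV²≤ = abs-square G≥0 (*-cancel-≤ {x = ⟪ pos 4 ⟫ * # D} 4D>0 (≤-trans
          (prove (lit 4 :* d :* (lit 200 :* (e :* w :^ 2) :* (lit 200 :* (e :* w :^ 2)))) (lit 1) (# D ∷ η ∷ V ∷ [])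
            (le (lit 50000 :* (lit 4 :* (d :* (e :* e :* w :^ 4)))) (lit 1) η-small ⊕ nonneg) refl)
          (≤-trans (4dγ D D>0) (≤-reflexive (ring (lit 4 :* (d′ :* (g :* g))) (lit 4 :* d′ :* (g :* g)) (# D ∷ G ∷ []) refl)))))
        where
        d = var 0F ; e = var 1F ; w = var 2F ; d′ = var 0F ; g = var 1F
        nonneg : Nn (# D ∷ η ∷ V ∷ [])
        nonneg = nat 40000 ⊗ (ge0 d (⟪⟫≥0 D) ⊗ sq (e :* w :^ 2))
        D>0 : 0# < # D
        D>0 = d>0 {D} {20} {10} D≥
        4D>0 : 0# < ⟪ pos 4 ⟫ * # D
        4D>0 = *>0 (⟪⟫>0 3) D>0
        4dγ : ∀ d → 0# < # d → 1# ≤ ⟪ pos 4 ⟫ * (# d * (γ d * γ d))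
        4dγ zero p = ⊥-elim (p ≤-refl)
          where open import Data.Empty using (⊥-elim)
        4dγ (suc d) _ = 4dγ²≥1 d

      b1 b2 b3 : F
      b1 = β 1 D
      b2 = β 2 D
      b3 = β 3 D
      e1 : (# D + 1#) * b1 ≡ ⟪ pos 2 ⟫ * G
      e1 = trans (ring ((d :+ lit 1) :* x) ((d :+ lit 0 :+ lit 1) :* x) (# D ∷ b1 ∷ []) refl) (trans (β-suc 0 D) (ring ((lit 4 :* lit 0 :+ lit 2) :* g) (lit 2 :* g) (G ∷ []) refl))
        where d = var 0F ; x = var 1F ; g = var 0F
      e2 : (# D + ⟪ pos 2 ⟫) * b2 ≡ ⟪ pos 6 ⟫ * b1
      e2 = trans (ring ((d :+ lit 2) :* x) ((d :+ lit 1 :+ lit 1) :* x) (# D ∷ b2 ∷ []) refl) (trans (β-suc 1 D) (ring ((lit 4 :* lit 1 :+ lit 2) :* g) (lit 6 :* g) (b1 ∷ []) refl))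
        where d = var 0F ; x = var 1F ; g = var 0F
      e3 : (# D + ⟪ pos 3 ⟫) * b3 ≡ ⟪ pos 10 ⟫ * b2
      e3 = trans (ring ((d :+ lit 3) :* x) ((d :+ lit 2 :+ lit 1) :* x) (# D ∷ b3 ∷ []) refl) (trans (β-suc 2 D) (ring ((lit 4 :* lit 2 :+ lit 2) :* g) (lit 10 :* g) (b2 ∷ []) refl))
        where d = var 0F ; x = var 1F ; g = var 0F

      vec : Vec F 7
      vec = V ∷ # D ∷ G ∷ b1 ∷ b2 ∷ b3 ∷ i₁ ∷ []
      vV vD vG v1 v2 v3 vi : Expr {7}
      vV = var 0F ; vD = var 1F ; vG = var 2F ; v1 = var 3F ; v2 = var 4F ; v3 = var 5F ; vi = var 6F
      D₊ : Nn vec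
      D₊ = le (lit 21 :* vV) (lit 10 :* vD) D≥
      D₋ : Nn vec
      D₋ = le (lit 1000 :* (vD :+ lit 2)) (lit 2121 :* vV) D≤
      V₊ = ge0 {ρ = vec} vV V≥0
      1₊ = ge0 {ρ = vec} v1 (β≥0 1 D)
      2₊ = ge0 {ρ = vec} v2 (β≥0 2 D)
      3₊ = ge0 {ρ = vec} v3 (β≥0 3 D)
      E1 : Expr → Nn vec
      E1 = eqn ((vD :+ lit 1) :* v1) (lit 2 :* vG) e1
      E2 : Expr → Nn vec
      E2 = eqn ((vD :+ lit 2) :* v2) (lit 6 :* v1) e2
      E3 : Expr → Nn vec
      E3 = eqn ((vD :+ lit 3) :* v3) (lit 10 :* v2) e3
      EI : Expr → Nn vec
      EI = eqn (lit 13 :* vi) vV 13i₁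

      Vb1≤ : ⟪ pos 21 ⟫ * (V * b1) ≤ ⟪ pos 20 ⟫ * G
      Vb1≤ = prove (lit 21 :* (vV :* v1)) (lit 20 :* vG) vec (D₊ ⊗ 1₊ ⊕ nat 10 ⊗ 1₊ ⊕ E1 (con (negsuc 9))) refl
      Vb1≥ : ⟪ pos 2000 ⟫ * G ≤ ⟪ pos 2121 ⟫ * (V * b1)
      Vb1≥ = prove (lit 2000 :* vG) (lit 2121 :* (vV :* v1)) vec (D₋ ⊗ 1₊ ⊕ nat 1000 ⊗ 1₊ ⊕ E1 (lit 1000)) refl
      Vb2≤ : ⟪ pos 21 ⟫ * (V * b2) ≤ ⟪ pos 60 ⟫ * b1
      Vb2≤ = prove (lit 21 :* (vV :* v2)) (lit 60 :* v1) vec (D₊ ⊗ 2₊ ⊕ nat 20 ⊗ 2₊ ⊕ E2 (con (negsuc 9))) refl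
      Vb2≥ : ⟪ pos 6000 ⟫ * b1 ≤ ⟪ pos 2121 ⟫ * (V * b2)
      Vb2≥ = prove (lit 6000 :* v1) (lit 2121 :* (vV :* v2)) vec (D₋ ⊗ 2₊ ⊕ E2 (lit 1000)) refl
      Vb3≤ : ⟪ pos 21 ⟫ * (V * b3) ≤ ⟪ pos 100 ⟫ * b2
      Vb3≤ = prove (lit 21 :* (vV :* v3)) (lit 100 :* v2) vec (D₊ ⊗ 3₊ ⊕ nat 30 ⊗ 3₊ ⊕ E3 (con (negsuc 9))) refl

      main : ℕ → F
      main r = β r D - i₁ * β (suc r) D
      main0≥ : ⟪ pos 253 ⟫ * G ≤ ⟪ pos 273 ⟫ * main 0
      main0≥ = prove (lit 253 :* vG) (lit 273 :* (vG :- vi :* v1)) vec (le (lit 21 :* (vV :* v1)) (lit 20 :* vG) Vb1≤ ⊕ EI (con (negsuc 20) :* v1)) refl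
      main1≥ : ⟪ pos 426000 ⟫ * G ≤ ⟪ pos 579033 ⟫ * (V * main 1)
      main1≥ = prove (lit 426000 :* vG) (lit 579033 :* (vV :* (v1 :- vi :* v2))) vec
        (nat 2121 ⊗ (V₊ ⊗ le (lit 21 :* (vV :* v2)) (lit 60 :* v1) Vb2≤) ⊕ EI (con (negsuc 44540) :* (vV :* v2)) ⊕ nat 213 ⊗ le (lit 2000 :* vG) (lit 2121 :* (vV :* v1)) Vb1≥) refl
      main1≤ : ⟪ pos 1000 ⟫ * (V * main 1) ≤ ⟪ pos 750 ⟫ * G
      main1≤ = *-cancel-≤ (⟪⟫>0 (27573 ℕ.* 21 ℕ.∸ 1)) (prove (con (pos (27573 ℕ.* 21)) :* (lit 1000 :* (vV :* (v1 :- vi :* v2)))) (con (pos (27573 ℕ.* 21)) :* (lit 750 :* vG)) vec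
        (nat 21000 ⊗ (V₊ ⊗ le (lit 6000 :* v1) (lit 2121 :* (vV :* v2)) Vb2≥) ⊕ EI (con (pos (21000 ℕ.* 2121)) :* (vV :* v2)) ⊕ nat 21573000 ⊗ le (lit 21 :* (vV :* v1)) (lit 20 :* vG) Vb1≤
         ⊕ nat (27573 ℕ.* 21 ℕ.* 750 ℕ.∸ 20 ℕ.* 21573000) ⊗ ge0 vG G≥0) refl)
      main2≥ : ⟪ pos 168 ⟫ * G ≤ ⟪ pos 100 ⟫ * (V ^ 2 * main 2)
      main2≥ = *-cancel-≤ (⟪⟫>0 (273 ℕ.* 2121 ℕ.* 2121 ℕ.∸ 1)) (prove (con (pos (273 ℕ.* 2121 ℕ.* 2121)) :* (lit 168 :* vG)) (con (pos (273 ℕ.* 2121 ℕ.* 2121)) :* (lit 100 :* (vV :^ 2 :* (v2 :- vi :* v3)))) vec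
        (nat (100 ℕ.* 2121 ℕ.* 2121) ⊗ (sq vV ⊗ le (lit 21 :* (vV :* v3)) (lit 100 :* v2) Vb3≤) ⊕ EI (:- (con (pos (2100 ℕ.* 2121 ℕ.* 2121)) :* (vV :^ 2 :* v3)))
         ⊕ nat (17300 ℕ.* 2121) ⊗ (V₊ ⊗ le (lit 6000 :* v1) (lit 2121 :* (vV :* v2)) Vb2≥) ⊕ nat (17300 ℕ.* 6000) ⊗ le (lit 2000 :* vG) (lit 2121 :* (vV :* v1)) Vb1≥
         ⊕ nat (17300 ℕ.* 6000 ℕ.* 2000 ℕ.∸ 273 ℕ.* 2121 ℕ.* 2121 ℕ.* 168) ⊗ ge0 vG G≥0) refl)

      i₁^4 : ⟪ pos 28561 ⟫ * i₁ ^ 4 ≡ V ^ 4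
      i₁^4 = trans (ring (lit 28561 :* x :^ 4) ((lit 13 :* x) :^ 4) (i₁ ∷ []) refl) (cong (_^ 4) 13i₁)
        where x = var 0F

      t₁ t₂ : ℕ → F
      t₁ r = i₁ ^ 4 * β (4 ℕ.+ r) d₁
      t₂ r = i₂ ^ 8 * β (8 ℕ.+ r) d₂
      i₁≥0 : 0# ≤ i₁
      i₁≥0 = cancel≥0 (⟪⟫>0 12) (subst (0# ≤_) (sym 13i₁) V≥0)
      t₁≥0 : ∀ r → 0# ≤ t₁ r
      t₁≥0 r = *≥0 (^≥0 i₁≥0 4) (β≥0 (4 ℕ.+ r) d₁)
      t₂≥0 : ∀ r → 0# ≤ t₂ r
      t₂≥0 r = *≥0 (^≥0 i₂≥0 8) (β≥0 (8 ℕ.+ r) d₂)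

      t₁≤ : ∀ r → ⟪ pos 28561 ⟫ * (# 46 ^ (4 ℕ.+ r) * (V ^ r * t₁ r)) ≤ # (∏ 25 (4 ℕ.+ r)) * γ d₁
      t₁≤ r = ≤-trans (≤-reflexive (trans (prove= (lit 28561 :* (A :* (W :* (I :* b)))) (A :* (V4 :* W) :* b) (# 46 ^ (4 ℕ.+ r) ∷ V ^ r ∷ i₁ ^ 4 ∷ β (4 ℕ.+ r) d₁ ∷ V ^ 4 ∷ []) (by= (lit 28561 :* I) V4 i₁^4 (A :* W :* b)) refl)
          (cong (_* β (4 ℕ.+ r) d₁) (trans (cong (# 46 ^ (4 ℕ.+ r) *_) (sym (^-+ V 4 r))) (sym (^-distrib-* (# 46) V (4 ℕ.+ r)))))))
        (β-upper V V≥0 d₁ 46 25 d₁≥ (4 ℕ.+ r))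
        where A = var 0F ; W = var 1F ; I = var 2F ; b = var 3F ; V4 = var 4F

      t₂≤ : ∀ r → ⟪ pos 36 ⟫ ^ 8 * (# 231 ^ (8 ℕ.+ r) * (V ^ r * t₂ r)) ≤ # (∏ 200 (8 ℕ.+ r)) * γ d₂
      t₂≤ r = ≤-trans (prove (c :* (A :* (W :* (I :* b)))) (A :* (V8 :* W) :* b) (# 231 ^ (8 ℕ.+ r) ∷ V ^ r ∷ i₂ ^ 8 ∷ β (8 ℕ.+ r) d₂ ∷ V ^ 8 ∷ ⟪ pos 36 ⟫ ^ 8 ∷ [])
          (ge0 A (^≥0 (⟪⟫≥0 231) (8 ℕ.+ r)) ⊗ ge0 W (^≥0 V≥0 r) ⊗ ge0 b (β≥0 (8 ℕ.+ r) d₂) ⊗ le (c :* I) V8 (≤-trans (≤-reflexive (sym (^-distrib-* ⟪ pos 36 ⟫ i₂ 8))) (^-mono (*≥0 (⟪⟫≥0 36) i₂≥0) 36i₂≤V 8))) refl)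
        (≤-trans (≤-reflexive (cong (_* β (8 ℕ.+ r) d₂) (trans (cong (# 231 ^ (8 ℕ.+ r) *_) (sym (^-+ V 8 r))) (sym (^-distrib-* (# 231) V (8 ℕ.+ r))))))
          (β-upper V V≥0 d₂ 231 200 d₂≥ (8 ℕ.+ r)))
        where A = var 0F ; W = var 1F ; I = var 2F ; b = var 3F ; V8 = var 4F ; c = var 5F

      fold-bound : ∀ c k s τ x y → # c * x ≤ # k * y → ⟪ pos 100 ⟫ * y ≤ # s * G → 0# < # c → k ℕ.* s ℕ.* 10000 ℕ.≤ c ℕ.* 100 ℕ.* τ → ⟪ pos 10000 ⟫ * x ≤ # τ * G
      fold-bound c k s τ x y h₁ h₂ c>0 num = *-cancel-≤ c>0 (*-cancel-≤ (⟪⟫>0 99) (prove (lit 100 :* (c′ :* (lit 10000 :* x′))) (lit 100 :* (c′ :* (τ′ :* g))) (# c ∷ # k ∷ # s ∷ # τ ∷ x ∷ y ∷ G ∷ [])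
        (nat 1000000 ⊗ le (c′ :* x′) (k′ :* y′) h₁ ⊕ nat 10000 ⊗ (ge0 k′ (⟪⟫≥0 k) ⊗ le (lit 100 :* y′) (s′ :* g) h₂)
         ⊕ ge0 g G≥0 ⊗ le (k′ :* s′ :* lit 10000) (c′ :* lit 100 :* τ′) (subst₂ _≤_ (trans (#-* (k ℕ.* s) 10000) (cong (_* # 10000) (#-* k s))) (trans (#-* (c ℕ.* 100) τ) (cong (_* # τ) (#-* c 100))) (#-mono num))) refl))
        where c′ = var 0F ; k′ = var 1F ; s′ = var 2F ; τ′ = var 3F ; x′ = var 4F ; y′ = var 5F ; g = var 6F

      #-*-^ : ∀ c a n x → # (c ℕ.* a ℕ.^ n) * x ≡ # c * (# a ^ n * x)
      #-*-^ c a n x = trans (cong (_* x) (trans (#-* c (a ℕ.^ n)) (cong (# c *_) (#-^ a n)))) (*-assoc (# c) (# a ^ n) x)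

      #>0 : ∀ c → 1 ℕ.≤ c → 0# < # c
      #>0 c p q = ⟪⟫>0 0 (≤-trans (#-mono p) q)

      t₁-bound : ∀ r τ → ∏ 25 (4 ℕ.+ r) ℕ.* 108 ℕ.* 10000 ℕ.≤ 28561 ℕ.* 46 ℕ.^ (4 ℕ.+ r) ℕ.* 100 ℕ.* τ → ⟪ pos 10000 ⟫ * (V ^ r * t₁ r) ≤ # τ * G
      t₁-bound r τ = fold-bound (28561 ℕ.* 46 ℕ.^ (4 ℕ.+ r)) (∏ 25 (4 ℕ.+ r)) 108 τ (V ^ r * t₁ r) (γ d₁) (≤-trans (≤-reflexive (#-*-^ 28561 46 (4 ℕ.+ r) (V ^ r * t₁ r))) (t₁≤ r)) γ₁≤
        (#>0 (28561 ℕ.* 46 ℕ.^ (4 ℕ.+ r)) (ℕP.*-mono-≤ {1} {28561} {1} {46 ℕ.^ (4 ℕ.+ r)} (ℕ.s≤s ℕ.z≤n) (ℕP.m^n>0 46 (4 ℕ.+ r))))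
      t₂-bound : ∀ r τ → ∏ 200 (8 ℕ.+ r) ℕ.* 136 ℕ.* 10000 ℕ.≤ 36 ℕ.^ 8 ℕ.* 231 ℕ.^ (8 ℕ.+ r) ℕ.* 100 ℕ.* τ → ⟪ pos 10000 ⟫ * (V ^ r * t₂ r) ≤ # τ * G
      t₂-bound r τ = fold-bound (36 ℕ.^ 8 ℕ.* 231 ℕ.^ (8 ℕ.+ r)) (∏ 200 (8 ℕ.+ r)) 136 τ (V ^ r * t₂ r) (γ d₂)
        (≤-trans (≤-reflexive (trans (#-*-^ (36 ℕ.^ 8) 231 (8 ℕ.+ r) (V ^ r * t₂ r)) (cong (_* (# 231 ^ (8 ℕ.+ r) * (V ^ r * t₂ r))) (#-^ 36 8)))) (t₂≤ r)) γ₂≤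
        (#>0 (36 ℕ.^ 8 ℕ.* 231 ℕ.^ (8 ℕ.+ r)) (ℕP.*-mono-≤ {1} {36 ℕ.^ 8} {1} {231 ℕ.^ (8 ℕ.+ r)} (ℕP.m^n>0 36 8) (ℕP.m^n>0 231 (8 ℕ.+ r))))

    X : ℕ → F
    X = moment D d₁ d₂ i₁ i₂ η

    private
      xvec : ℕ → Vec F 8
      xvec r = V ∷ main r ∷ t₁ r ∷ t₂ r ∷ η ∷ G ∷ β r D ∷ i₁ * β (suc r) D ∷ []
      xV xm x₁ x₂ xη xG : Expr {8}
      xV = var 0F ; xm = var 1F ; x₁ = var 2F ; x₂ = var 3F ; xη = var 4F ; xG = var 5F
      η₊ : Nn (xvec 0)
      η₊ = ge0 xη η≥0
      X≡ : ∀ r {b} → β r 0 ≡ b → X r ≡ main r - t₁ r - t₂ r - η * b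
      X≡ r e = trans (moment-def D d₁ d₂ i₁ i₂ η r) (cong (λ b → main r - t₁ r - t₂ r - η * b) e)
      le-V : ∀ r → Nn (xvec r)
      le-V r = le (lit 2) xV 2≤V
      η-le : ∀ r → Nn (xvec r)
      η-le r = le (lit 200 :* (xη :* xV :^ 2)) xG ηV²≤
      V∸2 : ∀ r → Nn (xvec r)
      V∸2 r = ge0 xV V≥0

    -- The targets are X₀ ≥ 0.91 G, 0.65 G ≤ V X₁ ≤ 0.75 G and V²X₂ ≥ 0.90 G; what matters is 0.75²
    -- < 0.91 · 0.90. The arguments 56 and 1 of the tail bounds are in units of G/10000.
    X0≥ : ⟪ pos 910 ⟫ * G ≤ ⟪ pos 1000 ⟫ * X 0
    X0≥ = subst (λ z → ⟪ pos 910 ⟫ * G ≤ ⟪ pos 1000 ⟫ * z) (sym (X≡ 0 β00)) (*-cancel-≤ (⟪⟫>0 2729) (prove (lit 2730 :* (lit 910 :* xG)) (lit 2730 :* (lit 1000 :* (xm :- x₁ :- x₂ :- xη :* lit 1))) (xvec 0)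
      (nat 10000 ⊗ le (lit 253 :* xG) (lit 273 :* xm) main0≥ ⊕ nat 273 ⊗ le (lit 10000 :* (lit 1 :* x₁)) (lit 56 :* xG) (t₁-bound 0 56 (ℕP.≤ᵇ⇒≤ _ _ _))
       ⊕ nat 273 ⊗ le (lit 10000 :* (lit 1 :* x₂)) (lit 1 :* xG) (t₂-bound 0 1 (ℕP.≤ᵇ⇒≤ _ _ _))
       ⊕ nat 13650 ⊗ η-le 0 ⊕ nat 2730000 ⊗ (η₊ ⊗ le-V 0 ⊗ (V∸2 0 ⊕ nat 2)) ⊕ nat 8190000 ⊗ η₊ ⊕ nat (2530000 ℕ.∸ 273 ℕ.* 57 ℕ.∸ 13650 ℕ.∸ 2730 ℕ.* 910) ⊗ ge0 xG G≥0) refl))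

    X1≥ : ⟪ pos 650 ⟫ * G ≤ ⟪ pos 1000 ⟫ * (V * X 1)
    X1≥ = subst (λ z → ⟪ pos 650 ⟫ * G ≤ ⟪ pos 1000 ⟫ * (V * z)) (sym (X≡ 1 β10)) (*-cancel-≤ (⟪⟫>0 579032) (prove (lit 579033 :* (lit 650 :* xG)) (lit 579033 :* (lit 1000 :* (xV :* (xm :- x₁ :- x₂ :- xη :* lit 2)))) (xvec 1)
      (nat 1000 ⊗ le (lit 426000 :* xG) (lit 579033 :* (xV :* xm)) main1≥ ⊕ nat 57904 ⊗ le (lit 10000 :* (xV :^ 1 :* x₁)) (lit 543 :* xG) (t₁-bound 1 543 (ℕP.≤ᵇ⇒≤ _ _ _))
       ⊕ nat 57904 ⊗ le (lit 10000 :* (xV :^ 1 :* x₂)) (lit 25 :* xG) (t₂-bound 1 25 (ℕP.≤ᵇ⇒≤ _ _ _))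
       ⊕ nat 7000 ⊗ (ge0 xV V≥0 ⊗ (ge0 x₁ (t₁≥0 1) ⊕ ge0 x₂ (t₂≥0 1)))
       ⊕ nat 2895165 ⊗ η-le 1 ⊕ nat 579033000 ⊗ (ge0 xV V≥0 ⊗ ge0 xη η≥0 ⊗ le-V 1) ⊕ nat 13843913 ⊗ ge0 xG G≥0) refl))

    X2≥ : ⟪ pos 900 ⟫ * G ≤ ⟪ pos 1000 ⟫ * (V ^ 2 * X 2)
    X2≥ = subst (λ z → ⟪ pos 900 ⟫ * G ≤ ⟪ pos 1000 ⟫ * (V ^ 2 * z)) (sym (X≡ 2 β20)) (*-cancel-≤ (⟪⟫>0 9) (prove (lit 10 :* (lit 900 :* xG)) (lit 10 :* (lit 1000 :* (xV :^ 2 :* (xm :- x₁ :- x₂ :- xη :* lit 6)))) (xvec 2)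
      (nat 100 ⊗ le (lit 168 :* xG) (lit 100 :* (xV :^ 2 :* xm)) main2≥ ⊕ le (lit 10000 :* (xV :^ 2 :* x₁)) (lit 6490 :* xG) (t₁-bound 2 6490 (ℕP.≤ᵇ⇒≤ _ _ _))
       ⊕ le (lit 10000 :* (xV :^ 2 :* x₂)) (lit 770 :* xG) (t₂-bound 2 770 (ℕP.≤ᵇ⇒≤ _ _ _))
       ⊕ nat 300 ⊗ η-le 2 ⊕ nat 240 ⊗ ge0 xG G≥0) refl))

    X1≤ : ⟪ pos 1000 ⟫ * (V * X 1) ≤ ⟪ pos 750 ⟫ * G
    X1≤ = subst (λ z → ⟪ pos 1000 ⟫ * (V * z) ≤ ⟪ pos 750 ⟫ * G) (sym (X≡ 1 β10)) (prove (lit 1000 :* (xV :* (xm :- x₁ :- x₂ :- xη :* lit 2))) (lit 750 :* xG) (xvec 1)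
      (le (lit 1000 :* (xV :* xm)) (lit 750 :* xG) main1≤ ⊕ nat 1000 ⊗ (ge0 xV V≥0 ⊗ (ge0 x₁ (t₁≥0 1) ⊕ ge0 x₂ (t₂≥0 1) ⊕ nat 2 ⊗ ge0 xη η≥0))) refl)

    X2≤ : ⟪ pos 441 ⟫ * (V ^ 2 * X 2) ≤ ⟪ pos 1200 ⟫ * G
    X2≤ = ≤-trans (subst (λ z → ⟪ pos 441 ⟫ * (V ^ 2 * z) ≤ ⟪ pos 441 ⟫ * (V ^ 2 * b2)) (sym (X≡ 2 β20)) (prove (lit 441 :* (xV :^ 2 :* (xm′ :- x₁ :- x₂ :- xη :* lit 6))) (lit 441 :* (xV :^ 2 :* var 6F)) (xvec 2)
        (nat 441 ⊗ (sq xV ⊗ (ge0 x₁ (t₁≥0 2) ⊕ ge0 x₂ (t₂≥0 2) ⊕ nat 6 ⊗ ge0 xη η≥0 ⊕ ge0 (var 7F) (*≥0 i₁≥0 (β≥0 3 D))))) refl))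
      (prove (lit 441 :* (vV :^ 2 :* v2)) (lit 1200 :* vG) vec (nat 21 ⊗ (V₊ ⊗ le (lit 21 :* (vV :* v2)) (lit 60 :* v1) Vb2≤) ⊕ nat 60 ⊗ le (lit 21 :* (vV :* v1)) (lit 20 :* vG) Vb1≤) refl)
      where xm′ = var 6F :- var 7F

    G>0 : 0# < G
    G>0 = γ>0 D

    module Consequences (g I₀ I₁ I₂ : F) (g>0 : 0# < g)
      (bound : ∀ w₀ w₁ w₂ → (∀ x → 0# ≤ x → x ≤ ⟪ pos 4 ⟫ → 0# ≤ w₀ + w₁ * x + w₂ * (x * x)) → g * (w₀ * X 0 + w₁ * X 1 + w₂ * X 2) ≤ w₀ * I₀ + w₁ * I₁ + w₂ * I₂) where
      private
        V>0 : 0# < V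
        V>0 = <-≤-trans (⟪⟫>0 1) 2≤V
        pos-from : ∀ {c x} n → # (suc n) * G ≤ c * x → 0# ≤ c → 0# < x
        pos-from {c} {x} n h c≥0 q = *>0 (⟪⟫>0 n) G>0 (≤-trans h (prove (var 0F :* var 1F) (lit 0) (c ∷ x ∷ []) (ge0 (var 0F) c≥0 ⊗ le (var 1F) (lit 0) q) refl))
        X0>0 : 0# < X 0
        X0>0 = pos-from 909 X0≥ (⟪⟫≥0 1000)

      I₀>0 : 0# < I₀
      I₀>0 = <-≤-trans (*>0 g>0 X0>0) (subst₂ _≤_ (ring (g′ :* (lit 1 :* x :+ lit 0 :* y :+ lit 0 :* z)) (g′ :* x) (g ∷ X 0 ∷ X 1 ∷ X 2 ∷ []) refl)
        (ring (lit 1 :* x′ :+ lit 0 :* y′ :+ lit 0 :* z′) x′ (I₀ ∷ I₁ ∷ I₂ ∷ []) refl)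
        (bound 1# 0# 0# (λ x _ _ → prove (lit 0) (lit 1 :+ lit 0 :* var 0F :+ lit 0 :* (var 0F :* var 0F)) (x ∷ []) (nat 1) refl)))
        where g′ = var 0F ; x = var 1F ; y = var 2F ; z = var 3F ; x′ = var 0F ; y′ = var 1F ; z′ = var 2F

      -- The weight is x(4 - x); V X₁ ≥ 0.65 G against V²X₂ ≤ (1200/441) G decides for V ≥ 2.
      4I₁>I₂ : I₂ < ⟪ pos 4 ⟫ * I₁
      4I₁>I₂ q = *>0 g>0 4X₁>X₂ (≤-trans (subst₂ _≤_ (ring (g′ :* (lit 0 :* x :+ lit 4 :* y :+ con (negsuc 0) :* z)) (g′ :* (lit 4 :* y :- z)) (g ∷ X 0 ∷ X 1 ∷ X 2 ∷ []) refl)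
        (ring (lit 0 :* x′ :+ lit 4 :* y′ :+ con (negsuc 0) :* z′) (lit 4 :* y′ :- z′) (I₀ ∷ I₁ ∷ I₂ ∷ []) refl)
        (bound 0# ⟪ pos 4 ⟫ ⟪ negsuc 0 ⟫ (λ x 0≤x x≤4 → prove (lit 0) (lit 0 :+ lit 4 :* var 0F :+ con (negsuc 0) :* (var 0F :* var 0F)) (x ∷ []) (ge0 (var 0F) 0≤x ⊗ le (var 0F) (lit 4) x≤4) refl)))
        (prove (lit 4 :* y′ :- z′) (lit 0) (I₀ ∷ I₁ ∷ I₂ ∷ []) (le (lit 4 :* y′) z′ q) refl))
        where
        g′ = var 0F ; x = var 1F ; y = var 2F ; z = var 3F ; x′ = var 0F ; y′ = var 1F ; z′ = var 2F
        4X₁>X₂ : 0# < ⟪ pos 4 ⟫ * X 1 - X 2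
        4X₁>X₂ = pos-from {c = ⟪ pos 441000 ⟫ * V ^ 2} 1092599 (prove (lit 1092600 :* u) (lit 441000 :* w :^ 2 :* (lit 4 :* a :- b)) (V ∷ G ∷ X 1 ∷ X 2 ∷ [])
          (nat 1764 ⊗ (ge0 w V≥0 ⊗ le (lit 650 :* u) (lit 1000 :* (w :* a)) X1≥) ⊕ nat 1146600 ⊗ (le (lit 2) w 2≤V ⊗ ge0 u G≥0) ⊕ nat 1000 ⊗ le (lit 441 :* (w :^ 2 :* b)) (lit 1200 :* u) X2≤ ⊕ nat 600 ⊗ ge0 u G≥0) refl)
          (*≥0 (⟪⟫≥0 441000) (^≥0 V≥0 2))
          where w = var 0F ; u = var 1F ; a = var 2F ; b = var 3F

      I₂>0 : 0# < I₂
      I₂>0 = <-≤-trans (*>0 g>0 (pos-from {c = ⟪ pos 1000 ⟫ * V ^ 2} 899 (≤-trans X2≥ (≤-reflexive (sym (*-assoc _ _ _)))) (*≥0 (⟪⟫≥0 1000) (^≥0 V≥0 2))))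
        (subst₂ _≤_ (ring (g′ :* (lit 0 :* x :+ lit 0 :* y :+ lit 1 :* z)) (g′ :* z) (g ∷ X 0 ∷ X 1 ∷ X 2 ∷ []) refl)
          (ring (lit 0 :* x′ :+ lit 0 :* y′ :+ lit 1 :* z′) z′ (I₀ ∷ I₁ ∷ I₂ ∷ []) refl)
          (bound 0# 0# 1# (λ x _ _ → prove (lit 0) (lit 0 :+ lit 0 :* var 0F :+ lit 1 :* (var 0F :* var 0F)) (x ∷ []) (sq (var 0F)) refl)))
        where g′ = var 0F ; x = var 1F ; y = var 2F ; z = var 3F ; x′ = var 0F ; y′ = var 1F ; z′ = var 2F

      I₁>0 : 0# < I₁
      I₁>0 q = 4I₁>I₂ (prove (lit 4 :* x) y (I₁ ∷ I₂ ∷ []) (nat 4 ⊗ le x (lit 0) q ⊕ ge0 y (<⇒≤ I₂>0)) refl)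
        where x = var 0F ; y = var 1F

      -- The weight is (I₀x - I₁)², which yields I₀(I₀I₂ - I₁²) on the right; the lower bound is a
      -- quadratic form in I₀ and I₁, positive because X₁² < X₀X₂.
      I₁²<I₀I₂ : I₁ * I₁ < I₀ * I₂
      I₁²<I₀I₂ q = *>0 g>0 Q>0 (≤-trans (subst₂ _≤_ refl
          (ring (y′ :* y′ :* x′ :+ con (negsuc 1) :* (x′ :* y′) :* y′ :+ x′ :* x′ :* z′) (x′ :* (x′ :* z′ :- y′ :* y′)) (I₀ ∷ I₁ ∷ I₂ ∷ []) refl)
          (bound (I₁ * I₁) (⟪ negsuc 1 ⟫ * (I₀ * I₁)) (I₀ * I₀) (λ x _ _ → prove (lit 0) (var 1F :* var 1F :+ con (negsuc 1) :* (var 0F :* var 1F) :* var 2F :+ var 0F :* var 0F :* (var 2F :* var 2F)) (I₀ ∷ I₁ ∷ x ∷ []) (sq (var 0F :* var 2F :- var 1F)) refl)))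
        (prove (x′ :* (x′ :* z′ :- y′ :* y′)) (lit 0) (I₀ ∷ I₁ ∷ I₂ ∷ []) (ge0 x′ (<⇒≤ I₀>0) ⊗ le (x′ :* z′) (y′ :* y′) q) refl))
        where
        x′ = var 0F ; y′ = var 1F ; z′ = var 2F
        Q = I₁ * I₁ * X 0 + ⟪ negsuc 1 ⟫ * (I₀ * I₁) * X 1 + I₀ * I₀ * X 2
        Q>0 : 0# < Q
        Q>0 p = *>0 (⟪⟫>0 256499) (*>0 G>0 (*>0 I₀>0 I₀>0)) (≤-trans
          (prove (lit 256500 :* (u :* (a :* a))) (lit 910000 :* (w :* w :* (b :* b :* x0 :+ con (negsuc 1) :* (a :* b) :* x1 :+ a :* a :* x2))) (V ∷ G ∷ I₀ ∷ I₁ ∷ X 0 ∷ X 1 ∷ X 2 ∷ [])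
            (nat 910 ⊗ (sq (w :* b) ⊗ le (lit 910 :* u) (lit 1000 :* x0) X0≥)
             ⊕ nat 1820 ⊗ (ge0 a (<⇒≤ I₀>0) ⊗ ge0 b (<⇒≤ I₁>0) ⊗ (ge0 w V≥0 ⊗ le (lit 1000 :* (w :* x1)) (lit 750 :* u) X1≤))
             ⊕ nat 910 ⊗ (sq a ⊗ le (lit 900 :* u) (lit 1000 :* (w :^ 2 :* x2)) X2≥)
             -- Completing the square; 256500 = 910 · 900 - 750² is what remains.
             ⊕ ge0 u G≥0 ⊗ sq (lit 910 :* (w :* b) :- lit 750 :* a)) refl)
          (prove (lit 910000 :* (w′ :* w′ :* q′)) (lit 0) (V ∷ Q ∷ []) (nat 910000 ⊗ (sq w′ ⊗ le q′ (lit 0) p)) refl))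
          where
          w = var 0F ; u = var 1F ; a = var 2F ; b = var 3F ; x0 = var 4F ; x1 = var 5F ; x2 = var 6F
          w′ = var 0F ; q′ = var 1F

-- Assembly of the circle method

module CircleMethod where
  open Inequalities
  open PowersOfUnit
  open SampleMeans using (module Sample; A²≤1; module Base)
  open PairProducts
  open RotatedProduct using (sumℕ)
  open BinomialKernel
  open TiltedSums
  open Rounding
  open CentralArcs
  open OuterArcs
  open MinorArcs
  open Moments
  open Coefficients using (I)
  open Minorant
  open import Data.Nat.Base as ℕ using (ℕ; suc; zero)
  open import Data.Sum.Base using (_⊎_; inj₁; inj₂)
  open import Data.Product.Base using (_×_; _,_)

  module Circle (t : F) (t>0 : 0# < t) (360t≤1 : ⟪ pos 360 ⟫ * t ≤ 1#) (N : ℕ)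
    (Nt²≤ : # N * (t * t) ≤ 1# + ⟪ pos 2 ⟫ * (t * t))
    (tail : ⟪ pos 400 ⟫ * ((1# - t) ^ N * (# N * # N * (t * t) + ⟪ pos 2 ⟫ * (# N * t) + ⟪ pos 2 ⟫)) ≤ 1#) where

    open Sums t t>0 360t≤1 N Nt²≤ tail
    module Gr = Greedy (λ m → # m * p m) (λ k → *≥0 (⟪⟫≥0 (suc k)) (p≥0 (suc k)))
      (λ k → prove (lit 2 :* (var 0F :* var 1F)) (var 0F) (# (suc k) ∷ p (suc k) ∷ []) (ge0 (var 0F) (⟪⟫≥0 (suc k)) ⊗ le (lit 2 :* var 1F) (lit 1) (2p≤1 (suc k))) refl)
    module C = CentralArc t t>0 360t≤1 N Nt²≤ tail Gr.e Gr.e≤f+1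
    module O = OuterArc t t>0 360t≤1 N Nt²≤ tail
    module η = MinorArc t t>0 360t≤1
    open C using (c₁; V>0; c₁V; 8c₁≤)

    n : ℕ
    n = sumℕ Gr.e N

    private
      V≥0 : 0# ≤ V
      V≥0 = <⇒≤ V>0
      t³>0 : 0# < t ^ 3
      t³>0 = *>0 t>0 (*>0 t>0 (*>0 t>0 (⟪⟫>0 0)))
      -- the arcs are c ≤ c₁ = 13/V, c₁ ≤ c ≤ c₂ = (t/4)², c₂ ≤ c ≤ c₃ = (29t/50)² and c₃ ≤ c, with i₁ = 1/c₁ and i₂ = 1/c₂
      c₂ c₃ i₁ i₂ : F
      c₂ = inv (# 16) * (t * t)
      c₃ = ⟪ pos 841 ⟫ * (inv (# 2500) * (t * t))
      i₁ = inv (# 13) * V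
      i₂ = ⟪ pos 16 ⟫ * (inv t * inv t)
      tS : t * inv t ≡ 1#
      tS = inv-eq t>0
      c₂≥0 : 0# ≤ c₂
      c₂≥0 = *≥0 (inv≥0 (⟪⟫>0 15)) (sq≥0 t)
      c₃≥0 : 0# ≤ c₃
      c₃≥0 = *≥0 (⟪⟫≥0 841) (*≥0 (inv≥0 (⟪⟫>0 2499)) (sq≥0 t))
      16c₂ : ⟪ pos 16 ⟫ * c₂ ≡ t * t
      16c₂ = prove= (lit 16 :* (i :* x)) x (inv (# 16) ∷ t * t ∷ []) (by= (lit 16 :* i) (lit 1) (reciprocal 15) x) refl
        where i = var 0F ; x = var 1F
      2500c₃ : ⟪ pos 2500 ⟫ * c₃ ≡ ⟪ pos 841 ⟫ * (t * t)
      2500c₃ = prove= (lit 2500 :* (lit 841 :* (i :* x))) (lit 841 :* x) (inv (# 2500) ∷ t * t ∷ []) (by= (lit 2500 :* i) (lit 1) (reciprocal 2499) (lit 841 :* x)) refl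
        where i = var 0F ; x = var 1F
      13i₁ : ⟪ pos 13 ⟫ * i₁ ≡ V
      13i₁ = prove= (lit 13 :* (i :* x)) x (inv (# 13) ∷ V ∷ []) (by= (lit 13 :* i) (lit 1) (reciprocal 12) x) refl
        where i = var 0F ; x = var 1F
      i₁c₁ : i₁ * c₁ ≡ 1#
      i₁c₁ = *-cancel (⟪⟫>0 12) (prove= (lit 13 :* (i :* c)) (lit 13 :* lit 1) (i₁ ∷ c₁ ∷ V ∷ []) (by= (lit 13 :* i) v′ 13i₁ c ⊞ by= (c :* v′) (lit 13) c₁V (lit 1)) refl)
        where i = var 0F ; c = var 1F ; v′ = var 2F
      i₂c₂ : i₂ * c₂ ≡ 1#
      i₂c₂ = prove= (lit 16 :* (s :* s) :* (i :* (T :* T))) (lit 1) (t ∷ inv t ∷ inv (# 16) ∷ []) (by= (T :* s) (lit 1) tS (lit 16 :* i :* (T :* s :+ lit 1)) ⊞ by= (lit 16 :* i) (lit 1) (reciprocal 15) (lit 1)) refl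
        where T = var 0F ; s = var 1F ; i = var 2F
      i₁≥0 : 0# ≤ i₁
      i₁≥0 = *≥0 (inv≥0 (⟪⟫>0 12)) V≥0
      i₂≥0 : 0# ≤ i₂
      i₂≥0 = *≥0 (⟪⟫≥0 16) (sq≥0 (inv t))

    module T₁ = O.Tier c₂ c₂≥0
    module T₂ = O.Tier c₃ c₃≥0

    private
      B₁ B₂ : F
      B₁ = t ^ 3 * (c₂ * V₄)
      B₂ = t ^ 3 * (c₃ * V₄)
      16B₁≤ : ⟪ pos 16 ⟫ * B₁ ≤ ⟪ pos 24 ⟫
      16B₁≤ = prove (lit 16 :* (T :^ 3 :* (c :* w))) (lit 24) (t ∷ c₂ ∷ V₄ ∷ []) (le (T :^ 5 :* w) (lit 24) V₄≤ ⊕ eqn (lit 16 :* c) (T :* T) 16c₂ (:- (T :^ 3 :* w))) refl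
        where T = var 0F ; c = var 1F ; w = var 2F
      2500B₂≤ : ⟪ pos 2500 ⟫ * B₂ ≤ ⟪ pos 20184 ⟫
      2500B₂≤ = prove (lit 2500 :* (T :^ 3 :* (c :* w))) (lit 20184) (t ∷ c₃ ∷ V₄ ∷ []) (nat 841 ⊗ le (T :^ 5 :* w) (lit 24) V₄≤ ⊕ eqn (lit 2500 :* c) (lit 841 :* (T :* T)) 2500c₃ (:- (T :^ 3 :* w))) refl
        where T = var 0F ; c = var 1F ; w = var 2F

    -- 2V - c₂V₄/6 with c₂ = t²/16, t⁵V₄ ≤ 24 and t³V ≥ 8/5 leaves 1.84 V after rounding; the wider
    -- arc c₃ leaves 1.155 V.
    d₁≥ : # 46 * V ≤ # 25 * # T₁.d
    d₁≥ = *-cancel-≤ t³>0 (*-cancel-≤ (⟪⟫>0 (2154 ℕ.* 16 ℕ.∸ 1)) (prove (con (pos (2154 ℕ.* 16)) :* (T :* (lit 46 :* v′))) (con (pos (2154 ℕ.* 16)) :* (T :* (lit 25 :* d))) (t ^ 3 ∷ V ∷ # T₁.d ∷ B₁ ∷ [])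
        (nat 400 ⊗ le (lit 359 :* (lit 12 :* (T :* v′))) (lit 359 :* (lit 6 :* (T :* d) :+ b) :+ lit 4) (T₁.d≥ B₁ ≤-refl)
         ⊕ nat 8975 ⊗ le (lit 16 :* b) (lit 24) 16B₁≤ ⊕ nat 27571 ⊗ le (lit 8) (lit 5 :* (T :* v′)) V≥ ⊕ ge0 T (^≥0 t≥0 3) ⊗ ge0 v′ V≥0 ⊕ nat 3568) refl))
      where T = var 0F ; v′ = var 1F ; d = var 2F ; b = var 3F
    d₂≥ : # 231 * V ≤ # 200 * # T₂.d
    d₂≥ = *-cancel-≤ t³>0 (*-cancel-≤ (⟪⟫>0 (2154 ℕ.* 2500 ℕ.∸ 1)) (prove (con (pos (2154 ℕ.* 2500)) :* (T :* (lit 231 :* v′))) (con (pos (2154 ℕ.* 2500)) :* (T :* (lit 200 :* d))) (t ^ 3 ∷ V ∷ # T₂.d ∷ B₂ ∷ [])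
        (nat 500000 ⊗ le (lit 359 :* (lit 12 :* (T :* v′))) (lit 359 :* (lit 6 :* (T :* d) :+ b) :+ lit 4) (T₂.d≥ B₂ ≤-refl)
         ⊕ nat 71800 ⊗ le (lit 2500 :* b) (lit 20184) 2500B₂≤ ⊕ nat 182013000 ⊗ le (lit 8) (lit 5 :* (T :* v′)) V≥ ⊕ nat 4892800) refl))
      where T = var 0F ; v′ = var 1F ; d = var 2F ; b = var 3F

    private
      2V≤D : ∀ {d} → # d ≤ ⟪ pos 2 ⟫ * V → d ℕ.≤ C.D
      2V≤D {d} h = #-mono⁻ (≤-trans h (*-cancel-≤ (⟪⟫>0 9) (prove (lit 10 :* (lit 2 :* v′)) (lit 10 :* D′) (V ∷ # C.D ∷ []) (le (lit 21 :* v′) (lit 10 :* D′) C.D≥ ⊕ ge0 v′ V≥0) refl)))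
        where v′ = var 0F ; D′ = var 1F
      2≤V : ⟪ pos 2 ⟫ ≤ V
      2≤V = *-cancel-≤ t³>0 (*-cancel-≤ (⟪⟫>0 4) (prove (lit 5 :* (T :^ 3 :* lit 2)) (lit 5 :* (T :^ 3 :* v′)) (t ∷ V ∷ [])
        (le (lit 8) (lit 5 :* (T :^ 3 :* v′)) V≥ ⊕ ge0 T t≥0 ⊗ le (lit 129600 :* (T :* T)) (lit 1) t² ⊕ nat 8 ⊗ le (lit 360 :* T) (lit 1) 360t≤1 ⊕ nat 2879 ⊗ ge0 T t≥0 ⊕ nat 129590 ⊗ (ge0 T t≥0 ⊗ sq T)) refl))
        where T = var 0F ; v′ = var 1F
      36i₂≤V : ⟪ pos 36 ⟫ * i₂ ≤ V
      36i₂≤V = *-cancel-≤ t³>0 (*-cancel-≤ (⟪⟫>0 4) (prove (lit 5 :* (T :^ 3 :* (lit 36 :* (lit 16 :* (s :* s))))) (lit 5 :* (T :^ 3 :* v′)) (t ∷ inv t ∷ V ∷ [])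
        (eqn (T :* s) (lit 1) tS (con (negsuc 2879) :* (T :* (T :* s :+ lit 1))) ⊕ le (lit 8) (lit 5 :* (T :^ 3 :* v′)) V≥ ⊕ nat 8 ⊗ le (lit 360 :* T) (lit 1) 360t≤1) refl))
        where T = var 0F ; s = var 1F ; v′ = var 2F
      c₁-small : ⟪ pos 1000 ⟫ * c₁ ≤ 1#
      c₁-small = *-cancel-≤ (⟪⟫>0 7) (prove (lit 8 :* (lit 1000 :* c)) (lit 8 :* lit 1) (t ∷ c₁ ∷ [])
        (nat 1000 ⊗ le (lit 8 :* c) (lit 65 :* T :^ 3) 8c₁≤ ⊕ ge0 T t≥0 ⊗ le (lit 129600 :* (T :* T)) (lit 1) t² ⊕ nat 8 ⊗ le (lit 360 :* T) (lit 1) 360t≤1 ⊕ nat 2879 ⊗ ge0 T t≥0 ⊕ nat 64600 ⊗ (ge0 T t≥0 ⊗ sq T)) refl)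
        where T = var 0F ; c = var 1F
      -- η² ≤ (t/3)¹⁵ and D V⁴ ≤ 2.121 V⁵ ≤ 2.121 · 32 t⁻¹⁵: the powers of t cancel, which is the
      -- origin of the exponent 15 in `η-small`.
      η-tiny : ⟪ pos 50000 ⟫ * (⟪ pos 4 ⟫ * (# C.D * (η.η * η.η * V ^ 4))) ≤ 1#
      η-tiny = *-cancel-≤ (⟪⟫>0 (14348907000 ℕ.∸ 1)) (≤-trans
        (prove (lit 14348907000 :* (lit 50000 :* (lit 4 :* (D′ :* (e :* v′ :^ 4))))) (lit 424200000 :* (T :^ 15 :* v′ :^ 5)) (t ∷ V ∷ # C.D ∷ η.η * η.η ∷ [])
          (nat 2869781400000 ⊗ (ge0 e (sq≥0 η.η) ⊗ (sq (v′ :* v′) ⊗ D₋)) ⊕ nat 424200000 ⊗ (ge0 v′ V≥0 ⊗ sq (v′ :* v′) ⊗ le (lit 14348907 :* e) (T :^ 15) η.η-small)) refl)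
        (≤-trans (prove (lit 424200000 :* (T′ :^ 15 :* w :^ 5)) (lit 424200000 :* (T′ :^ 3 :* w) :^ 5) (t ∷ V ∷ []) (nat 0) refl)
          (≤-trans (prove (lit 424200000 :* x) (lit 424200000 :* y) ((t ^ 3 * V) ^ 5 ∷ ⟪ pos 2 ⟫ ^ 5 ∷ []) (nat 424200000 ⊗ le x y (^-mono (*≥0 (^≥0 t≥0 3) V≥0) V≤ 5)) refl)
            (prove (lit 424200000 :* (lit 2) :^ 5) (lit 14348907000 :* lit 1) [] (nat (14348907000 ℕ.∸ 424200000 ℕ.* 32)) refl))))
        where
        T = var 0F ; v′ = var 1F ; D′ = var 2F ; e = var 3F ; T′ = var 0F ; w = var 1F ; x = var 0F ; y = var 1F
        D₋ : Nn (t ∷ V ∷ # C.D ∷ η.η * η.η ∷ [])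
        D₋ = le (lit 1000 :* (D′ :+ lit 2)) (lit 2121 :* v′) C.D≤ ⊕ nat 2000

    module _ (l : ℕ) where
      private
        a = Base.A l
        open Sample l using (c; c≥0)
        module L = CentralBound.Lower a (A²≤1 l) p Gr.e Gr.δ (λ k → p≥0 (suc k)) (λ k → 2p≤1 (suc k)) Gr.e≤m Gr.δ0 Gr.δ≥0 Gr.δ≤1 Gr.δ-step c₁ c₁-small
        module Up = UpperBounds.Upper a (A²≤1 l) p (λ k → p≥0 (suc k)) (λ k → 2p≤1 (suc k))
        module Sp = O.Spread a (A²≤1 l)
        rot = rotₛ ρ p p-def N n l
        hD h₁ h₂ : F
        hD = hₛ l ^ C.D
        h₁ = hₛ l ^ T₁.d
        h₂ = hₛ l ^ T₂.d
        h≥0 : ∀ k → 0# ≤ hₛ l ^ k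
        h≥0 = ^≥0 Up.h≥0
        vec : Vec F 9
        vec = c ∷ i₁ ∷ i₂ ∷ hD ∷ h₁ ∷ h₂ ∷ η.η ∷ rot ∷ c₁ ∷ []
        vc vi₁ vi₂ vD v₁ v₂ vη vr vc₁ : Expr {9}
        vc = var 0F ; vi₁ = var 1F ; vi₂ = var 2F ; vD = var 3F ; v₁ = var 4F ; v₂ = var 5F ; vη = var 6F ; vr = var 7F ; vc₁ = var 8F
        lhs rhs : Expr {9}
        lhs = (lit 1 :- vi₁ :* vc) :* vD
        rhs = vr :+ vi₁ :^ 4 :* (vc :^ 4 :* v₁) :+ vi₂ :^ 8 :* (vc :^ 8 :* v₂) :+ vη
        1₊ 2₊ η₊ D₊ : Nn vec
        1₊ = ge0 (vi₁ :^ 4 :* (vc :^ 4 :* v₁)) (*≥0 (^≥0 i₁≥0 4) (*≥0 (^≥0 c≥0 4) (h≥0 T₁.d)))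
        2₊ = ge0 (vi₂ :^ 8 :* (vc :^ 8 :* v₂)) (*≥0 (^≥0 i₂≥0 8) (*≥0 (^≥0 c≥0 8) (h≥0 T₂.d)))
        η₊ = ge0 vη η.η≥0
        D₊ = ge0 vD (h≥0 C.D)
        ic≥1 : ∀ {i c̄} → 0# ≤ i → i * c̄ ≡ 1# → c̄ ≤ c → 1# ≤ i * c
        ic≥1 {i} {c̄} i≥0 e h = prove (lit 1) (j :* x) (i ∷ c̄ ∷ c ∷ []) (ge0 j i≥0 ⊗ le y x h ⊕ eqn (j :* y) (lit 1) e (lit 1)) refl
          where j = var 0F ; y = var 1F ; x = var 2F
        1≤^ : ∀ {x} → 1# ≤ x → ∀ k → 1# ≤ x ^ k
        1≤^ {x} h k = subst (_≤ x ^ k) (UpperBounds.1^ k) (^-mono (⟪⟫≥0 1) h k)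
        ic^≥1 : ∀ {i} → 1# ≤ i * c → ∀ k → 1# ≤ i ^ k * c ^ k
        ic^≥1 {i} h k = subst (1# ≤_) (UpperBounds.^-distrib-* i c k) (1≤^ h k)

        central : c ≤ c₁ → ⟦ lhs ⟧ vec ≤ ⟦ rhs ⟧ vec
        central h = prove lhs rhs vec (ge0 vi₁ i₁≥0 ⊗ le (vD :* (vc₁ :- vc)) (vc₁ :* vr) lower ⊕ eqn (vi₁ :* vc₁) (lit 1) i₁c₁ (vD :- vr) ⊕ 1₊ ⊕ 2₊ ⊕ η₊) refl
          where
          lower : hD * (c₁ - c) ≤ c₁ * rot
          lower = L.Final.central-lower N C.z C.kk C.M h C.z≥0 (λ k → ≤-reflexive (sym (C.5700z (suc k)))) C.hx C.hk C.1≤M C.hM C.hθ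

        -- Beyond c₁ the left side is nonpositive, as i₁c ≥ 1, so it is enough that one error term
        -- exceeds |rot|; its prefactor (i₁c)⁴ is at least 1 there.
        outer₁ : c₁ ≤ c → c ≤ c₂ → ⟦ lhs ⟧ vec ≤ ⟦ rhs ⟧ vec
        outer₁ h h′ = prove lhs rhs vec (D₊ ⊗ le (lit 1) (vi₁ :* vc) (ic≥1 i₁≥0 i₁c₁ h) ⊕ le (:- v₁) vr (Up.tier N T₁.exponent c₂ h′ T₁.exponent-spec n T₁.d T₁.2d≤)
          ⊕ ge0 v₁ (h≥0 T₁.d) ⊗ le (lit 1) (vi₁ :^ 4 :* vc :^ 4) (ic^≥1 (ic≥1 i₁≥0 i₁c₁ h) 4) ⊕ 2₊ ⊕ η₊) refl

        outer₂ : c₁ ≤ c → c₂ ≤ c → c ≤ c₃ → ⟦ lhs ⟧ vec ≤ ⟦ rhs ⟧ vec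
        outer₂ h h′ h″ = prove lhs rhs vec (D₊ ⊗ le (lit 1) (vi₁ :* vc) (ic≥1 i₁≥0 i₁c₁ h) ⊕ le (:- v₂) vr (Up.tier N T₂.exponent c₃ h″ T₂.exponent-spec n T₂.d T₂.2d≤)
          ⊕ ge0 v₂ (h≥0 T₂.d) ⊗ le (lit 1) (vi₂ :^ 8 :* vc :^ 8) (ic^≥1 (ic≥1 i₂≥0 i₂c₂ h′) 8) ⊕ 1₊ ⊕ η₊) refl

        minor : c₁ ≤ c → c₃ ≤ c → ⟦ lhs ⟧ vec ≤ ⟦ rhs ⟧ vec
        minor h h′ = prove lhs rhs vec (D₊ ⊗ le (lit 1) (vi₁ :* vc) (ic≥1 i₁≥0 i₁c₁ h) ⊕ le (:- vη) vr
            (Up.minor η.H N n η.η η.W η.η≥0 η.W≥0 (η.W≤ _ (Sp.spread (prove (lit 841 :* x) (lit 2500 :* y) (t * t ∷ c ∷ c₃ ∷ []) (nat 2500 ⊗ le z y h′ ⊕ eqn (lit 2500 :* z) (lit 841 :* x) 2500c₃ (lit 1)) refl)))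
              η.1≤η²g)
          ⊕ 1₊ ⊕ 2₊) refl
          where x = var 0F ; y = var 1F ; z = var 2F

      minorant : (1# - i₁ * cₛ l) * hₛ l ^ C.D ≤ rotₛ ρ p p-def N n l + i₁ ^ 4 * (cₛ l ^ 4 * hₛ l ^ T₁.d) + i₂ ^ 8 * (cₛ l ^ 8 * hₛ l ^ T₂.d) + η.η
      minorant = by-cases (≤-total c c₁) (≤-total c c₂) (≤-total c c₃)
        where
        by-cases : c ≤ c₁ ⊎ c₁ ≤ c → c ≤ c₂ ⊎ c₂ ≤ c → c ≤ c₃ ⊎ c₃ ≤ c → ⟦ lhs ⟧ vec ≤ ⟦ rhs ⟧ vec
        by-cases (inj₁ h) _ _ = central h
        by-cases (inj₂ h) (inj₁ h′) _ = outer₁ h h′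
        by-cases (inj₂ h) (inj₂ h′) (inj₁ h″) = outer₂ h h′ h″
        by-cases (inj₂ h) (inj₂ h′) (inj₂ h″) = minor h h″

    private
      module Es = Estimates V 2≤V C.D T₁.d T₂.d C.D≥ C.D≤ d₁≥ d₂≥ (2V≤D T₁.d≤2V) (2V≤D T₂.d≤2V) i₁ i₂ η.η 13i₁ i₂≥0 36i₂≤V η.η≥0 η-tiny
      G>0 : ∀ k → 0# < G ρ p p-def k
      G>0 zero = ⟪⟫>0 0
      G>0 (suc k) = *>0 (G>0 k) (1+y>0 (suc k))
      open Es.Consequences (G ρ p p-def N) (I ρ N n 0) (I ρ N n 1) (I ρ N n 2) (G>0 N) (coefficient-bound ρ p p-def N n C.D T₁.d T₂.d i₁ i₂ η.η minorant y≥0)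

    saddle : 0# < I ρ N n 0 × I ρ N n 1 * I ρ N n 1 < I ρ N n 0 * I ρ N n 2 × I ρ N n 2 < ⟪ pos 4 ⟫ * I ρ N n 1
    saddle = I₀>0 , I₁²<I₀I₂ , 4I₁>I₂

-- Counting partitions with bounded parts

module Counting where
  open import Defs
  open import Data.Nat.Base
  open import Data.Nat.Properties
  open import Data.Nat.ListAction using (sum)
  open import Data.List.Base using (List; []; _∷_; map; _++_; length; filter)
  open import Data.List.Properties using (filter-++; length-++; filter-accept; filter-reject)
  open import Relation.Binary.PropositionalEquality
  open import Relation.Nullary.Decidable.Core using (Dec; yes; no)

  count : List (List ℕ) → ℕ → ℕ
  count ps k = length (filter (λ p → sum p ≟ k) ps)

  count-++ : ∀ ps qs k → count (ps ++ qs) k ≡ count ps k + count qs k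
  count-++ ps qs k = trans (cong length (filter-++ (λ p → sum p ≟ k) ps qs)) (length-++ (filter (λ p → sum p ≟ k) ps))

  count-accept : ∀ p ps {k} → sum p ≡ k → count (p ∷ ps) k ≡ suc (count ps k)
  count-accept p ps {k} e = cong length (filter-accept (λ p → sum p ≟ k) {p} {ps} e)

  count-reject : ∀ p ps {k} → sum p ≢ k → count (p ∷ ps) k ≡ count ps k
  count-reject p ps {k} e = cong length (filter-reject (λ p → sum p ≟ k) {p} {ps} e)

  count-map : ∀ m ps j → count (map (m ∷_) ps) (m + j) ≡ count ps j
  count-map m [] j = refl
  count-map m (p ∷ ps) j = by-cases (sum p ≟ j)
    where
    by-cases : Dec (sum p ≡ j) → count (map (m ∷_) (p ∷ ps)) (m + j) ≡ count (p ∷ ps) j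
    by-cases (yes e) = trans (count-accept (m ∷ p) (map (m ∷_) ps) (cong (m +_) e)) (trans (cong suc (count-map m ps j)) (sym (count-accept p ps e)))
    by-cases (no ¬e) = trans (count-reject (m ∷ p) (map (m ∷_) ps) (λ e → ¬e (+-cancelˡ-≡ m (sum p) j e))) (trans (count-map m ps j) (sym (count-reject p ps ¬e)))

  count-map-< : ∀ m ps k → k < m → count (map (m ∷_) ps) k ≡ 0
  count-map-< m [] k k<m = refl
  count-map-< m (p ∷ ps) k k<m = trans (count-reject (m ∷ p) (map (m ∷_) ps) (λ e → <⇒≱ k<m (≤-trans (m≤m+n m (sum p)) (≤-reflexive e)))) (count-map-< m ps k k<m)

  parts : ℕ → ℕ → ℕ
  parts m = count (sublists (down m))

  parts-< : ∀ m k → k < suc m → parts (suc m) k ≡ parts m k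
  parts-< m k h = trans (count-++ (map (suc m ∷_) (sublists (down m))) (sublists (down m)) k) (cong (_+ parts m k) (count-map-< (suc m) (sublists (down m)) k h))

  parts-≥ : ∀ m j → parts (suc m) (suc m + j) ≡ parts m j + parts m (suc m + j)
  parts-≥ m j = trans (count-++ (map (suc m ∷_) (sublists (down m))) (sublists (down m)) (suc m + j)) (cong (_+ parts m (suc m + j)) (count-map (suc m) (sublists (down m)) j))

  -- A part exceeding k cannot occur in a partition of k.
  parts≡q : ∀ {k m} → k ≤ m → parts m k ≡ q k
  parts≡q {k} {m} k≤m = subst (λ i → parts i k ≡ q k) (m∸n+n≡m k≤m) (go (m ∸ k))
    where
    go : ∀ i → parts (i + k) k ≡ q k
    go zero = refl
    go (suc i) = trans (parts-< (i + k) k (s≤s (m≤n+m k i))) (go i)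

-- From the coefficients to the inequality for q

module LogConcavity where
  open Inequalities
  open PowersOfUnit
  open SampleMeans using (δ₀)
  open import Defs
  open Counting
  open Coefficients
  open import Data.Nat.Base as ℕ using (ℕ; suc; zero)
  import Data.Nat.Properties as ℕP
  import Data.Integer.Base as ℤ
  import Data.Integer.Properties as ℤP
  open import Data.Nat.ListAction using (sum)
  import Data.List.Base as L
  open import Data.Empty using (⊥; ⊥-elim)
  open import Relation.Nullary.Decidable.Core using (Dec; yes; no)

  ⟪⟫-neg : ∀ i → ⟪ ℤ.- i ⟫ ≡ - ⟪ i ⟫
  ⟪⟫-neg i = neg-unique ⟪ i ⟫ ⟪ ℤ.- i ⟫ (trans (sym (⟪⟫-+ i (ℤ.- i))) (cong ⟪_⟫ (ℤP.+-inverseʳ i)))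

  ⟪⟫-sub : ∀ i j → ⟪ i ℤ.- j ⟫ ≡ ⟪ i ⟫ - ⟪ j ⟫
  ⟪⟫-sub i j = trans (⟪⟫-+ i (ℤ.- j)) (cong (⟪ i ⟫ +_) (⟪⟫-neg j))

  module _ (ρ : F) where
    lsum-δ : ∀ ps k → lsum ps (λ s → ρ ^ s * δ₀ ℕ.∣ s - k ∣) ≡ ρ ^ k * # (count ps k)
    lsum-δ L.[] k = sym (*0 _)
    lsum-δ (p L.∷ ps) k = by-cases (sum p ℕP.≟ k)
      where
      by-cases : Dec (sum p ≡ k) → lsum (p L.∷ ps) (λ s → ρ ^ s * δ₀ ℕ.∣ s - k ∣) ≡ ρ ^ k * # (count (p L.∷ ps) k)
      by-cases (yes e) = trans (cong₂ _+_ (trans (cong (λ s → ρ ^ s * δ₀ ℕ.∣ s - k ∣) e) (trans (cong (λ j → ρ ^ k * δ₀ j) (ℕP.∣n-n∣≡0 k)) (*1 _))) (lsum-δ ps k))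
        (trans (sym (trans (distribˡ (ρ ^ k) 1# (# (count ps k))) (cong (_+ ρ ^ k * # (count ps k)) (*1 _))))
          (cong (ρ ^ k *_) (trans (sym (#-suc (count ps k))) (cong # (sym (count-accept p ps e))))))
      by-cases (no ¬e) = trans (cong₂ _+_ (trans (cong (ρ ^ sum p *_) (δ₀-off ℕ.∣ sum p - k ∣ (λ z → ¬e (ℕP.∣m-n∣≡0⇒m≡n z)))) (*0 _)) (lsum-δ ps k))
        (trans (⟪0⟫+ _) (cong (λ c → ρ ^ k * # c) (sym (count-reject p ps ¬e))))
        where
        δ₀-off : ∀ j → (j ≡ 0 → ⊥) → δ₀ j ≡ 0#
        δ₀-off zero h = ⊥-elim (h refl)
        δ₀-off (suc j) h = refl

    a : ℕ → F
    a k = ρ ^ k * # (q k)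

    module _ (N : ℕ) where
      private
        S = sublists (down N)
        L : (ℕ → F) → F
        L f = lsum S (λ s → ρ ^ s * f s)
        L-δ : ∀ {k} → k ℕ.≤ N → L (λ s → δ₀ ℕ.∣ s - k ∣) ≡ a k
        L-δ {k} k≤N = trans (lsum-δ S k) (cong (λ c → ρ ^ k * # c) (parts≡q k≤N))
        L-lin : ∀ f g h → L (λ s → ⟪ pos 2 ⟫ * f s + (⟪ negsuc 0 ⟫ * g s + ⟪ negsuc 0 ⟫ * h s)) ≡ ⟪ pos 2 ⟫ * L f + (⟪ negsuc 0 ⟫ * L g + ⟪ negsuc 0 ⟫ * L h)
        L-lin f g h = trans (lsum-cong S (λ s → ring (r :* (lit 2 :* x :+ (con (negsuc 0) :* y :+ con (negsuc 0) :* z))) (lit 2 :* (r :* x) :+ lit 1 :* (con (negsuc 0) :* (r :* y) :+ con (negsuc 0) :* (r :* z))) (ρ ^ s ∷ f s ∷ g s ∷ h s ∷ []) refl))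
          (trans (lsum-lin S ⟪ pos 2 ⟫ 1# (λ s → ρ ^ s * f s) (λ s → ⟪ negsuc 0 ⟫ * (ρ ^ s * g s) + ⟪ negsuc 0 ⟫ * (ρ ^ s * h s)))
            (cong (⟪ pos 2 ⟫ * L f +_) (trans (⟪1⟫* _) (lsum-lin S ⟪ negsuc 0 ⟫ ⟪ negsuc 0 ⟫ (λ s → ρ ^ s * g s) (λ s → ρ ^ s * h s)))))
          where r = var 0F ; x = var 1F ; y = var 2F ; z = var 3F
        Δ² : F → F → F → F
        Δ² x y z = ⟪ pos 2 ⟫ * x + (⟪ negsuc 0 ⟫ * y + ⟪ negsuc 0 ⟫ * z)
        L-Δ² : ∀ f g h {x y z} → L f ≡ x → L g ≡ y → L h ≡ z → L (λ s → Δ² (f s) (g s) (h s)) ≡ Δ² x y z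
        L-Δ² f g h refl refl refl = L-lin f g h
        δ : ℕ → ℕ → F
        δ k s = δ₀ ℕ.∣ s - k ∣

      module _ (m : ℕ) (m+4≤N : 4 ℕ.+ m ℕ.≤ N) where
        private
          k₀ : m ℕ.≤ N
          k₀ = ℕP.≤-trans (ℕP.m≤n+m m 4) m+4≤N
          k₁ : 1 ℕ.+ m ℕ.≤ N
          k₁ = ℕP.≤-trans (ℕP.m≤n+m _ 3) m+4≤N
          k₂ : 2 ℕ.+ m ℕ.≤ N
          k₂ = ℕP.≤-trans (ℕP.m≤n+m _ 2) m+4≤N
          k₃ : 3 ℕ.+ m ℕ.≤ N
          k₃ = ℕP.≤-trans (ℕP.m≤n+m _ 1) m+4≤N
          D₁ D₂ D₃ : ℕ → F
          D₁ s = Δ² (δ (1 ℕ.+ m) s) (δ m s) (δ (2 ℕ.+ m) s)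
          D₂ s = Δ² (δ (2 ℕ.+ m) s) (δ (1 ℕ.+ m) s) (δ (3 ℕ.+ m) s)
          D₃ s = Δ² (δ (3 ℕ.+ m) s) (δ (2 ℕ.+ m) s) (δ (4 ℕ.+ m) s)
        I0≡ : I ρ N (2 ℕ.+ m) 0 ≡ a (2 ℕ.+ m)
        I0≡ = L-δ k₂
        I1≡ : I ρ N (2 ℕ.+ m) 1 ≡ Δ² (a (2 ℕ.+ m)) (a (1 ℕ.+ m)) (a (3 ℕ.+ m))
        I1≡ = L-Δ² (δ (2 ℕ.+ m)) (δ (1 ℕ.+ m)) (δ (3 ℕ.+ m)) (L-δ k₂) (L-δ k₁) (L-δ k₃)
        I2≡ : I ρ N (2 ℕ.+ m) 2 ≡ Δ² (Δ² (a (2 ℕ.+ m)) (a (1 ℕ.+ m)) (a (3 ℕ.+ m))) (Δ² (a (1 ℕ.+ m)) (a m) (a (2 ℕ.+ m))) (Δ² (a (3 ℕ.+ m)) (a (2 ℕ.+ m)) (a (4 ℕ.+ m)))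
        I2≡ = L-Δ² D₂ D₁ D₃ (L-Δ² (δ (2 ℕ.+ m)) (δ (1 ℕ.+ m)) (δ (3 ℕ.+ m)) (L-δ k₂) (L-δ k₁) (L-δ k₃))
          (L-Δ² (δ (1 ℕ.+ m)) (δ m) (δ (2 ℕ.+ m)) (L-δ k₁) (L-δ k₀) (L-δ k₂))
          (L-Δ² (δ (3 ℕ.+ m)) (δ (2 ℕ.+ m)) (δ (4 ℕ.+ m)) (L-δ k₃) (L-δ k₂) (L-δ m+4≤N))

        -- With Δ = I₀I₂ − I₁² the identity D₋ + D₊ = 2D − Δ turns 0 < Δ < 4D into 4D₋D₊ ≤ (2D − Δ)² < 4D².
        log-concave : 0# ≤ ρ → 0# < I ρ N (2 ℕ.+ m) 0 → I ρ N (2 ℕ.+ m) 1 * I ρ N (2 ℕ.+ m) 1 < I ρ N (2 ℕ.+ m) 0 * I ρ N (2 ℕ.+ m) 2 → I ρ N (2 ℕ.+ m) 2 < ⟪ pos 4 ⟫ * I ρ N (2 ℕ.+ m) 1 →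
          (# (q (1 ℕ.+ m)) * # (q (1 ℕ.+ m)) - # (q m) * # (q (2 ℕ.+ m))) * (# (q (3 ℕ.+ m)) * # (q (3 ℕ.+ m)) - # (q (2 ℕ.+ m)) * # (q (4 ℕ.+ m)))
            < (# (q (2 ℕ.+ m)) * # (q (2 ℕ.+ m)) - # (q (1 ℕ.+ m)) * # (q (3 ℕ.+ m))) * (# (q (2 ℕ.+ m)) * # (q (2 ℕ.+ m)) - # (q (1 ℕ.+ m)) * # (q (3 ℕ.+ m)))
        log-concave ρ≥0 I₀>0 h₁ h₂ bad = *>0 Δ>0 4D-Δ>0 (prove (Δ :* (lit 4 :* D :- Δ)) (lit 0) vec
            -- The factor ρ^(8 + 4m) is common to D² and D₋D₊, so the tilt drops out of the
            -- comparison.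
            (nat 4 ⊗ (ge0 (r :^ 8 :* R :^ 4) (*≥0 (^≥0 ρ≥0 8) (^≥0 (^≥0 ρ≥0 m) 4)) ⊗ le (d q₂ q₁ q₃ :* d q₂ q₁ q₃) (d q₁ q₀ q₂ :* d q₃ q₂ q₄) bad) ⊕ sq (d A₁ A₀ A₂ :- d A₃ A₂ A₄)) refl)
          where
          vec : Vec F 7
          vec = ρ ∷ ρ ^ m ∷ # (q m) ∷ # (q (1 ℕ.+ m)) ∷ # (q (2 ℕ.+ m)) ∷ # (q (3 ℕ.+ m)) ∷ # (q (4 ℕ.+ m)) ∷ []
          r R q₀ q₁ q₂ q₃ q₄ A₀ A₁ A₂ A₃ A₄ I₁ I₂ Δ D : Expr {7}
          r = var 0F ; R = var 1F ; q₀ = var 2F ; q₁ = var 3F ; q₂ = var 4F ; q₃ = var 5F ; q₄ = var 6F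
          A₀ = R :* q₀
          A₁ = r :* R :* q₁
          A₂ = r :* (r :* R) :* q₂
          A₃ = r :* (r :* (r :* R)) :* q₃
          A₄ = r :* (r :* (r :* (r :* R))) :* q₄
          d δ² : Expr {7} → Expr {7} → Expr {7} → Expr {7}
          d x y z = x :* x :- y :* z
          δ² x y z = lit 2 :* x :+ (con (negsuc 0) :* y :+ con (negsuc 0) :* z)
          I₁ = δ² A₂ A₁ A₃
          I₂ = δ² I₁ (δ² A₁ A₀ A₂) (δ² A₃ A₂ A₄)
          Δ = A₂ :* I₂ :- I₁ :* I₁
          D = d A₂ A₁ A₃
          Δ>0 : 0# < ⟦ Δ ⟧ vec
          Δ>0 p = subst₂ _<_ (cong₂ _*_ I1≡ I1≡) (cong₂ _*_ I0≡ I2≡) h₁ (prove (A₂ :* I₂) (I₁ :* I₁) vec (le Δ (lit 0) p) refl)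
          4D-Δ>0 : 0# < ⟦ lit 4 :* D :- Δ ⟧ vec
          4D-Δ>0 p = *>0 {y = ⟦ lit 4 :* I₁ :- I₂ ⟧ vec} (subst (0# <_) I0≡ I₀>0) (λ p′ → subst₂ _<_ I2≡ (cong (⟪ pos 4 ⟫ *_) I1≡) h₂ (prove (lit 4 :* I₁) I₂ vec (le (lit 4 :* I₁ :- I₂) (lit 0) p′) refl))
            -- 4D - Δ = A₂(4I₁ - I₂) + (A₁ - A₃)².
            (prove (A₂ :* (lit 4 :* I₁ :- I₂)) (lit 0) vec (le (lit 4 :* D :- Δ) (lit 0) p ⊕ sq (A₁ :- A₃)) refl)

  to-ℤ : ∀ {i j} → ⟪ i ⟫ < ⟪ j ⟫ → i ℤ.< j
  to-ℤ h = ℤP.≰⇒> (λ p → h (⟪⟫-≤ p))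

  -- the theorem for n = m + 2
  Claim : ℕ → Set
  Claim m = (qℤ (1 ℕ.+ m) ℤ.* qℤ (1 ℕ.+ m) ℤ.- qℤ m ℤ.* qℤ (2 ℕ.+ m)) ℤ.* (qℤ (3 ℕ.+ m) ℤ.* qℤ (3 ℕ.+ m) ℤ.- qℤ (2 ℕ.+ m) ℤ.* qℤ (4 ℕ.+ m))
    ℤ.< (qℤ (2 ℕ.+ m) ℤ.* qℤ (2 ℕ.+ m) ℤ.- qℤ (1 ℕ.+ m) ℤ.* qℤ (3 ℕ.+ m)) ℤ.* (qℤ (2 ℕ.+ m) ℤ.* qℤ (2 ℕ.+ m) ℤ.- qℤ (1 ℕ.+ m) ℤ.* qℤ (3 ℕ.+ m))

  module _ (m : ℕ) where
    private
      d : ℕ → ℕ → ℕ → ℤ.ℤ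
      d i j k = qℤ i ℤ.* qℤ i ℤ.- qℤ j ℤ.* qℤ k
      ⟪d⟫ : ∀ i j k → ⟪ d i j k ⟫ ≡ # (q i) * # (q i) - # (q j) * # (q k)
      ⟪d⟫ i j k = trans (⟪⟫-sub (qℤ i ℤ.* qℤ i) (qℤ j ℤ.* qℤ k)) (cong₂ _-_ (⟪⟫-* (qℤ i) (qℤ i)) (⟪⟫-* (qℤ j) (qℤ k)))

    descend : (# (q (1 ℕ.+ m)) * # (q (1 ℕ.+ m)) - # (q m) * # (q (2 ℕ.+ m))) * (# (q (3 ℕ.+ m)) * # (q (3 ℕ.+ m)) - # (q (2 ℕ.+ m)) * # (q (4 ℕ.+ m)))
        < (# (q (2 ℕ.+ m)) * # (q (2 ℕ.+ m)) - # (q (1 ℕ.+ m)) * # (q (3 ℕ.+ m))) * (# (q (2 ℕ.+ m)) * # (q (2 ℕ.+ m)) - # (q (1 ℕ.+ m)) * # (q (3 ℕ.+ m))) → Claim m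
    descend h = to-ℤ (subst₂ _<_ (sym (prod (1 ℕ.+ m) m (2 ℕ.+ m) (3 ℕ.+ m) (2 ℕ.+ m) (4 ℕ.+ m))) (sym (prod (2 ℕ.+ m) (1 ℕ.+ m) (3 ℕ.+ m) (2 ℕ.+ m) (1 ℕ.+ m) (3 ℕ.+ m))) h)
      where
      prod : ∀ i j k i′ j′ k′ → ⟪ d i j k ℤ.* d i′ j′ k′ ⟫ ≡ (# (q i) * # (q i) - # (q j) * # (q k)) * (# (q i′) * # (q i′) - # (q j′) * # (q k′))
      prod i j k i′ j′ k′ = trans (⟪⟫-* (d i j k) (d i′ j′ k′)) (cong₂ _*_ (⟪d⟫ i j k) (⟪d⟫ i′ j′ k′))

    saddle⇒claim : ∀ ρ N → 0# ≤ ρ → 4 ℕ.+ m ℕ.≤ N → 0# < I ρ N (2 ℕ.+ m) 0 → I ρ N (2 ℕ.+ m) 1 * I ρ N (2 ℕ.+ m) 1 < I ρ N (2 ℕ.+ m) 0 * I ρ N (2 ℕ.+ m) 2 → I ρ N (2 ℕ.+ m) 2 < ⟪ pos 4 ⟫ * I ρ N (2 ℕ.+ m) 1 → Claim m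
    saddle⇒claim ρ N ρ≥0 m+4≤N h₀ h₁ h₂ = descend (log-concave ρ N m m+4≤N ρ≥0 h₀ h₁ h₂)

-- Choice of the saddle point for large n

module SaddlePoint where
  open Inequalities
  open PowersOfUnit
  open PairProducts
  open CentralBound using (pow-bernoulli; pow≤1)
  open UpperBounds using (bernoulli; ^-anti; 1^)
  open PowerSums
  open TiltedSums
  open Rounding
  open MinorArcs using (^-*)
  open Moments using (#-*)
  open CircleMethod
  open LogConcavity using (Claim; saddle⇒claim)
  open import Data.Nat.Base as ℕ using (ℕ; suc; zero)
  import Data.Nat.Properties as ℕP
  import Data.Nat.DivMod as ℕD
  open import Data.Sum.Base using (_⊎_; inj₁; inj₂)
  open import Data.Product.Base using (∃; _×_; _,_; proj₁; proj₂)
  open import Data.Empty using (⊥-elim)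
  open import Relation.Nullary.Decidable.Core using (yes; no)

  ^-lipschitz : ∀ {x y} → 0# ≤ x → x ≤ y → y ≤ 1# → ∀ m → y ^ m ≤ x ^ m + # m * (y - x)
  ^-lipschitz {x} {y} x≥0 x≤y y≤1 zero = prove (lit 1) (lit 1 :+ lit 0 :* (var 1F :- var 0F)) (x ∷ y ∷ []) (nat 0) refl
  ^-lipschitz {x} {y} x≥0 x≤y y≤1 (suc m) = subst (λ k → y ^ suc m ≤ x ^ suc m + k * (y - x)) (sym (#-suc m))
    (prove (Y :* u) (X :* w :+ (lit 1 :+ k) :* (Y :- X)) (x ∷ y ∷ x ^ m ∷ y ^ m ∷ # m ∷ [])
      (ge0 X x≥0 ⊗ le u (w :+ k :* (Y :- X)) (^-lipschitz x≥0 x≤y y≤1 m) ⊕ le X Y x≤y ⊗ le u (lit 1) (pow≤1 (≤-trans x≥0 x≤y) y≤1 m)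
        ⊕ ge0 k (⟪⟫≥0 m) ⊗ (le X Y x≤y ⊗ (le X Y x≤y ⊕ le Y (lit 1) y≤1))) refl)
    where X = var 0F ; Y = var 1F ; w = var 2F ; u = var 3F ; k = var 4F

  prob : F → ℕ → F
  prob ρ m = ρ ^ m * inv (1# + ρ ^ m)

  mean : F → ℕ → F
  mean ρ = Σ₁ (λ m → # m * prob ρ m)

  prob-lipschitz : ∀ {x y} → 0# ≤ x → x ≤ y → y ≤ 1# → ∀ m → prob y m ≤ prob x m + # m * (y - x)
  prob-lipschitz {x} {y} x≥0 x≤y y≤1 m = *-cancel-≤ (*>0 (P.1+y>0 m) (Q.1+y>0 m)) (prove
      ((lit 1 :+ u) :* (lit 1 :+ w) :* q) ((lit 1 :+ u) :* (lit 1 :+ w) :* (p :+ k)) (x ^ m ∷ y ^ m ∷ prob x m ∷ prob y m ∷ # m * (y - x) ∷ [])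
      (eqn (p :* (lit 1 :+ u)) u (P.p-def m) (lit 1 :+ w) ⊕ eqn (q :* (lit 1 :+ w)) w (Q.p-def m) (:- (lit 1 :+ u))
       ⊕ le w (u :+ k) (^-lipschitz x≥0 x≤y y≤1 m) ⊕ ge0 k k≥0 ⊗ (ge0 u (P.y≥0 m) ⊕ ge0 w (Q.y≥0 m) ⊕ ge0 u (P.y≥0 m) ⊗ ge0 w (Q.y≥0 m))) refl)
    where
    module P = Probability x x≥0 (≤-trans x≤y y≤1)
    module Q = Probability y (≤-trans x≥0 x≤y) y≤1
    u = var 0F ; w = var 1F ; p = var 2F ; q = var 3F ; k = var 4F
    k≥0 : 0# ≤ # m * (y - x)
    k≥0 = *≥0 (⟪⟫≥0 m) (sub≥0 x≤y)

  mean-lipschitz : ∀ {x y} → 0# ≤ x → x ≤ y → y ≤ 1# → ∀ N → mean y N ≤ mean x N + # N * # N * # N * (y - x)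
  mean-lipschitz {x} {y} x≥0 x≤y y≤1 N = ≤-trans (Σ₁-mono {λ m → # m * prob y m} {λ m → # m * prob x m + # N * # N * (y - x)} N termwise)
    (≤-reflexive (trans (Σ₁-+ (λ m → # m * prob x m) (λ _ → # N * # N * (y - x)) N) (cong (mean x N +_) (trans (Σ₁-const _ N) (ring (n :* (n :* n :* d)) (n :* n :* n :* d) (# N ∷ y - x ∷ []) refl)))))
    where
    n = var 0F ; d = var 1F
    termwise : ∀ k → k ℕ.< N → # (suc k) * prob y (suc k) ≤ # (suc k) * prob x (suc k) + # N * # N * (y - x)
    termwise k k<N = prove (m :* q) (m :* p :+ n′ :* n′ :* δ) (# (suc k) ∷ # N ∷ prob x (suc k) ∷ prob y (suc k) ∷ y - x ∷ [])
      (ge0 m (⟪⟫≥0 (suc k)) ⊗ le q (p :+ m :* δ) (prob-lipschitz x≥0 x≤y y≤1 (suc k)) ⊕ ge0 δ (sub≥0 x≤y) ⊗ (le m n′ (#-mono k<N) ⊗ (ge0 m (⟪⟫≥0 (suc k)) ⊕ ge0 n′ (⟪⟫≥0 N)))) refl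
      where m = var 0F ; n′ = var 1F ; p = var 2F ; q = var 3F ; δ = var 4F

  -- A discrete intermediate value theorem: steps of at most 1 cannot jump over an interval of
  -- length 1.
  first-crossing : ∀ (μ : ℕ → F) (a : F) → μ 0 < a → ∀ K → (∀ j → j ℕ.< K → μ (suc j) ≤ μ j + 1#) → μ K < a ⊎ ∃ λ j → j ℕ.≤ K × a ≤ μ j × μ j < a + 1#
  first-crossing μ a h zero step = inj₁ h
  first-crossing μ a h (suc K) step with first-crossing μ a h K (λ j p → step j (ℕP.m≤n⇒m≤1+n p))
  ... | inj₂ (j , j≤K , p) = inj₂ (j , ℕP.m≤n⇒m≤1+n j≤K , p)
  ... | inj₁ q with a ≤? μ (suc K)
  ...   | no r = inj₁ r
  ...   | yes r = inj₂ (suc K , ℕP.≤-refl , r , λ s → q (prove (var 1F) (var 0F) (μ K ∷ a ∷ μ (suc K) ∷ []) (le (var 2F) (var 0F :+ lit 1) (step K ℕP.≤-refl) ⊕ le (var 1F :+ lit 1) (var 2F) s) refl))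

  Σm≡ : ∀ N → ⟪ pos 2 ⟫ * Σ₁ # N ≡ # N * (# N + 1#)
  Σm≡ zero = ring (lit 2 :* lit 0) (lit 0 :* (lit 0 :+ lit 1)) [] refl
  Σm≡ (suc k) = prove= (lit 2 :* (s :+ n)) (n :* (n :+ lit 1)) (Σ₁ # k ∷ # k ∷ # (suc k) ∷ []) (by= (lit 2 :* s) (m :* (m :+ lit 1)) (Σm≡ k) (lit 1) ⊞ by= n (lit 1 :+ m) (#-suc k) (lit 0 :- n :- m)) refl
    where s = var 0F ; m = var 1F ; n = var 2F

  -- ρ runs through the multiples of 1/N³ until the mean ∑ m pₘ of the tilted partition lies in [n, n + 1)
  module Saddle (m : ℕ) (m≥ : 129598 ℕ.≤ m) where
    n N : ℕ
    n = 2 ℕ.+ m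
    N = 4 ℕ.+ m
    private
      step : F
      step = inv (# N * # N * # N)
      N³>0 : 0# < # N * # N * # N
      N³>0 = *>0 (*>0 (⟪⟫>0 (3 ℕ.+ m)) (⟪⟫>0 (3 ℕ.+ m))) (⟪⟫>0 (3 ℕ.+ m))
      step≥0 : 0# ≤ step
      step≥0 = inv≥0 N³>0
      tₛ : ℕ → F
      tₛ j = 1# - # j * step
      μ : ℕ → F
      μ j = mean (1# - tₛ j) N
      x≡ : ∀ j → 1# - tₛ j ≡ # j * step
      x≡ j = ring (lit 1 :- (lit 1 :- x)) x (# j * step ∷ []) refl
        where x = var 0F
      J = N ℕ.* N ℕ.* N
      #J : # J * step ≡ 1#
      #J = trans (cong (_* step) (trans (#-* (N ℕ.* N) N) (cong (_* # N) (#-* N N)))) (inv-eq N³>0)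
      x≥0 : ∀ j → 0# ≤ 1# - tₛ j
      x≥0 j = subst (0# ≤_) (sym (x≡ j)) (*≥0 (⟪⟫≥0 j) step≥0)
      x≤1 : ∀ {j} → j ℕ.≤ J → 1# - tₛ j ≤ 1#
      x≤1 {j} h = subst₂ _≤_ (sym (x≡ j)) #J (prove (a :* s) (b :* s) (# j ∷ # J ∷ step ∷ []) (le a b (#-mono h) ⊗ ge0 s step≥0) refl)
        where a = var 0F ; b = var 1F ; s = var 2F
      x-suc : ∀ j → (1# - tₛ (suc j)) - (1# - tₛ j) ≡ step
      x-suc j = prove= ((lit 1 :- (lit 1 :- a :* s)) :- (lit 1 :- (lit 1 :- b :* s))) s (# (suc j) ∷ # j ∷ step ∷ []) (by= a (lit 1 :+ b) (#-suc j) s) refl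
        where a = var 0F ; b = var 1F ; s = var 2F
      μ-step : ∀ j → j ℕ.< J → μ (suc j) ≤ μ j + 1#
      μ-step j h = ≤-trans (mean-lipschitz (x≥0 j) (from≥0 (subst (0# ≤_) (sym (x-suc j)) step≥0)) (x≤1 h) N)
        (≤-reflexive (cong (μ j +_) (trans (cong (# N * # N * # N *_) (x-suc j)) (inv-eq N³>0))))
      μ0 : μ 0 < # n
      μ0 = ≤-<-trans (≤-reflexive (trans (Σ₁-≗ (λ k → # k * prob (1# - tₛ 0) k) (λ _ → 0#) N zeros) (trans (Σ₁-const 0# N) (*0 _)))) (⟪⟫>0 (1 ℕ.+ m))
        where
        zeros : ∀ k → # (suc k) * prob (1# - tₛ 0) (suc k) ≡ 0#
        zeros k = prove= (a :* ((x :* w) :* i)) (lit 0) (# (suc k) ∷ 1# - tₛ 0 ∷ (1# - tₛ 0) ^ k ∷ inv (1# + (1# - tₛ 0) ^ suc k) ∷ step ∷ []) (by= x (lit 0 :* s) (x≡ 0) (a :* (w :* i))) refl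
          where a = var 0F ; x = var 1F ; w = var 2F ; i = var 3F ; s = var 4F
      -- At ρ = 1 every pₘ is 1/2, so the mean is N(N + 1)/4.
      μK : # n + 1# ≤ μ J
      μK = *-cancel-≤ (⟪⟫>0 3) (prove (lit 4 :* (n′ :+ lit 1)) (lit 4 :* M) (# n ∷ μ J ∷ Σ₁ # N ∷ # N ∷ [])
          (nat 2 ⊗ le s (lit 2 :* M) half ⊕ eqn (lit 2 :* s) (N′ :* (N′ :+ lit 1)) (Σm≡ N) (lit 1) ⊕ eqn N′ (lit 2 :+ n′) (⟪⟫-+ (pos 2) (pos n)) (N′ :+ n′ :+ lit 3) ⊕ ge0 n′ (⟪⟫≥0 n) ⊕ sq n′ ⊕ nat 2) refl)
        where
        n′ = var 0F ; M = var 1F ; s = var 2F ; N′ = var 3F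
        x≡1 : 1# - tₛ J ≡ 1#
        x≡1 = trans (x≡ J) #J
        module P₁ = Probability (1# - tₛ J) (x≥0 J) (≤-reflexive x≡1)
        half : Σ₁ # N ≤ ⟪ pos 2 ⟫ * μ J
        half = ≤-trans (Σ₁≤ # (λ k → ⟪ pos 2 ⟫ * (# k * prob (1# - tₛ J) k)) N (λ k → prove a (lit 2 :* (a :* p)) (# (suc k) ∷ prob (1# - tₛ J) (suc k) ∷ (1# - tₛ J) ^ suc k ∷ [])
            (ge0 a (⟪⟫≥0 (suc k)) ⊗ (le y (lit 2 :* p) (P₁.y≤2p (suc k)) ⊕ le (lit 1) y (≤-reflexive (sym (trans (cong (_^ suc k) x≡1) (1^ (suc k))))))) refl))
          (≤-reflexive (Σ₁-* _ (λ k → # k * prob (1# - tₛ J) k) N))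
          where a = var 0F ; p = var 1F ; y = var 2F

      crossing : ∃ λ j → j ℕ.≤ J × # n ≤ μ j × μ j < # n + 1#
      crossing = from-⊎ (first-crossing μ (# n) μ0 J μ-step)
        where
        from-⊎ : μ J < # n ⊎ (∃ λ j → j ℕ.≤ J × # n ≤ μ j × μ j < # n + 1#) → ∃ λ j → j ℕ.≤ J × # n ≤ μ j × μ j < # n + 1#
        from-⊎ (inj₂ c) = c
        from-⊎ (inj₁ q) = ⊥-elim (q (≤-trans (prove (var 0F) (var 0F :+ lit 1) (# n ∷ []) (nat 1) refl) μK))

    j : ℕ
    j = proj₁ crossing
    t ρ : F
    t = tₛ j
    ρ = 1# - t
    private
      n≤μ : # n ≤ mean ρ N
      n≤μ = proj₁ (proj₂ (proj₂ crossing))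
      μ<n+1 : mean ρ N < # n + 1#
      μ<n+1 = proj₂ (proj₂ (proj₂ crossing))
      ρ≤1 : ρ ≤ 1#
      ρ≤1 = x≤1 (proj₁ (proj₂ crossing))
    ρ≥0 : 0# ≤ ρ
    ρ≥0 = x≥0 j
    private
      t≥0 : 0# ≤ t
      t≥0 = prove (lit 0) T (t ∷ []) (le (lit 1 :- T) (lit 1) ρ≤1) refl
        where T = var 0F
      t>0 : 0# < t
      t>0 q = μ<n+1 (≤-trans μK (≤-reflexive (cong (λ x → mean x N) (trans (x≡ J) (trans #J (sym (trans (cong (λ z → 1# - z) (≤-antisym q t≥0)) (ring (lit 1 :- lit 0) (lit 1) [] refl))))))))

      module P = Probability ρ ρ≥0 ρ≤1
      module G₁ = Geometric ρ ρ≥0 ρ≤1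
      1-ρ : 1# - ρ ≡ t
      1-ρ = ring (lit 1 :- (lit 1 :- T)) T (t ∷ []) refl
        where T = var 0F
      Σmρ^m : F
      Σmρ^m = Σ₁ (λ k → # k * ρ ^ k) N
      μ≤ : mean ρ N ≤ Σmρ^m
      μ≤ = Σ₁≤ (λ k → # k * prob ρ k) (λ k → # k * ρ ^ k) N (λ k → prove (a :* p) (a :* y) (# (suc k) ∷ prob ρ (suc k) ∷ ρ ^ suc k ∷ []) (ge0 a (⟪⟫≥0 (suc k)) ⊗ le p y (P.p≤y (suc k))) refl)
        where a = var 0F ; p = var 1F ; y = var 2F
      2μ≥ : Σmρ^m ≤ ⟪ pos 2 ⟫ * mean ρ N
      2μ≥ = ≤-trans (Σ₁≤ (λ k → # k * ρ ^ k) (λ k → ⟪ pos 2 ⟫ * (# k * prob ρ k)) N (λ k → prove (a :* y) (lit 2 :* (a :* p)) (# (suc k) ∷ prob ρ (suc k) ∷ ρ ^ suc k ∷ []) (ge0 a (⟪⟫≥0 (suc k)) ⊗ le y (lit 2 :* p) (P.y≤2p (suc k))) refl))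
        (≤-reflexive (Σ₁-* _ (λ k → # k * prob ρ k) N))
        where a = var 0F ; p = var 1F ; y = var 2F
      -- n ≤ μ ≤ Σ mρᵐ ≤ t⁻².
      nt²≤1 : # n * (t * t) ≤ 1#
      nt²≤1 = prove (a :* (T :* T)) (lit 1) (# n ∷ t ∷ Σmρ^m ∷ mean ρ N ∷ [])
          (sq T ⊗ (le a M n≤μ ⊕ le M s μ≤) ⊕ le (T :^ 2 :* s) (lit 1) (subst (λ d → d ^ 2 * Σmρ^m ≤ 1#) 1-ρ (G₁.Σm≤ N))) refl
        where a = var 0F ; T = var 1F ; s = var 2F ; M = var 3F
      #N : # N ≡ ⟪ pos 2 ⟫ + # n
      #N = ⟪⟫-+ (pos 2) (pos n)
      Nt²≤ : # N * (t * t) ≤ 1# + ⟪ pos 2 ⟫ * (t * t)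
      Nt²≤ = prove (b :* (T :* T)) (lit 1 :+ lit 2 :* (T :* T)) (# n ∷ t ∷ # N ∷ []) (le (a :* (T :* T)) (lit 1) nt²≤1 ⊕ eqn b (lit 2 :+ a) #N (:- (T :* T))) refl
        where a = var 0F ; T = var 1F ; b = var 2F
      360t≤1 : ⟪ pos 360 ⟫ * t ≤ 1#
      360t≤1 = sq≤1⇒≤1 _ (prove (lit 360 :* T :* (lit 360 :* T)) (lit 1) (# n ∷ t ∷ []) (le (a :* (T :* T)) (lit 1) nt²≤1 ⊕ sq T ⊗ le (lit 129600) a (#-mono (ℕP.+-monoʳ-≤ 2 m≥))) refl)
        where a = var 0F ; T = var 1F

      S : F
      S = inv t
      tS : t * S ≡ 1#
      tS = inv-eq t>0
      -- Minorant of Σ mρᵐ by ρᵐ ≥ 1 - mt. Its closed form, used up to k of size about 1/t, bounds t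
      -- from below.
      Λ : ℕ → F
      Λ = Σ₁ (λ k → # k * (1# - # k * t))
      6Λ : ∀ k → ⟪ pos 6 ⟫ * Λ k ≡ ⟪ pos 3 ⟫ * (# k * (# k + 1#)) - t * (# k * (# k + 1#) * (⟪ pos 2 ⟫ * # k + 1#))
      6Λ zero = ring (lit 6 :* lit 0) (lit 3 :* (lit 0 :* (lit 0 :+ lit 1)) :- T :* (lit 0 :* (lit 0 :+ lit 1) :* (lit 2 :* lit 0 :+ lit 1))) (t ∷ []) refl
        where T = var 0F
      6Λ (suc k) = prove= (lit 6 :* (l :+ b :* (lit 1 :- b :* T))) (f b) (t ∷ Λ k ∷ # k ∷ # (suc k) ∷ [])
        (by= (lit 6 :* l) (f a) (6Λ k) (lit 1) ⊞ by= b (lit 1 :+ a) (#-suc k)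
          (lit 6 :- lit 6 :* T :* (b :+ a :+ lit 1) :- lit 3 :* (b :+ a :+ lit 2) :+ T :* (lit 2 :* (b :* b :+ b :* (a :+ lit 1) :+ (a :+ lit 1) :* (a :+ lit 1)) :+ lit 3 :* (b :+ a :+ lit 1) :+ lit 1))) refl
        where
        T = var 0F ; l = var 1F ; a = var 2F ; b = var 3F
        f : Expr {4} → Expr {4}
        f x = lit 3 :* (x :* (x :+ lit 1)) :- T :* (x :* (x :+ lit 1) :* (lit 2 :* x :+ lit 1))

      Λ≤ : ∀ {k} → k ℕ.≤ N → Λ k ≤ Σmρ^m
      Λ≤ {k} k≤N = ≤-trans (Σ₁≤ (λ k → # k * (1# - # k * t)) (λ k → # k * ρ ^ k) k (λ i → prove (a :* b) (a :* y) (# (suc i) ∷ 1# - # (suc i) * t ∷ ρ ^ suc i ∷ []) (ge0 a (⟪⟫≥0 (suc i)) ⊗ le b y (bernoulli t≥0 t≤1 (suc i))) refl))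
          (subst (λ i → Σ₁ (λ k → # k * ρ ^ k) k ≤ Σ₁ (λ k → # k * ρ ^ k) i) (ℕP.m∸n+n≡m k≤N) (grow (N ℕ.∸ k)))
        where
        a = var 0F ; b = var 1F ; y = var 2F
        t≤1 : t ≤ 1#
        t≤1 = prove T (lit 1) (t ∷ []) (le (lit 360 :* T) (lit 1) 360t≤1 ⊕ nat 359 ⊗ ge0 T t≥0) refl
          where T = var 0F
        grow : ∀ i → Σ₁ (λ k → # k * ρ ^ k) k ≤ Σ₁ (λ k → # k * ρ ^ k) (i ℕ.+ k)
        grow zero = ≤-refl
        grow (suc i) = ≤-trans (grow i) (prove u (u :+ w) (Σ₁ (λ k → # k * ρ ^ k) (i ℕ.+ k) ∷ # (suc (i ℕ.+ k)) * ρ ^ suc (i ℕ.+ k) ∷ []) (ge0 w (*≥0 (⟪⟫≥0 _) (^≥0 ρ≥0 (suc (i ℕ.+ k))))) refl)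
          where u = var 0F ; w = var 1F

      -- For kt ≤ 1 one has k² - 1 ≤ 6Λ(k) ≤ 12μ < 12(n + 1), and n + 1 = N - 1.
      k²≤ : ∀ k → k ℕ.≤ N → # k * t ≤ 1# → # k * # k ≤ ⟪ pos 12 ⟫ * # N - ⟪ pos 11 ⟫
      k²≤ k k≤N kt≤1 = prove (a :* a) (lit 12 :* b :- lit 11) (# k ∷ t ∷ # N ∷ Λ k ∷ Σmρ^m ∷ mean ρ N ∷ # n ∷ [])
        (eqn (lit 6 :* l) (lit 3 :* (a :* (a :+ lit 1)) :- T :* (a :* (a :+ lit 1) :* (lit 2 :* a :+ lit 1))) (6Λ k) (lit 1)
         ⊕ nat 6 ⊗ le l s (Λ≤ k≤N) ⊕ nat 6 ⊗ le s (lit 2 :* M) 2μ≥ ⊕ nat 12 ⊗ le M (c :+ lit 1) (<⇒≤ μ<n+1)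
         ⊕ (ge0 a (⟪⟫≥0 k) ⊕ nat 1) ⊗ (nat 2 ⊗ ge0 a (⟪⟫≥0 k) ⊕ nat 1) ⊗ le (a :* T) (lit 1) kt≤1 ⊕ eqn b (lit 2 :+ c) #N (lit 12)) refl
        where a = var 0F ; T = var 1F ; b = var 2F ; l = var 3F ; s = var 4F ; M = var 5F ; c = var 6F

      -- k = ⌊1/t⌋ in `k²≤` makes 12N at least about t⁻², hence 12Nt at least about 1/t ≥ 360. The
      -- case Nt ≤ 1 is excluded, since k = N would give N² < 12N.
      Nt≥ : ⟪ pos 358 ⟫ ≤ ⟪ pos 12 ⟫ * (# N * t)
      Nt≥ = by-cases (≤-total (# N * t) 1#)
        where
        by-cases : # N * t ≤ 1# ⊎ 1# ≤ # N * t → ⟪ pos 358 ⟫ ≤ ⟪ pos 12 ⟫ * (# N * t)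
        by-cases (inj₁ h) = ⊥-elim (⟪⟫>0 0 (prove (lit 1) (lit 0) (# N ∷ []) (le (a :* a) (lit 12 :* a :- lit 11) (k²≤ N ℕP.≤-refl h) ⊕ le (lit 129602) a N≥ ⊗ (le (lit 129602) a N≥ ⊕ nat 259192) ⊕ nat (129602 ℕ.* 129590 ℕ.+ 10)) refl))
          where
          a = var 0F
          N≥ : # 129602 ≤ # N
          N≥ = #-mono (ℕP.+-monoʳ-≤ 4 m≥)
        by-cases (inj₂ h) = *-cancel-≤ t>0 (prove (T :* lit 358) (T :* (lit 12 :* (b :* T))) (t ∷ # N ∷ # ⌊ S ⌋ ∷ S ∷ [])
          (sq T ⊗ le (a :* a) (lit 12 :* b :- lit 11) (k²≤ ⌊ S ⌋ K≤N Kt≤1)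
           ⊕ sq T ⊗ (le s (a :+ lit 1) (≤⌊⌋+1 S) ⊗ (ge0 a (⟪⟫≥0 ⌊ S ⌋) ⊕ nat 1 ⊕ ge0 s (inv≥0 t>0))) ⊕ eqn (T :* s) (lit 1) tS (T :* s :+ lit 1)
           ⊕ nat 2 ⊗ (ge0 T t≥0 ⊗ le (a :* T) (lit 1) Kt≤1) ⊕ le (lit 360 :* T) (lit 1) 360t≤1 ⊕ nat 10 ⊗ sq T) refl)
          where
          T = var 0F ; b = var 1F ; a = var 2F ; s = var 3F
          Kt≤1 : # ⌊ S ⌋ * t ≤ 1#
          Kt≤1 = prove (a :* T) (lit 1) (t ∷ # N ∷ # ⌊ S ⌋ ∷ S ∷ []) (ge0 T t≥0 ⊗ le a s (⌊⌋≤ (inv≥0 t>0)) ⊕ eqn (T :* s) (lit 1) tS (con (negsuc 0))) refl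
          K≤N : ⌊ S ⌋ ℕ.≤ N
          K≤N = #-mono⁻ (*-cancel-≤ t>0 (≤-trans (≤-reflexive (*-comm t _)) (≤-trans Kt≤1 (≤-trans h (≤-reflexive (*-comm _ t))))))

      -- ρᴺ ≤ ((1 - t)ᵏ)¹⁰ ≤ w⁻¹⁰ with w = 1 + kt ≥ 3.9, a decay that beats the quadratic factor in
      -- `tail` without an exponential.
      k : ℕ
      k = N ℕD./ 10
      N≤ : N ℕ.≤ 9 ℕ.+ 10 ℕ.* k
      N≤ = ℕP.≤-trans (ℕP.≤-reflexive (ℕD.m≡m%n+[m/n]*n N 10)) (ℕP.+-mono-≤ (ℕP.≤-pred (ℕD.m%n<n N 10)) (ℕP.≤-reflexive (ℕP.*-comm k 10)))
      10k≤N : 10 ℕ.* k ℕ.≤ N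
      10k≤N = ℕP.≤-trans (ℕP.≤-reflexive (ℕP.*-comm 10 k)) (ℕP.≤-trans (ℕP.m≤n+m (k ℕ.* 10) (N ℕD.% 10)) (ℕP.≤-reflexive (sym (ℕD.m≡m%n+[m/n]*n N 10))))
      #N≤ : # N ≤ ⟪ pos 9 ⟫ + ⟪ pos 10 ⟫ * # k
      #N≤ = ≤-trans (#-mono N≤) (≤-reflexive (trans (⟪⟫-+ (pos 9) (pos (10 ℕ.* k))) (cong (⟪ pos 9 ⟫ +_) (#-* 10 k))))
      w : F
      w = 1# + # k * t
      w≥1 : 1# ≤ w
      w≥1 = prove (lit 1) (lit 1 :+ a) (# k * t ∷ []) (ge0 a (*≥0 (⟪⟫≥0 k) t≥0)) refl
        where a = var 0F
      w≥0 : 0# ≤ w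
      w≥0 = ≤-trans (⟪⟫≥0 1) w≥1
      t≤1 : t ≤ 1#
      t≤1 = prove T (lit 1) (t ∷ []) (le (lit 360 :* T) (lit 1) 360t≤1 ⊕ nat 359 ⊗ ge0 T t≥0) refl
        where T = var 0F
      w≥ : ⟪ pos 39 ⟫ ≤ ⟪ pos 10 ⟫ * w
      w≥ = *-cancel-≤ (⟪⟫>0 11) (prove (lit 12 :* lit 39) (lit 12 :* (lit 10 :* (lit 1 :+ a :* T))) (t ∷ # k ∷ # N ∷ [])
        (le (lit 358) (lit 12 :* (b :* T)) Nt≥ ⊕ nat 12 ⊗ (ge0 T t≥0 ⊗ le b (lit 9 :+ lit 10 :* a) #N≤) ⊕ le (lit 360 :* T) (lit 1) 360t≤1 ⊕ nat 9 ⊕ nat 252 ⊗ ge0 T t≥0) refl)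
        where T = var 0F ; a = var 1F ; b = var 2F
      ρ^N*w¹⁰≤1 : ρ ^ N * w ^ 10 ≤ 1#
      ρ^N*w¹⁰≤1 = ≤-trans (*-mono (^≥0 ρ≥0 N) (^≥0 w≥0 10) (^-anti ρ≥0 ρ≤1 10k≤N) ≤-refl)
        (≤-trans (≤-reflexive (trans (cong (_* w ^ 10) (sym (^-* ρ k 10))) (sym (UpperBounds.^-distrib-* (ρ ^ k) w 10))))
          (≤-trans (^-mono (*≥0 (^≥0 ρ≥0 k) w≥0) (pow-bernoulli t≥0 t≤1 k) 10) (≤-reflexive (1^ 10))))
      -- 48800 = 400 · 122, where N²t² + 2Nt + 2 ≤ 122w² because Nt ≤ 10w and w ≥ 1.
      48800≤w⁸ : ⟪ pos 48800 ⟫ ≤ w ^ 8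
      48800≤w⁸ = *-cancel-≤ {x = ⟪ pos 10 ⟫ ^ 8} (<-≤-trans (⟪⟫>0 0) (prove (lit 1) (lit 10 :^ 8) [] (nat 99999999) refl))
        (≤-trans (prove (lit 10 :^ 8 :* lit 48800) (lit 39 :^ 8) [] (nat (39 ℕ.^ 8 ℕ.∸ 10 ℕ.^ 8 ℕ.* 48800)) refl) (≤-trans (^-mono (⟪⟫≥0 39) w≥ 8) (≤-reflexive (UpperBounds.^-distrib-* ⟪ pos 10 ⟫ w 8))))
      tail : ⟪ pos 400 ⟫ * (ρ ^ N * (# N * # N * (t * t) + ⟪ pos 2 ⟫ * (# N * t) + ⟪ pos 2 ⟫)) ≤ 1#
      tail = ≤-trans (prove (lit 400 :* (r :* (b :* b :* (T :* T) :+ lit 2 :* (b :* T) :+ lit 2))) (r :* u :^ 10) (ρ ^ N ∷ # N ∷ t ∷ w ∷ [])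
          (ge0 r (^≥0 ρ≥0 N) ⊗ (nat 400 ⊗ (Nt≤w ⊗ (nat 10 ⊗ ge0 u w≥0 ⊕ ge0 b (⟪⟫≥0 N) ⊗ ge0 T t≥0 ⊕ nat 2) ⊕ le (lit 1) u w≥1 ⊗ (nat 22 ⊗ ge0 u w≥0 ⊕ nat 2)) ⊕ sq u ⊗ le (lit 48800) (u :^ 8) 48800≤w⁸)) refl)
        ρ^N*w¹⁰≤1
        where
        r = var 0F ; b = var 1F ; T = var 2F ; u = var 3F
        Nt≤w : Nn (ρ ^ N ∷ # N ∷ t ∷ w ∷ [])
        Nt≤w = le (b :* T) (lit 10 :* u) (prove (b′ :* T′) (lit 10 :* (lit 1 :+ a′ :* T′)) (t ∷ # k ∷ # N ∷ []) (ge0 T′ t≥0 ⊗ le b′ (lit 9 :+ lit 10 :* a′) #N≤ ⊕ nat 9 ⊗ le T′ (lit 1) t≤1 ⊕ nat 1) refl)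
          where T′ = var 0F ; a′ = var 1F ; b′ = var 2F

      module Ci = Circle t t>0 360t≤1 N Nt²≤ tail

      -- The rounded increments sum to the floor of the mean, which lies in [n, n + 1).
      n≡ : Ci.n ≡ n
      n≡ = trans (Ci.Gr.sum-e N) (⌊⌋-unique n n≤μ (<-≤-trans μ<n+1 (≤-reflexive (trans (+-comm (# n) 1#) (sym (#-suc n))))))

    conclusion : Claim m
    conclusion = saddle⇒claim m ρ N ρ≥0 ℕP.≤-refl (proj₁ s) (proj₁ (proj₂ s)) (proj₂ (proj₂ s))
      where
      s : 0# < Coefficients.I ρ N n 0 × Coefficients.I ρ N n 1 * Coefficients.I ρ N n 1 < Coefficients.I ρ N n 0 * Coefficients.I ρ N n 2 × Coefficients.I ρ N n 2 < ⟪ pos 4 ⟫ * Coefficients.I ρ N n 1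
      s = subst (λ i → 0# < Coefficients.I ρ N i 0 × Coefficients.I ρ N i 1 * Coefficients.I ρ N i 1 < Coefficients.I ρ N i 0 * Coefficients.I ρ N i 2 × Coefficients.I ρ N i 2 < ⟪ pos 4 ⟫ * Coefficients.I ρ N i 1) n≡ Ci.saddle

-- Distinct partitions by number of parts

module Ranked where
  open import Defs
  open Counting
  open import Data.Nat.Base
  open import Data.Nat.Properties
  open import Data.Sum.Base using (inj₁; inj₂)
  open import Relation.Binary.PropositionalEquality

  -- Multiplication of a generating function by xʲ; generic in the zero, so that it applies to
  -- counts and to field-valued partial sums.
  shift : {A : Set} → A → ℕ → (ℕ → A) → ℕ → A
  shift z zero f n = f n
  shift z (suc j) f zero = z
  shift z (suc j) f (suc n) = shift z j f n

  shift-< : ∀ {A : Set} (z : A) j f {n} → n < j → shift z j f n ≡ z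
  shift-< z (suc j) f {zero} h = refl
  shift-< z (suc j) f {suc n} h = shift-< z j f (s<s⁻¹ h)

  shift-≥ : ∀ {A : Set} (z : A) j f n → shift z j f (j + n) ≡ f n
  shift-≥ z zero f n = refl
  shift-≥ z (suc j) f n = shift-≥ z j f n

  shift-shift : ∀ {A : Set} (z : A) i j f n → shift z i (shift z j f) n ≡ shift z (i + j) f n
  shift-shift z zero j f n = refl
  shift-shift z (suc i) j f zero = refl
  shift-shift z (suc i) j f (suc n) = shift-shift z i j f n

  shift-cong : ∀ {A : Set} (z : A) j f g → (∀ n → f n ≡ g n) → ∀ n → shift z j f n ≡ shift z j g n
  shift-cong z zero f g h n = h n
  shift-cong z (suc j) f g h zero = refl
  shift-cong z (suc j) f g h (suc n) = shift-cong z j f g h n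

  shift-+ : ∀ j f g n → shift 0 j (λ i → f i + g i) n ≡ shift 0 j f n + shift 0 j g n
  shift-+ zero f g n = refl
  shift-+ (suc j) f g zero = refl
  shift-+ (suc j) f g (suc n) = shift-+ j f g n

  parts-suc : ∀ m n → parts (suc m) n ≡ parts m n + shift 0 (suc m) (parts m) n
  parts-suc m n with <-≤-connex n (suc m)
  ... | inj₁ h = trans (parts-< m n h) (sym (trans (cong (parts m n +_) (shift-< 0 (suc m) (parts m) h)) (+-identityʳ _)))
  ... | inj₂ h = subst (λ i → parts (suc m) i ≡ parts m i + shift 0 (suc m) (parts m) i) (m+[n∸m]≡n h)
    (trans (parts-≥ m j) (trans (+-comm (parts m j) _) (cong (parts m (suc m + j) +_) (sym (shift-≥ 0 (suc m) (parts m) j)))))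
    where j = n ∸ suc m

  -- partitions of n into exactly k distinct parts of size at most m
  ranked : ℕ → ℕ → ℕ → ℕ
  ranked zero zero zero = 1
  ranked zero zero (suc n) = 0
  ranked zero (suc k) n = 0
  ranked (suc m) zero n = ranked m zero n
  ranked (suc m) (suc k) n = ranked m (suc k) n + shift 0 (suc m) (ranked m k) n

  shift-0 : ∀ j n → shift 0 j (λ _ → 0) n ≡ 0
  shift-0 zero n = refl
  shift-0 (suc j) zero = refl
  shift-0 (suc j) (suc n) = shift-0 j n

  -- subtract 1 from every part
  ranked-lower : ∀ m k n → ranked (suc m) (suc k) n ≡ shift 0 (suc k) (λ i → ranked m (suc k) i + ranked m k i) n
  ranked-lower zero zero n = refl
  ranked-lower zero (suc k) n = trans (shift-0 1 n) (sym (shift-0 (2 + k) n))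
  ranked-lower (suc m) zero n = trans (cong₂ _+_ (ranked-lower m zero n) (sym (shift-shift 0 1 (suc m) (ranked m 0) n)))
    (trans (sym (shift-+ 1 (λ i → ranked m 1 i + ranked m 0 i) (shift 0 (suc m) (ranked m 0)) n))
      (shift-cong 0 1 _ _ (λ i → trans (+-assoc (ranked m 1 i) _ _) (trans (cong (ranked m 1 i +_) (+-comm (ranked m 0 i) _)) (sym (+-assoc (ranked m 1 i) _ _)))) n))
  ranked-lower (suc m) (suc k) n = trans (cong₂ _+_ (ranked-lower m (suc k) n) second)
    (trans (sym (shift-+ (2 + k) (λ i → ranked m (2 + k) i + ranked m (1 + k) i) (shift 0 (suc m) (λ i → ranked m (1 + k) i + ranked m k i)) n))
      (shift-cong 0 (2 + k) _ _ rearrange n))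
    where
    second : shift 0 (2 + m) (ranked (suc m) (suc k)) n ≡ shift 0 (2 + k) (shift 0 (suc m) (λ i → ranked m (1 + k) i + ranked m k i)) n
    second = trans (shift-cong 0 (2 + m) _ _ (ranked-lower m k) n) (trans (shift-shift 0 (2 + m) (suc k) _ n)
      (trans (cong (λ j → shift 0 j (λ i → ranked m (1 + k) i + ranked m k i) n) (cong suc (trans (+-comm (suc m) (suc k)) (cong suc (+-suc k m) ))))
        (sym (trans (shift-shift 0 (2 + k) (suc m) _ n) (cong (λ j → shift 0 j (λ i → ranked m (1 + k) i + ranked m k i) n) (cong (λ j → suc (suc j)) (+-suc k m)))))))
    rearrange : ∀ i → ranked m (2 + k) i + ranked m (1 + k) i + shift 0 (suc m) (λ i → ranked m (1 + k) i + ranked m k i) i ≡ ranked (suc m) (2 + k) i + ranked (suc m) (1 + k) i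
    rearrange i = trans (cong (ranked m (2 + k) i + ranked m (1 + k) i +_) (shift-+ (suc m) (ranked m (1 + k)) (ranked m k) i)) (swap (ranked m (2 + k) i) _ _ _)
      where
      swap : ∀ a b c d → (a + b) + (c + d) ≡ (a + c) + (b + d)
      swap a b c d = trans (+-assoc a b (c + d)) (trans (cong (a +_) (trans (sym (+-assoc b c d)) (trans (cong (_+ d) (+-comm b c)) (+-assoc c b d)))) (sym (+-assoc a c (b + d))))

  ranked-stable : ∀ m k n → n ≤ m → ranked (suc m) k n ≡ ranked m k n
  ranked-stable m zero n h = refl
  ranked-stable m (suc k) n h = trans (cong (ranked m (suc k) n +_) (shift-< 0 (suc m) (ranked m k) (s≤s h))) (+-identityʳ _)

  -- For n ≤ m the bound on the parts has no effect, so the recursion closes on a single m.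
  ranked-rec : ∀ m k n → n ≤ m → ranked m (suc k) n ≡ shift 0 (suc k) (λ i → ranked m (suc k) i + ranked m k i) n
  ranked-rec m k n h = trans (sym (ranked-stable m (suc k) n h)) (ranked-lower m k n)

  ranked-0 : ∀ m n → ranked m 0 (suc n) ≡ 0
  ranked-0 zero n = refl
  ranked-0 (suc m) n = ranked-0 m n

  ranked-00 : ∀ m → ranked m 0 0 ≡ 1
  ranked-00 zero = refl
  ranked-00 (suc m) = ranked-00 m

  triangle : ℕ → ℕ
  triangle zero = 0
  triangle (suc k) = suc k + triangle k

  ranked-vanish : ∀ m k n → n < triangle k → ranked m k n ≡ 0
  ranked-vanish zero (suc k) n h = refl
  ranked-vanish (suc m) (suc k) n h with <-≤-connex n (suc k)
  ... | inj₁ n<k = trans (ranked-lower m k n) (shift-< 0 (suc k) _ n<k)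
  ... | inj₂ k≤n = trans (ranked-lower m k n) (trans (cong (shift 0 (suc k) (λ i → ranked m (suc k) i + ranked m k i)) (sym (m+[n∸m]≡n k≤n)))
      (trans (shift-≥ 0 (suc k) _ j) (cong₂ _+_ (ranked-vanish m (suc k) j (≤-trans j< (m≤n+m (triangle k) (suc k)))) (ranked-vanish m k j j<))))
    where
    j = n ∸ suc k
    j< : j < triangle k
    j< = +-cancelˡ-< (suc k) j (triangle k) (subst (_< triangle (suc k)) (sym (m+[n∸m]≡n k≤n)) h)

  rankSum : ℕ → ℕ → ℕ → ℕ
  rankSum m zero n = ranked m 0 n
  rankSum m (suc k) n = rankSum m k n + ranked m (suc k) n

  rankSum-suc : ∀ m k n → rankSum (suc m) (suc k) n ≡ rankSum m (suc k) n + shift 0 (suc m) (rankSum m k) n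
  rankSum-suc m zero n = sym (+-assoc (ranked m 0 n) (ranked m 1 n) _)
  rankSum-suc m (suc k) n = trans (cong (_+ ranked (suc m) (2 + k) n) (rankSum-suc m k n))
    (trans (swap (rankSum m (suc k) n) _ (ranked m (2 + k) n) _) (cong (rankSum m (2 + k) n +_) (sym (shift-+ (suc m) (rankSum m k) (ranked m (suc k)) n))))
    where
    swap : ∀ a b c d → (a + b) + (c + d) ≡ (a + c) + (b + d)
    swap a b c d = trans (+-assoc a b (c + d)) (trans (cong (a +_) (trans (sym (+-assoc b c d)) (trans (cong (_+ d) (+-comm b c)) (+-assoc c b d)))) (sym (+-assoc a c (b + d))))

  parts≡rankSum : ∀ m k n → m ≤ k → parts m n ≡ rankSum m k n
  parts≡rankSum zero k zero h = sym (zeroSum k)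
    where
    zeroSum : ∀ k → rankSum 0 k 0 ≡ 1
    zeroSum zero = refl
    zeroSum (suc k) = trans (+-identityʳ _) (zeroSum k)
  parts≡rankSum zero k (suc n) h = sym (zeroSum k)
    where
    zeroSum : ∀ k → rankSum 0 k (suc n) ≡ 0
    zeroSum zero = refl
    zeroSum (suc k) = trans (+-identityʳ _) (zeroSum k)
  parts≡rankSum (suc m) (suc k) n h = trans (parts-suc m n) (trans (cong₂ _+_ (parts≡rankSum m (suc k) n (m≤n⇒m≤1+n (s≤s⁻¹ h))) (shift-cong 0 (suc m) _ _ (λ i → parts≡rankSum m k i (s≤s⁻¹ h)) n))
    (sym (rankSum-suc m k n)))

  triangle-mono : ∀ {j k} → j ≤ k → triangle j ≤ triangle k
  triangle-mono z≤n = z≤n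
  triangle-mono (s≤s h) = +-mono-≤ (s≤s h) (triangle-mono h)

  rankSum-truncate : ∀ m k n j → n < triangle (suc k) → rankSum m (j + k) n ≡ rankSum m k n
  rankSum-truncate m k n zero h = refl
  rankSum-truncate m k n (suc j) h = trans (cong (rankSum m (j + k) n +_) (ranked-vanish m (suc j + k) n (<-≤-trans h (triangle-mono (s≤s (m≤n+m k j)))))) (trans (+-identityʳ _) (rankSum-truncate m k n j h))

  -- More than k distinct parts sum to at least 1 + 2 + ... + (k + 1), which exceeds n.
  q≡rankSum : ∀ m k n → n ≤ m → k ≤ m → n < triangle (suc k) → q n ≡ rankSum m k n
  q≡rankSum m k n h h′ h″ = trans (sym (parts≡q h)) (trans (parts≡rankSum m m n ≤-refl) (trans (cong (λ j → rankSum m j n) (sym (m∸n+n≡m h′))) (rankSum-truncate m k n (m ∸ k) h″)))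

-- Euler's series and its truncation error

module EulerSeries where
  open Inequalities
  open PowersOfUnit
  open RotatedProduct using (#-+)
  open CentralBound using (pow≤1)
  open Rounding using (#-mono)
  open Ranked
  open import Data.Nat.Base as ℕ using (ℕ; suc; zero)
  import Data.Nat.Properties as ℕP
  open import Data.Sum.Base using (inj₁; inj₂)

  Σ≺ : (ℕ → F) → ℕ → F
  Σ≺ f zero = 0#
  Σ≺ f (suc n) = Σ≺ f n + f n

  Σ≺-head : ∀ f n → Σ≺ f (suc n) ≡ f 0 + Σ≺ (λ i → f (suc i)) n
  Σ≺-head f zero = trans (⟪0⟫+ _) (sym (+0 _))
  Σ≺-head f (suc n) = trans (cong (_+ f (suc n)) (Σ≺-head f n)) (+-assoc _ _ _)

  Σ≺-+ : ∀ f g n → Σ≺ (λ i → f i + g i) n ≡ Σ≺ f n + Σ≺ g n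
  Σ≺-+ f g zero = sym (+0 0#)
  Σ≺-+ f g (suc n) = trans (cong (_+ (f n + g n)) (Σ≺-+ f g n)) (+-swap _ _ _ _)

  Σ≺-* : ∀ a f n → Σ≺ (λ i → a * f i) n ≡ a * Σ≺ f n
  Σ≺-* a f zero = sym (*0 a)
  Σ≺-* a f (suc n) = trans (cong (_+ a * f n) (Σ≺-* a f n)) (sym (distribˡ a _ _))

  Σ≺-cong : ∀ (f g : ℕ → F) n → (∀ i → i ℕ.< n → f i ≡ g i) → Σ≺ f n ≡ Σ≺ g n
  Σ≺-cong f g zero h = refl
  Σ≺-cong f g (suc n) h = cong₂ _+_ (Σ≺-cong f g n (λ i p → h i (ℕP.m≤n⇒m≤1+n p))) (h n ℕP.≤-refl)

  Σ≺≥0 : ∀ (f : ℕ → F) n → (∀ i → 0# ≤ f i) → 0# ≤ Σ≺ f n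
  Σ≺≥0 f zero h = ≤-refl
  Σ≺≥0 f (suc n) h = +≥0 (Σ≺≥0 f n h) (h n)

  Σ≺-0 : ∀ (f : ℕ → F) n → (∀ i → i ℕ.< n → f i ≡ 0#) → Σ≺ f n ≡ 0#
  Σ≺-0 f zero h = refl
  Σ≺-0 f (suc n) h = trans (cong₂ _+_ (Σ≺-0 f n (λ i p → h i (ℕP.m≤n⇒m≤1+n p))) (h n ℕP.≤-refl)) (+0 0#)

  module Series (x : F) (x≥0 : 0# ≤ x) (x<1 : x < 1#) where
    series : (ℕ → ℕ) → ℕ → F
    series f = Σ≺ (λ n → # (f n) * x ^ n)

    series-shift : ∀ j f l → series (shift 0 j f) l ≡ x ^ j * shift 0# j (series f) l
    series-shift zero f l = sym (⟪1⟫* _)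
    series-shift (suc j) f zero = sym (*0 _)
    series-shift (suc j) f (suc l) = trans (Σ≺-head (λ n → # (shift 0 (suc j) f n) * x ^ n) l)
      (trans (cong₂ _+_ (0* _) (trans (Σ≺-cong _ (λ n → x * (# (shift 0 j f n) * x ^ n)) l (λ n _ → ring (a :* (b :* c)) (b :* (a :* c)) (# (shift 0 j f n) ∷ x ∷ x ^ n ∷ []) refl)) (Σ≺-* x _ l)))
        (trans (⟪0⟫+ _) (trans (cong (x *_) (series-shift j f l)) (sym (*-assoc _ _ _)))))
      where a = var 0F ; b = var 1F ; c = var 2F

    series≥0 : ∀ f l → 0# ≤ series f l
    series≥0 f l = Σ≺≥0 (λ n → # (f n) * x ^ n) l (λ n → *≥0 (⟪⟫≥0 (f n)) (^≥0 x≥0 n))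

    x≤1 : x ≤ 1#
    x≤1 = <⇒≤ x<1

    1-x^>0 : ∀ k → 0# < 1# - x ^ suc k
    1-x^>0 k q = x<1 (prove (lit 1) X (x ∷ x ^ k ∷ []) (le (lit 1 :- X :* y) (lit 0) q ⊕ ge0 X x≥0 ⊗ le y (lit 1) (pow≤1 x≥0 x≤1 k)) refl)
      where X = var 0F ; y = var 1F

    -- x^(k(k+1)/2) / ((1 − x) ⋯ (1 − xᵏ)), the generating function of partitions into k distinct parts
    τ : ℕ → F
    τ zero = 1#
    τ (suc k) = τ k * (x ^ suc k * inv (1# - x ^ suc k))

    τ-rec : ∀ k → τ (suc k) * (1# - x ^ suc k) ≡ τ k * x ^ suc k
    τ-rec k = prove= (a :* (y :* i) :* d) (a :* y) (τ k ∷ x ^ suc k ∷ inv (1# - x ^ suc k) ∷ 1# - x ^ suc k ∷ []) (by= (d :* i) (lit 1) (inv-eq (1-x^>0 k)) (a :* y)) refl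
      where a = var 0F ; y = var 1F ; i = var 2F ; d = var 3F

    τ≥0 : ∀ k → 0# ≤ τ k
    τ≥0 zero = ⟪⟫≥0 1
    τ≥0 (suc k) = *≥0 (τ≥0 k) (*≥0 (^≥0 x≥0 (suc k)) (inv≥0 (1-x^>0 k)))

    τsum : ℕ → F
    τsum zero = τ 0
    τsum (suc k) = τsum k + τ (suc k)

    module _ (m : ℕ) where
      c : ℕ → ℕ → ℕ
      c = ranked m
      private
        y : ℕ → F
        y k = x ^ suc k
        both : ℕ → ℕ → ℕ
        both k i = c (suc k) i ℕ.+ c k i

      series-c0 : ∀ l → series (c 0) (suc l) ≡ 1#
      series-c0 l = trans (Σ≺-head (λ n → # (c 0 n) * x ^ n) l) (trans (cong₂ _+_ (trans (cong (λ n → # n * 1#) (ranked-00 m)) (*1 1#)) (Σ≺-0 _ l (λ i _ → trans (cong (λ n → # n * x ^ suc i) (ranked-0 m i)) (0* _)))) (+0 1#))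

      series-rec : ∀ k l → l ℕ.≤ suc m → series (c (suc k)) l ≡ y k * shift 0# (suc k) (series (both k)) l
      series-rec k l h = trans (Σ≺-cong _ (λ n → # (shift 0 (suc k) (both k) n) * x ^ n) l (λ n n<l → cong (λ j → # j * x ^ n) (ranked-rec m k n (ℕP.≤-pred (ℕP.≤-trans n<l h))))) (series-shift (suc k) (both k) l)

      series-both : ∀ k l → series (both k) l ≡ series (c (suc k)) l + series (c k) l
      series-both k l = trans (Σ≺-cong _ (λ n → # (c (suc k) n) * x ^ n + # (c k n) * x ^ n) l (λ n _ → trans (cong (_* x ^ n) (#-+ (c (suc k) n) (c k n))) (distribʳ _ _ _))) (Σ≺-+ _ _ l)

      series-mono : ∀ f l i → series f l ≤ series f (i ℕ.+ l)
      series-mono f l zero = ≤-refl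
      series-mono f l (suc i) = ≤-trans (series-mono f l i) (prove (var 0F) (var 0F :+ var 1F) (series f (i ℕ.+ l) ∷ # (f (i ℕ.+ l)) * x ^ (i ℕ.+ l) ∷ []) (ge0 (var 1F) (*≥0 (⟪⟫≥0 _) (^≥0 x≥0 (i ℕ.+ l)))) refl)

      -- `series-rec` gives (1 - y)s ≤ y s₀, which is the recursion of `τ` with an inequality.
      series≤τ : ∀ k l → l ℕ.≤ suc m → series (c k) l ≤ τ k
      series≤τ zero zero h = ⟪⟫≥0 1
      series≤τ zero (suc l) h = ≤-reflexive (series-c0 l)
      series≤τ (suc k) l h with ℕP.<-≤-connex l (suc k)
      ... | inj₁ l< = ≤-trans (≤-reflexive (trans (series-rec k l h) (trans (cong (y k *_) (shift-< 0# (suc k) _ l<)) (*0 _)))) (τ≥0 (suc k))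
      ... | inj₂ k≤ = *-cancel-≤ (1-x^>0 k) (prove ((lit 1 :- Y) :* s) ((lit 1 :- Y) :* t′) (y k ∷ series (c (suc k)) l ∷ series (c (suc k)) j ∷ series (c k) j ∷ τ k ∷ τ (suc k) ∷ [])
          (Y₊ ⊗ le s₁ s (subst (λ i → series (c (suc k)) j ≤ series (c (suc k)) i) (ℕP.m+[n∸m]≡n k≤) (series-mono (c (suc k)) j (suc k)))
           ⊕ Y₊ ⊗ le s₀ t (series≤τ k j (ℕP.≤-trans (ℕP.m∸n≤m l (suc k)) h))
           ⊕ eqn s (Y :* (s₁ :+ s₀)) eq (con (negsuc 0)) ⊕ eqn (t′ :* (lit 1 :- Y)) (t :* Y) (τ-rec k) (lit 1)) refl)
        where
        j = l ℕ.∸ suc k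
        Y = var 0F ; s = var 1F ; s₁ = var 2F ; s₀ = var 3F ; t = var 4F ; t′ = var 5F
        Y₊ = ge0 {ρ = y k ∷ series (c (suc k)) l ∷ series (c (suc k)) j ∷ series (c k) j ∷ τ k ∷ τ (suc k) ∷ []} Y (^≥0 x≥0 (suc k))
        eq : series (c (suc k)) l ≡ y k * (series (c (suc k)) j + series (c k) j)
        eq = trans (series-rec k l h) (cong (y k *_) (trans (cong (shift 0# (suc k) (series (both k))) (sym (ℕP.m+[n∸m]≡n k≤))) (trans (shift-≥ 0# (suc k) _ j) (series-both k j))))

      series-rankSum : ℕ → ℕ → F
      series-rankSum k = series (rankSum m k)

      rankSum-split : ∀ k l → series-rankSum (suc k) l ≡ series-rankSum k l + series (c (suc k)) l
      rankSum-split k l = trans (Σ≺-cong _ (λ n → # (rankSum m k n) * x ^ n + # (c (suc k) n) * x ^ n) l (λ n _ → trans (cong (_* x ^ n) (#-+ (rankSum m k n) (c (suc k) n))) (distribʳ _ _ _))) (Σ≺-+ _ _ l)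

      rankSum≤ : ∀ k l → l ℕ.≤ suc m → series-rankSum k l ≤ τsum k
      rankSum≤ zero l h = series≤τ 0 l h
      rankSum≤ (suc k) l h = subst (_≤ τsum (suc k)) (sym (rankSum-split k l)) (+-mono (rankSum≤ k l h) (series≤τ (suc k) l h))

      module _ (1024x≤1 : ⟪ pos 1024 ⟫ * x ≤ 1#) (B : F) (1≤B : 1# ≤ B) (c≤B : ∀ k n → n ℕ.≤ m → # (c k n) ≤ B) where
        private
          2x≤1 : ⟪ pos 2 ⟫ * x ≤ 1#
          2x≤1 = prove (lit 2 :* X) (lit 1) (x ∷ []) (le (lit 1024 :* X) (lit 1) 1024x≤1 ⊕ nat 1022 ⊗ ge0 X x≥0) refl
            where X = var 0F
          B≥0 : 0# ≤ B
          B≥0 = ≤-trans (⟪⟫≥0 1) 1≤B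
          y≤x : ∀ k → y k ≤ x
          y≤x k = prove (X :* z) X (x ∷ x ^ k ∷ []) (ge0 X x≥0 ⊗ le z (lit 1) (pow≤1 x≥0 x≤1 k)) refl
            where X = var 0F ; z = var 1F

          -- The terms in between are bounded by B times a geometric series of ratio x ≤ 1/2.
          series-tail : ∀ k j i → i ℕ.+ j ℕ.≤ suc m → series (c k) (i ℕ.+ j) + ⟪ pos 2 ⟫ * B * x ^ (i ℕ.+ j) ≤ series (c k) j + ⟪ pos 2 ⟫ * B * x ^ j
          series-tail k j zero h = ≤-refl
          series-tail k j (suc i) h = ≤-trans (prove (s :+ a :* z :+ lit 2 :* b :* (X :* z)) (s :+ lit 2 :* b :* z) (series (c k) (i ℕ.+ j) ∷ # (c k (i ℕ.+ j)) ∷ x ^ (i ℕ.+ j) ∷ B ∷ x ∷ [])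
              (ge0 z (^≥0 x≥0 (i ℕ.+ j)) ⊗ (le a b (c≤B k (i ℕ.+ j) (ℕP.≤-pred h)) ⊕ ge0 b B≥0 ⊗ le (lit 2 :* X) (lit 1) 2x≤1)) refl)
            (series-tail k j i (ℕP.≤-trans (ℕP.n≤1+n _) h))
            where s = var 0F ; a = var 1F ; z = var 2F ; b = var 3F ; X = var 4F

          1-y>0 = 1-x^>0
          τ≤1 : ∀ k → τ k ≤ 1#
          τ≤1 zero = ≤-refl
          τ≤1 (suc k) = *-cancel-≤ (1-y>0 k) (prove ((lit 1 :- Y) :* t′) ((lit 1 :- Y) :* lit 1) (y k ∷ τ k ∷ τ (suc k) ∷ x ∷ [])
            (ge0 Y (^≥0 x≥0 (suc k)) ⊗ le t (lit 1) (τ≤1 k) ⊕ nat 2 ⊗ le Y X (y≤x k) ⊕ le (lit 2 :* X) (lit 1) 2x≤1 ⊕ eqn (t′ :* (lit 1 :- Y)) (t :* Y) (τ-rec k) (con (negsuc 0))) refl)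
            where Y = var 0F ; t = var 1F ; t′ = var 2F ; X = var 3F

        -- The error passes through the recursion of `τ` and picks up a factor 1/(1 - xᵏ). A growth
        -- of 4 per rank absorbs this as long as 2kxᵏ ≤ 1, which 1024x ≤ 1 and k ≤ 512 ensure.
        deficit : ∀ k l → k ℕ.≤ 512 → suc l ℕ.≤ suc m → τ k ≤ series (c k) (suc l) + ⟪ pos 4 ⟫ * # k * B * x ^ suc l
        deficit zero l hk h = ≤-trans (≤-reflexive (sym (series-c0 l))) (prove s (s :+ lit 4 :* lit 0 :* b :* z) (series (c 0) (suc l) ∷ B ∷ x ^ suc l ∷ []) (nat 0) refl)
          where s = var 0F ; b = var 1F ; z = var 2F
        deficit (suc k) l hk h with ℕP.<-≤-connex l (suc k)
        -- The truncation comes before the first term of this rank; `τ` itself is then at most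
        -- 2x^(k+1).
        ... | inj₁ l< = ≤-trans (*-cancel-≤ (1-y>0 k) (prove ((lit 1 :- Y) :* t′) ((lit 1 :- Y) :* (lit 2 :* Y)) (y k ∷ τ k ∷ τ (suc k) ∷ x ∷ [])
            (Y₊ ⊗ le t (lit 1) (τ≤1 k) ⊕ Y₊ ⊗ (nat 2 ⊗ le Y X (y≤x k) ⊕ le (lit 2 :* X) (lit 1) 2x≤1) ⊕ eqn (t′ :* (lit 1 :- Y)) (t :* Y) (τ-rec k) (con (negsuc 0))) refl))
          (prove (lit 2 :* Y′) (s :+ lit 4 :* K′ :* b :* z) (y k ∷ series (c (suc k)) (suc l) ∷ # (suc k) ∷ B ∷ x ^ suc l ∷ [])
            (ge0 s (series≥0 _ (suc l)) ⊕ nat 2 ⊗ le Y′ z (UpperBounds.^-anti x≥0 x≤1 l<)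
             ⊕ ge0 z (^≥0 x≥0 (suc l)) ⊗ (nat 4 ⊗ (le (lit 1) K′ (#-mono (ℕ.s≤s ℕ.z≤n)) ⊗ ge0 b B≥0 ⊕ le (lit 1) b 1≤B) ⊕ nat 2)) refl)
          where
          Y = var 0F ; t = var 1F ; t′ = var 2F ; X = var 3F
          Y₊ = ge0 {ρ = y k ∷ τ k ∷ τ (suc k) ∷ x ∷ []} Y (^≥0 x≥0 (suc k))
          Y′ = var 0F ; s = var 1F ; K′ = var 2F ; b = var 3F ; z = var 4F
        ... | inj₂ k≤ = *-cancel-≤ (1-y>0 k) (prove ((lit 1 :- Y) :* t′) ((lit 1 :- Y) :* (s :+ lit 4 :* k₁ :* b :* z))
            (y k ∷ τ k ∷ τ (suc k) ∷ series (c (suc k)) (suc l) ∷ series (c (suc k)) j ∷ series (c k) j ∷ # k ∷ # (suc k) ∷ B ∷ x ^ suc l ∷ x ^ j ∷ x ∷ [])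
            (eqn (t′ :* (lit 1 :- Y)) (t :* Y) (τ-rec k) (con (negsuc 0)) ⊕ eqn s (Y :* (s₁ :+ s₀)) eq (lit 1)
             ⊕ ge0 Y (^≥0 x≥0 (suc k)) ⊗ (le t (s₀ :+ lit 4 :* k₀ :* b :* w) δ₀ ⊕ le (s :+ lit 2 :* b :* z) (s₁ :+ lit 2 :* b :* w) tl ⊕ nat 2 ⊗ ge0 b B≥0 ⊗ ge0 z (^≥0 x≥0 (suc l)))
             ⊕ eqn z (Y :* w) z≡ (lit 4 :* k₀ :* b :+ lit 2 :* b) ⊕ eqn k₁ (lit 1 :+ k₀) (#-suc k) (lit 4 :* b :* z)
             ⊕ nat 2 ⊗ (ge0 b B≥0 ⊗ ge0 z (^≥0 x≥0 (suc l)) ⊗ (le (lit 1024 :* X) (lit 1) 1024x≤1 ⊕ nat 1024 ⊗ le Y X (y≤x k) ⊕ nat 2 ⊗ (ge0 Y (^≥0 x≥0 (suc k)) ⊗ le k₁ (lit 512) (#-mono hk))))) refl)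
          where
          j = suc l ℕ.∸ suc k
          open import Data.Fin.Base using (suc)
          Y = var 0F ; t = var 1F ; t′ = var 2F ; s = var 3F ; s₁ = var 4F ; s₀ = var 5F ; k₀ = var 6F ; k₁ = var 7F ; b = var 8F ; z = var 9F ; w = var (suc 9F) ; X = var (suc (suc 9F))
          l≡ : suc k ℕ.+ j ≡ ℕ.suc l
          l≡ = ℕP.m+[n∸m]≡n (ℕP.m≤n⇒m≤1+n k≤)
          z≡ : x ^ ℕ.suc l ≡ y k * x ^ j
          z≡ = trans (cong (x ^_) (sym l≡)) (^-+ x (ℕ.suc k) j)
          eq : series (c (ℕ.suc k)) (ℕ.suc l) ≡ y k * (series (c (ℕ.suc k)) j + series (c k) j)
          eq = trans (series-rec k (ℕ.suc l) h) (cong (y k *_) (trans (cong (shift 0# (ℕ.suc k) (series (both k))) (sym l≡)) (trans (shift-≥ 0# (ℕ.suc k) _ j) (series-both k j))))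
          δ₀ : τ k ≤ series (c k) j + ⟪ pos 4 ⟫ * # k * B * x ^ j
          δ₀ = subst (λ i → τ k ≤ series (c k) i + ⟪ pos 4 ⟫ * # k * B * x ^ i) (sym j≡) (deficit k (l ℕ.∸ ℕ.suc k) (ℕP.≤-trans (ℕP.n≤1+n k) hk) (ℕ.s≤s (ℕP.≤-trans (ℕP.m∸n≤m l (ℕ.suc k)) (ℕP.≤-pred h))))
            where
            j≡ : j ≡ ℕ.suc (l ℕ.∸ ℕ.suc k)
            j≡ = ℕP.+-∸-assoc 1 k≤
          tl : series (c (ℕ.suc k)) (ℕ.suc l) + ⟪ pos 2 ⟫ * B * x ^ ℕ.suc l ≤ series (c (ℕ.suc k)) j + ⟪ pos 2 ⟫ * B * x ^ j
          tl = subst (λ i → series (c (ℕ.suc k)) i + ⟪ pos 2 ⟫ * B * x ^ i ≤ series (c (ℕ.suc k)) j + ⟪ pos 2 ⟫ * B * x ^ j) l≡ (series-tail (ℕ.suc k) j (ℕ.suc k) (ℕP.≤-trans (ℕP.≤-reflexive l≡) h))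

        total-deficit : ∀ k l → k ℕ.≤ 512 → suc l ℕ.≤ suc m → τsum k ≤ series-rankSum k (suc l) + ⟪ pos 2048 ⟫ * # (suc k) * B * x ^ suc l
        total-deficit zero l hk h = ≤-trans (deficit 0 l hk h) (prove (s :+ lit 4 :* lit 0 :* b :* z) (s :+ lit 2048 :* lit 1 :* b :* z) (series (c 0) (suc l) ∷ B ∷ x ^ suc l ∷ [])
            (nat 2048 ⊗ ge0 b (≤-trans (⟪⟫≥0 1) 1≤B) ⊗ ge0 z (^≥0 x≥0 (suc l))) refl)
          where s = var 0F ; b = var 1F ; z = var 2F
        total-deficit (suc k) l hk h = prove (a :+ t) (r :+ lit 2048 :* k₂ :* b :* z) (τsum k ∷ τ (suc k) ∷ series-rankSum (suc k) (suc l) ∷ series-rankSum k (suc l) ∷ series (c (suc k)) (suc l) ∷ # (2 ℕ.+ k) ∷ # (suc k) ∷ B ∷ x ^ suc l ∷ [])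
            (le a (r₀ :+ lit 2048 :* k₁ :* b :* z) (total-deficit k l (ℕP.≤-trans (ℕP.n≤1+n k) hk) h) ⊕ le t (s :+ lit 4 :* k₁ :* b :* z) (deficit (suc k) l hk h)
             ⊕ eqn r (r₀ :+ s) (rankSum-split k (suc l)) (lit 1) ⊕ eqn k₂ (lit 1 :+ k₁) (#-suc (suc k)) (lit 2048 :* b :* z)
             ⊕ nat 4 ⊗ (ge0 b (≤-trans (⟪⟫≥0 1) 1≤B) ⊗ ge0 z (^≥0 x≥0 (suc l)) ⊗ le k₁ (lit 512) (#-mono hk))) refl
          where a = var 0F ; t = var 1F ; r = var 2F ; r₀ = var 3F ; s = var 4F ; k₂ = var 5F ; k₁ = var 6F ; b = var 7F ; z = var 8F

-- Reading off q(n) as digits of one fraction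

module DigitExtraction where
  open Inequalities
  open PowersOfUnit
  open RotatedProduct using (#-+)
  open Rounding using (#-mono; #-mono⁻)
  open MinorArcs using (#-^)
  open Moments using (#-*)
  open UpperBounds using (^-distrib-*; ^-anti)
  open EulerSeries
  open Ranked
  open import Defs using (q)
  open import Data.Nat.Base as ℕ using (ℕ; suc; zero)
  import Data.Nat.Properties as ℕP
  open import Data.Nat.DivMod using (_/_; m≡m%n+[m/n]*n; m%n<n)
  open import Data.List.Base as L using (List)
  open import Data.Product.Base using (_×_; _,_; proj₁; proj₂)
  open import Data.Sum.Base using (inj₁; inj₂)
  open import Data.Empty using (⊥)
  import Data.Fin.Base as Fin

  record Node : Set where
    constructor node
    field A B S : ℕ
  open Node

  -- Binary splitting: the partial products of the second block are weighted by the whole product of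
  -- the first.
  join : Node → Node → Node
  join (node a b s) (node a′ b′ s′) = node (a ℕ.* a′) (b ℕ.* b′) (s ℕ.* b′ ℕ.+ a ℕ.* s′)

  -- A / B = ∏ αʲ / (βʲ − αʲ) over i < j ≤ i + 2ᵈ, and S / B is the sum of the partial products
  tree : ℕ → ℕ → ℕ → ℕ → Node
  tree zero α β i = node (α ℕ.^ suc i) (β ℕ.^ suc i ℕ.∸ α ℕ.^ suc i) (α ℕ.^ suc i)
  tree (suc d) α β i = join (tree d α β i) (tree d α β (2 ℕ.^ d ℕ.+ i))

  double : ∀ d i → 2 ℕ.^ d ℕ.+ (2 ℕ.^ d ℕ.+ i) ≡ 2 ℕ.^ suc d ℕ.+ i
  double d i = trans (sym (ℕP.+-assoc (2 ℕ.^ d) (2 ℕ.^ d) i)) (cong (λ k → 2 ℕ.^ d ℕ.+ k ℕ.+ i) (sym (ℕP.+-identityʳ _)))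

  module Ratio (α β : ℕ) (α<β : α ℕ.< β) where
    β>0 : 0# < # β
    β>0 q = ℕP.<⇒≱ (ℕP.≤-<-trans ℕ.z≤n α<β) (#-mono⁻ q)
    x : F
    x = # α * inv (# β)
    βx : # β * x ≡ # α
    βx = prove= (b :* (a :* i)) a (# α ∷ # β ∷ inv (# β) ∷ []) (by= (b :* i) (lit 1) (inv-eq β>0) a) refl
      where a = var 0F ; b = var 1F ; i = var 2F
    x≥0 : 0# ≤ x
    x≥0 = *≥0 (⟪⟫≥0 α) (inv≥0 β>0)
    x<1 : x < 1#
    x<1 h = ℕP.<⇒≱ α<β (#-mono⁻ (subst (# β ≤_) βx (prove b (b :* y) (# β ∷ x ∷ []) (ge0 b (⟪⟫≥0 β) ⊗ le (lit 1) y h) refl)))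
      where b = var 0F ; y = var 1F
    open Series x x≥0 x<1 public
    βx^ : ∀ k → # β ^ k * x ^ k ≡ # α ^ k
    βx^ k = trans (sym (^-distrib-* (# β) x k)) (cong (_^ k) βx)
    private
      #∸ : ∀ i j → j ℕ.≤ i → # (i ℕ.∸ j) ≡ # i - # j
      #∸ i j h = trans (ring y (y :+ z :- z) (# (i ℕ.∸ j) ∷ # j ∷ []) refl) (cong (_- # j) (trans (sym (#-+ (i ℕ.∸ j) j)) (cong # (ℕP.m∸n+n≡m h))))
        where y = var 0F ; z = var 1F

    spec : ∀ d i → (0# < # (B (tree d α β i))) × (# (B (tree d α β i)) * τ (2 ℕ.^ d ℕ.+ i) ≡ τ i * # (A (tree d α β i))) × (# (B (tree d α β i)) * (τsum (2 ℕ.^ d ℕ.+ i) - τsum i) ≡ τ i * # (S (tree d α β i)))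
    spec zero i = B>0 , ratio , trans (cong (# (β ℕ.^ suc i ℕ.∸ α ℕ.^ suc i) *_) (ring (u :+ w :- u) w (τsum i ∷ τ (suc i) ∷ []) refl)) ratio
      where
      u = var 0F ; w = var 1F
      #B : # (β ℕ.^ suc i ℕ.∸ α ℕ.^ suc i) ≡ # β ^ suc i * (1# - x ^ suc i)
      #B = trans (#∸ (β ℕ.^ suc i) (α ℕ.^ suc i) (ℕP.^-monoˡ-≤ (suc i) (ℕP.<⇒≤ α<β))) (trans (cong₂ _-_ (#-^ β (suc i)) (trans (#-^ α (suc i)) (sym (βx^ (suc i)))))
        (ring (b :- b :* y) (b :* (lit 1 :- y)) (# β ^ suc i ∷ x ^ suc i ∷ []) refl))
        where b = var 0F ; y = var 1F
      β^>0 : ∀ k → 0# < # β ^ k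
      β^>0 zero = ⟪⟫>0 0
      β^>0 (suc k) = *>0 β>0 (β^>0 k)
      B>0 : 0# < # (β ℕ.^ suc i ℕ.∸ α ℕ.^ suc i)
      B>0 = subst (0# <_) (sym #B) (*>0 (β^>0 (suc i)) (1-x^>0 i))
      ratio : # (β ℕ.^ suc i ℕ.∸ α ℕ.^ suc i) * τ (suc i) ≡ τ i * # (α ℕ.^ suc i)
      ratio = trans (cong (_* τ (suc i)) #B) (trans (prove= (b :* (lit 1 :- y) :* t′) (t :* (b :* y)) (# β ^ suc i ∷ x ^ suc i ∷ τ i ∷ τ (suc i) ∷ []) (by= (t′ :* (lit 1 :- y)) (t :* y) (τ-rec i) b) refl)
        (cong (τ i *_) (trans (βx^ (suc i)) (sym (#-^ α (suc i))))))
        where b = var 0F ; y = var 1F ; t = var 2F ; t′ = var 3F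
    spec (suc d) i = subst₂ (λ j b → (0# < # b) × (# b * τ j ≡ τ i * # (A l ℕ.* A r)) × (# b * (τsum j - τsum i) ≡ τ i * # (S l ℕ.* B r ℕ.+ A l ℕ.* S r))) (double d i) refl
      ( subst (0# <_) (sym (#-* (B l) (B r))) (*>0 B₁>0 B₂>0)
      , trans (cong (_* τ k) (#-* (B l) (B r))) (trans (prove= (b₁ :* b₂ :* t₂) (t₀ :* (a₁ :* a₂)) vec (by= (b₂ :* t₂) (t₁ :* a₂) e₂ b₁ ⊞ by= (b₁ :* t₁) (t₀ :* a₁) e₁ a₂) refl) (cong (τ i *_) (sym (#-* (A l) (A r)))))
      , trans (cong (_* (τsum k - τsum i)) (#-* (B l) (B r))) (trans (prove= (b₁ :* b₂ :* (u₂ :- u₀)) (t₀ :* (s₁ :* b₂ :+ a₁ :* s₂)) vec (by= (b₂ :* (u₂ :- u₁)) (t₁ :* s₂) f₂ b₁ ⊞ by= (b₁ :* (u₁ :- u₀)) (t₀ :* s₁) f₁ b₂ ⊞ by= (b₁ :* t₁) (t₀ :* a₁) e₁ s₂) refl)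
          (cong (τ i *_) (sym (trans (#-+ (S l ℕ.* B r) (A l ℕ.* S r)) (cong₂ _+_ (#-* (S l) (B r)) (#-* (A l) (S r))))))))
      where
      open import Data.Fin.Base using (suc)
      j = 2 ℕ.^ d ℕ.+ i
      k = 2 ℕ.^ d ℕ.+ j
      l = tree d α β i
      r = tree d α β j
      B₁>0 = proj₁ (spec d i)
      B₂>0 = proj₁ (spec d j)
      e₁ = proj₁ (proj₂ (spec d i))
      e₂ = proj₁ (proj₂ (spec d j))
      f₁ = proj₂ (proj₂ (spec d i))
      f₂ = proj₂ (proj₂ (spec d j))
      vec : Vec F 12
      vec = # (B l) ∷ # (B r) ∷ τ i ∷ τ j ∷ τ k ∷ # (A l) ∷ # (A r) ∷ # (S l) ∷ # (S r) ∷ τsum i ∷ τsum j ∷ τsum k ∷ []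
      b₁ b₂ t₀ t₁ t₂ a₁ a₂ s₁ s₂ u₀ u₁ u₂ : Expr {12}
      b₁ = var 0F ; b₂ = var 1F ; t₀ = var 2F ; t₁ = var 3F ; t₂ = var 4F ; a₁ = var 5F ; a₂ = var 6F ; s₁ = var 7F ; s₂ = var 8F
      u₀ = var 9F ; u₁ = var (suc 9F) ; u₂ = var (suc (suc 9F))

    tree-sum : ∀ d → (0# < # (B (tree d α β 0))) × (# (B (tree d α β 0)) * τsum (2 ℕ.^ d) ≡ # (S (tree d α β 0) ℕ.+ B (tree d α β 0)))
    tree-sum d = proj₁ h , prove= (b :* u) w (# (B t) ∷ τsum (2 ℕ.^ d) ∷ # (S t ℕ.+ B t) ∷ # (S t) ∷ [])
        (by= (b :* (u :- lit 1)) (lit 1 :* s) (subst (λ j → # (B t) * (τsum j - 1#) ≡ 1# * # (S t)) (ℕP.+-identityʳ (2 ℕ.^ d)) (proj₂ (proj₂ h))) (lit 1) ⊞ by= w (s :+ b) (#-+ (S t) (B t)) (con (negsuc 0))) refl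
      where
      t = tree d α β 0
      h = spec d 0
      b = var 0F ; u = var 1F ; w = var 2F ; s = var 3F

  square : ℕ → ℕ → ℕ
  square zero x = x
  square (suc d) x = square d (x ℕ.* x)

  #-square : ∀ d x → # (square d x) ≡ # x ^ (2 ℕ.^ d)
  #-square zero x = sym (*1 _)
  #-square (suc d) x = trans (#-square d (x ℕ.* x)) (trans (cong (_^ (2 ℕ.^ d)) (#-* x x)) (trans (^-distrib-* (# x) (# x) (2 ℕ.^ d)) (trans (sym (^-+ (# x) (2 ℕ.^ d) (2 ℕ.^ d))) (cong (# x ^_) (cong (2 ℕ.^ d ℕ.+_) (sym (ℕP.+-identityʳ _)))))))

  -- Base-X digits with `f i` the most significant, because the series runs in powers of 1/X; built
  -- by halves to match the reading by halves in `digits`.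
  pack : ℕ → ℕ → (ℕ → ℕ) → ℕ → ℕ
  pack X zero f i = f i
  pack X (suc d) f i = pack X d f i ℕ.* square d X ℕ.+ pack X d f (2 ℕ.^ d ℕ.+ i)

  _÷_ : ℕ → ℕ → ℕ
  a ÷ zero = 0
  a ÷ suc b = a / suc b

  ÷-unique : ∀ k z y → k ℕ.* y ℕ.≤ z → z ℕ.< suc k ℕ.* y → z ÷ y ≡ k
  ÷-unique k z zero h h′ with subst (z ℕ.<_) (ℕP.*-zeroʳ (suc k)) h′
  ... | ()
  ÷-unique k z (suc y) h h′ = ℕP.≤-antisym
    (ℕP.≤-pred (ℕP.*-cancelʳ-< (suc y) (z / suc y) (suc k) (ℕP.≤-<-trans (ℕP.≤-trans (ℕP.m≤n+m _ _) (ℕP.≤-reflexive (sym (m≡m%n+[m/n]*n z (suc y))))) h′)))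
    (ℕP.≤-pred (ℕP.*-cancelʳ-< (suc y) k (suc (z / suc y)) (ℕP.≤-<-trans h (ℕP.≤-<-trans (ℕP.≤-reflexive (m≡m%n+[m/n]*n z (suc y))) (ℕP.+-monoˡ-< _ (m%n<n z (suc y)))))))

  squares : ℕ → ℕ → List ℕ → List ℕ
  squares zero x acc = acc
  squares (suc d) x acc = squares d (x ℕ.* x) (x L.∷ acc)

  -- the divisor is passed through split so that the quotient is shared during evaluation
  mutual
    digits : List ℕ → ℕ → List ℕ → List ℕ
    digits L.[] z acc = z L.∷ acc
    digits (y L.∷ ys) z acc = split ys y z (z ÷ y) acc
    split : List ℕ → ℕ → ℕ → ℕ → List ℕ → List ℕ
    split ys y z h acc = digits ys h (digits ys (z ℕ.∸ h ℕ.* y) acc)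

  segment : ℕ → (ℕ → ℕ) → ℕ → List ℕ → List ℕ
  segment zero f i acc = f i L.∷ acc
  segment (suc d) f i acc = segment d f i (segment d f (2 ℕ.^ d ℕ.+ i) acc)

  pack< : ∀ X d f i → (∀ j → j ℕ.< 2 ℕ.^ d ℕ.+ i → f j ℕ.< X) → pack X d f i ℕ.< square d X
  pack< X zero f i h = h i ℕP.≤-refl
  pack< X (suc d) f i h = subst (pack X (suc d) f i ℕ.<_) (sym (square-suc d X)) (ℕP.<-≤-trans
      (ℕP.+-monoʳ-< (pack X d f i ℕ.* square d X) (pack< X d f (2 ℕ.^ d ℕ.+ i) (λ j p → h j (subst (j ℕ.<_) (double d i) p))))
      (ℕP.≤-trans (ℕP.≤-reflexive (ℕP.+-comm _ (square d X))) (ℕP.*-monoˡ-≤ (square d X) (pack< X d f i (λ j p → h j (ℕP.<-≤-trans p (ℕP.+-monoˡ-≤ i (ℕP.m≤m+n (2 ℕ.^ d) _))))))))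
    where
    square-suc : ∀ d x → square (suc d) x ≡ square d x ℕ.* square d x
    square-suc zero x = refl
    square-suc (suc d) x = square-suc d (x ℕ.* x)

  squares-cons : ∀ d x → squares (suc d) x L.[] ≡ square d x L.∷ squares d x L.[]
  squares-cons d x = go d x L.[]
    where
    go : ∀ d x acc → squares (suc d) x acc ≡ square d x L.∷ squares d x acc
    go zero x acc = refl
    go (suc d) x acc = go d (x ℕ.* x) (x L.∷ acc)

  digits-pack : ∀ X d f i acc → (∀ j → j ℕ.< 2 ℕ.^ d ℕ.+ i → f j ℕ.< X) → digits (squares d X L.[]) (pack X d f i) acc ≡ segment d f i acc
  digits-pack X zero f i acc h = refl
  digits-pack X (suc d) f i acc h = trans (cong (λ ys → digits ys (pack X (suc d) f i) acc) (squares-cons d X))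
      (trans (cong (λ k → split (squares d X L.[]) (square d X) (pack X (suc d) f i) k acc) quotient)
        (trans (cong (digits (squares d X L.[]) (pack X d f i)) (trans (cong (λ k → digits (squares d X L.[]) k acc) (ℕP.m+n∸m≡n (pack X d f i ℕ.* square d X) _)) (digits-pack X d f (2 ℕ.^ d ℕ.+ i) acc h₂)))
          (digits-pack X d f i _ h₁)))
    where
    h₁ : ∀ j → j ℕ.< 2 ℕ.^ d ℕ.+ i → f j ℕ.< X
    h₁ j p = h j (ℕP.<-≤-trans p (ℕP.+-monoˡ-≤ i (ℕP.m≤m+n (2 ℕ.^ d) _)))
    h₂ : ∀ j → j ℕ.< 2 ℕ.^ d ℕ.+ (2 ℕ.^ d ℕ.+ i) → f j ℕ.< X
    h₂ j p = h j (subst (j ℕ.<_) (double d i) p)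
    quotient : pack X (suc d) f i ÷ square d X ≡ pack X d f i
    quotient = ÷-unique (pack X d f i) _ (square d X) (ℕP.m≤m+n _ _) (ℕP.<-≤-trans (ℕP.+-monoʳ-< (pack X d f i ℕ.* square d X) (pack< X d f (2 ℕ.^ d ℕ.+ i) h₂)) (ℕP.≤-reflexive (ℕP.+-comm _ (square d X))))

  -- The same product tree is evaluated twice: at 399/400 to bound all coefficients by U, at 1/X to
  -- obtain the digits.
  module Extract (d m X U e K : ℕ) (2^d : 2 ℕ.^ d ≡ suc m) (2^e : 2 ℕ.^ e ≡ K) (K≤512 : K ℕ.≤ 512) (m<T : m ℕ.< triangle (suc K)) (K≤m : K ℕ.≤ m)
    (t₁ t₂ : Node) (t₁≡ : t₁ ≡ tree e 399 400 0) (t₂≡ : t₂ ≡ tree e 1 X 0)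
    (1≤U : 1 ℕ.≤ U) (U<X : 2048 ℕ.* suc K ℕ.* U ℕ.< X) (1024≤X : 1024 ℕ.≤ X)
    (numeric : (S t₁ ℕ.+ B t₁) ℕ.* square d 400 ℕ.≤ U ℕ.* (B t₁ ℕ.* square d 399)) where

    private
      module R₁ = Ratio 399 400 (ℕP.≤-refl)
      module R₂ = Ratio 1 X (ℕP.<-≤-trans (ℕP.≤ᵇ⇒≤ 2 1024 _) 1024≤X)
      total₁ : (0# < # (B t₁)) × (# (B t₁) * R₁.τsum K ≡ # (S t₁ ℕ.+ B t₁))
      total₁ = subst (λ t → (0# < # (B t)) × (# (B t) * R₁.τsum K ≡ # (S t ℕ.+ B t))) (sym t₁≡) (subst (λ j → (0# < # (B (tree e 399 400 0))) × (# (B (tree e 399 400 0)) * R₁.τsum j ≡ # (S (tree e 399 400 0) ℕ.+ B (tree e 399 400 0)))) 2^e (R₁.tree-sum e))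
      total₂ : (0# < # (B t₂)) × (# (B t₂) * R₂.τsum K ≡ # (S t₂ ℕ.+ B t₂))
      total₂ = subst (λ t → (0# < # (B t)) × (# (B t) * R₂.τsum K ≡ # (S t ℕ.+ B t))) (sym t₂≡) (subst (λ j → (0# < # (B (tree e 1 X 0))) × (# (B (tree e 1 X 0)) * R₂.τsum j ≡ # (S (tree e 1 X 0) ℕ.+ B (tree e 1 X 0)))) 2^e (R₂.tree-sum e))

      ^>0 : ∀ {y} → 0# < y → ∀ k → 0# < y ^ k
      ^>0 p zero = ⟪⟫>0 0
      ^>0 p (suc k) = *>0 p (^>0 p k)

      -- A coefficient is at most the value of the series divided by xⁿ. The point 399/400 is close
      -- to the saddle point for n near 131071, and `numeric` is the resulting bound with
      -- denominators cleared.
      rankSum-bound : ∀ n → n ℕ.≤ m → rankSum m K n ℕ.≤ U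
      rankSum-bound n n≤m = #-mono⁻ (*-cancel-≤ {x = # (B t₁) * # 399 ^ P} (*>0 (proj₁ total₁) (^>0 (⟪⟫>0 398) P)) (≤-trans
          (prove (b :* p :* r) (w :* h) (# (B t₁) ∷ # 399 ^ P ∷ # 400 ^ P ∷ # (rankSum m K n) ∷ # (S t₁ ℕ.+ B t₁) ∷ R₁.τsum K ∷ R₁.x ^ P ∷ R₁.x ^ n ∷ [])
            (ge0 b (⟪⟫≥0 (B t₁)) ⊗ ge0 h (^≥0 (⟪⟫≥0 400) P) ⊗ (le (r :* y) s term ⊕ ge0 r (⟪⟫≥0 (rankSum m K n)) ⊗ le z y x^P≤) ⊕ eqn (h :* z) p (R₁.βx^ P) (b :* r) ⊕ eqn (b :* s) w (proj₂ total₁) (:- h)) refl)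
          (subst₂ _≤_ (trans (#-* (S t₁ ℕ.+ B t₁) (square d 400)) (cong (# (S t₁ ℕ.+ B t₁) *_) (#-square d 400)))
            (trans (#-* U _) (trans (*-comm _ _) (cong (_* # U) (trans (#-* (B t₁) (square d 399)) (cong (# (B t₁) *_) (#-square d 399)))))) (#-mono numeric))))
        where
        P = 2 ℕ.^ d
        b = var 0F ; p = var 1F ; h = var 2F ; r = var 3F ; w = var 4F ; s = var 5F ; z = var 6F ; y = var 7F
        x^P≤ : R₁.x ^ P ≤ R₁.x ^ n
        x^P≤ = ^-anti R₁.x≥0 R₁.x≤1 (ℕP.≤-trans (ℕP.m≤n⇒m≤1+n n≤m) (ℕP.≤-reflexive (sym 2^d)))
        term : # (rankSum m K n) * R₁.x ^ n ≤ R₁.τsum K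
        term = ≤-trans (prove v (g :+ v) (# (rankSum m K n) * R₁.x ^ n ∷ R₁.series (rankSum m K) n ∷ []) (ge0 g (R₁.series≥0 (rankSum m K) n)) refl) (R₁.rankSum≤ m K (suc n) (ℕ.s≤s n≤m))
          where v = var 0F ; g = var 1F

      ranked≤ : ∀ k n → n ℕ.≤ m → ranked m k n ℕ.≤ U
      ranked≤ k n n≤m with ℕP.≤-<-connex k K
      ... | inj₁ k≤ = ℕP.≤-trans (below k K k≤) (rankSum-bound n n≤m)
        where
        below : ∀ k j → k ℕ.≤ j → ranked m k n ℕ.≤ rankSum m j n
        below k zero ℕ.z≤n = ℕP.≤-refl
        below k (suc j) h with ℕP.m≤n⇒m<n∨m≡n h
        ... | inj₁ h′ = ℕP.≤-trans (below k j (ℕP.≤-pred h′)) (ℕP.m≤m+n _ _)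
        ... | inj₂ refl = ℕP.m≤n+m _ _
      ... | inj₂ k> = ℕP.≤-trans (ℕP.≤-reflexive (ranked-vanish m k n (ℕP.<-≤-trans (ℕP.≤-<-trans n≤m m<T) (triangle-mono k>)))) ℕ.z≤n

    q≡ : ∀ n → n ℕ.≤ m → rankSum m K n ≡ q n
    q≡ n n≤m = sym (q≡rankSum m K n n≤m K≤m (ℕP.≤-<-trans n≤m m<T))

    q<X : ∀ n → n ℕ.≤ m → q n ℕ.< X
    q<X n n≤m = ℕP.≤-<-trans (ℕP.≤-trans (ℕP.≤-reflexive (sym (q≡ n n≤m))) (rankSum-bound n n≤m)) (ℕP.≤-<-trans (ℕP.m≤n*m U (2048 ℕ.* suc K)) U<X)

    private
      x>0 : 0# < R₂.x
      x>0 h = ⟪⟫>0 0 (subst (_≤ 0#) R₂.βx (prove (b :* y) (lit 0) (# X ∷ R₂.x ∷ []) (ge0 b (⟪⟫≥0 X) ⊗ le y (lit 0) h) refl))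
        where b = var 0F ; y = var 1F
      1024x≤1 : ⟪ pos 1024 ⟫ * R₂.x ≤ 1#
      1024x≤1 = subst (⟪ pos 1024 ⟫ * R₂.x ≤_) R₂.βx (prove (lit 1024 :* y) (b :* y) (# X ∷ R₂.x ∷ []) (le (lit 1024) b (#-mono 1024≤X) ⊗ ge0 y R₂.x≥0) refl)
        where b = var 0F ; y = var 1F

    value : ℕ
    value = (square d X ℕ.* (S t₂ ℕ.+ B t₂)) ÷ (B t₂ ℕ.* X)

    private
      seriesQ : ℕ → F
      seriesQ = R₂.series q

      pack-series : ∀ k i → # (pack X k q i) * R₂.x ^ (2 ℕ.^ k ℕ.+ i) ≡ R₂.x * (seriesQ (2 ℕ.^ k ℕ.+ i) - seriesQ i)
      pack-series zero i = ring (a :* (y :* w)) (y :* (s :+ a :* w :- s)) (# (q i) ∷ R₂.x ∷ R₂.x ^ i ∷ seriesQ i ∷ []) refl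
        where a = var 0F ; y = var 1F ; w = var 2F ; s = var 3F
      pack-series (suc k) i = subst (λ j → # (pack X (suc k) q i) * R₂.x ^ j ≡ R₂.x * (seriesQ j - seriesQ i)) (double k i)
        (trans (cong₂ _*_ (trans (#-+ (pack X k q i ℕ.* square k X) (pack X k q j)) (cong (_+ # (pack X k q j)) (trans (#-* (pack X k q i) (square k X)) (cong (# (pack X k q i) *_) (#-square k X))))) (^-+ R₂.x (2 ℕ.^ k) j))
          (prove= ((p :* h :+ p′) :* (z :* w)) (y :* (u :- s₀)) (# (pack X k q i) ∷ # X ^ (2 ℕ.^ k) ∷ # (pack X k q j) ∷ R₂.x ^ (2 ℕ.^ k) ∷ R₂.x ^ j ∷ R₂.x ∷ seriesQ (2 ℕ.^ k ℕ.+ j) ∷ seriesQ i ∷ seriesQ j ∷ [])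
            (by= (h :* z) (lit 1) hz (p :* w) ⊞ by= (p :* w) (y :* (s₁ :- s₀)) (pack-series k i) (lit 1)
             ⊞ by= (p′ :* (z :* w)) (y :* (u :- s₁)) (trans (cong (# (pack X k q j) *_) (sym (^-+ R₂.x (2 ℕ.^ k) j))) (pack-series k j)) (lit 1)) refl))
        where
        j = 2 ℕ.^ k ℕ.+ i
        p = var 0F ; h = var 1F ; p′ = var 2F ; z = var 3F ; w = var 4F ; y = var 5F ; u = var 6F ; s₀ = var 7F ; s₁ = var 8F
        hz : # X ^ (2 ℕ.^ k) * R₂.x ^ (2 ℕ.^ k) ≡ 1#
        hz = trans (R₂.βx^ (2 ℕ.^ k)) (UpperBounds.1^ (2 ℕ.^ k))

      P = 2 ℕ.^ d
      Qd : F
      Qd = seriesQ (suc m)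
      Qd≡ : R₂.series-rankSum m K (suc m) ≡ Qd
      Qd≡ = Σ≺-cong _ (λ n → # (q n) * R₂.x ^ n) (suc m) (λ n n≤m → cong (λ j → # j * R₂.x ^ n) (q≡ n (ℕP.≤-pred n≤m)))
      pack≡ : # (pack X d q 0) * R₂.x ^ suc m ≡ R₂.x * Qd
      pack≡ = trans (subst (λ j → # (pack X d q 0) * R₂.x ^ j ≡ R₂.x * (seriesQ j - 0#)) (trans (ℕP.+-identityʳ P) 2^d) (pack-series d 0)) (cong (R₂.x *_) (ring (s :- lit 0) s (Qd ∷ []) refl))
        where s = var 0F
      lower : Qd ≤ R₂.τsum K
      lower = subst (_≤ R₂.τsum K) Qd≡ (R₂.rankSum≤ m K (suc m) ℕP.≤-refl)
      upper : R₂.τsum K ≤ Qd + ⟪ pos 2048 ⟫ * # (suc K) * # U * R₂.x ^ suc m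
      upper = subst (λ s → R₂.τsum K ≤ s + ⟪ pos 2048 ⟫ * # (suc K) * # U * R₂.x ^ suc m) Qd≡
        (R₂.total-deficit m 1024x≤1 (# U) (#-mono 1≤U) (λ k n n≤m → #-mono (ranked≤ k n n≤m)) K m K≤512 ℕP.≤-refl)
      x^>0 : 0# < R₂.x ^ suc m
      x^>0 = ^>0 x>0 (suc m)
      Hx : # (square d X) * R₂.x ^ suc m ≡ 1#
      Hx = trans (cong (_* R₂.x ^ suc m) (trans (#-square d X) (cong (# X ^_) 2^d))) (trans (R₂.βx^ (suc m)) (UpperBounds.1^ (suc m)))

    -- Multiplied by Xᵐ the omitted tail of the series is below 1, by `U<X`, so rounding down leaves
    -- exactly the packed digits.
    value≡pack : value ≡ pack X d q 0
    value≡pack = ÷-unique (pack X d q 0) _ (B t₂ ℕ.* X)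
        (#-mono⁻ (subst₂ _≤_ (sym (trans (#-* p₀ (B t₂ ℕ.* X)) (cong (# p₀ *_) (#-* (B t₂) X)))) (sym (#-* (square d X) _)) (*-cancel-≤ x^>0 (prove (z :* (p :* (b :* X′))) (z :* (H :* w)) vec
          (ge0 b (⟪⟫≥0 (B t₂)) ⊗ le Q T lower ⊕ eqn (p :* z) (y :* Q) pack≡ (:- (b :* X′)) ⊕ eqn (X′ :* y) (lit 1) Xx (:- (b :* Q)) ⊕ eqn (H :* z) (lit 1) Hx w ⊕ eqn (b :* T) w (proj₂ total₂) (con (negsuc 0))) refl))))
        (ℕP.≰⇒> (λ h → strict (subst₂ _≤_ (trans (#-* (suc p₀) (B t₂ ℕ.* X)) (cong₂ _*_ (#-suc p₀) (#-* (B t₂) X))) (#-* (square d X) _) (#-mono h))))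
      where
      p₀ = pack X d q 0
      vec : Vec F 11
      vec = # p₀ ∷ # (B t₂) ∷ # X ∷ # (square d X) ∷ # (S t₂ ℕ.+ B t₂) ∷ R₂.x ^ suc m ∷ Qd ∷ R₂.τsum K ∷ R₂.x ∷ # (suc K) ∷ # U ∷ []
      p b X′ H w z Q T y k u : Expr {11}
      p = var 0F ; b = var 1F ; X′ = var 2F ; H = var 3F ; w = var 4F ; z = var 5F ; Q = var 6F ; T = var 7F ; y = var 8F ; k = var 9F ; u = var (Fin.suc 9F)
      Xx : # X * R₂.x ≡ 1#
      Xx = R₂.βx
      small : ⟪ pos 2048 ⟫ * # (suc K) * # U < # X
      small h = ℕP.<⇒≱ U<X (#-mono⁻ (subst (# X ≤_) (sym (trans (#-* (2048 ℕ.* suc K) U) (cong (_* # U) (#-* 2048 (suc K))))) h))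
      strict : (1# + # p₀) * (# (B t₂) * # X) ≤ # (square d X) * # (S t₂ ℕ.+ B t₂) → ⊥
      strict h = small (*-cancel-≤ (*>0 (proj₁ total₂) x^>0) (prove (b :* z :* X′) (b :* z :* (lit 2048 :* k :* u)) vec
        (ge0 z (<⇒≤ x^>0) ⊗ le ((lit 1 :+ p) :* (b :* X′)) (H :* w) h ⊕ ge0 b (⟪⟫≥0 (B t₂)) ⊗ le T (Q :+ lit 2048 :* k :* u :* z) upper
         ⊕ eqn (p :* z) (y :* Q) pack≡ (b :* X′) ⊕ eqn (X′ :* y) (lit 1) Xx (b :* Q) ⊕ eqn (H :* z) (lit 1) Hx (:- w) ⊕ eqn (b :* T) w (proj₂ total₂) (lit 1)) refl))

-- Verification below the threshold

module Numerics where
  open Inequalities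
  open PowersOfUnit
  open RotatedProduct using (#-+)
  open Rounding using (#-mono; #-mono⁻)
  open Moments using (#-*)
  open DigitExtraction
  open Ranked using (triangle)
  open LogConcavity using (Claim; descend)
  open import Defs using (q)
  open import Data.Nat.Base as ℕ using (ℕ; suc; zero)
  import Data.Nat.Properties as ℕP
  open import Data.List.Base as L using (List)
  open import Data.Bool.Base using (Bool; true; _∧_; T)
  open import Data.Product.Base using (_×_; _,_; proj₁; proj₂)
  open import Data.Empty using (⊥-elim)
  open import Data.Sum.Base using (inj₁; inj₂)

  -- Subtraction truncates. The first difference is guarded explicitly; the strict inequality rules
  -- out that the squared one is truncated; a truncated last difference is larger than the true one,
  -- which only strengthens the test.
  test : ℕ → ℕ → ℕ → ℕ → ℕ → Bool
  test a b c d e = (a ℕ.* c ℕ.≤ᵇ b ℕ.* b) ∧ ((b ℕ.* b ℕ.∸ a ℕ.* c) ℕ.* (d ℕ.* d ℕ.∸ c ℕ.* e) ℕ.<ᵇ (c ℕ.* c ℕ.∸ b ℕ.* d) ℕ.* (c ℕ.* c ℕ.∸ b ℕ.* d))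

  testAll : ℕ → ℕ → ℕ → ℕ → List ℕ → Bool
  testAll a b c d L.[] = true
  testAll a b c d (e L.∷ es) = test a b c d e ∧ testAll b c d e es

  testFrom : ℕ → List ℕ → Bool
  testFrom zero (a L.∷ b L.∷ c L.∷ d L.∷ es) = testAll a b c d es
  testFrom zero _ = true
  testFrom (suc k) L.[] = true
  testFrom (suc k) (x L.∷ xs) = testFrom k xs

  range : (ℕ → ℕ) → ℕ → ℕ → List ℕ
  range f i zero = L.[]
  range f i (suc n) = f i L.∷ range f (suc i) n

  range-++ : ∀ f i m n → range f i (m ℕ.+ n) ≡ range f i m L.++ range f (m ℕ.+ i) n
  range-++ f i zero n = refl
  range-++ f i (suc m) n = cong (f i L.∷_) (trans (range-++ f (suc i) m n) (cong (λ j → range f (suc i) m L.++ range f j n) (ℕP.+-suc m i)))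

  segment≡range : ∀ d f i n → segment d f i (range f (2 ℕ.^ d ℕ.+ i) n) ≡ range f i (2 ℕ.^ d ℕ.+ n)
  segment≡range zero f i n = refl
  segment≡range (suc d) f i n = trans (cong (segment d f i) (trans (cong (λ j → segment d f (2 ℕ.^ d ℕ.+ i) (range f j n)) (sym (double d i))) (segment≡range d f (2 ℕ.^ d ℕ.+ i) n)))
    (trans (segment≡range d f i (2 ℕ.^ d ℕ.+ n)) (cong (range f i) (double d n)))

  ∧-true : ∀ {a b} → a ∧ b ≡ true → a ≡ true × b ≡ true
  ∧-true {true} {true} refl = refl , refl

  testAll-sound : ∀ f n i → testAll (f i) (f (1 ℕ.+ i)) (f (2 ℕ.+ i)) (f (3 ℕ.+ i)) (range f (4 ℕ.+ i) n) ≡ true →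
    ∀ j → j ℕ.< n → test (f (j ℕ.+ i)) (f (1 ℕ.+ (j ℕ.+ i))) (f (2 ℕ.+ (j ℕ.+ i))) (f (3 ℕ.+ (j ℕ.+ i))) (f (4 ℕ.+ (j ℕ.+ i))) ≡ true
  testAll-sound f (suc n) i h zero p = proj₁ (∧-true h)
  testAll-sound f (suc n) i h (suc j) p = subst (λ k → test (f k) (f (1 ℕ.+ k)) (f (2 ℕ.+ k)) (f (3 ℕ.+ k)) (f (4 ℕ.+ k)) ≡ true) (ℕP.+-suc j i) (testAll-sound f n (suc i) (proj₂ (∧-true h)) j (ℕP.≤-pred p))

  testFrom-sound : ∀ f k i n → testFrom k (range f i (k ℕ.+ (4 ℕ.+ n))) ≡ true → testAll (f (k ℕ.+ i)) (f (1 ℕ.+ (k ℕ.+ i))) (f (2 ℕ.+ (k ℕ.+ i))) (f (3 ℕ.+ (k ℕ.+ i))) (range f (4 ℕ.+ (k ℕ.+ i)) n) ≡ true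
  testFrom-sound f zero i n h = h
  testFrom-sound f (suc k) i n h = subst (λ j → testAll (f j) (f (1 ℕ.+ j)) (f (2 ℕ.+ j)) (f (3 ℕ.+ j)) (range f (4 ℕ.+ j) n) ≡ true) (ℕP.+-suc k i) (testFrom-sound f k (suc i) n h)

  ≤ᵇ-true : ∀ a b → (a ℕ.≤ᵇ b) ≡ true → a ℕ.≤ b
  ≤ᵇ-true a b h = ℕP.≤ᵇ⇒≤ a b (subst T (sym h) _)

  test-sound : ∀ m → test (q m) (q (1 ℕ.+ m)) (q (2 ℕ.+ m)) (q (3 ℕ.+ m)) (q (4 ℕ.+ m)) ≡ true → Claim m
  test-sound m h = descend m (λ bad → ℕP.<⇒≱ xy<zz (#-mono⁻ (subst₂ _≤_ (sym (#-* z z)) (sym (#-* x y)) (≤-trans (*-mono (⟪⟫≥0 z) (⟪⟫≥0 z) z≤ z≤) (≤-trans bad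
        (prove (x′ :* w) (x₁ :* y′) (# x ∷ # y ∷ # b * # b - # a * # c ∷ # d * # d - # c * # e ∷ []) (ge0 x₁ (⟪⟫≥0 x) ⊗ le w y′ y≥ ⊕ eqn x₁ x′ x≡ (w)) refl))))))
    where
    a = q m
    b = q (1 ℕ.+ m)
    c = q (2 ℕ.+ m)
    d = q (3 ℕ.+ m)
    e = q (4 ℕ.+ m)
    x = b ℕ.* b ℕ.∸ a ℕ.* c
    y = d ℕ.* d ℕ.∸ c ℕ.* e
    z = c ℕ.* c ℕ.∸ b ℕ.* d
    x₁ = var 0F ; y′ = var 1F ; x′ = var 2F ; w = var 3F
    xy<zz : x ℕ.* y ℕ.< z ℕ.* z
    xy<zz = ℕP.<ᵇ⇒< (x ℕ.* y) (z ℕ.* z) (subst T (sym (proj₂ (∧-true {a ℕ.* c ℕ.≤ᵇ b ℕ.* b} h))) _)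
    sub : ∀ i j k l → # (i ℕ.* j) - # (k ℕ.* l) ≡ # i * # j - # k * # l
    sub i j k l = cong₂ _-_ (#-* i j) (#-* k l)
    monus : ∀ i j → j ℕ.≤ i → # (i ℕ.∸ j) ≡ # i - # j
    monus i j p = trans (ring u (u :+ v :- v) (# (i ℕ.∸ j) ∷ # j ∷ []) refl) (cong (_- # j) (trans (sym (#-+ (i ℕ.∸ j) j)) (cong # (ℕP.m∸n+n≡m p))))
      where u = var 0F ; v = var 1F
    x≡ : # x ≡ # b * # b - # a * # c
    x≡ = trans (monus (b ℕ.* b) (a ℕ.* c) (≤ᵇ-true _ _ (proj₁ (∧-true {a ℕ.* c ℕ.≤ᵇ b ℕ.* b} h)))) (sub b b a c)
    y≥ : # d * # d - # c * # e ≤ # y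
    y≥ = subst (_≤ # y) (sub d d c e) (prove (u :- v) s (# (d ℕ.* d) ∷ # (c ℕ.* e) ∷ # y ∷ []) (le u (v :+ s) (≤-trans (#-mono (ℕP.m≤n+m∸n (d ℕ.* d) (c ℕ.* e))) (≤-reflexive (#-+ (c ℕ.* e) y)))) refl)
      where u = var 0F ; v = var 1F ; s = var 2F
    z≤ : # z ≤ # c * # c - # b * # d
    z≤ with ℕP.≤-total (b ℕ.* d) (c ℕ.* c)
    ... | inj₁ p = ≤-reflexive (trans (monus (c ℕ.* c) (b ℕ.* d) p) (sub c c b d))
    ... | inj₂ p = ⊥-elim (ℕP.<⇒≱ xy<zz (subst (ℕ._≤ x ℕ.* y) (sym (cong (λ k → k ℕ.* k) (ℕP.m≤n⇒m∸n≡0 p))) ℕ.z≤n))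

  -- U bounds q(n) for n ≤ m, by the product tree at x = 399/400; X exceeds U by enough to absorb the truncation error
  abstract
    depth X U treeDepth treeSize m first rest : ℕ
    depth = 17
    X = 2 ℕ.^ 976
    U = 2 ℕ.^ 950
    treeDepth = 9
    treeSize = 512
    -- 2¹⁷ digits are the least power of two that reaches q(129601); 512 ranks suffice, as 513
    -- distinct parts sum to at least 131841.
    m = 131071
    first = 271
    rest = 130797

    t₁ t₂ : Node
    t₁ = tree 9 399 400 0
    t₂ = tree 9 1 X 0

    t₁≡ : t₁ ≡ tree treeDepth 399 400 0
    t₁≡ = refl
    t₂≡ : t₂ ≡ tree treeDepth 1 X 0
    t₂≡ = refl
    2^depth : 2 ℕ.^ depth ≡ suc m
    2^depth = refl
    2^treeDepth : 2 ℕ.^ treeDepth ≡ treeSize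
    2^treeDepth = refl
    treeSize≤512 : treeSize ℕ.≤ 512
    treeSize≤512 = ≤ᵇ-true treeSize 512 refl
    m< : m ℕ.< triangle (suc treeSize)
    m< = ≤ᵇ-true (suc m) (triangle (suc treeSize)) refl
    treeSize≤m : treeSize ℕ.≤ m
    treeSize≤m = ≤ᵇ-true treeSize m refl
    1≤U : 1 ℕ.≤ U
    1≤U = ≤ᵇ-true 1 U refl
    U<X : 2048 ℕ.* suc treeSize ℕ.* U ℕ.< X
    U<X = ≤ᵇ-true (suc (2048 ℕ.* suc treeSize ℕ.* U)) X refl
    1024≤X : 1024 ℕ.≤ X
    1024≤X = ≤ᵇ-true 1024 X refl
    numeric : (Node.S t₁ ℕ.+ Node.B t₁) ℕ.* square depth 400 ℕ.≤ U ℕ.* (Node.B t₁ ℕ.* square depth 399)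
    numeric = ≤ᵇ-true ((Node.S t₁ ℕ.+ Node.B t₁) ℕ.* square depth 400) (U ℕ.* (Node.B t₁ ℕ.* square depth 399)) refl
    split-range : 2 ℕ.^ depth ≡ first ℕ.+ (4 ℕ.+ rest)
    split-range = refl
    first≤271 : first ℕ.≤ 271
    first≤271 = ≤ᵇ-true first 271 refl
    end≤rest : 129598 ℕ.∸ first ℕ.≤ rest
    end≤rest = ≤ᵇ-true (129598 ℕ.∸ first) rest refl

    -- All of the finite verification happens in checking this `refl`; the enclosing `abstract`
    -- prevents it from being unfolded again.
    computed : testFrom first (digits (squares depth X L.[]) ((square depth X ℕ.* (Node.S t₂ ℕ.+ Node.B t₂)) ÷ (Node.B t₂ ℕ.* X)) L.[]) ≡ true
    computed = refl

  module Ex = Extract depth m X U treeDepth treeSize 2^depth 2^treeDepth treeSize≤512 m< treeSize≤m t₁ t₂ t₁≡ t₂≡ 1≤U U<X 1024≤X numeric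

  tests : ∀ (f : ℕ → ℕ) → testFrom first (range f 0 (first ℕ.+ (4 ℕ.+ rest))) ≡ true → ∀ k → first ℕ.≤ k → k ℕ.< 129598 → test (f k) (f (1 ℕ.+ k)) (f (2 ℕ.+ k)) (f (3 ℕ.+ k)) (f (4 ℕ.+ k)) ≡ true
  tests f h k first≤k k< = subst (λ i → test (f i) (f (1 ℕ.+ i)) (f (2 ℕ.+ i)) (f (3 ℕ.+ i)) (f (4 ℕ.+ i)) ≡ true) (ℕP.m∸n+n≡m first≤k)
      (testAll-sound f rest first (subst (λ i → testAll (f i) (f (1 ℕ.+ i)) (f (2 ℕ.+ i)) (f (3 ℕ.+ i)) (range f (4 ℕ.+ i) rest) ≡ true) (ℕP.+-identityʳ first) (testFrom-sound f first 0 rest h)) (k ℕ.∸ first) (ℕP.<-≤-trans (ℕP.∸-monoˡ-< k< first≤k) end≤rest))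

  small-claim : ∀ k → 271 ℕ.≤ k → k ℕ.< 129598 → Claim k
  small-claim k 271≤k k< = test-sound k (tests q (subst (λ xs → testFrom first xs ≡ true) list≡ computed) k (ℕP.≤-trans first≤271 271≤k) k<)
    where
    list≡ : digits (squares depth X L.[]) Ex.value L.[] ≡ range q 0 (first ℕ.+ (4 ℕ.+ rest))
    list≡ = trans (cong (λ v → digits (squares depth X L.[]) v L.[]) Ex.value≡pack)
      (trans (digits-pack X depth q 0 L.[] (λ j p → Ex.q<X j (ℕP.≤-pred (subst (j ℕ.<_) (trans (ℕP.+-identityʳ _) 2^depth) p))))
        (trans (segment≡range depth q 0 0) (cong (range q 0) (trans (ℕP.+-identityʳ _) split-range))))

-- The theorem, with n = m + 2

open import Defs
open import Data.Nat using (ℕ; _≤_; _∸_; _+_)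
open import Data.Integer using (_*_; _-_; _>_)
open import Data.Nat using (suc; s≤s; _<_)
open import Data.Nat.Properties using (+-comm; <-≤-connex)
open import Data.Sum.Base using (_⊎_; inj₁; inj₂)

private
  from-claim : ∀ m → LogConcavity.Claim m → let n = 2 + m in
    (qℤ n * qℤ n - qℤ (n ∸ 1) * qℤ (n + 1)) * (qℤ n * qℤ n - qℤ (n ∸ 1) * qℤ (n + 1))
    > (qℤ (n ∸ 1) * qℤ (n ∸ 1) - qℤ (n ∸ 2) * qℤ n)
    * (qℤ (n + 1) * qℤ (n + 1) - qℤ n * qℤ (n + 2))
  from-claim m h rewrite +-comm m 1 | +-comm m 2 = h

theorem1p6 : (n : ℕ) → 273 ≤ n →
    (qℤ n * qℤ n - qℤ (n ∸ 1) * qℤ (n + 1)) * (qℤ n * qℤ n - qℤ (n ∸ 1) * qℤ (n + 1))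
    > (qℤ (n ∸ 1) * qℤ (n ∸ 1) - qℤ (n ∸ 2) * qℤ n)
    * (qℤ (n + 1) * qℤ (n + 1) - qℤ n * qℤ (n + 2))
theorem1p6 (suc (suc m)) (s≤s (s≤s 271≤m)) = from-claim m (by-size (<-≤-connex m 129598))
  where
  by-size : m < 129598 ⊎ 129598 ≤ m → LogConcavity.Claim m
  by-size (inj₁ m<) = Numerics.small-claim m 271≤m m<
  by-size (inj₂ m≥) = SaddlePoint.Saddle.conclusion m m≥
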